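{- Let $\mathcal{C}_0$ and $\mathcal{C}$ be ind-closed categories and let $I:\mathcal{C}_0\to\mathcal{C}$, $F:\mathcal{C}\to\mathcal{C}_0$ be an internal cover of $\mathcal{C}_0$. Assume in addition: (1) for any two objects $X$ and $Y$ of $\mathcal{C}$, the ind-object $\underline{Hom}(X,Y)$ is semi-strict; (2) for any two objects $X$ and $Y$ of $\mathcal{C}_0$, the ind-object $\underline{Bi}(X,Y)$ is strict; (3) if $X$ is an ind-object of $\mathcal{C}$ such that $F(X)$ is compact (in $\mathrm{Ind}(\mathcal{C}_0)$), then $X$ is compact; (4) for any monomorphism $k:X\to Y$ and object $Z$, all in $\mathcal{C}_0$, the map $\underline{Hom}(Z,X)\to\underline{Hom}(Z,Y)$ induced by composition with $k$ is proper. Let $G$ be the pro-group in $\mathrm{Ind}(\mathcal{C})$ of automorphisms fixing $I$, i.e. the one representing $T\mapsto\mathrm{Aut}_T(\iota/I)$ on $\mathrm{Ind}(\mathcal{C})$, where $\iota:\mathcal{C}\to\mathrm{Ind}(\mathcal{C})$ is the inclusion. Then $G$ is a pro-group in $\mathcal{C}$.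
   Context: Categories are essentially small (except for the categories $\mathrm{Ind}$ and $\mathrm{Pro}$ built from them) and have all finite (inverse) limits; $\mathbf{1}$ is the terminal object. $\mathrm{Ind}(\mathcal{C})$ and $\mathrm{Pro}(\mathcal{C})$ are the usual categories of ind-objects (formal filtered colimits) and pro-objects (formal cofiltered limits); functors are extended to ind- and pro-objects termwise. An ind-object is called compact if it is (isomorphic to) an object of the original category. A pro-group in a category $\mathcal{E}$ is a pro-object of $\mathcal{E}$ that can be represented by a cofiltered inverse system of group objects of $\mathcal{E}$ (and group homomorphisms). For objects $X,Y$ of $\mathcal{C}$, $\underline{Hom}(X,Y)$ is the presheaf $Z\mapsto Hom(Z\times X,Y)$ on $\mathcal{C}$. The category $\mathcal{C}$ is ind-closed if it has finite limits and $\underline{Hom}(X,Y)$ is representable by an ind-object (denoted by the same symbol) for all objects $X,Y$; there is then an evaluation map $\underline{Hom}(X,Y)\times X\to Y$ in $\mathrm{Ind}(\mathcal{C})$. A functor $F:\mathcal{C}\to\mathcal{D}$ with $\mathcal{C}$ ind-closed is closed if it preserves finite limits and, for all $X,Y$, the map $F(\underline{Hom}(X,Y))\to\underline{Hom}(F(X),F(Y))$ induced by applying $F$ to the evaluation map is an isomorphism. An internal cover of an ind-closed category $\mathcal{C}_0$ consists of an ind-closed category $\mathcal{C}$, closed functors $I:\mathcal{C}_0\to\mathcal{C}$ and $F:\mathcal{C}\to\mathcal{C}_0$, and an isomorphism of $F\circ I$ with the identity functor. $\underline{Bi}(X,Y)$ is the ind-object of invertible maps from $X$ to $Y$: it represents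 the presheaf sending $T$ to the set of isomorphisms $T\times X\to T\times Y$ over $T$. A map $f:X\to Y$ in $\mathrm{Ind}(\mathcal{C})$ is proper if for any $g:Z\to Y$ with $Z$ compact, the pullback $X\times_Y Z$ is compact. An ind-object $Y$ is semi-strict if any map from a compact object to $Y$ is proper. An ind-object $Y$ is strict if any map $X\to Y$ with $X$ compact factors as $X\to Z\to Y$ with $Z$ compact and $Z\to Y$ a monomorphism. For an object $T$ of $\mathrm{Ind}(\mathcal{C})$, $\mathrm{Aut}_T(\iota/I)$ is the group of natural transformations $t$ from $X\mapsto T\times\iota(X)$ to $\iota$ (functors on $\mathcal{C}$) such that the induced endomorphism $(\mathrm{pr}_T,t)$ of $T\times\iota$ is invertible and such that, for each object $X_0$ of $\mathcal{C}_0$, $t_{I(X_0)}:T\times I(X_0)\to I(X_0)$ is the projection. The functor $T\mapsto\mathrm{Aut}_T(\iota/I)$ on $\mathrm{Ind}(\mathcal{C})$ is represented by a pro-group $G$ in $\mathrm{Ind}(\mathcal{C})$. This $G$ acts on each object of $\mathcal{C}$ and satisfies $\Gamma_{\mathcal{D}}(H(F(G)))=\mathrm{Aut}(\Gamma_{\mathcal{D}}\circ H\circ F/I)$ (the automorphisms of the functor $\Gamma_{\mathcal{D}}\circ H\circ F$ that are the identity on objects $I(X_0)$) for every closed functor $H:\mathcal{C}_0\to\mathcal{D}$ into an ind-closed category, where $\Gamma_{\mathcal{D}}=Hom(\mathbf{1},-)$. The conclusion "$G$ is a pro-group in $\mathcal{C}$" means that $G$ is isomorphic to the image of a pro-group in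 $\mathcal{C}$, i.e. can be represented by a cofiltered system of group objects of $\mathcal{C}$.
   Formalization: G is required to represent Aut_T(ι/I) for all test objects T in Pro(Ind(C)), not only in Ind(C): on Ind(C) alone G is not determined (for finite sets, I=F=id, the system ⊕_{k≥n}ℤ also represents the trivial functor but is not pro-finite). Existence of such a G is also proved. -}

module Defs where

open import Level using (Level; _⊔_) renaming (suc to lsuc)
open import Algebra.Bundles using (Group)
open import Data.Product using (Σ; Σ-syntax; _×_; _,_; proj₁; proj₂)
open import Data.Unit.Polymorphic using (⊤; tt)
open import Function.Bundles using (Func; Inverse)
open import Relation.Binary.Bundles using (Setoid)
open import Relation.Binary.Structures using (IsEquivalence)
import Relation.Binary.Reasoning.Setoid as SetoidReasoning

private
  variable
    o o′ ℓ ℓ′ u : Level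

record Category (o ℓ : Level) : Set (lsuc (o ⊔ ℓ)) where
  no-eta-equality
  infix  4 _⇒_ _≈_
  infixr 9 _∘_
  field
    Obj : Set o
    _⇒_ : Obj → Obj → Set ℓ
    _≈_ : ∀ {A B} → A ⇒ B → A ⇒ B → Set ℓ
    id  : ∀ {A} → A ⇒ A
    _∘_ : ∀ {A B C} → B ⇒ C → A ⇒ B → A ⇒ C
    equiv     : ∀ {A B} → IsEquivalence (_≈_ {A} {B})
    ∘-resp-≈  : ∀ {A B C} {f f′ : B ⇒ C} {g g′ : A ⇒ B} →
                f ≈ f′ → g ≈ g′ → f ∘ g ≈ f′ ∘ g′
    assoc     : ∀ {A B C D} {f : C ⇒ D} {g : B ⇒ C} {h : A ⇒ B} →
                (f ∘ g) ∘ h ≈ f ∘ (g ∘ h)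
    identityˡ : ∀ {A B} {f : A ⇒ B} → id ∘ f ≈ f
    identityʳ : ∀ {A B} {f : A ⇒ B} → f ∘ id ≈ f

  hom-setoid : Obj → Obj → Setoid ℓ ℓ
  hom-setoid A B = record { Carrier = A ⇒ B ; _≈_ = _≈_ ; isEquivalence = equiv }

  module _ {A B : Obj} where
    open IsEquivalence (equiv {A} {B}) public
      renaming (refl to ≈-refl; sym to ≈-sym; trans to ≈-trans)
      using ()
    open SetoidReasoning (hom-setoid A B) public

  infixl 5 _⟩∘⟨refl
  infixr 4 refl⟩∘⟨_
  _⟩∘⟨refl : ∀ {A B C} {f f′ : B ⇒ C} {g : A ⇒ B} → f ≈ f′ → f ∘ g ≈ f′ ∘ g
  e ⟩∘⟨refl = ∘-resp-≈ e ≈-refl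

  refl⟩∘⟨_ : ∀ {A B C} {f : B ⇒ C} {g g′ : A ⇒ B} → g ≈ g′ → f ∘ g ≈ f ∘ g′
  refl⟩∘⟨ e = ∘-resp-≈ ≈-refl e

  record IsIso {A B : Obj} (f : A ⇒ B) : Set ℓ where
    field
      inv  : B ⇒ A
      isoˡ : inv ∘ f ≈ id
      isoʳ : f ∘ inv ≈ id

  infix 4 _≅_
  record _≅_ (A B : Obj) : Set ℓ where
    field
      to    : A ⇒ B
      isIso : IsIso to

  IsMono : ∀ {A B} → A ⇒ B → Set (o ⊔ ℓ)
  IsMono {A} m = ∀ {T} (x y : T ⇒ A) → m ∘ x ≈ m ∘ y → x ≈ y

module _ (C : Category o ℓ) where
  private module C = Category C
  open Category

  op : Category o ℓ
  op .Obj       = C.Obj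
  op ._⇒_ A B   = B C.⇒ A
  op ._≈_       = C._≈_
  op .id        = C.id
  op ._∘_ f g   = g C.∘ f
  op .equiv     = C.equiv
  op .∘-resp-≈ e e′ = C.∘-resp-≈ e′ e
  op .assoc     = C.≈-sym C.assoc
  op .identityˡ = C.identityʳ
  op .identityʳ = C.identityˡ

record Functor (C : Category o ℓ) (D : Category o′ ℓ′) : Set (o ⊔ ℓ ⊔ o′ ⊔ ℓ′) where
  private
    module C = Category C
    module D = Category D
  field
    F₀ : C.Obj → D.Obj
    F₁ : ∀ {A B} → A C.⇒ B → F₀ A D.⇒ F₀ B
    F-resp-≈     : ∀ {A B} {f g : A C.⇒ B} → f C.≈ g → F₁ f D.≈ F₁ g
    identity     : ∀ {A} → F₁ (C.id {A}) D.≈ D.id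
    homomorphism : ∀ {X Y Z} {f : X C.⇒ Y} {g : Y C.⇒ Z} →
                   F₁ (g C.∘ f) D.≈ F₁ g D.∘ F₁ f

idF : {C : Category o ℓ} → Functor C C
idF {C = C} = record
  { F₀ = λ A → A ; F₁ = λ f → f ; F-resp-≈ = λ e → e
  ; identity = Category.≈-refl C ; homomorphism = Category.≈-refl C }

infixr 9 _∘F_
_∘F_ : ∀ {o₁ ℓ₁ o₂ ℓ₂ o₃ ℓ₃} {C : Category o₁ ℓ₁} {D : Category o₂ ℓ₂} {E : Category o₃ ℓ₃} →
       Functor D E → Functor C D → Functor C E
_∘F_ {E = E} G F = record
  { F₀ = λ A → G.F₀ (F.F₀ A) ; F₁ = λ f → G.F₁ (F.F₁ f)
  ; F-resp-≈ = λ e → G.F-resp-≈ (F.F-resp-≈ e)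
  ; identity = ≈-trans (G.F-resp-≈ F.identity) G.identity
  ; homomorphism = ≈-trans (G.F-resp-≈ F.homomorphism) G.homomorphism }
  where
  module F = Functor F
  module G = Functor G
  open Category E using (≈-trans)

opF : {C : Category o ℓ} {D : Category o′ ℓ′} → Functor C D → Functor (op C) (op D)
opF F = record
  { F₀ = F₀ ; F₁ = λ {A} {B} → F₁ {B} {A} ; F-resp-≈ = λ {A} {B} {f} {g} → F-resp-≈ {B} {A} {f} {g}
  ; identity = λ {A} → identity {A}
  ; homomorphism = λ {X} {Y} {Z} {f} {g} → homomorphism {Z} {Y} {X} {g} {f} }
  where open Functor F

record NaturalIsomorphism {C : Category o ℓ} {D : Category o′ ℓ′} (F G : Functor C D) :
                          Set (o ⊔ ℓ ⊔ o′ ⊔ ℓ′) where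
  private
    module C = Category C
    module F = Functor F
    module G = Functor G
  open Category D
  field
    η       : ∀ X → F.F₀ X ⇒ G.F₀ X
    natural : ∀ {X Y} (f : X C.⇒ Y) → η Y ∘ F.F₁ f ≈ G.F₁ f ∘ η X
    isIso   : ∀ X → IsIso (η X)

module _ (C : Category o ℓ) where
  open Category C

  record IsTerminal (T : Obj) : Set (o ⊔ ℓ) where
    field
      !        : ∀ {A} → A ⇒ T
      !-unique : ∀ {A} (f : A ⇒ T) → ! ≈ f

  record IsProduct {A B P : Obj} (π₁ : P ⇒ A) (π₂ : P ⇒ B) : Set (o ⊔ ℓ) where
    field
      ⟨_,_⟩    : ∀ {T} → T ⇒ A → T ⇒ B → T ⇒ P
      project₁ : ∀ {T} {f : T ⇒ A} {g : T ⇒ B} → π₁ ∘ ⟨ f , g ⟩ ≈ f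
      project₂ : ∀ {T} {f : T ⇒ A} {g : T ⇒ B} → π₂ ∘ ⟨ f , g ⟩ ≈ g
      unique   : ∀ {T} {f : T ⇒ A} {g : T ⇒ B} {h : T ⇒ P} →
                 π₁ ∘ h ≈ f → π₂ ∘ h ≈ g → ⟨ f , g ⟩ ≈ h

  record IsEqualizer {E A B : Obj} (e : E ⇒ A) (f g : A ⇒ B) : Set (o ⊔ ℓ) where
    field
      equality : f ∘ e ≈ g ∘ e
      lift     : ∀ {T} (h : T ⇒ A) → f ∘ h ≈ g ∘ h → T ⇒ E
      commute  : ∀ {T} {h : T ⇒ A} {eq : f ∘ h ≈ g ∘ h} → e ∘ lift h eq ≈ h
      unique   : ∀ {T} {h : T ⇒ A} {eq : f ∘ h ≈ g ∘ h} {k : T ⇒ E} →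
                 e ∘ k ≈ h → lift h eq ≈ k

  record IsPullback {P X Y Z : Obj} (p : P ⇒ X) (q : P ⇒ Z) (f : X ⇒ Y) (g : Z ⇒ Y) :
                    Set (o ⊔ ℓ) where
    field
      commute  : f ∘ p ≈ g ∘ q
      lift     : ∀ {T} (h : T ⇒ X) (k : T ⇒ Z) → f ∘ h ≈ g ∘ k → T ⇒ P
      project₁ : ∀ {T} {h : T ⇒ X} {k : T ⇒ Z} {eq : f ∘ h ≈ g ∘ k} → p ∘ lift h k eq ≈ h
      project₂ : ∀ {T} {h : T ⇒ X} {k : T ⇒ Z} {eq : f ∘ h ≈ g ∘ k} → q ∘ lift h k eq ≈ k
      unique   : ∀ {T} {h : T ⇒ X} {k : T ⇒ Z} {eq : f ∘ h ≈ g ∘ k} {m : T ⇒ P} →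
                 p ∘ m ≈ h → q ∘ m ≈ k → lift h k eq ≈ m

  record Cartesian : Set (o ⊔ ℓ) where
    infixr 7 _⊠_
    field
      𝟏          : Obj
      isTerminal : IsTerminal 𝟏
      _⊠_        : Obj → Obj → Obj
      π₁         : ∀ {A B} → A ⊠ B ⇒ A
      π₂         : ∀ {A B} → A ⊠ B ⇒ B
      isProduct  : ∀ {A B} → IsProduct (π₁ {A} {B}) π₂

    open IsTerminal isTerminal public
    module _ {A B : Obj} where
      open IsProduct (isProduct {A} {B}) public

    infixr 8 _⁂_
    _⁂_ : ∀ {A B A′ B′} → A ⇒ A′ → B ⇒ B′ → A ⊠ B ⇒ A′ ⊠ B′
    f ⁂ g = ⟨ f ∘ π₁ , g ∘ π₂ ⟩

    assocʳ : ∀ {A B D} → (A ⊠ B) ⊠ D ⇒ A ⊠ (B ⊠ D)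
    assocʳ = ⟨ π₁ ∘ π₁ , π₂ ⁂ id ⟩

    abstract
      ⊠-ext : ∀ {T A B} {h k : T ⇒ A ⊠ B} → π₁ ∘ h ≈ π₁ ∘ k → π₂ ∘ h ≈ π₂ ∘ k → h ≈ k
      ⊠-ext e₁ e₂ = ≈-trans (≈-sym (unique e₁ e₂)) (unique ≈-refl ≈-refl)

      ⟨⟩-resp : ∀ {T A B} {f f′ : T ⇒ A} {g g′ : T ⇒ B} → f ≈ f′ → g ≈ g′ → ⟨ f , g ⟩ ≈ ⟨ f′ , g′ ⟩
      ⟨⟩-resp e₁ e₂ = unique (≈-trans project₁ (≈-sym e₁)) (≈-trans project₂ (≈-sym e₂))

      ⟨⟩∘ : ∀ {S T A B} {f : T ⇒ A} {g : T ⇒ B} {h : S ⇒ T} → ⟨ f , g ⟩ ∘ h ≈ ⟨ f ∘ h , g ∘ h ⟩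
      ⟨⟩∘ = ≈-sym (unique (≈-trans (≈-sym assoc) (project₁ ⟩∘⟨refl))
                          (≈-trans (≈-sym assoc) (project₂ ⟩∘⟨refl)))

      ⁂∘⟨⟩ : ∀ {T A B A′ B′} {f : A ⇒ A′} {g : B ⇒ B′} {h : T ⇒ A} {k : T ⇒ B} →
             (f ⁂ g) ∘ ⟨ h , k ⟩ ≈ ⟨ f ∘ h , g ∘ k ⟩
      ⁂∘⟨⟩ = ≈-trans ⟨⟩∘ (⟨⟩-resp (≈-trans assoc (refl⟩∘⟨ project₁)) (≈-trans assoc (refl⟩∘⟨ project₂)))

      ⁂∘⁂ : ∀ {A B A′ B′ A″ B″} {f : A′ ⇒ A″} {g : B′ ⇒ B″} {h : A ⇒ A′} {k : B ⇒ B′} →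
            (f ⁂ g) ∘ (h ⁂ k) ≈ (f ∘ h) ⁂ (g ∘ k)
      ⁂∘⁂ = ≈-trans ⁂∘⟨⟩ (⟨⟩-resp (≈-sym assoc) (≈-sym assoc))

      ⁂-resp : ∀ {A B A′ B′} {f f′ : A ⇒ A′} {g g′ : B ⇒ B′} → f ≈ f′ → g ≈ g′ → f ⁂ g ≈ f′ ⁂ g′
      ⁂-resp e₁ e₂ = ⟨⟩-resp (e₁ ⟩∘⟨refl) (e₂ ⟩∘⟨refl)

      ⟨π₁,π₂⟩ : ∀ {A B} → ⟨ π₁ , π₂ ⟩ ≈ id {A ⊠ B}
      ⟨π₁,π₂⟩ = unique identityʳ identityʳ

      id⁂id : ∀ {A B} → id ⁂ id ≈ id {A ⊠ B}
      id⁂id = unique (≈-trans identityʳ (≈-sym identityˡ)) (≈-trans identityʳ (≈-sym identityˡ))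

  record FinitelyComplete : Set (o ⊔ ℓ) where
    field
      cartesian : Cartesian
      equalizer : ∀ {A B} (f g : A ⇒ B) → Σ[ E ∈ Obj ] Σ[ e ∈ E ⇒ A ] IsEqualizer e f g

module _ {C : Category o ℓ} {D : Category o′ ℓ′} (F : Functor C D) where
  private module C = Category C
  open Functor F

  record PreservesFiniteProducts : Set (o ⊔ ℓ ⊔ o′ ⊔ ℓ′) where
    field
      terminal : ∀ {T} → IsTerminal C T → IsTerminal D (F₀ T)
      product  : ∀ {A B P} {π₁ : P C.⇒ A} {π₂ : P C.⇒ B} →
                 IsProduct C π₁ π₂ → IsProduct D (F₁ π₁) (F₁ π₂)

  record PreservesFiniteLimits : Set (o ⊔ ℓ ⊔ o′ ⊔ ℓ′) where
    field
      products  : PreservesFiniteProducts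
      equalizer : ∀ {E A B} {e : E C.⇒ A} {f g : A C.⇒ B} →
                  IsEqualizer C e f g → IsEqualizer D (F₁ e) (F₁ f) (F₁ g)
    open PreservesFiniteProducts products public

record Presheaf (C : Category o ℓ) : Set (o ⊔ lsuc ℓ) where
  open Category C
  field
    at       : Obj → Setoid ℓ ℓ
    restrict : ∀ {S T} → S ⇒ T → Func (at T) (at S)
  infix 4 _∼_
  _∼_ : ∀ {T} → Setoid.Carrier (at T) → Setoid.Carrier (at T) → Set ℓ
  _∼_ {T} = Setoid._≈_ (at T)
  infixl 8 _∣_
  _∣_ : ∀ {S T} → Setoid.Carrier (at T) → S ⇒ T → Setoid.Carrier (at S)
  x ∣ f = Func.to (restrict f) x
  field
    ∣-resp : ∀ {S T} {f g : S ⇒ T} (x : Setoid.Carrier (at T)) → f ≈ g → x ∣ f ∼ x ∣ g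
    ∣-id   : ∀ {T} (x : Setoid.Carrier (at T)) → x ∣ id ∼ x
    ∣-∘    : ∀ {R S T} (f : S ⇒ T) (g : R ⇒ S) (x : Setoid.Carrier (at T)) →
             x ∣ (f ∘ g) ∼ x ∣ f ∣ g

record PresheafIso {C : Category o ℓ} (P Q : Presheaf C) : Set (o ⊔ ℓ) where
  private
    module P = Presheaf P
    module Q = Presheaf Q
  open Category C
  field
    iso : ∀ T → Inverse (P.at T) (Q.at T)
  to : ∀ {T} → Setoid.Carrier (P.at T) → Setoid.Carrier (Q.at T)
  to {T} = Inverse.to (iso T)
  from : ∀ {T} → Setoid.Carrier (Q.at T) → Setoid.Carrier (P.at T)
  from {T} = Inverse.from (iso T)
  field
    natural : ∀ {S T} (f : S ⇒ T) (x : Setoid.Carrier (P.at T)) → to (x P.∣ f) Q.∼ to x Q.∣ f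

record Filtered (J : Category o ℓ) : Set (o ⊔ ℓ) where
  open Category J
  field
    point      : Obj
    upperBound : ∀ i j → Σ[ k ∈ Obj ] (i ⇒ k) × (j ⇒ k)
    coequalize : ∀ {i j} (a b : i ⇒ j) → Σ[ k ∈ Obj ] Σ[ c ∈ j ⇒ k ] c ∘ a ≈ c ∘ b

  merge : ∀ {i j m n} (a : i ⇒ m) (b : j ⇒ m) (c : i ⇒ n) (d : j ⇒ n) →
          Σ[ k ∈ Obj ] Σ[ s ∈ m ⇒ k ] Σ[ t ∈ n ⇒ k ] (s ∘ a ≈ t ∘ c) × (s ∘ b ≈ t ∘ d)
  merge {m = m} {n} a b c d with upperBound m n
  ... | p , s , t with coequalize (s ∘ a) (t ∘ c)
  ... | q , e , ea with coequalize (e ∘ s ∘ b) (e ∘ t ∘ d)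
  ... | k , h , hb = k , h ∘ e ∘ s , h ∘ e ∘ t
    , ≈-trans (reassoc a) (≈-trans (refl⟩∘⟨ ea) (≈-sym (reassoc c)))
    , ≈-trans (reassoc b) (≈-trans hb (≈-sym (reassoc d)))
    where
    reassoc : ∀ {x y} {r : y ⇒ p} (z : x ⇒ y) → (h ∘ e ∘ r) ∘ z ≈ h ∘ (e ∘ r ∘ z)
    reassoc z = ≈-trans assoc (refl⟩∘⟨ assoc)

module _ where
  open Category

  One : ∀ {o ℓ} → Category o ℓ
  One .Obj       = ⊤
  One ._⇒_ _ _   = ⊤
  One ._≈_ _ _   = ⊤
  One .id        = tt
  One ._∘_ _ _   = tt
  One .equiv     = record { refl = tt ; sym = λ _ → tt ; trans = λ _ _ → tt }
  One .∘-resp-≈ _ _ = tt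
  One .assoc     = tt
  One .identityˡ = tt
  One .identityʳ = tt

One-filtered : Filtered (One {o} {ℓ})
One-filtered = record
  { point = tt ; upperBound = λ _ _ → tt , tt , tt ; coequalize = λ _ _ → tt , tt , tt }

module _ (J : Category o ℓ) (K : Category o′ ℓ′) where
  private
    module J = Category J
    module K = Category K
  open Category

  Prod : Category (o ⊔ o′) (ℓ ⊔ ℓ′)
  Prod .Obj = J.Obj × K.Obj
  Prod ._⇒_ (i , k) (i′ , k′) = (i J.⇒ i′) × (k K.⇒ k′)
  Prod ._≈_ (a , b) (a′ , b′) = (a J.≈ a′) × (b K.≈ b′)
  Prod .id = J.id , K.id
  Prod ._∘_ (a , b) (a′ , b′) = (a J.∘ a′) , (b K.∘ b′)
  Prod .equiv = record
    { refl  = J.≈-refl , K.≈-refl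
    ; sym   = λ (p , q) → J.≈-sym p , K.≈-sym q
    ; trans = λ (p , q) (p′ , q′) → J.≈-trans p p′ , K.≈-trans q q′ }
  Prod .∘-resp-≈ (p , q) (p′ , q′) = J.∘-resp-≈ p p′ , K.∘-resp-≈ q q′
  Prod .assoc = J.assoc , K.assoc
  Prod .identityˡ = J.identityˡ , K.identityˡ
  Prod .identityʳ = J.identityʳ , K.identityʳ

Prod-filtered : {J : Category o ℓ} {K : Category o′ ℓ′} →
                Filtered J → Filtered K → Filtered (Prod J K)
Prod-filtered FJ FK = record
  { point = J.point , K.point
  ; upperBound = λ (i , k) (i′ , k′) →
      let (m , a , a′) = J.upperBound i i′ ; (n , b , b′) = K.upperBound k k′
      in (m , n) , (a , b) , (a′ , b′)
  ; coequalize = λ (a , b) (a′ , b′) →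
      let (m , c , p) = J.coequalize a a′ ; (n , d , q) = K.coequalize b b′
      in (m , n) , (c , d) , (p , q) }
  where
  module J = Filtered FJ
  module K = Filtered FK

record IndObj (C : Category o ℓ) : Set (o ⊔ lsuc ℓ) where
  field
    index    : Category ℓ ℓ
    filtered : Filtered index
    diagram  : Functor index C
  open Category index public using ()
    renaming (Obj to Index; _⇒_ to _↝_; _∘_ to _∘ᵢ_; id to idᵢ)
  open Filtered filtered public
  open Functor diagram public
    renaming (F₀ to ob; F₁ to tr; F-resp-≈ to tr-resp; identity to tr-id; homomorphism to tr-∘)

-- The presheaf  Z ↦ colimⱼ Hom(Z, Bⱼ)  of an ind-object B.
module _ {C : Category o ℓ} (B : IndObj C) where
  open Category C
  private module B = IndObj B

  El : Obj → Set ℓ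
  El Z = Σ[ j ∈ B.Index ] Z ⇒ B.ob j

  record SameEl {Z : Obj} (x y : El Z) : Set ℓ where
    constructor same
    field
      {stage} : B.Index
      left    : proj₁ x B.↝ stage
      right   : proj₁ y B.↝ stage
      agree   : B.tr left ∘ proj₂ x ≈ B.tr right ∘ proj₂ y

  abstract
    SameEl-trans : ∀ {Z} {x y z : El Z} → SameEl x y → SameEl y z → SameEl x z
    SameEl-trans {x = i , f} {j , g} {k , h} (same a b p) (same b′ c q)
      with B.merge b b b′ b′
    ... | _ , s , t , e , _ = same (s B.∘ᵢ a) (t B.∘ᵢ c) (begin
        B.tr (s B.∘ᵢ a) ∘ f      ≈⟨ B.tr-∘ ⟩∘⟨refl ⟩
        (B.tr s ∘ B.tr a) ∘ f    ≈⟨ assoc ⟩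
        B.tr s ∘ (B.tr a ∘ f)    ≈⟨ refl⟩∘⟨ p ⟩
        B.tr s ∘ (B.tr b ∘ g)    ≈⟨ ≈-sym assoc ⟩
        (B.tr s ∘ B.tr b) ∘ g    ≈⟨ ≈-sym B.tr-∘ ⟩∘⟨refl ⟩
        B.tr (s B.∘ᵢ b) ∘ g      ≈⟨ B.tr-resp e ⟩∘⟨refl ⟩
        B.tr (t B.∘ᵢ b′) ∘ g     ≈⟨ B.tr-∘ ⟩∘⟨refl ⟩
        (B.tr t ∘ B.tr b′) ∘ g   ≈⟨ assoc ⟩
        B.tr t ∘ (B.tr b′ ∘ g)   ≈⟨ refl⟩∘⟨ q ⟩
        B.tr t ∘ (B.tr c ∘ h)    ≈⟨ ≈-sym assoc ⟩
        (B.tr t ∘ B.tr c) ∘ h    ≈⟨ ≈-sym B.tr-∘ ⟩∘⟨refl ⟩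
        B.tr (t B.∘ᵢ c) ∘ h      ∎)

  El-setoid : Obj → Setoid ℓ ℓ
  El-setoid Z = record
    { Carrier = El Z ; _≈_ = SameEl
    ; isEquivalence = record
      { refl  = same B.idᵢ B.idᵢ ≈-refl
      ; sym   = λ (same a b p) → same b a (≈-sym p)
      ; trans = SameEl-trans } }

  abstract
    El-≈ : ∀ {Z j} {f g : Z ⇒ B.ob j} → f ≈ g → SameEl (j , f) (j , g)
    El-≈ e = same B.idᵢ B.idᵢ (refl⟩∘⟨ e)

    El-tr : ∀ {Z i j} (a : i B.↝ j) (f : Z ⇒ B.ob i) → SameEl (i , f) (j , B.tr a ∘ f)
    El-tr a f = same a B.idᵢ (≈-sym (≈-trans (B.tr-id ⟩∘⟨refl) identityˡ))

  El-restrict : ∀ {S T} → S ⇒ T → El T → El S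
  El-restrict h (j , f) = j , f ∘ h

  abstract
    El-restrict-resp : ∀ {S T} (h : S ⇒ T) {x y : El T} →
                       SameEl x y → SameEl (El-restrict h x) (El-restrict h y)
    El-restrict-resp h (same a b p) =
      same a b (≈-trans (≈-sym assoc) (≈-trans (p ⟩∘⟨refl) assoc))

  El-presheaf : Presheaf C
  El-presheaf = record
    { at = El-setoid
    ; restrict = λ h → record { to = El-restrict h ; cong = El-restrict-resp h }
    ; ∣-resp = λ x e → El-≈ (refl⟩∘⟨ e)
    ; ∣-id = λ x → El-≈ identityʳ
    ; ∣-∘ = λ f g x → El-≈ (≈-sym assoc) }

-- Hom(A, B) = limᵢ colimⱼ Hom(Aᵢ, Bⱼ)
record IndHom {C : Category o ℓ} (A B : IndObj C) : Set ℓ where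
  private
    module A = IndObj A
  field
    comp   : ∀ i → El B (A.ob i)
    compat : ∀ {i j} (a : i A.↝ j) → SameEl B (El-restrict B (A.tr a) (comp j)) (comp i)

module _ {C : Category o ℓ} where
  open Category C

  push : {A B : IndObj C} → IndHom A B → ∀ {Z} → El A Z → El B Z
  push {B = B} f (i , x) = El-restrict B x (IndHom.comp f i)

  abstract
    push-resp : {A B : IndObj C} (f : IndHom A B) → ∀ {Z} {x y : El A Z} →
                SameEl A x y → SameEl B (push f x) (push f y)
    push-resp {A} {B} f {Z} {_ , x} {_ , y} (same a b p) =
      to-stage a x then (El-≈ B (refl⟩∘⟨ p) then back (to-stage b y))
      where
      module A = IndObj A
      module f = IndHom f
      open Setoid (El-setoid B Z) using () renaming (trans to _then_; sym to back)
      to-stage : ∀ {i k} (a : i A.↝ k) (x : Z ⇒ A.ob i) →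
                 SameEl B (El-restrict B x (f.comp i)) (El-restrict B (A.tr a ∘ x) (f.comp k))
      to-stage a x = back (El-≈ B (≈-sym assoc) then El-restrict-resp B x (f.compat a))

module _ (C : Category o ℓ) where
  private
    module C = Category C
    module S (B : IndObj C) {Z : C.Obj} = Setoid (El-setoid B Z)
    abstract
      id-compat : (A : IndObj C) → let module A = IndObj A in ∀ {i j} (a : i A.↝ j) →
                  SameEl A (j , C.id C.∘ A.tr a) (i , C.id)
      id-compat A a = S.trans A (El-≈ A (C.≈-trans C.identityˡ (C.≈-sym C.identityʳ)))
                        (S.sym A (El-tr A a C.id))

      ∘-compat : {A B D : IndObj C} (g : IndHom B D) (f : IndHom A B) → let module A = IndObj A in
                 ∀ {i j} (a : i A.↝ j) →
                 SameEl D (El-restrict D (A.tr a) (push g (IndHom.comp f j))) (push g (IndHom.comp f i))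
      ∘-compat {D = D} g f a = S.trans D (El-≈ D C.assoc) (push-resp g (IndHom.compat f a))
  open Category

  Ind : Category (o ⊔ lsuc ℓ) ℓ
  Ind .Obj = IndObj C
  Ind ._⇒_ = IndHom
  Ind ._≈_ {B = B} f g = ∀ i → SameEl B (IndHom.comp f i) (IndHom.comp g i)
  Ind .id {A} = record { comp = λ i → i , C.id ; compat = id-compat A }
  Ind ._∘_ g f = record { comp = λ i → push g (IndHom.comp f i) ; compat = ∘-compat g f }
  Ind .equiv {B = B} = record
    { refl = λ i → S.refl B ; sym = λ e i → S.sym B (e i)
    ; trans = λ e e′ i → S.trans B (e i) (e′ i) }
  Ind .∘-resp-≈ {C = D} {f = g} e e′ i =
    S.trans D (push-resp g (e′ i)) (El-restrict-resp D _ (e _))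
  Ind .assoc {D = D} i = El-≈ D C.assoc
  Ind .identityˡ {B = B} i = El-≈ B C.identityˡ
  Ind .identityʳ {B = B} i = El-≈ B C.identityʳ

ι : {C : Category o ℓ} → Functor C (Ind C)
ι {C = C} = record
  { F₀ = λ X → record
      { index = One ; filtered = One-filtered
      ; diagram = record { F₀ = λ _ → X ; F₁ = λ _ → id ; F-resp-≈ = λ _ → ≈-refl
                         ; identity = ≈-refl ; homomorphism = ≈-sym identityˡ } }
  ; F₁ = λ f → record { comp = λ _ → tt , f ; compat = λ _ → same tt tt (refl⟩∘⟨ identityʳ) }
  ; F-resp-≈ = λ e _ → same tt tt (refl⟩∘⟨ e)
  ; identity = λ _ → same tt tt ≈-refl
  ; homomorphism = λ _ → same tt tt ≈-refl }
  where open Category C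

-- Termwise extension of a functor to ind-objects.
IndF : {C : Category o ℓ} {D : Category o′ ℓ} → Functor C D → Functor (Ind C) (Ind D)
IndF {C = C} {D} F = record
  { F₀ = obj
  ; F₁ = λ {A} {B} f → record
      { comp = λ i → el {B} (IndHom.comp f i)
      ; compat = λ a → Setoid.trans (El-setoid (obj B) _)
                         (El-≈ (obj B) (≈-sym homomorphism)) (el-resp {B} (IndHom.compat f a)) }
  ; F-resp-≈ = λ {A} {B} e i → el-resp {B} (e i)
  ; identity = λ {A} i → El-≈ (obj A) identity
  ; homomorphism = λ {X} {Y} {Z} i → El-≈ (obj Z) homomorphism }
  where
  module C = Category C
  open Category D
  open Functor F
  obj : IndObj C → IndObj D
  obj A = record { index = A.index ; filtered = A.filtered ; diagram = F ∘F A.diagram }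
    where module A = IndObj A
  el : {B : IndObj C} → ∀ {Z} → El B Z → El (obj B) (F₀ Z)
  el (j , f) = j , F₁ f
  el-resp : {B : IndObj C} → ∀ {Z} {x y : El B Z} →
            SameEl B x y → SameEl (obj B) (el {B} x) (el {B} y)
  el-resp (same a b p) =
    same a b (≈-trans (≈-sym homomorphism) (≈-trans (F-resp-≈ p) homomorphism))

-- A pro-object of C is an ind-object of op C: its index category is filtered
-- and its diagram is contravariant.
Pro : Category o ℓ → Category (o ⊔ lsuc ℓ) ℓ
Pro C = op (Ind (op C))

κ : {C : Category o ℓ} → Functor C (Pro C)
κ {C = C} = record
  { F₀ = F₀ ; F₁ = λ {A} {B} → F₁ {B} {A} ; F-resp-≈ = λ {A} {B} {f} {g} → F-resp-≈ {B} {A} {f} {g}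
  ; identity = λ {A} → identity {A}
  ; homomorphism = λ {X} {Y} {Z} {f} {g} → homomorphism {Z} {Y} {X} {g} {f} }
  where open Functor (ι {C = op C})

ProF : {C : Category o ℓ} {D : Category o′ ℓ} → Functor C D → Functor (Pro C) (Pro D)
ProF {C = C} {D} F =
  opF {C = Ind (op C)} {D = Ind (op D)} (IndF {C = op C} {D = op D} (opF {C = C} {D = D} F))

Compact : {C : Category o ℓ} → IndObj C → Set (o ⊔ ℓ)
Compact {C = C} A = Σ[ X ∈ Category.Obj C ] Functor.F₀ ι X ≅ A
  where open Category (Ind C)

module _ {C : Category o ℓ} (c : Cartesian C) where
  open Category C
  open Cartesian c

  private
    _⊠ᵢ_ : IndObj C → IndObj C → IndObj C
    A ⊠ᵢ B = record
      { index = Prod A.index B.index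
      ; filtered = Prod-filtered A.filtered B.filtered
      ; diagram = record
        { F₀ = λ (i , j) → A.ob i ⊠ B.ob j
        ; F₁ = λ (a , b) → A.tr a ⁂ B.tr b
        ; F-resp-≈ = λ (p , q) → ⁂-resp (A.tr-resp p) (B.tr-resp q)
        ; identity = ≈-trans (⁂-resp A.tr-id B.tr-id) id⁂id
        ; homomorphism = ≈-trans (⁂-resp A.tr-∘ B.tr-∘) (≈-sym ⁂∘⁂) } }
      where
      module A = IndObj A
      module B = IndObj B

    module _ {A B : IndObj C} where
      private
        module A = IndObj A
        module B = IndObj B
        P = A ⊠ᵢ B

      abstract
        pr₁-compat : ∀ {k l} (r : Category._⇒_ (IndObj.index P) k l) →
                     SameEl A (proj₁ l , π₁ ∘ IndObj.tr P r) (proj₁ k , π₁)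
        pr₁-compat (a , b) = Setoid.trans (El-setoid A _) (El-≈ A project₁)
                               (Setoid.sym (El-setoid A _) (El-tr A a π₁))

        pr₂-compat : ∀ {k l} (r : Category._⇒_ (IndObj.index P) k l) →
                     SameEl B (proj₂ l , π₂ ∘ IndObj.tr P r) (proj₂ k , π₂)
        pr₂-compat (a , b) = Setoid.trans (El-setoid B _) (El-≈ B project₂)
                               (Setoid.sym (El-setoid B _) (El-tr B b π₂))

      pr₁ : IndHom P A
      pr₁ = record { comp = λ (i , _) → i , π₁ ; compat = pr₁-compat }

      pr₂ : IndHom P B
      pr₂ = record { comp = λ (_ , j) → j , π₂ ; compat = pr₂-compat }

      pair : ∀ {Z} → El A Z → El B Z → El P Z
      pair (i , f) (j , g) = (i , j) , ⟨ f , g ⟩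

      abstract
        pair-resp : ∀ {Z} {x x′ : El A Z} {y y′ : El B Z} →
                    SameEl A x x′ → SameEl B y y′ → SameEl P (pair x y) (pair x′ y′)
        pair-resp (same a b p) (same c d q) =
          same (a , c) (b , d) (≈-trans ⁂∘⟨⟩ (≈-trans (⟨⟩-resp p q) (≈-sym ⁂∘⟨⟩)))

        pair-compat : ∀ {T} (f : IndHom T A) (g : IndHom T B) → let module T = IndObj T in
                      ∀ {i j} (a : i T.↝ j) →
                      SameEl P (El-restrict P (T.tr a) (pair (IndHom.comp f j) (IndHom.comp g j)))
                               (pair (IndHom.comp f i) (IndHom.comp g i))
        pair-compat f g a = Setoid.trans (El-setoid P _) (El-≈ P ⟨⟩∘)
                              (pair-resp (IndHom.compat f a) (IndHom.compat g a))

        pair-unique : ∀ {T} {f : IndHom T A} {g : IndHom T B} {h : IndHom T P} →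
                      Category._≈_ (Ind C) (Category._∘_ (Ind C) pr₁ h) f →
                      Category._≈_ (Ind C) (Category._∘_ (Ind C) pr₂ h) g →
                      ∀ i → SameEl P (pair (IndHom.comp f i) (IndHom.comp g i)) (IndHom.comp h i)
        pair-unique e₁ e₂ i = Setoid.trans (El-setoid P _)
          (Setoid.sym (El-setoid P _) (pair-resp (e₁ i) (e₂ i)))
          (El-≈ P (unique ≈-refl ≈-refl))

      ind-isProduct : IsProduct (Ind C) pr₁ pr₂
      ind-isProduct = record
        { ⟨_,_⟩ = λ f g → record
            { comp = λ i → pair (IndHom.comp f i) (IndHom.comp g i) ; compat = pair-compat f g }
        ; project₁ = λ i → El-≈ A project₁
        ; project₂ = λ i → El-≈ B project₂
        ; unique = λ {T} {f} {g} {h} → pair-unique {T} {f} {g} {h} }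

  private
    module ι = Functor (ι {C = C})

    ι-terminal : ∀ {T} → IsTerminal C T → IsTerminal (Ind C) (ι.F₀ T)
    ι-terminal {T} t = record
      { ! = record { comp = λ _ → tt , t.! ; compat = λ _ → El-≈ (ι.F₀ T) (≈-sym (t.!-unique _)) }
      ; !-unique = λ f i → El-≈ (ι.F₀ T) (t.!-unique _) }
      where module t = IsTerminal t

    unι : ∀ {X Z} {x y : El (ι.F₀ X) Z} →
          SameEl (ι.F₀ X) x y → proj₂ x ≈ proj₂ y
    unι (same _ _ e) = ≈-trans (≈-sym identityˡ) (≈-trans e identityˡ)

    ι-product : ∀ {A B P} {p : P ⇒ A} {q : P ⇒ B} → IsProduct C p q →
                IsProduct (Ind C) (ι.F₁ p) (ι.F₁ q)
    ι-product {A} {B} {P} {p} {q} isP = record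
      { ⟨_,_⟩ = λ f g → record
          { comp = λ i → tt , P.⟨ proj₂ (IndHom.comp f i) , proj₂ (IndHom.comp g i) ⟩
          ; compat = λ a → El-≈ (ι.F₀ P) (≈-sym (P.unique
              (≈-trans (≈-sym assoc) (≈-trans (P.project₁ ⟩∘⟨refl) (unι {A} (IndHom.compat f a))))
              (≈-trans (≈-sym assoc) (≈-trans (P.project₂ ⟩∘⟨refl) (unι {B} (IndHom.compat g a)))))) }
      ; project₁ = λ i → El-≈ (ι.F₀ A) P.project₁
      ; project₂ = λ i → El-≈ (ι.F₀ B) P.project₂
      ; unique = λ e₁ e₂ i → El-≈ (ι.F₀ P) (P.unique (unι {A} (e₁ i)) (unι {B} (e₂ i))) }
      where module P = IsProduct isP

  ι-preserves : PreservesFiniteProducts (ι {C = C})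
  ι-preserves = record { terminal = ι-terminal ; product = ι-product }

  Ind-cartesian : Cartesian (Ind C)
  Ind-cartesian = record
    { 𝟏 = Functor.F₀ ι 𝟏
    ; isTerminal = ι-terminal isTerminal
    ; _⊠_ = _⊠ᵢ_ ; π₁ = λ {A} {B} → pr₁ {A} {B} ; π₂ = λ {A} {B} → pr₂ {A} {B}
    ; isProduct = λ {A} {B} → ind-isProduct {A} {B} }

module _ {C : Category o ℓ} (c : Cartesian C) where
  open Category C
  open Cartesian c

  -- Pro C is the opposite of Ind (op C), so these are coproducts in Ind (op C).
  private
    _⊠ₚ_ : IndObj (op C) → IndObj (op C) → IndObj (op C)
    A ⊠ₚ B = record
      { index = Prod A.index B.index
      ; filtered = Prod-filtered A.filtered B.filtered
      ; diagram = record
        { F₀ = λ (i , j) → A.ob i ⊠ B.ob j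
        ; F₁ = λ (a , b) → A.tr a ⁂ B.tr b
        ; F-resp-≈ = λ (p , q) → ⁂-resp (A.tr-resp p) (B.tr-resp q)
        ; identity = ≈-trans (⁂-resp A.tr-id B.tr-id) id⁂id
        ; homomorphism = ≈-trans (⁂-resp A.tr-∘ B.tr-∘) (≈-sym ⁂∘⁂) } }
      where
      module A = IndObj A
      module B = IndObj B

    module _ (X : IndObj (op C)) where
      private
        module X = IndObj X
        module S {Z : Obj} = Setoid (El-setoid X Z)

      pair : ∀ {P Q} → El X P → El X Q → El X (P ⊠ Q)
      pair (i , f) (j , g) =
        let (k , a , b) = X.upperBound i j in k , ⟨ f ∘ X.tr a , g ∘ X.tr b ⟩

      abstract
        pair-at : ∀ {P Q i j k} (f : X.ob i ⇒ P) (g : X.ob j ⇒ Q) (a : i X.↝ k) (b : j X.↝ k) →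
                  SameEl X (pair (i , f) (j , g)) (k , ⟨ f ∘ X.tr a , g ∘ X.tr b ⟩)
        pair-at {i = i} {j} f g a b with X.upperBound i j
        ... | m , c , d with X.merge c d a b
        ... | n , s , t , p , q = same s t (≈-trans ⟨⟩∘ (≈-trans
                (⟨⟩-resp (glue p) (glue q)) (≈-sym ⟨⟩∘)))
          where
          glue : ∀ {R i m k n} {h : X.ob i ⇒ R} {c : i X.↝ m} {a : i X.↝ k} {s : m X.↝ n} {t : k X.↝ n} →
                 Category._≈_ X.index (s X.∘ᵢ c) (t X.∘ᵢ a) →
                 (h ∘ X.tr c) ∘ X.tr s ≈ (h ∘ X.tr a) ∘ X.tr t
          glue e = ≈-trans assoc (≈-trans (refl⟩∘⟨ ≈-trans (≈-sym X.tr-∘) (≈-trans (X.tr-resp e) X.tr-∘))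
                     (≈-sym assoc))

        pair-resp : ∀ {P Q} {x x′ : El X P} {y y′ : El X Q} →
                    SameEl X x x′ → SameEl X y y′ → SameEl X (pair x y) (pair x′ y′)
        pair-resp {x = i , f} {i′ , f′} {j , g} {j′ , g′} (same {k} a a′ p) (same {l} b b′ q)
          with X.upperBound k l
        ... | n , s , t = S.trans (pair-at f g (s X.∘ᵢ a) (t X.∘ᵢ b)) (S.trans
                (El-≈ X (⟨⟩-resp (shift p) (shift q)))
                (S.sym (pair-at f′ g′ (s X.∘ᵢ a′) (t X.∘ᵢ b′))))
          where
          shift : ∀ {R i i′ k n} {h : X.ob i ⇒ R} {h′ : X.ob i′ ⇒ R} {a : i X.↝ k} {a′ : i′ X.↝ k}
                  {s : k X.↝ n} → h ∘ X.tr a ≈ h′ ∘ X.tr a′ →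
                  h ∘ X.tr (s X.∘ᵢ a) ≈ h′ ∘ X.tr (s X.∘ᵢ a′)
          shift e = ≈-trans (refl⟩∘⟨ X.tr-∘) (≈-trans (≈-sym assoc) (≈-trans (e ⟩∘⟨refl)
                      (≈-trans assoc (refl⟩∘⟨ ≈-sym X.tr-∘))))

    module _ {A B : IndObj (op C)} where
      private
        module A = IndObj A
        module B = IndObj B
        P = A ⊠ₚ B
        module SP {Z : Obj} = Setoid (El-setoid P Z)

      abstract
        in₁ : ∀ {i j j′} → SameEl P ((i , j) , π₁ {A.ob i} {B.ob j}) ((i , j′) , π₁)
        in₁ {i} {j} {j′} with B.upperBound j j′
        ... | _ , b , b′ = same (A.idᵢ , b) (A.idᵢ , b′) (≈-trans project₁ (≈-sym project₁))

        in₂ : ∀ {i i′ j} → SameEl P ((i , j) , π₂ {A.ob i} {B.ob j}) ((i′ , j) , π₂)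
        in₂ {i} {i′} {j} with A.upperBound i i′
        ... | _ , a , a′ = same (a , B.idᵢ) (a′ , B.idᵢ) (≈-trans project₂ (≈-sym project₂))

        pr₁-compat : ∀ {i i′} (a : i A.↝ i′) →
                     SameEl P ((i′ , B.point) , A.tr a ∘ π₁) ((i , B.point) , π₁)
        pr₁-compat a = SP.trans (El-≈ P (≈-sym project₁)) (SP.trans (SP.sym (El-tr P (a , B.idᵢ) π₁)) in₁)

        pr₂-compat : ∀ {j j′} (b : j B.↝ j′) →
                     SameEl P ((A.point , j′) , B.tr b ∘ π₂) ((A.point , j) , π₂)
        pr₂-compat b = SP.trans (El-≈ P (≈-sym project₂)) (SP.trans (SP.sym (El-tr P (A.idᵢ , b) π₂)) in₂)

      pr₁ : IndHom A P
      pr₁ = record { comp = λ i → (i , B.point) , π₁ ; compat = pr₁-compat }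

      pr₂ : IndHom B P
      pr₂ = record { comp = λ j → (A.point , j) , π₂ ; compat = pr₂-compat }

      module _ {X : IndObj (op C)} where
        private
          module X = IndObj X
          module S {Z : Obj} = Setoid (El-setoid X Z)

        copair : IndHom A X → IndHom B X → ∀ ((i , j) : A.Index × B.Index) → El X (A.ob i ⊠ B.ob j)
        copair f g (i , j) = pair X (IndHom.comp f i) (IndHom.comp g j)

        abstract
          copair-compat : (f : IndHom A X) (g : IndHom B X) →
                          ∀ {k l} (r : Category._⇒_ (IndObj.index P) k l) →
                          SameEl X (El-restrict X (IndObj.tr P r) (copair f g l)) (copair f g k)
          copair-compat f g (a , b) = S.trans
            (El-≈ X (≈-trans ⁂∘⟨⟩ (⟨⟩-resp (≈-sym assoc) (≈-sym assoc))))
            (pair-resp X (IndHom.compat f a) (IndHom.compat g b))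

          copair-unique : {f : IndHom A X} {g : IndHom B X} {h : IndHom P X} →
                          (∀ i → SameEl X (push h (IndHom.comp pr₁ i)) (IndHom.comp f i)) →
                          (∀ j → SameEl X (push h (IndHom.comp pr₂ j)) (IndHom.comp g j)) →
                          ∀ k → SameEl X (copair f g k) (IndHom.comp h k)
          copair-unique {f} {g} {h} e₁ e₂ (i , j) = S.trans
            (pair-resp X
              (S.trans (S.sym (e₁ i)) (push-resp h (in₁ {j′ = j})))
              (S.trans (S.sym (e₂ j)) (push-resp h (in₂ {i′ = i}))))
            (S.trans (pair-at X _ _ X.idᵢ X.idᵢ)
              (El-≈ X (unique (≈-sym (≈-trans (refl⟩∘⟨ X.tr-id) identityʳ))
                              (≈-sym (≈-trans (refl⟩∘⟨ X.tr-id) identityʳ)))))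

          copair-project₁ : (f : IndHom A X) (g : IndHom B X) →
                            ∀ i → SameEl X (El-restrict X π₁ (copair f g (i , B.point))) (IndHom.comp f i)
          copair-project₁ f g i = S.trans (El-≈ X project₁) (S.sym (El-tr X _ _))

          copair-project₂ : (f : IndHom A X) (g : IndHom B X) →
                            ∀ j → SameEl X (El-restrict X π₂ (copair f g (A.point , j))) (IndHom.comp g j)
          copair-project₂ f g j = S.trans (El-≈ X project₂) (S.sym (El-tr X _ _))

      pro-isProduct : IsProduct (Pro C) pr₁ pr₂
      pro-isProduct = record
        { ⟨_,_⟩ = λ f g → record { comp = copair f g ; compat = copair-compat f g }
        ; project₁ = λ {X} {f} {g} → copair-project₁ f g
        ; project₂ = λ {X} {f} {g} → copair-project₂ f g
        ; unique = λ {X} {f} {g} {h} → copair-unique {X} {f} {g} {h} }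

  private
    abstract
      any-two : (X : IndObj (op C)) {x y : El X 𝟏} → SameEl X x y
      any-two X {i , f} {j , g} with IndObj.upperBound X i j
      ... | _ , a , b = same a b (≈-trans (≈-sym (!-unique _)) (!-unique _))

  Pro-cartesian : Cartesian (Pro C)
  Pro-cartesian = record
    { 𝟏 = Functor.F₀ κ 𝟏
    ; isTerminal = record
      { ! = λ {X} → record { comp = λ _ → IndObj.point X , ! ; compat = λ _ → any-two X }
      ; !-unique = λ {X} f _ → any-two X }
    ; _⊠_ = _⊠ₚ_ ; π₁ = λ {A} {B} → pr₁ {A} {B} ; π₂ = λ {A} {B} → pr₂ {A} {B}
    ; isProduct = λ {A} {B} → pro-isProduct {A} {B} }

module _ {C : Category o ℓ} (c : Cartesian C) where
  open Category C
  open Cartesian c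

  record GroupObj : Set (o ⊔ ℓ) where
    field
      carrier   : Obj
      mul       : carrier ⊠ carrier ⇒ carrier
      unit      : 𝟏 ⇒ carrier
      inv       : carrier ⇒ carrier
      mul-assoc : mul ∘ (mul ⁂ id) ≈ mul ∘ (id ⁂ mul) ∘ assocʳ
      unitˡ     : mul ∘ ⟨ unit ∘ ! , id ⟩ ≈ id
      unitʳ     : mul ∘ ⟨ id , unit ∘ ! ⟩ ≈ id
      invˡ      : mul ∘ ⟨ inv , id ⟩ ≈ unit ∘ !
      invʳ      : mul ∘ ⟨ id , inv ⟩ ≈ unit ∘ !

  record GroupHom (G H : GroupObj) : Set ℓ where
    private
      module G = GroupObj G
      module H = GroupObj H
    field
      hom     : G.carrier ⇒ H.carrier
      hom-mul : hom ∘ G.mul ≈ H.mul ∘ (hom ⁂ hom)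

module _ {C : Category o ℓ} (c : Cartesian C) where
  private
    module C = Category C
    module c = Cartesian c
  open Category

  Grp : Category (o ⊔ ℓ) ℓ
  Grp .Obj = GroupObj c
  Grp ._⇒_ = GroupHom c
  Grp ._≈_ f g = GroupHom.hom f C.≈ GroupHom.hom g
  Grp .id = record
    { hom = C.id
    ; hom-mul = C.≈-trans C.identityˡ (C.≈-sym (C.≈-trans (C.refl⟩∘⟨ c.id⁂id) C.identityʳ)) }
  Grp ._∘_ g f = record
    { hom = g.hom C.∘ f.hom
    ; hom-mul = C.≈-trans C.assoc (C.≈-trans (C.refl⟩∘⟨ f.hom-mul) (C.≈-trans (C.≈-sym C.assoc)
        (C.≈-trans (g.hom-mul C.⟩∘⟨refl) (C.≈-trans C.assoc (C.refl⟩∘⟨ c.⁂∘⁂))))) }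
    where
    module g = GroupHom g
    module f = GroupHom f
  Grp .equiv = record { refl = C.≈-refl ; sym = C.≈-sym ; trans = C.≈-trans }
  Grp .∘-resp-≈ = C.∘-resp-≈
  Grp .assoc = C.assoc
  Grp .identityˡ = C.identityˡ
  Grp .identityʳ = C.identityʳ

  forget : Functor Grp C
  forget = record
    { F₀ = GroupObj.carrier ; F₁ = GroupHom.hom ; F-resp-≈ = λ e → e
    ; identity = C.≈-refl ; homomorphism = C.≈-refl }

module Comparison {C : Category o ℓ} {D : Category o′ ℓ′} (c : Cartesian C) (d : Cartesian D)
                  (F : Functor C D) (pres : PreservesFiniteProducts F) where
  private
    module C = Category C
    module c = Cartesian c
  open Category D
  open Cartesian d
  open Functor F
  open PreservesFiniteProducts pres
  private
    module FP {A B : C.Obj} = IsProduct (product (c.isProduct {A} {B}))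

  φ : ∀ {A B} → F₀ A ⊠ F₀ B ⇒ F₀ (A c.⊠ B)
  φ = FP.⟨ π₁ , π₂ ⟩

  abstract
    φ-ext : ∀ {T A B} {h k : T ⇒ F₀ (A c.⊠ B)} →
            F₁ c.π₁ ∘ h ≈ F₁ c.π₁ ∘ k → F₁ c.π₂ ∘ h ≈ F₁ c.π₂ ∘ k → h ≈ k
    φ-ext e₁ e₂ = ≈-trans (≈-sym (FP.unique e₁ e₂)) (FP.unique ≈-refl ≈-refl)

    private
      pull₁ : ∀ {T A B} {h : T ⇒ F₀ A ⊠ F₀ B} → F₁ c.π₁ ∘ φ ∘ h ≈ π₁ ∘ h
      pull₁ = ≈-trans (≈-sym assoc) (FP.project₁ ⟩∘⟨refl)
      pull₂ : ∀ {T A B} {h : T ⇒ F₀ A ⊠ F₀ B} → F₁ c.π₂ ∘ φ ∘ h ≈ π₂ ∘ h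
      pull₂ = ≈-trans (≈-sym assoc) (FP.project₂ ⟩∘⟨refl)

    F-square : ∀ {X Y Y′ Z} {f : X C.⇒ Y} {g : Y C.⇒ Z} {h : X C.⇒ Y′} {k : Y′ C.⇒ Z} →
               g C.∘ f C.≈ k C.∘ h → F₁ g ∘ F₁ f ≈ F₁ k ∘ F₁ h
    F-square e = ≈-trans (≈-sym homomorphism) (≈-trans (F-resp-≈ e) homomorphism)

    φ-⟨⟩ : ∀ {T A B} {f : T C.⇒ A} {g : T C.⇒ B} → φ ∘ ⟨ F₁ f , F₁ g ⟩ ≈ F₁ c.⟨ f , g ⟩
    φ-⟨⟩ = φ-ext
      (≈-trans pull₁ (≈-trans project₁ (≈-trans (F-resp-≈ (C.≈-sym c.project₁)) homomorphism)))
      (≈-trans pull₂ (≈-trans project₂ (≈-trans (F-resp-≈ (C.≈-sym c.project₂)) homomorphism)))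

    φ-natural : ∀ {A B A′ B′} {f : A C.⇒ A′} {g : B C.⇒ B′} → φ ∘ (F₁ f ⁂ F₁ g) ≈ F₁ (f c.⁂ g) ∘ φ
    φ-natural = φ-ext
      (≈-trans pull₁ (≈-trans project₁ (≈-sym (≈-trans (≈-sym assoc)
        (≈-trans (F-square c.project₁ ⟩∘⟨refl) (≈-trans assoc (refl⟩∘⟨ FP.project₁)))))))
      (≈-trans pull₂ (≈-trans project₂ (≈-sym (≈-trans (≈-sym assoc)
        (≈-trans (F-square c.project₂ ⟩∘⟨refl) (≈-trans assoc (refl⟩∘⟨ FP.project₂)))))))

    φ-assoc : ∀ {A B E} → φ ∘ (id ⁂ φ) ∘ assocʳ ≈ F₁ (c.assocʳ {A} {B} {E}) ∘ φ ∘ (φ ⁂ id)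
    φ-assoc = φ-ext
      (begin
        F₁ c.π₁ ∘ φ ∘ (id ⁂ φ) ∘ assocʳ         ≈⟨ pull₁ ⟩
        π₁ ∘ (id ⁂ φ) ∘ assocʳ                  ≈⟨ refl⟩∘⟨ ⁂∘⟨⟩ ⟩
        π₁ ∘ ⟨ id ∘ π₁ ∘ π₁ , φ ∘ (π₂ ⁂ id) ⟩   ≈⟨ ≈-trans project₁ identityˡ ⟩
        π₁ ∘ π₁                                 ≈⟨ ≈-sym FP.project₁ ⟩∘⟨refl ⟩
        (F₁ c.π₁ ∘ φ) ∘ π₁                      ≈⟨ assoc ⟩
        F₁ c.π₁ ∘ φ ∘ π₁                        ≈⟨ refl⟩∘⟨ ≈-sym project₁ ⟩
        F₁ c.π₁ ∘ π₁ ∘ (φ ⁂ id)                 ≈⟨ refl⟩∘⟨ ≈-sym pull₁ ⟩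
        F₁ c.π₁ ∘ F₁ c.π₁ ∘ φ ∘ (φ ⁂ id)        ≈⟨ ≈-sym assoc ⟩
        (F₁ c.π₁ ∘ F₁ c.π₁) ∘ φ ∘ (φ ⁂ id)      ≈⟨ F-square (C.≈-sym c.project₁) ⟩∘⟨refl ⟩
        (F₁ c.π₁ ∘ F₁ c.assocʳ) ∘ φ ∘ (φ ⁂ id)  ≈⟨ assoc ⟩
        F₁ c.π₁ ∘ F₁ c.assocʳ ∘ φ ∘ (φ ⁂ id)    ∎)
      (begin
        F₁ c.π₂ ∘ φ ∘ (id ⁂ φ) ∘ assocʳ         ≈⟨ pull₂ ⟩
        π₂ ∘ (id ⁂ φ) ∘ assocʳ                  ≈⟨ refl⟩∘⟨ ⁂∘⟨⟩ ⟩
        π₂ ∘ ⟨ id ∘ π₁ ∘ π₁ , φ ∘ (π₂ ⁂ id) ⟩   ≈⟨ project₂ ⟩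
        φ ∘ (π₂ ⁂ id)                           ≈⟨ refl⟩∘⟨ ⁂-resp (≈-sym FP.project₂)
                                                     (≈-sym (≈-trans identityʳ identity)) ⟩
        φ ∘ ((F₁ c.π₂ ∘ φ) ⁂ (F₁ C.id ∘ id))    ≈⟨ refl⟩∘⟨ ≈-sym ⁂∘⁂ ⟩
        φ ∘ (F₁ c.π₂ ⁂ F₁ C.id) ∘ (φ ⁂ id)      ≈⟨ ≈-sym assoc ⟩
        (φ ∘ (F₁ c.π₂ ⁂ F₁ C.id)) ∘ (φ ⁂ id)    ≈⟨ φ-natural ⟩∘⟨refl ⟩
        (F₁ (c.π₂ c.⁂ C.id) ∘ φ) ∘ (φ ⁂ id)     ≈⟨ assoc ⟩
        F₁ (c.π₂ c.⁂ C.id) ∘ φ ∘ (φ ⁂ id)       ≈⟨ F-resp-≈ (C.≈-sym c.project₂) ⟩∘⟨refl ⟩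
        F₁ (c.π₂ C.∘ c.assocʳ) ∘ φ ∘ (φ ⁂ id)   ≈⟨ homomorphism ⟩∘⟨refl ⟩
        (F₁ c.π₂ ∘ F₁ c.assocʳ) ∘ φ ∘ (φ ⁂ id)  ≈⟨ assoc ⟩
        F₁ c.π₂ ∘ F₁ c.assocʳ ∘ φ ∘ (φ ⁂ id)    ∎)

module _ {C : Category o ℓ} {D : Category o′ ℓ′} (c : Cartesian C) (d : Cartesian D)
         (F : Functor C D) (pres : PreservesFiniteProducts F) where
  private
    module C = Category C
    module c = Cartesian c
  open Category D
  open Cartesian d
  open Functor F
  open PreservesFiniteProducts pres
  open Comparison c d F pres
  private
    module F𝟏 = IsTerminal (terminal c.isTerminal)

    GrpF₀ : GroupObj c → GroupObj d
    GrpF₀ G = record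
      { carrier = F₀ G.carrier
      ; mul = F₁ G.mul ∘ φ
      ; unit = F₁ G.unit ∘ F𝟏.!
      ; inv = F₁ G.inv
      ; mul-assoc = begin
          (F₁ G.mul ∘ φ) ∘ ((F₁ G.mul ∘ φ) ⁂ id)                    ≈⟨ assoc ⟩
          F₁ G.mul ∘ φ ∘ ((F₁ G.mul ∘ φ) ⁂ id)                      ≈⟨ refl⟩∘⟨ refl⟩∘⟨ ⁂-resp ≈-refl
                                                                         (≈-sym (≈-trans identityʳ identity)) ⟩
          F₁ G.mul ∘ φ ∘ ((F₁ G.mul ∘ φ) ⁂ (F₁ C.id ∘ id))          ≈⟨ refl⟩∘⟨ shift ⟩
          F₁ G.mul ∘ F₁ (G.mul c.⁂ C.id) ∘ φ ∘ (φ ⁂ id)             ≈⟨ ≈-sym assoc ⟩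
          (F₁ G.mul ∘ F₁ (G.mul c.⁂ C.id)) ∘ φ ∘ (φ ⁂ id)           ≈⟨ F-square G.mul-assoc ⟩∘⟨refl ⟩
          (F₁ G.mul ∘ F₁ ((C.id c.⁂ G.mul) C.∘ c.assocʳ)) ∘ φ ∘ (φ ⁂ id) ≈⟨ assoc ⟩
          F₁ G.mul ∘ F₁ ((C.id c.⁂ G.mul) C.∘ c.assocʳ) ∘ φ ∘ (φ ⁂ id)   ≈⟨ refl⟩∘⟨ homomorphism ⟩∘⟨refl ⟩
          F₁ G.mul ∘ (F₁ (C.id c.⁂ G.mul) ∘ F₁ c.assocʳ) ∘ φ ∘ (φ ⁂ id)  ≈⟨ refl⟩∘⟨ assoc ⟩
          F₁ G.mul ∘ F₁ (C.id c.⁂ G.mul) ∘ F₁ c.assocʳ ∘ φ ∘ (φ ⁂ id)    ≈⟨ refl⟩∘⟨ refl⟩∘⟨ ≈-sym φ-assoc ⟩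
          F₁ G.mul ∘ F₁ (C.id c.⁂ G.mul) ∘ φ ∘ (id ⁂ φ) ∘ assocʳ    ≈⟨ refl⟩∘⟨ ≈-sym shift′ ⟩
          F₁ G.mul ∘ φ ∘ ((F₁ C.id ∘ id) ⁂ (F₁ G.mul ∘ φ)) ∘ assocʳ ≈⟨ refl⟩∘⟨ refl⟩∘⟨
                                                                         (⁂-resp (≈-trans identityʳ identity) ≈-refl ⟩∘⟨refl) ⟩
          F₁ G.mul ∘ φ ∘ (id ⁂ (F₁ G.mul ∘ φ)) ∘ assocʳ             ≈⟨ ≈-sym assoc ⟩
          (F₁ G.mul ∘ φ) ∘ (id ⁂ (F₁ G.mul ∘ φ)) ∘ assocʳ           ∎
      ; unitˡ = law (⟨⟩-resp const (≈-sym identity)) G.unitˡ identity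
      ; unitʳ = law (⟨⟩-resp (≈-sym identity) const) G.unitʳ identity
      ; invˡ = law (⟨⟩-resp ≈-refl (≈-sym identity)) G.invˡ (≈-sym const)
      ; invʳ = law (⟨⟩-resp (≈-sym identity) ≈-refl) G.invʳ (≈-sym const) }
      where
      module G = GroupObj G
      const : ∀ {A} → (F₁ G.unit ∘ F𝟏.!) ∘ ! ≈ F₁ (G.unit C.∘ c.! {A})
      const = ≈-trans assoc (≈-trans (refl⟩∘⟨ ≈-trans (≈-sym (F𝟏.!-unique _)) (F𝟏.!-unique _))
                (≈-sym homomorphism))
      law : ∀ {A} {f g : A C.⇒ G.carrier} {k : A C.⇒ G.carrier} {m : F₀ A ⇒ F₀ G.carrier ⊠ F₀ G.carrier}
            {r : F₀ A ⇒ F₀ G.carrier} →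
            m ≈ ⟨ F₁ f , F₁ g ⟩ → G.mul C.∘ c.⟨ f , g ⟩ C.≈ k → F₁ k ≈ r →
            (F₁ G.mul ∘ φ) ∘ m ≈ r
      law em e er = ≈-trans assoc (≈-trans (refl⟩∘⟨ ≈-trans (refl⟩∘⟨ em) φ-⟨⟩)
        (≈-trans (≈-sym homomorphism) (≈-trans (F-resp-≈ e) er)))
      shift : ∀ {A B X Y} {f : A C.⇒ X} {g : B C.⇒ Y} {S T} {h : S ⇒ F₀ A} {k : T ⇒ F₀ B} →
              φ ∘ ((F₁ f ∘ h) ⁂ (F₁ g ∘ k)) ≈ F₁ (f c.⁂ g) ∘ φ ∘ (h ⁂ k)
      shift = ≈-trans (refl⟩∘⟨ ≈-sym ⁂∘⁂) (≈-trans (≈-sym assoc)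
                (≈-trans (φ-natural ⟩∘⟨refl) assoc))
      shift′ : ∀ {A B X Y} {f : A C.⇒ X} {g : B C.⇒ Y} {R S T} {h : S ⇒ F₀ A} {k : T ⇒ F₀ B}
               {r : R ⇒ S ⊠ T} →
               φ ∘ ((F₁ f ∘ h) ⁂ (F₁ g ∘ k)) ∘ r ≈ F₁ (f c.⁂ g) ∘ φ ∘ (h ⁂ k) ∘ r
      shift′ = ≈-trans (≈-sym assoc) (≈-trans (shift ⟩∘⟨refl) (≈-trans assoc (refl⟩∘⟨ assoc)))

  GrpF : Functor (Grp c) (Grp d)
  GrpF = record
    { F₀ = GrpF₀
    ; F₁ = λ f → let module f = GroupHom f in record
        { hom = F₁ f.hom
        ; hom-mul = ≈-trans (≈-sym assoc) (≈-trans (F-square f.hom-mul ⟩∘⟨refl)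
            (≈-trans assoc (≈-trans (refl⟩∘⟨ ≈-sym φ-natural) (≈-sym assoc)))) }
    ; F-resp-≈ = F-resp-≈
    ; identity = identity
    ; homomorphism = homomorphism }

-- Homomorphisms of pro-groups are computed in Pro (Grp E), which is a full
-- subcategory of the group objects of Pro E.
ProGroup : {E : Category o ℓ} → Cartesian E → Category (o ⊔ lsuc ℓ) ℓ
ProGroup e = Pro (Grp e)

module _ {E : Category o ℓ} (e : Cartesian E) where
  open Category (Pro E)
  open Cartesian (Pro-cartesian e) using (_⊠_)

  underlying : Category.Obj (ProGroup e) → Obj
  underlying = Functor.F₀ (ProF (forget e))

  module _ (G : Category.Obj (ProGroup e)) where
    private
      module G = IndObj G
      P = underlying G ⊠ underlying G
      module S {Z : Category.Obj E} = Setoid (El-setoid P Z)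

      abstract
        mul-compat : ∀ {i j} (a : i G.↝ j) →
                     SameEl P ((j , j) , Category._∘_ E (GroupHom.hom (G.tr a)) (GroupObj.mul (G.ob j)))
                              ((i , i) , GroupObj.mul (G.ob i))
        mul-compat {i} a = S.trans (El-≈ P (GroupHom.hom-mul (G.tr a)))
                             (S.sym (El-tr P (a , a) (GroupObj.mul (G.ob i))))

    pro-mul : P ⇒ underlying G
    pro-mul = record { comp = λ i → (i , i) , GroupObj.mul (G.ob i) ; compat = mul-compat }

module _ {C : Category o ℓ} (c : Cartesian C) where
  open Category C
  open Cartesian c

  HomPresheaf : Obj → Obj → Presheaf C
  HomPresheaf X Y = record
    { at = λ Z → hom-setoid (Z ⊠ X) Y
    ; restrict = λ f → record { to = λ h → h ∘ (f ⁂ id) ; cong = λ e → e ⟩∘⟨refl }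
    ; ∣-resp = λ h e → refl⟩∘⟨ ⁂-resp e ≈-refl
    ; ∣-id = λ h → ≈-trans (refl⟩∘⟨ id⁂id) identityʳ
    ; ∣-∘ = λ f g h → ≈-trans (refl⟩∘⟨ ≈-sym (≈-trans ⁂∘⁂ (⁂-resp ≈-refl identityˡ))) (≈-sym assoc) }

  record IsoOver (T X Y : Obj) : Set ℓ where
    field
      fwd   : T ⊠ X ⇒ T ⊠ Y
      over  : π₁ ∘ fwd ≈ π₁
      isIso : IsIso fwd
    open IsIso isIso public renaming (inv to bwd)

    over-bwd : π₁ ∘ bwd ≈ π₁
    over-bwd = ≈-trans (≈-sym over ⟩∘⟨refl) (≈-trans assoc (≈-trans (refl⟩∘⟨ isoʳ) identityʳ))

  private
    base : ∀ {S T X Y} → S ⇒ T → T ⊠ X ⇒ T ⊠ Y → S ⊠ X ⇒ S ⊠ Y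
    base f h = ⟨ π₁ , π₂ ∘ h ∘ (f ⁂ id) ⟩

    abstract
      base-resp : ∀ {S T X Y} {f g : S ⇒ T} {h k : T ⊠ X ⇒ T ⊠ Y} →
                  f ≈ g → h ≈ k → base f h ≈ base g k
      base-resp e e′ = ⟨⟩-resp ≈-refl (refl⟩∘⟨ ∘-resp-≈ e′ (⁂-resp e ≈-refl))

      base-square : ∀ {S T X Y} (f : S ⇒ T) (h : T ⊠ X ⇒ T ⊠ Y) → π₁ ∘ h ≈ π₁ →
                    (f ⁂ id) ∘ base f h ≈ h ∘ (f ⁂ id)
      base-square f h e = ≈-trans ⁂∘⟨⟩ (unique
        (≈-trans (≈-sym assoc) (≈-trans (e ⟩∘⟨refl) project₁)) (≈-sym identityˡ))

      base-inverse : ∀ {S T X Y} (f : S ⇒ T) (h : T ⊠ X ⇒ T ⊠ Y) (k : T ⊠ Y ⇒ T ⊠ X) →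
                     π₁ ∘ h ≈ π₁ → k ∘ h ≈ id → base f k ∘ base f h ≈ id
      base-inverse f h k e kh = ≈-trans ⟨⟩∘ (unique
        (≈-trans identityʳ (≈-sym project₁))
        (≈-trans identityʳ (≈-sym (begin
          (π₂ ∘ k ∘ (f ⁂ id)) ∘ base f h   ≈⟨ ≈-trans assoc (refl⟩∘⟨ assoc) ⟩
          π₂ ∘ k ∘ (f ⁂ id) ∘ base f h     ≈⟨ refl⟩∘⟨ refl⟩∘⟨ base-square f h e ⟩
          π₂ ∘ k ∘ h ∘ (f ⁂ id)            ≈⟨ refl⟩∘⟨ ≈-trans (≈-sym assoc) (kh ⟩∘⟨refl) ⟩
          π₂ ∘ id ∘ (f ⁂ id)               ≈⟨ refl⟩∘⟨ identityˡ ⟩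
          π₂ ∘ (f ⁂ id)                    ≈⟨ ≈-trans project₂ identityˡ ⟩
          π₂                               ∎))))

  BiPresheaf : Obj → Obj → Presheaf C
  BiPresheaf X Y = record
    { at = λ T → record
        { Carrier = IsoOver T X Y ; _≈_ = λ a b → IsoOver.fwd a ≈ IsoOver.fwd b
        ; isEquivalence = record { refl = ≈-refl ; sym = ≈-sym ; trans = ≈-trans } }
    ; restrict = λ f → record
        { to = λ a → let module a = IsoOver a in record
            { fwd = base f a.fwd
            ; over = project₁
            ; isIso = record
              { inv = base f a.bwd
              ; isoˡ = base-inverse f a.fwd a.bwd a.over a.isoˡ
              ; isoʳ = base-inverse f a.bwd a.fwd a.over-bwd a.isoʳ } }
        ; cong = λ e → base-resp ≈-refl e }
    ; ∣-resp = λ a e → base-resp e ≈-refl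
    ; ∣-id = λ a → unique (IsoOver.over a)
                     (≈-sym (refl⟩∘⟨ ≈-trans (refl⟩∘⟨ id⁂id) identityʳ))
    ; ∣-∘ = λ f g a → ⟨⟩-resp ≈-refl (≈-trans
        (refl⟩∘⟨ ≈-trans (refl⟩∘⟨ ≈-sym (≈-trans ⁂∘⁂ (⁂-resp ≈-refl identityˡ))) (≈-sym assoc))
        (≈-trans (≈-sym assoc) (≈-trans (≈-sym project₂ ⟩∘⟨refl) assoc))) }

infix 4 _IndRepresents_
_IndRepresents_ : {C : Category o ℓ} → IndObj C → Presheaf C → Set (o ⊔ ℓ)
B IndRepresents P = PresheafIso P (El-presheaf B)

-- A compatible family of elements of P(Aᵢ) is a morphism from A to the
-- ind-object representing P.
module _ {C : Category o ℓ} {P : Presheaf C} {B : IndObj C} (r : B IndRepresents P)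
         (A : IndObj C) where
  private
    module P = Presheaf P
    module A = IndObj A
    module r = PresheafIso r

  classify : (p : ∀ i → Setoid.Carrier (P.at (A.ob i))) →
             (∀ {i j} (a : i A.↝ j) → p j P.∣ A.tr a P.∼ p i) → IndHom A B
  classify p coh = record { comp = λ i → r.to (p i) ; compat = classify-compat }
    where
    abstract
      classify-compat : ∀ {i j} (a : i A.↝ j) →
                        SameEl B (El-restrict B (A.tr a) (r.to (p j))) (r.to (p i))
      classify-compat a = Setoid.trans (El-setoid B _)
        (Setoid.sym (El-setoid B _) (r.natural _ _)) (Inverse.to-cong (r.iso _) (coh a))

record IndClosed (C : Category o ℓ) : Set (o ⊔ lsuc ℓ) where
  open Category C
  field
    finitelyComplete : FinitelyComplete C
  open FinitelyComplete finitelyComplete public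
  open Cartesian cartesian public
  field
    HomObj     : Obj → Obj → IndObj C
    represents : ∀ X Y → HomObj X Y IndRepresents HomPresheaf cartesian X Y

  -- the components  Hᵢ × X → Y  of the evaluation  Hom(X, Y) × X → Y,
  -- where Hom(X, Y) = colimᵢ Hᵢ
  module _ (X Y : Obj) where
    private
      module H = IndObj (HomObj X Y)
      module r = PresheafIso (represents X Y)
      module P = Presheaf (HomPresheaf cartesian X Y)

    ev : ∀ i → H.ob i ⊠ X ⇒ Y
    ev i = r.from (i , id)

    abstract
      ev-compat : ∀ {i j} (a : i H.↝ j) → ev j ∘ (H.tr a ⁂ id) ≈ ev i
      ev-compat {i} {j} a = ≈-sym (Inverse.inverseʳ (r.iso _) (S.sym
          (S.trans (r.natural (H.tr a) (ev j))
          (S.trans (El-restrict-resp (HomObj X Y) (H.tr a) (Inverse.inverseˡ (r.iso _) ≈-refl))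
          (S.trans (El-≈ (HomObj X Y) (≈-trans identityˡ (≈-sym identityʳ)))
                   (S.sym (El-tr (HomObj X Y) a id)))))))
        where module S {Z : Obj} = Setoid (El-setoid (HomObj X Y) Z)

  postcompose : ∀ Z {X Y} → X ⇒ Y → IndHom (HomObj Z X) (HomObj Z Y)
  postcompose Z {X} {Y} k = classify (represents Z Y) (HomObj Z X)
    (λ i → k ∘ ev Z X i)
    (λ a → ≈-trans assoc (refl⟩∘⟨ ev-compat Z X a))

module _ {C : Category o ℓ} {D : Category o′ ℓ} (KC : IndClosed C) (KD : IndClosed D) where
  private
    module C = Category C
    module KC = IndClosed KC
    module KD = IndClosed KD
  open Category D

  module _ (F : Functor C D) (pres : PreservesFiniteProducts F) (X Y : C.Obj) where
    open Functor F
    open Comparison KC.cartesian KD.cartesian F pres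
    private
      module H = IndObj (KC.HomObj X Y)

    -- the components of  F (Hom(X, Y)) × F X ≅ F (Hom(X, Y) × X) → F Y
    F-ev : ∀ i → F₀ (H.ob i) KD.⊠ F₀ X ⇒ F₀ Y
    F-ev i = F₁ (KC.ev X Y i) ∘ φ

    abstract
      F-ev-compat : ∀ {i j} (a : i H.↝ j) → F-ev j ∘ (F₁ (H.tr a) KD.⁂ id) ≈ F-ev i
      F-ev-compat {i} {j} a = begin
        (F₁ (KC.ev X Y j) ∘ φ) ∘ (F₁ (H.tr a) KD.⁂ id)      ≈⟨ assoc ⟩
        F₁ (KC.ev X Y j) ∘ φ ∘ (F₁ (H.tr a) KD.⁂ id)        ≈⟨ refl⟩∘⟨ refl⟩∘⟨ KD.⁂-resp ≈-refl (≈-sym identity) ⟩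
        F₁ (KC.ev X Y j) ∘ φ ∘ (F₁ (H.tr a) KD.⁂ F₁ C.id)   ≈⟨ refl⟩∘⟨ φ-natural ⟩
        F₁ (KC.ev X Y j) ∘ F₁ (H.tr a KC.⁂ C.id) ∘ φ        ≈⟨ ≈-sym assoc ⟩
        (F₁ (KC.ev X Y j) ∘ F₁ (H.tr a KC.⁂ C.id)) ∘ φ      ≈⟨ ≈-sym homomorphism ⟩∘⟨refl ⟩
        F₁ (KC.ev X Y j C.∘ (H.tr a KC.⁂ C.id)) ∘ φ         ≈⟨ F-resp-≈ (KC.ev-compat X Y a) ⟩∘⟨refl ⟩
        F₁ (KC.ev X Y i) ∘ φ                                ∎

    -- the transpose  F (Hom(X, Y)) → Hom(F X, F Y)
    closed-map : IndHom (Functor.F₀ (IndF F) (KC.HomObj X Y)) (KD.HomObj (F₀ X) (F₀ Y))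
    closed-map = classify (KD.represents (F₀ X) (F₀ Y)) (Functor.F₀ (IndF F) (KC.HomObj X Y))
                   F-ev F-ev-compat

  record IsClosed (F : Functor C D) : Set (o ⊔ o′ ⊔ ℓ) where
    field
      preserves : PreservesFiniteLimits F
    open PreservesFiniteLimits preserves public
    field
      closed : ∀ X Y → Category.IsIso (Ind D) (closed-map F products X Y)

-- Both categories are small relative to the universe u, which also bounds the
-- index categories of ind- and pro-objects.
record InternalCover {C₀ C : Category u u} (K₀ : IndClosed C₀) (K : IndClosed C) : Set u where
  field
    I        : Functor C₀ C
    F        : Functor C C₀
    I-closed : IsClosed K₀ K I
    F-closed : IsClosed K K₀ F
    F∘I≅id   : NaturalIsomorphism (F ∘F I) idF

module _ {C : Category o ℓ} where
  open Category (Ind C)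

  -- Pullbacks are unique up to isomorphism and Compact is isomorphism-invariant,
  -- so it suffices to exhibit one compact pullback.
  Proper : ∀ {X Y} → X ⇒ Y → Set (o ⊔ lsuc ℓ)
  Proper {X} {Y} f = ∀ {Z} → Compact Z → (g : Z ⇒ Y) →
    Σ[ P ∈ Obj ] Σ[ p ∈ P ⇒ X ] Σ[ q ∈ P ⇒ Z ] IsPullback (Ind C) p q f g × Compact P

  SemiStrict : Obj → Set (o ⊔ lsuc ℓ)
  SemiStrict Y = ∀ {X} → Compact X → (f : X ⇒ Y) → Proper f

  Strict : Obj → Set (o ⊔ lsuc ℓ)
  Strict Y = ∀ {X} → Compact X → (f : X ⇒ Y) →
    Σ[ Z ∈ Obj ] Compact Z × (Σ[ h ∈ X ⇒ Z ] Σ[ m ∈ Z ⇒ Y ] IsMono m × m ∘ h ≈ f)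

module _ {C₀ : Category o ℓ} {C : Category o′ ℓ′} {o″ ℓ″} {E : Category o″ ℓ″} (e : Cartesian E)
         (j : Functor C E) (I : Functor C₀ C) where
  private
    module C₀ = Category C₀
    module C = Category C
    module I = Functor I
    module j = Functor j
  open Category E
  open Cartesian e

  record Aut (T : Obj) : Set (o ⊔ o′ ⊔ ℓ′ ⊔ ℓ″) where
    field
      act        : ∀ X → T ⊠ j.F₀ X ⇒ j.F₀ X
      natural    : ∀ {X Y} (f : X C.⇒ Y) → j.F₁ f ∘ act X ≈ act Y ∘ (id ⁂ j.F₁ f)
      invertible : ∀ X → IsIso ⟨ π₁ , act X ⟩
      fixes      : ∀ X₀ → act (I.F₀ X₀) ≈ π₂

    module _ {X : C.Obj} where
      open IsIso (invertible X) public

  private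
    iso-∘ : ∀ {A B D} {g : B ⇒ D} {f : A ⇒ B} → IsIso g → IsIso f → IsIso (g ∘ f)
    iso-∘ {g = g} {f} ig if = record
      { inv = f.inv ∘ g.inv
      ; isoˡ = ≈-trans assoc (≈-trans (refl⟩∘⟨ ≈-trans (≈-sym assoc) (≈-trans (g.isoˡ ⟩∘⟨refl) identityˡ)) f.isoˡ)
      ; isoʳ = ≈-trans assoc (≈-trans (refl⟩∘⟨ ≈-trans (≈-sym assoc) (≈-trans (f.isoʳ ⟩∘⟨refl) identityˡ)) g.isoʳ) }
      where
      module g = IsIso ig
      module f = IsIso if

    iso-≈ : ∀ {A B} {f g : A ⇒ B} → f ≈ g → IsIso f → IsIso g
    iso-≈ eq i = record
      { inv = IsIso.inv i
      ; isoˡ = ≈-trans (refl⟩∘⟨ ≈-sym eq) (IsIso.isoˡ i)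
      ; isoʳ = ≈-trans (≈-sym eq ⟩∘⟨refl) (IsIso.isoʳ i) }

    id-isIso : ∀ {A} → IsIso (id {A})
    id-isIso = record { inv = id ; isoˡ = identityˡ ; isoʳ = identityˡ }

    abstract
      inv-unique : ∀ {A B} {f g : A ⇒ B} (i : IsIso f) (k : IsIso g) → f ≈ g → IsIso.inv i ≈ IsIso.inv k
      inv-unique {f = f} {g} i k eq = begin
        i.inv                 ≈⟨ ≈-sym identityʳ ⟩
        i.inv ∘ id            ≈⟨ refl⟩∘⟨ ≈-sym k.isoʳ ⟩
        i.inv ∘ g ∘ k.inv     ≈⟨ ≈-sym assoc ⟩
        (i.inv ∘ g) ∘ k.inv   ≈⟨ ≈-trans (refl⟩∘⟨ ≈-sym eq) i.isoˡ ⟩∘⟨refl ⟩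
        id ∘ k.inv            ≈⟨ identityˡ ⟩
        k.inv                 ∎
        where
        module i = IsIso i
        module k = IsIso k

      ⟨π₁,⟩∘ : ∀ {T A B D} {s : T ⊠ B ⇒ D} {t : T ⊠ A ⇒ B} →
               ⟨ π₁ , s ⟩ ∘ ⟨ π₁ , t ⟩ ≈ ⟨ π₁ , s ∘ ⟨ π₁ , t ⟩ ⟩
      ⟨π₁,⟩∘ = ≈-trans ⟨⟩∘ (⟨⟩-resp project₁ ≈-refl)

      square : ∀ {T A B} {t : T ⊠ A ⇒ A} {s : T ⊠ B ⇒ B} {f : A ⇒ B} → f ∘ t ≈ s ∘ (id ⁂ f) →
               (id ⁂ f) ∘ ⟨ π₁ , t ⟩ ≈ ⟨ π₁ , s ⟩ ∘ (id ⁂ f)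
      square n = ≈-trans ⁂∘⟨⟩ (≈-trans (⟨⟩-resp (≈-sym project₁) n) (≈-sym ⟨⟩∘))

    module _ {T : Obj} where
      compose : Aut T → Aut T → Aut T
      compose s t = record
        { act = λ X → s.act X ∘ ⟨ π₁ , t.act X ⟩
        ; natural = λ f → ≈-trans (≈-sym assoc) (≈-trans (s.natural f ⟩∘⟨refl)
            (≈-trans assoc (≈-trans (refl⟩∘⟨ square (t.natural f)) (≈-sym assoc))))
        ; invertible = λ X → iso-≈ ⟨π₁,⟩∘ (iso-∘ (s.invertible X) (t.invertible X))
        ; fixes = λ X₀ → ≈-trans (s.fixes X₀ ⟩∘⟨refl) (≈-trans project₂ (t.fixes X₀)) }
        where
        module s = Aut s
        module t = Aut t

      neutral : Aut T
      neutral = record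
        { act = λ X → π₂
        ; natural = λ f → ≈-sym project₂
        ; invertible = λ X → iso-≈ (≈-sym ⟨π₁,π₂⟩) id-isIso
        ; fixes = λ X₀ → ≈-refl }

      module _ (t : Aut T) where
        private module t = Aut t

        π₁-inv : ∀ {X} → π₁ ∘ t.inv {X} ≈ π₁
        π₁-inv = ≈-trans (≈-sym project₁ ⟩∘⟨refl)
                   (≈-trans assoc (≈-trans (refl⟩∘⟨ t.isoʳ) identityʳ))

        ⟨π₁,inv⟩ : ∀ {X} → ⟨ π₁ , π₂ ∘ t.inv {X} ⟩ ≈ t.inv
        ⟨π₁,inv⟩ = unique π₁-inv ≈-refl

        inv-square : ∀ {X Y} (f : X C.⇒ Y) → (id ⁂ j.F₁ f) ∘ t.inv ≈ t.inv ∘ (id ⁂ j.F₁ f)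
        inv-square f = begin
          (id ⁂ j.F₁ f) ∘ t.inv
            ≈⟨ ≈-sym identityˡ ⟩
          id ∘ (id ⁂ j.F₁ f) ∘ t.inv
            ≈⟨ ≈-sym t.isoˡ ⟩∘⟨refl ⟩
          (t.inv ∘ ⟨ π₁ , t.act _ ⟩) ∘ (id ⁂ j.F₁ f) ∘ t.inv
            ≈⟨ ≈-trans assoc (refl⟩∘⟨ ≈-sym assoc) ⟩
          t.inv ∘ (⟨ π₁ , t.act _ ⟩ ∘ (id ⁂ j.F₁ f)) ∘ t.inv
            ≈⟨ refl⟩∘⟨ ≈-sym (square (t.natural f)) ⟩∘⟨refl ⟩
          t.inv ∘ ((id ⁂ j.F₁ f) ∘ ⟨ π₁ , t.act _ ⟩) ∘ t.inv
            ≈⟨ refl⟩∘⟨ assoc ⟩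
          t.inv ∘ (id ⁂ j.F₁ f) ∘ ⟨ π₁ , t.act _ ⟩ ∘ t.inv
            ≈⟨ refl⟩∘⟨ ≈-trans (refl⟩∘⟨ t.isoʳ) identityʳ ⟩
          t.inv ∘ (id ⁂ j.F₁ f)
            ∎

        inverse : Aut T
        inverse = record
          { act = λ X → π₂ ∘ t.inv
          ; natural = λ f → ≈-trans (≈-sym assoc) (≈-trans (≈-sym project₂ ⟩∘⟨refl)
              (≈-trans assoc (≈-trans (refl⟩∘⟨ inv-square f) (≈-sym assoc))))
          ; invertible = λ X → iso-≈ (≈-sym ⟨π₁,inv⟩)
              (record { inv = ⟨ π₁ , t.act X ⟩ ; isoˡ = t.isoʳ ; isoʳ = t.isoˡ })
          ; fixes = λ X₀ → ≈-trans (refl⟩∘⟨ inv-unique (t.invertible _) id-isIso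
              (≈-trans (⟨⟩-resp ≈-refl (t.fixes X₀)) ⟨π₁,π₂⟩)) identityʳ }

  -- s ∙ t is the composite (pr, s) ∘ (pr, t)
  AutGroup : Obj → Group (o ⊔ o′ ⊔ ℓ′ ⊔ ℓ″) (o′ ⊔ ℓ″)
  AutGroup T = record
    { Carrier = Aut T
    ; _≈_ = λ s t → ∀ X → Aut.act s X ≈ Aut.act t X
    ; _∙_ = compose
    ; ε = neutral
    ; _⁻¹ = inverse
    ; isGroup = record
      { isMonoid = record
        { isSemigroup = record
          { isMagma = record
            { isEquivalence = record
              { refl = λ X → ≈-refl ; sym = λ p X → ≈-sym (p X) ; trans = λ p q X → ≈-trans (p X) (q X) }
            ; ∙-cong = λ p q X → ∘-resp-≈ (p X) (⟨⟩-resp ≈-refl (q X)) }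
          ; assoc = λ r s t X → ≈-trans assoc (refl⟩∘⟨ ⟨π₁,⟩∘) }
        ; identity = (λ t X → project₂) , (λ t X → ≈-trans (refl⟩∘⟨ ⟨π₁,π₂⟩) identityʳ) }
      ; inverse = (λ t X → ≈-trans assoc (≈-trans (refl⟩∘⟨ Aut.isoˡ t) identityʳ))
                , (λ t X → ≈-trans (refl⟩∘⟨ ⟨π₁,inv⟩ t)
                    (≈-trans (≈-sym project₂ ⟩∘⟨refl) (≈-trans assoc
                      (≈-trans (refl⟩∘⟨ Aut.isoʳ t) identityʳ))))
      ; ⁻¹-cong = λ {s} {t} p X → refl⟩∘⟨ inv-unique (Aut.invertible s X) (Aut.invertible t X)
                                            (⟨⟩-resp ≈-refl (p X)) } }

module _ {C₀ C : Category u u} (c : Cartesian C) (I : Functor C₀ C) where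
  private
    ic = Ind-cartesian c
    module E = Category (Pro (Ind C))
    module e = Cartesian (Pro-cartesian ic)

  ι̂ : Functor C (Pro (Ind C))
  ι̂ = κ {C = Ind C} ∘F ι {C = C}

  Autᵀ : E.Obj → Group u u
  Autᵀ = AutGroup (Pro-cartesian ic) ι̂ I

  -- G represents T ↦ Aut_T(ι/I) as a functor to groups.  The test objects T
  -- range over Pro (Ind C), which contains Ind C as a full subcategory closed
  -- under the products involved.  Test objects in Ind C alone would only see
  -- the presheaf limᵢ Hom(-, Gᵢ), which does not determine the pro-object G:
  -- for finite sets, the decreasing groups Gₙ = ⊕_{k ≥ n} ℤ have the same
  -- presheaf as the trivial group but are not pro-trivial.
  record RepresentsAut (G : Category.Obj (ProGroup ic)) : Set (lsuc u) where
    field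
      iso     : ∀ T → Inverse (E.hom-setoid T (underlying ic G)) (Group.setoid (Autᵀ T))
    to : ∀ {T} → T E.⇒ underlying ic G → Group.Carrier (Autᵀ T)
    to {T} = Inverse.to (iso T)
    field
      natural : ∀ {S T} (f : S E.⇒ T) (g : T E.⇒ underlying ic G) X →
                Aut.act (to (g E.∘ f)) X E.≈ Aut.act (to g) X E.∘ (f e.⁂ E.id)
      homo    : ∀ {T} (f g : T E.⇒ underlying ic G) → let open Group (Autᵀ T) in
                to (pro-mul ic G E.∘ e.⟨ f , g ⟩) ≈ to f ∙ to g

module _ {C : Category u u} (c : Cartesian C) where
  private ic = Ind-cartesian c

  IsProGroupIn : Category.Obj (ProGroup ic) → Set (lsuc u)
  IsProGroupIn G = Σ[ H ∈ Category.Obj (ProGroup c) ]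
    Functor.F₀ (ProF (GrpF c ic (ι {C = C}) (ι-preserves c))) H ≅ G
    where open Category (ProGroup ic)

-- Fix X in C. Since F I ≅ id and F is closed, the isomorphism F X ≅ F I F X comes from a family ζ of
-- isomorphisms X ≅ I F X, indexed by an object Z of C with a point of F Z. As Bi(F X, F X) is strict (2), the
-- quotients ζ(z) ζ(z′)⁻¹ are members of a faithful family I(W), with W an object of C₀.
-- The g : X → X with all ζ(z) g ζ(z′)⁻¹ in I(W) form an ind-object K of C. By (4), F K is compact, so K is an
-- object of C by (3). The automorphisms stabilising K form a group object of C through which every automorphism t
-- fixing I factors: t is the identity on I F X, so ζ(t z, t x) = ζ(z, x).
-- For finitely many objects X, finitely many naturality conditions, and conditions of being the identity on
-- I X₀, cut out closed subgroups, which are objects of C by (1). These form a cofiltered system of group objects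
-- of C representing Aut(ι/I), and a representing pro-group is unique up to isomorphism.
module Submission where

open import Level using (Level; _⊔_) renaming (suc to lsuc)
open import Algebra.Bundles using (Group)
open import Data.List.Base using (List; []; _∷_; _++_; map)
open import Data.List.Membership.Propositional using (_∈_)
open import Data.List.Membership.Propositional.Properties using (∈-++⁺ˡ; ∈-++⁺ʳ; ∈-map⁺)
open import Data.List.Relation.Unary.Any using (here; there)
open import Data.Product using (Σ-syntax; _×_; _,_; proj₁; proj₂)
open import Data.Unit.Polymorphic using (⊤; tt)
open import Function.Bundles using (Inverse)
open import Relation.Binary.Bundles using (Setoid)
open import Relation.Binary.PropositionalEquality.Core using (refl)
open import Defs

private
  variable
    o o′ o″ ℓ ℓ′ ℓ″ u : Level

module Isos (C : Category o ℓ) where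
  open Category C

  to : ∀ {A B} → A ≅ B → A ⇒ B
  to i = _≅_.to i

  from : ∀ {A B} → A ≅ B → B ⇒ A
  from i = IsIso.inv (_≅_.isIso i)

  from∘to : ∀ {A B} (i : A ≅ B) → from i ∘ to i ≈ id
  from∘to i = IsIso.isoˡ (_≅_.isIso i)

  to∘from : ∀ {A B} (i : A ≅ B) → to i ∘ from i ≈ id
  to∘from i = IsIso.isoʳ (_≅_.isIso i)

  mk≅ : ∀ {A B} (f : A ⇒ B) (g : B ⇒ A) → g ∘ f ≈ id → f ∘ g ≈ id → A ≅ B
  mk≅ f g p q = record { to = f ; isIso = record { inv = g ; isoˡ = p ; isoʳ = q } }

  opaque
    cancelˡ : ∀ {A B D} {f : A ⇒ B} {g : B ⇒ A} {h : D ⇒ A} → g ∘ f ≈ id → g ∘ f ∘ h ≈ h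
    cancelˡ p = ≈-trans (≈-sym assoc) (≈-trans (p ⟩∘⟨refl) identityˡ)

    cancelʳ : ∀ {A B D} {f : A ⇒ B} {g : B ⇒ A} {h : A ⇒ D} → g ∘ f ≈ id → (h ∘ g) ∘ f ≈ h
    cancelʳ p = ≈-trans assoc (≈-trans (refl⟩∘⟨ p) identityʳ)

    ∘-inverse : ∀ {A B D} {f : A ⇒ B} {f⁻ : B ⇒ A} {g : B ⇒ D} {g⁻ : D ⇒ B} →
                f⁻ ∘ f ≈ id → g⁻ ∘ g ≈ id → (f⁻ ∘ g⁻) ∘ (g ∘ f) ≈ id
    ∘-inverse p q = ≈-trans assoc (≈-trans (refl⟩∘⟨ cancelˡ q) p)

    cancel-middle : ∀ {A B D E G} {f : A ⇒ B} {f⁻ : B ⇒ A} {g : D ⇒ E} {g⁻ : E ⇒ D} {h : E ⇒ A} {k : G ⇒ E} →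
                    f⁻ ∘ f ≈ id → g ∘ g⁻ ≈ id → f⁻ ∘ (f ∘ h ∘ g) ∘ g⁻ ∘ k ≈ h ∘ k
    cancel-middle p q = ≈-trans (refl⟩∘⟨ ≈-trans assoc (refl⟩∘⟨ ≈-trans assoc (refl⟩∘⟨ cancelˡ q))) (cancelˡ p)

    conjugate : ∀ {A B D E} {f : A ⇒ B} {f⁻ : B ⇒ A} {g : D ⇒ E} {g⁻ : E ⇒ D} {x : D ⇒ B} →
                f ∘ f⁻ ≈ id → g⁻ ∘ g ≈ id → f ∘ (f⁻ ∘ x ∘ g⁻) ∘ g ≈ x
    conjugate p q = ≈-trans (refl⟩∘⟨ assoc) (≈-trans (cancelˡ p) (cancelʳ q))

    to-mono : ∀ {A B T} (i : A ≅ B) {x y : T ⇒ A} → to i ∘ x ≈ to i ∘ y → x ≈ y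
    to-mono i e = ≈-trans (≈-sym (cancelˡ (from∘to i))) (≈-trans (refl⟩∘⟨ e) (cancelˡ (from∘to i)))

    to-epi : ∀ {A B T} (i : A ≅ B) {x y : B ⇒ T} → x ∘ to i ≈ y ∘ to i → x ≈ y
    to-epi i e = ≈-trans (≈-sym (cancelʳ (to∘from i))) (≈-trans (e ⟩∘⟨refl) (cancelʳ (to∘from i)))

    inverse-unique : ∀ {A B} {f f′ : A ⇒ B} {g g′ : B ⇒ A} → f ≈ f′ → g ∘ f ≈ id → f′ ∘ g′ ≈ id → g ≈ g′
    inverse-unique {f = f} {f′} {g} {g′} e p q = begin
      g             ≈⟨ ≈-sym identityʳ ⟩
      g ∘ id        ≈⟨ refl⟩∘⟨ ≈-sym q ⟩
      g ∘ f′ ∘ g′   ≈⟨ refl⟩∘⟨ ≈-sym e ⟩∘⟨refl ⟩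
      g ∘ f ∘ g′    ≈⟨ cancelˡ p ⟩
      g′            ∎

  infixr 9 _⊙_
  _⊙_ : ∀ {A B D} → B ≅ D → A ≅ B → A ≅ D
  j ⊙ i = mk≅ (to j ∘ to i) (from i ∘ from j)
    (∘-inverse (from∘to i) (from∘to j)) (∘-inverse (to∘from j) (to∘from i))

  flip : ∀ {A B} → A ≅ B → B ≅ A
  flip i = mk≅ (from i) (to i) (to∘from i) (from∘to i)

  id≅ : ∀ {A} → A ≅ A
  id≅ = mk≅ id id identityˡ identityˡ

module _ {C : Category o ℓ} {D : Category o′ ℓ′} (F : Functor C D) where
  open Functor F
  private
    module C = Category C using (_≅_)
    module D = Category D using (_≅_; ≈-sym; ≈-trans)

  map≅ : ∀ {A B} → A C.≅ B → F₀ A D.≅ F₀ B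
  map≅ i = Isos.mk≅ D (F₁ (to i)) (F₁ (from i))
    (D.≈-trans (D.≈-sym homomorphism) (D.≈-trans (F-resp-≈ (from∘to i)) identity))
    (D.≈-trans (D.≈-sym homomorphism) (D.≈-trans (F-resp-≈ (to∘from i)) identity))
    where open Isos C

module _ {C : Category o ℓ} where
  open Category C
  open Isos C

  opaque
    pullback-ext : ∀ {P X Y Z} {p : P ⇒ X} {q : P ⇒ Z} {f : X ⇒ Y} {g : Z ⇒ Y} → IsPullback C p q f g →
                   ∀ {T} {x y : T ⇒ P} → p ∘ x ≈ p ∘ y → q ∘ x ≈ q ∘ y → x ≈ y
    pullback-ext {p = p} {q} {f} {g} pb {y = y} e₁ e₂ = ≈-trans (≈-sym (Pb.unique {eq = square} e₁ e₂)) (Pb.unique ≈-refl ≈-refl)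
      where
      module Pb = IsPullback pb using (commute; unique)
      square : f ∘ p ∘ y ≈ g ∘ q ∘ y
      square = ≈-trans (≈-sym assoc) (≈-trans (Pb.commute ⟩∘⟨refl) assoc)

  pullback-≅ : ∀ {P Q X Y Z} {p : P ⇒ X} {q : P ⇒ Z} {f : X ⇒ Y} {g : Z ⇒ Y} → IsPullback C p q f g →
               (i : Q ≅ P) → IsPullback C (p ∘ to i) (q ∘ to i) f g
  pullback-≅ pb i = record
    { commute = ≈-trans (≈-sym assoc) (≈-trans (Pb.commute ⟩∘⟨refl) assoc)
    ; lift = λ h k e → from i ∘ Pb.lift h k e
    ; project₁ = ≈-trans assoc (≈-trans (refl⟩∘⟨ cancelˡ (to∘from i)) Pb.project₁)
    ; project₂ = ≈-trans assoc (≈-trans (refl⟩∘⟨ cancelˡ (to∘from i)) Pb.project₂)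
    ; unique = λ e₁ e₂ → ≈-trans (refl⟩∘⟨ Pb.unique (≈-trans (≈-sym assoc) e₁) (≈-trans (≈-sym assoc) e₂))
                           (cancelˡ (from∘to i)) }
    where module Pb = IsPullback pb using (commute; lift; project₁; project₂; unique)

  opaque
    mono-≅ : ∀ {A B D} {m : B ⇒ D} → IsMono m → (i : A ≅ B) → IsMono (m ∘ to i)
    mono-≅ mono i x y e = ≈-trans (≈-sym (cancelˡ (from∘to i))) (≈-trans
      (refl⟩∘⟨ mono (to i ∘ x) (to i ∘ y) (≈-trans (≈-sym assoc) (≈-trans e assoc))) (cancelˡ (from∘to i)))

    factor-≅ : ∀ {A B D T} {m : B ⇒ D} {h : T ⇒ B} {f : T ⇒ D} → m ∘ h ≈ f → (i : A ≅ B) →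
               (m ∘ to i) ∘ (from i ∘ h) ≈ f
    factor-≅ e i = ≈-trans assoc (≈-trans (refl⟩∘⟨ cancelˡ (to∘from i)) e)

-- A morphism T × X → Y is a T-indexed family of morphisms X → Y; _•_ composes
-- families pointwise and _[_] reindexes them.
module Families {C : Category o ℓ} (c : Cartesian C) where
  open Category C
  open Cartesian c

  infixr 9 _•_
  infixl 10 _[_]

  _•_ : ∀ {T X Y Z} → T ⊠ Y ⇒ Z → T ⊠ X ⇒ Y → T ⊠ X ⇒ Z
  g • f = g ∘ ⟨ π₁ , f ⟩

  _[_] : ∀ {S T X Y} → T ⊠ X ⇒ Y → S ⇒ T → S ⊠ X ⇒ Y
  g [ h ] = g ∘ (h ⁂ id)

  const : ∀ {T X Y} → X ⇒ Y → T ⊠ X ⇒ Y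
  const f = f ∘ π₂

  Faithful : ∀ {K X Y} → K ⊠ X ⇒ Y → Set (o ⊔ ℓ)
  Faithful {K} γ = ∀ {T} (x y : T ⇒ K) → γ [ x ] ≈ γ [ y ] → x ≈ y

  assocˡ : ∀ {A B D} → A ⊠ (B ⊠ D) ⇒ (A ⊠ B) ⊠ D
  assocˡ = ⟨ id ⁂ π₁ , π₂ ∘ π₂ ⟩

  opaque
    •-resp : ∀ {T X Y Z} {g g′ : T ⊠ Y ⇒ Z} {f f′ : T ⊠ X ⇒ Y} → g ≈ g′ → f ≈ f′ → g • f ≈ g′ • f′
    •-resp p q = ∘-resp-≈ p (⟨⟩-resp ≈-refl q)

    •-assoc : ∀ {T W X Y Z} {h : T ⊠ Y ⇒ Z} {g : T ⊠ X ⇒ Y} {f : T ⊠ W ⇒ X} →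
              (h • g) • f ≈ h • (g • f)
    •-assoc = ≈-trans assoc (refl⟩∘⟨ ≈-trans ⟨⟩∘ (⟨⟩-resp project₁ ≈-refl))

    •-identityˡ : ∀ {T X Y} {f : T ⊠ X ⇒ Y} → π₂ • f ≈ f
    •-identityˡ = project₂

    •-identityʳ : ∀ {T X Y} {f : T ⊠ X ⇒ Y} → f • π₂ ≈ f
    •-identityʳ = ≈-trans (refl⟩∘⟨ ⟨π₁,π₂⟩) identityʳ

    []-resp : ∀ {S T X Y} {g g′ : T ⊠ X ⇒ Y} {h h′ : S ⇒ T} → g ≈ g′ → h ≈ h′ → g [ h ] ≈ g′ [ h′ ]
    []-resp p q = ∘-resp-≈ p (⁂-resp q ≈-refl)

    []-id : ∀ {T X Y} {g : T ⊠ X ⇒ Y} → g [ id ] ≈ g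
    []-id = ≈-trans (refl⟩∘⟨ id⁂id) identityʳ

    []-∘ : ∀ {R S T X Y} {g : T ⊠ X ⇒ Y} {h : S ⇒ T} {k : R ⇒ S} → g [ h ] [ k ] ≈ g [ h ∘ k ]
    []-∘ = ≈-trans assoc (refl⟩∘⟨ ≈-trans ⁂∘⁂ (⁂-resp ≈-refl identityˡ))

    []-• : ∀ {S T X Y Z} {g : T ⊠ Y ⇒ Z} {f : T ⊠ X ⇒ Y} {h : S ⇒ T} →
           (g • f) [ h ] ≈ g [ h ] • f [ h ]
    []-• = ≈-trans assoc (≈-trans (refl⟩∘⟨ ≈-trans ⟨⟩∘ (≈-trans (⟨⟩-resp project₁ (≈-sym identityˡ))
             (≈-sym ⁂∘⟨⟩))) (≈-sym assoc))

    []-π₂ : ∀ {S T X} {h : S ⇒ T} → π₂ [ h ] ≈ π₂ {S} {X}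
    []-π₂ = ≈-trans project₂ identityˡ

    []-const : ∀ {S T X Y} {f : X ⇒ Y} {h : S ⇒ T} → const f [ h ] ≈ const f
    []-const = ≈-trans assoc (refl⟩∘⟨ []-π₂)

    const-• : ∀ {T X Y Z} {g : Y ⇒ Z} {f : T ⊠ X ⇒ Y} → const g • f ≈ g ∘ f
    const-• = ≈-trans assoc (refl⟩∘⟨ project₂)

    const-∘ : ∀ {T X Y Z} {g : Y ⇒ Z} {f : X ⇒ Y} → const {T} g • const f ≈ const (g ∘ f)
    const-∘ = ≈-trans const-• (≈-sym assoc)

    ∘-• : ∀ {T X Y Z W} {h : Z ⇒ W} {g : T ⊠ Y ⇒ Z} {f : T ⊠ X ⇒ Y} → h ∘ (g • f) ≈ (h ∘ g) • f
    ∘-• = ≈-sym assoc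

    ∘-[] : ∀ {S T X Y Z} {h : Y ⇒ Z} {g : T ⊠ X ⇒ Y} {k : S ⇒ T} → h ∘ (g [ k ]) ≈ (h ∘ g) [ k ]
    ∘-[] = ≈-sym assoc

    []-square : ∀ {R S S′ T X Y} {g : T ⊠ X ⇒ Y} {h : S ⇒ T} {k : R ⇒ S} {h′ : S′ ⇒ T} {k′ : R ⇒ S′} →
                h ∘ k ≈ h′ ∘ k′ → g [ h ] [ k ] ≈ g [ h′ ] [ k′ ]
    []-square p = ≈-trans []-∘ (≈-trans ([]-resp ≈-refl p) (≈-sym []-∘))

    []-[] : ∀ {R S T X Y} {g : T ⊠ X ⇒ Y} {h : S ⇒ T} {k : R ⇒ S} {h′ : R ⇒ T} →
            h ∘ k ≈ h′ → g [ h ] [ k ] ≈ g [ h′ ]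
    []-[] p = ≈-trans []-∘ ([]-resp ≈-refl p)

    assocˡ-natural : ∀ {S T B D} {h : S ⇒ T} → assocˡ ∘ (h ⁂ id) ≈ ((h ⁂ id {B}) ⁂ id {D}) ∘ assocˡ
    assocˡ-natural = ⊠-ext
      (≈-trans (≈-sym assoc) (≈-trans (project₁ ⟩∘⟨refl) (≈-trans ⁂∘⁂ (≈-trans (⁂-resp (≈-trans identityˡ (≈-sym identityʳ)) (≈-trans identityʳ (≈-sym identityˡ)))
        (≈-sym (≈-trans (≈-sym assoc) (≈-trans (project₁ ⟩∘⟨refl) (≈-trans assoc (≈-trans (refl⟩∘⟨ project₁) ⁂∘⁂)))))))))
      (≈-trans (≈-sym assoc) (≈-trans (project₂ ⟩∘⟨refl) (≈-trans assoc (≈-trans (refl⟩∘⟨ []-π₂)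
        (≈-sym (≈-trans (≈-sym assoc) (≈-trans (project₂ ⟩∘⟨refl) (≈-trans assoc (≈-trans identityˡ project₂)))))))))

    assocˡ∘assocʳ : ∀ {A B D} → assocˡ ∘ assocʳ ≈ id {(A ⊠ B) ⊠ D}
    assocˡ∘assocʳ = ⊠-ext
      (≈-trans (≈-sym assoc) (≈-trans (project₁ ⟩∘⟨refl) (≈-trans ⁂∘⟨⟩ (⊠-ext
        (≈-trans project₁ (≈-trans identityˡ (≈-sym (refl⟩∘⟨ identityʳ))))
        (≈-trans project₂ (≈-trans project₁ (≈-sym (refl⟩∘⟨ identityʳ))))))))
      (≈-trans (≈-sym assoc) (≈-trans (project₂ ⟩∘⟨refl) (≈-trans assoc (≈-trans (refl⟩∘⟨ project₂)
        (≈-trans project₂ (≈-trans identityˡ (≈-sym identityʳ)))))))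

    assocʳ∘assocˡ : ∀ {A B D} → assocʳ ∘ assocˡ ≈ id {A ⊠ (B ⊠ D)}
    assocʳ∘assocˡ = ⊠-ext
      (≈-trans (≈-sym assoc) (≈-trans (project₁ ⟩∘⟨refl) (≈-trans assoc (≈-trans (refl⟩∘⟨ project₁) (≈-trans project₁
        (≈-trans identityˡ (≈-sym identityʳ)))))))
      (≈-trans (≈-sym assoc) (≈-trans (project₂ ⟩∘⟨refl) (≈-trans ⁂∘⟨⟩ (≈-trans (⟨⟩-resp project₂ identityˡ)
        (≈-trans (≈-sym ⟨⟩∘) (≈-trans (⟨π₁,π₂⟩ ⟩∘⟨refl) (≈-trans identityˡ (≈-sym identityʳ))))))))

  Fam : Obj → Category o ℓ
  Fam T = fam
    where
    open Category
    fam : Category o ℓ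
    fam .Obj = Category.Obj C
    fam ._⇒_ X Y = Category._⇒_ C (T ⊠ X) Y
    fam ._≈_ = Category._≈_ C
    fam .id = π₂
    fam ._∘_ = _•_
    fam .equiv = Category.equiv C
    fam .∘-resp-≈ = •-resp
    fam .assoc = •-assoc
    fam .identityˡ = •-identityˡ
    fam .identityʳ = •-identityʳ

  reindex : ∀ {S T} → S ⇒ T → Functor (Fam T) (Fam S)
  reindex h = record
    { F₀ = λ X → X ; F₁ = λ g → g [ h ] ; F-resp-≈ = λ e → []-resp e ≈-refl
    ; identity = []-π₂ ; homomorphism = []-• }

  constF : ∀ {T} → Functor C (Fam T)
  constF = record
    { F₀ = λ X → X ; F₁ = const ; F-resp-≈ = λ e → e ⟩∘⟨refl
    ; identity = identityˡ ; homomorphism = ≈-sym const-∘ }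

  IsoFam : Obj → Obj → Obj → Set ℓ
  IsoFam T X Y = Category._≅_ (Fam T) X Y

  module IsoFam {T X Y : Obj} (i : IsoFam T X Y) where
    to : T ⊠ X ⇒ Y
    to = Isos.to (Fam T) i

    from : T ⊠ Y ⇒ X
    from = Isos.from (Fam T) i

    from∘to : from • to ≈ π₂
    from∘to = Isos.from∘to (Fam T) i

    to∘from : to • from ≈ π₂
    to∘from = Isos.to∘from (Fam T) i

  infixl 10 _[_]≅
  _[_]≅ : ∀ {S T X Y} → IsoFam T X Y → S ⇒ T → IsoFam S X Y
  i [ h ]≅ = map≅ (reindex h) i

  record Equation (A : Obj) : Set (o ⊔ ℓ) where
    constructor equation
    field
      {dom cod} : Obj
      lhs rhs   : A ⊠ dom ⇒ cod

  System : Obj → Set (o ⊔ ℓ)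
  System A = List (Equation A)

  Solves : ∀ {A T} → T ⇒ A → System A → Set ℓ
  Solves s []        = ⊤
  Solves s (e ∷ sys) = lhs [ s ] ≈ rhs [ s ] × Solves s sys
    where open Equation e

  opaque
    Solves-∘ : ∀ {A S T} {s : T ⇒ A} {h : S ⇒ T} (sys : System A) → Solves s sys → Solves (s ∘ h) sys
    Solves-∘ [] _ = tt
    Solves-∘ (_ ∷ sys) (p , ps) =
      ≈-trans (≈-sym []-∘) (≈-trans ([]-resp p ≈-refl) []-∘) , Solves-∘ sys ps

    Solves-≈ : ∀ {A T} {s s′ : T ⇒ A} (sys : System A) → s ≈ s′ → Solves s sys → Solves s′ sys
    Solves-≈ [] _ _ = tt
    Solves-≈ (_ ∷ sys) e (p , ps) =
      ≈-trans ([]-resp ≈-refl (≈-sym e)) (≈-trans p ([]-resp ≈-refl e)) , Solves-≈ sys e ps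

  record Locus {A : Obj} (sys : System A) : Set (o ⊔ ℓ) where
    field
      obj     : Obj
      incl    : obj ⇒ A
      solves  : Solves incl sys
      lift    : ∀ {T} (s : T ⇒ A) → Solves s sys → T ⇒ obj
      commute : ∀ {T} (s : T ⇒ A) (p : Solves s sys) → incl ∘ lift s p ≈ s
      mono    : ∀ {T} {x y : T ⇒ obj} → incl ∘ x ≈ incl ∘ y → x ≈ y

  module _ (locus₁ : ∀ {A} (e : Equation A) → Locus (e ∷ [])) where
    locus : ∀ {A} (sys : System A) → Locus sys
    locus [] = record
      { obj = _ ; incl = id ; solves = tt ; lift = λ s _ → s ; commute = λ _ _ → identityˡ
      ; mono = λ p → ≈-trans (≈-sym identityˡ) (≈-trans p identityˡ) }
    locus {A} (e ∷ sys) = record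
      { obj = L₁.obj ; incl = L.incl ∘ L₁.incl
      ; solves = ≈-trans (≈-sym []-∘) (≈-trans (proj₁ L₁.solves) []-∘) , Solves-∘ sys L.solves
      ; lift = λ s p → L₁.lift (L.lift s (proj₂ p)) (sub s p , tt)
      ; commute = λ s p → ≈-trans assoc (≈-trans (refl⟩∘⟨ L₁.commute _ _) (L.commute _ _))
      ; mono = λ p → L₁.mono (L.mono (≈-trans (≈-sym assoc) (≈-trans p assoc))) }
      where
      module L = Locus (locus sys) using (commute; incl; lift; mono; solves)
      open Equation e
      module L₁ = Locus (locus₁ (equation (lhs [ L.incl ]) (rhs [ L.incl ]))) using (commute; incl; lift; mono; obj; solves)
      sub : ∀ {T} (s : T ⇒ A) (p : Solves s (e ∷ sys)) →
            lhs [ L.incl ] [ L.lift s (proj₂ p) ] ≈ rhs [ L.incl ] [ L.lift s (proj₂ p) ]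
      sub s p = ≈-trans ([]-[] (L.commute _ _)) (≈-trans (proj₁ p) (≈-sym ([]-[] (L.commute _ _))))

module Hat {C : Category o ℓ} {D : Category o′ ℓ′} (c : Cartesian C) (d : Cartesian D)
           (Φ : Functor C D) (pres : PreservesFiniteProducts Φ) where
  private
    module C = Category C using (Obj; _⇒_; _∘_; _≈_)
    module c = Cartesian c using (_⁂_; _⊠_; isProduct; project₁; project₂; π₁; π₂)
    module FC = Families c
  open Category D
  open Cartesian d
  open Functor Φ
  open PreservesFiniteProducts pres
  open Comparison c d Φ pres public
  open Families d
  private module FP {A B : C.Obj} = IsProduct (product (c.isProduct {A} {B})) using (project₁; project₂)

  opaque
    π₁-φ : ∀ {A B} → F₁ (c.π₁ {A} {B}) ∘ φ ≈ π₁
    π₁-φ = FP.project₁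

    π₂-φ : ∀ {A B} → F₁ (c.π₂ {A} {B}) ∘ φ ≈ π₂
    π₂-φ = FP.project₂

  ⟪_,_⟫ : ∀ {T A B} → T ⇒ F₀ A → T ⇒ F₀ B → T ⇒ F₀ (A c.⊠ B)
  ⟪ x , y ⟫ = φ ∘ ⟨ x , y ⟩

  opaque
    π₁-⟪⟫ : ∀ {T A B} {x : T ⇒ F₀ A} {y : T ⇒ F₀ B} → F₁ c.π₁ ∘ ⟪ x , y ⟫ ≈ x
    π₁-⟪⟫ = ≈-trans (≈-sym assoc) (≈-trans (π₁-φ ⟩∘⟨refl) project₁)

    π₂-⟪⟫ : ∀ {T A B} {x : T ⇒ F₀ A} {y : T ⇒ F₀ B} → F₁ c.π₂ ∘ ⟪ x , y ⟫ ≈ y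
    π₂-⟪⟫ = ≈-trans (≈-sym assoc) (≈-trans (π₂-φ ⟩∘⟨refl) project₂)

    φ-⁂ : ∀ {T S A B} {f : T ⇒ F₀ A} {g : S ⇒ F₀ B} {h : T ⊠ S ⇒ F₀ (A c.⊠ B)} →
          F₁ c.π₁ ∘ h ≈ f ∘ π₁ → F₁ c.π₂ ∘ h ≈ g ∘ π₂ → φ ∘ (f ⁂ g) ≈ h
    φ-⁂ p q = φ-ext (≈-trans π₁-⟪⟫ (≈-sym p)) (≈-trans π₂-⟪⟫ (≈-sym q))

    leg-multiplicative : ∀ {U V A A′ X} {l : U ⇒ F₀ A} {l′ : V ⇒ F₀ A′} {f : U ⇒ V} {f₀ : A C.⇒ A′} {μ : U ⊠ U ⇒ U} {ν : V ⊠ V ⇒ V}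
      {m : A′ c.⊠ A′ C.⇒ X} {k : V ⇒ F₀ X} {r : U ⊠ U ⇒ F₀ (A c.⊠ A)} →
      l′ ∘ f ≈ F₁ f₀ ∘ l → k ∘ ν ≈ F₁ m ∘ φ ∘ (l′ ⁂ l′) → f ∘ μ ≈ ν ∘ (f ⁂ f) → φ ∘ (l ⁂ l) ≈ r →
      k ∘ f ∘ μ ≈ F₁ (m C.∘ (f₀ c.⁂ f₀)) ∘ r
    leg-multiplicative {l = l} {l′} {f} {f₀} {μ} {ν} {m} {k} {r} e₁ e₂ e₃ e₄ = begin
      k ∘ f ∘ μ                                      ≈⟨ refl⟩∘⟨ e₃ ⟩
      k ∘ ν ∘ (f ⁂ f)                                ≈⟨ ≈-trans (≈-sym assoc) (≈-trans (e₂ ⟩∘⟨refl) (≈-trans assoc (refl⟩∘⟨ assoc))) ⟩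
      F₁ m ∘ φ ∘ (l′ ⁂ l′) ∘ (f ⁂ f)                 ≈⟨ refl⟩∘⟨ refl⟩∘⟨ ≈-trans ⁂∘⁂ (≈-trans (⁂-resp e₁ e₁) (≈-sym ⁂∘⁂)) ⟩
      F₁ m ∘ φ ∘ (F₁ f₀ ⁂ F₁ f₀) ∘ (l ⁂ l)           ≈⟨ refl⟩∘⟨ ≈-trans (≈-sym assoc) (≈-trans (φ-natural ⟩∘⟨refl) (≈-trans assoc (refl⟩∘⟨ e₄))) ⟩
      F₁ m ∘ F₁ (f₀ c.⁂ f₀) ∘ r                      ≈⟨ ≈-trans (≈-sym assoc) (≈-sym homomorphism ⟩∘⟨refl) ⟩
      F₁ (m C.∘ (f₀ c.⁂ f₀)) ∘ r                     ∎

  hat : ∀ {A X Y} → A c.⊠ X C.⇒ Y → F₀ A ⊠ F₀ X ⇒ F₀ Y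
  hat g = F₁ g ∘ φ

  opaque
    hat-resp : ∀ {A X Y} {g h : A c.⊠ X C.⇒ Y} → g C.≈ h → hat g ≈ hat h
    hat-resp e = F-resp-≈ e ⟩∘⟨refl

    hat-π₂ : ∀ {A X} → hat (c.π₂ {A} {X}) ≈ π₂
    hat-π₂ = π₂-φ

    hat-const : ∀ {A X Y} {f : X C.⇒ Y} → hat (FC.const {A} f) ≈ const (F₁ f)
    hat-const = ≈-trans (homomorphism ⟩∘⟨refl) (≈-trans assoc (refl⟩∘⟨ π₂-φ))

    hat-• : ∀ {A X Y Z} {g : A c.⊠ Y C.⇒ Z} {f : A c.⊠ X C.⇒ Y} → hat (g FC.• f) ≈ hat g • hat f
    hat-• = ≈-trans (homomorphism ⟩∘⟨refl) (≈-trans assoc (≈-trans (refl⟩∘⟨ φ-ext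
      (≈-trans (pull c.project₁) (≈-trans π₁-φ (≈-sym (≈-trans (≈-sym assoc) (≈-trans (π₁-φ ⟩∘⟨refl) project₁)))))
      (≈-trans (pull c.project₂) (≈-sym (≈-trans (≈-sym assoc) (≈-trans (π₂-φ ⟩∘⟨refl) project₂)))))
      (≈-sym assoc)))
      where
      pull : ∀ {T U V W} {p : U C.⇒ V} {q : T C.⇒ U} {r : T C.⇒ V} {k : W ⇒ F₀ T} → p C.∘ q C.≈ r → F₁ p ∘ F₁ q ∘ k ≈ F₁ r ∘ k
      pull e = ≈-trans (≈-sym assoc) (≈-trans (≈-sym homomorphism) (F-resp-≈ e) ⟩∘⟨refl)

    hat-[] : ∀ {A B X Y} {g : A c.⊠ X C.⇒ Y} {h : B C.⇒ A} → hat (g FC.[ h ]) ≈ hat g [ F₁ h ]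
    hat-[] = ≈-trans (homomorphism ⟩∘⟨refl) (≈-trans assoc (≈-trans (refl⟩∘⟨ ≈-trans (≈-sym φ-natural)
      (refl⟩∘⟨ ⁂-resp ≈-refl identity)) (≈-sym assoc)))

    hat-at : ∀ {A B T X Y} {g : A c.⊠ X C.⇒ Y} {h : B C.⇒ A} {s : T ⇒ F₀ B} {t : T ⇒ F₀ A} →
             F₁ h ∘ s ≈ t → hat (g FC.[ h ]) [ s ] ≈ hat g [ t ]
    hat-at p = ≈-trans ([]-resp hat-[] ≈-refl) ([]-[] p)

    hat-∘ : ∀ {A X Y Z} {h : Y C.⇒ Z} {g : A c.⊠ X C.⇒ Y} → F₁ h ∘ hat g ≈ hat (h C.∘ g)
    hat-∘ = ≈-trans (≈-sym assoc) (≈-sym homomorphism ⟩∘⟨refl)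

  hatF : ∀ T → Functor (FC.Fam T) (Fam (F₀ T))
  hatF T = record
    { F₀ = F₀ ; F₁ = hat ; F-resp-≈ = hat-resp ; identity = hat-π₂ ; homomorphism = hat-• }

  hat≅ : ∀ {T X Y} → FC.IsoFam T X Y → IsoFam (F₀ T) (F₀ X) (F₀ Y)
  hat≅ {T} = map≅ (hatF T)

  hatSystem : ∀ {A} → FC.System A → System (F₀ A)
  hatSystem [] = []
  hatSystem (e ∷ sys) = equation (hat lhs) (hat rhs) ∷ hatSystem sys
    where open FC.Equation e

  opaque
    hat-Solves : ∀ {A T} {s : T C.⇒ A} (sys : FC.System A) → FC.Solves s sys → Solves (F₁ s) (hatSystem sys)
    hat-Solves [] _ = tt
    hat-Solves (_ ∷ sys) (p , ps) =
      ≈-trans (≈-sym hat-[]) (≈-trans (hat-resp p) hat-[]) , hat-Solves sys ps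

module IndElements {C : Category o ℓ} where
  open Category C
  private module Ind = Category (Ind C) using (_∘_; _≈_; id)

  ι₀ : Obj → IndObj C
  ι₀ = Functor.F₀ (ι {C = C})

  ι₁ : ∀ {X Y} → X ⇒ Y → IndHom (ι₀ X) (ι₀ Y)
  ι₁ = Functor.F₁ (ι {C = C})

  element : ∀ {T} {B : IndObj C} → El B T → IndHom (ι₀ T) B
  element {B = B} x = record { comp = λ _ → x ; compat = λ _ → El-≈ B identityʳ }

  unι : ∀ {X Y} → IndHom (ι₀ X) (ι₀ Y) → X ⇒ Y
  unι f = proj₂ (IndHom.comp f tt)

  opaque
    unι-resp : ∀ {X Y} {f g : IndHom (ι₀ X) (ι₀ Y)} → f Ind.≈ g → unι f ≈ unι g
    unι-resp e with e tt
    ... | same _ _ p = ≈-trans (≈-sym identityˡ) (≈-trans p identityˡ)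

    push-∘ : ∀ {A B D : IndObj C} (g : IndHom B D) (f : IndHom A B) {Z} (x : El A Z) →
             SameEl D (push (g Ind.∘ f) x) (push g (push f x))
    push-∘ {D = D} g f x = El-≈ D assoc

    push-≈ : ∀ {A B : IndObj C} {f g : IndHom A B} → f Ind.≈ g → ∀ {Z} (x : El A Z) →
             SameEl B (push f x) (push g x)
    push-≈ {B = B} e (i , x) = El-restrict-resp B x (e i)

    push-id : ∀ {A : IndObj C} {Z} (x : El A Z) → SameEl A (push (Ind.id {A}) x) x
    push-id {A} x = El-≈ A identityˡ

    stage-agree : ∀ (B : IndObj C) (let module B = IndObj B) {T k} {x y : T ⇒ B.ob k} →
                  SameEl B (k , x) (k , y) → Σ[ m ∈ B.Index ] Σ[ a ∈ k B.↝ m ] B.tr a ∘ x ≈ B.tr a ∘ y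
    stage-agree B (same a b p) with IndObj.coequalize B a b
    ... | m , c , e = m , c B.∘ᵢ a ,
      ≈-trans (B.tr-∘ ⟩∘⟨refl) (≈-trans assoc (≈-trans (refl⟩∘⟨ p)
        (≈-trans (≈-sym assoc) (≈-sym (≈-trans (B.tr-resp e) B.tr-∘) ⟩∘⟨refl))))
      where module B = IndObj B using (Index; ob; tr; tr-resp; tr-∘; _↝_; _∘ᵢ_)

module _ {C : Category o ℓ} {X Y : IndObj C} (f : IndHom X Y) {A : Category.Obj C} (y : El Y A) where
  open Category C
  open IndElements {C = C}
  private
    module I = Category (Ind C) using (_∘_)

  record CompactPullback : Set (o ⊔ ℓ) where
    field
      {obj}    : Obj
      base     : obj ⇒ A
      point    : El X obj
      commute  : SameEl Y (push f point) (El-restrict Y base y)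
      lift     : ∀ {T} (a : T ⇒ A) (x : El X T) → SameEl Y (push f x) (El-restrict Y a y) → T ⇒ obj
      project₁ : ∀ {T} (a : T ⇒ A) (x : El X T) p → base ∘ lift a x p ≈ a
      project₂ : ∀ {T} (a : T ⇒ A) (x : El X T) p → SameEl X (El-restrict X (lift a x p) point) x
      unique   : ∀ {T} {h k : T ⇒ obj} → base ∘ h ≈ base ∘ k →
                 SameEl X (El-restrict X h point) (El-restrict X k point) → h ≈ k

  private
    compactPullback′ : Proper f → CompactPullback
    compactPullback′ proper = record
      { base = unι q ; point = IndHom.comp p tt ; commute = Pb.commute tt
      ; lift = λ a x e → unι (square a x e)
      ; project₁ = λ a x e → unι-resp {f = q I.∘ square a x e} {ι₁ a} (Pb.project₂ {eq = λ _ → e})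
      ; project₂ = λ a x e → Pb.project₁ {h = element x} {ι₁ a} {λ _ → e} tt
      ; unique = λ {T} {h} {k} e₁ e₂ → unι-resp {f = ι₁ h} {ι₁ k}
          (pullback-ext isPullback {x = ι₁ h} {ι₁ k} (λ _ → e₂) (λ _ → El-≈ (ι₀ A) e₁)) }
      where
      pb = proper {Z = ι₀ A} (A , Isos.id≅ (Ind C)) (element y)
      iso = proj₂ (proj₂ (proj₂ (proj₂ (proj₂ pb))))
      p = proj₁ (proj₂ pb) I.∘ Isos.to (Ind C) iso
      q = proj₁ (proj₂ (proj₂ pb)) I.∘ Isos.to (Ind C) iso
      isPullback : IsPullback (Ind C) p q f (element y)
      isPullback = pullback-≅ (proj₁ (proj₂ (proj₂ (proj₂ pb)))) iso
      module Pb = IsPullback isPullback using (commute; lift; project₁; project₂)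
      square : ∀ {T} (a : T ⇒ A) (x : El X T) → SameEl Y (push f x) (El-restrict Y a y) → IndHom (ι₀ T) (ι₀ (proj₁ (proj₂ (proj₂ (proj₂ (proj₂ pb))))))
      square a x e = Pb.lift (element x) (ι₁ a) (λ _ → e)

  opaque
    compactPullback : Proper f → CompactPullback
    compactPullback = compactPullback′

module _ {C : Category o ℓ} (c : Cartesian C) where
  open Category C
  open Cartesian c
  open Families c

  record IsHom (H : IndObj C) (X Y : Obj) : Set (o ⊔ ℓ) where
    private module H = IndObj H using (Index; ob; tr; upperBound; _↝_)
    field
      eval     : ∀ i → H.ob i ⊠ X ⇒ Y
      eval-tr  : ∀ {i j} (a : i H.↝ j) → eval j [ H.tr a ] ≈ eval i
      code     : ∀ {T} (g : T ⊠ X ⇒ Y) → Σ[ i ∈ H.Index ] Σ[ h ∈ T ⇒ H.ob i ] eval i [ h ] ≈ g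
      separate : ∀ {T i j} (x : T ⇒ H.ob i) (y : T ⇒ H.ob j) →
                 eval i [ x ] ≈ eval j [ y ] → SameEl H (i , x) (j , y)

    code-pair : ∀ {T} (g h : T ⊠ X ⇒ Y) → Σ[ k ∈ H.Index ] Σ[ x ∈ T ⇒ H.ob k ] Σ[ y ∈ T ⇒ H.ob k ]
                eval k [ x ] ≈ g × eval k [ y ] ≈ h
    code-pair g h =
      let (i , x , p) = code g
          (j , y , q) = code h
          (k , a , b) = H.upperBound i j
      in k , H.tr a ∘ x , H.tr b ∘ y
        , ≈-trans (≈-sym []-∘) (≈-trans ([]-resp (eval-tr a) ≈-refl) p)
        , ≈-trans (≈-sym []-∘) (≈-trans ([]-resp (eval-tr b) ≈-refl) q)

    opaque
      respect : ∀ {T} {x y : El H T} → SameEl H x y →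
                eval (proj₁ x) [ proj₂ x ] ≈ eval (proj₁ y) [ proj₂ y ]
      respect (same a b p) = ≈-trans ([]-resp (≈-sym (eval-tr a)) ≈-refl)
        (≈-trans ([]-square p) ([]-resp (eval-tr b) ≈-refl))

module _ {C : Category o ℓ} (K : IndClosed C) (X Y : Category.Obj C) where
  open Category C
  open IndClosed K
  open Families cartesian
  private
    H = HomObj X Y
    module H = IndObj H using (ob)
    module r = PresheafIso (represents X Y) using (iso; natural; to)
    module S {Z : Obj} = Setoid (El-setoid H Z) using (refl; sym; trans)

    to-restrict : ∀ {T i} (x : T ⇒ H.ob i) → SameEl H (r.to (ev X Y i [ x ])) (i , x)
    to-restrict {i = i} x = S.trans (r.natural x (ev X Y i))
      (S.trans (El-restrict-resp H x (Inverse.inverseˡ (r.iso _) ≈-refl)) (El-≈ H identityˡ))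

  opaque
    code-separated : ∀ {T} {g h : T ⊠ X ⇒ Y} → SameEl H (r.to g) (r.to h) → g ≈ h
    code-separated e = ≈-trans (≈-sym (Inverse.inverseʳ (r.iso _) S.refl)) (Inverse.inverseʳ (r.iso _) e)

  HomObj-isHom : IsHom cartesian H X Y
  HomObj-isHom = record
    { eval = ev X Y
    ; eval-tr = ev-compat X Y
    ; code = λ g → proj₁ (r.to g) , proj₂ (r.to g) , code-separated (to-restrict _)
    ; separate = λ x y p → S.trans (S.sym (to-restrict x)) (S.trans (Inverse.to-cong (r.iso _) p) (to-restrict y)) }

module _ {C : Category o ℓ} {D : Category o′ ℓ} (KC : IndClosed C) (KD : IndClosed D)
         (Φ : Functor C D) (closed : IsClosed KC KD Φ) where
  private
    module C = Category C using (Obj; _⇒_; _∘_; _≈_; assoc; id; ≈-refl; ≈-sym; ≈-trans)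
    module KC = IndClosed KC using (HomObj; _⊠_; cartesian; equalizer; ev; ev-compat; π₁; π₂)
    module KD = IndClosed KD
    module Φ = IsClosed closed using (closed; equalizer; products)
    module FC = Families KC.cartesian
  open Category D
  open Functor Φ
  open KD using (_⊠_)
  open Families KD.cartesian
  open Hat KC.cartesian KD.cartesian Φ Φ.products
  open IndElements {C = D}

  module _ (X Y : C.Obj) where
    private
      H = KC.HomObj X Y
      ΦH = Functor.F₀ (IndF Φ) H
      HΦ = KD.HomObj (F₀ X) (F₀ Y)
      module r = PresheafIso (KD.represents (F₀ X) (F₀ Y)) using (iso; natural; to)
      module S {Z : Obj} = Setoid (El-setoid HΦ Z) using (sym; trans)
      module S′ {Z : Obj} = Setoid (El-setoid ΦH Z) using (sym; trans)
      module I = Category (Ind D)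
      m = closed-map KC KD Φ Φ.products X Y
      open I.IsIso (Φ.closed X Y)

      inv-push : ∀ {Z} (x : El ΦH Z) → SameEl ΦH (push inv (push m x)) x
      inv-push x = S′.trans (S′.sym (push-∘ inv m x)) (S′.trans (push-≈ {f = inv I.∘ m} {I.id} isoˡ x) (push-id x))

      push-inv : ∀ {Z} (x : El HΦ Z) → SameEl HΦ (push m (push inv x)) x
      push-inv x = S.trans (S.sym (push-∘ m inv x)) (S.trans (push-≈ {f = m I.∘ inv} {I.id} isoʳ x) (push-id x))

    hat-isHom : IsHom KD.cartesian ΦH (F₀ X) (F₀ Y)
    hat-isHom = record
      { eval = λ i → hat (KC.ev X Y i)
      ; eval-tr = λ a → ≈-trans (≈-sym hat-[]) (hat-resp (KC.ev-compat X Y a))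
      ; code = λ g → let (i , h) = push inv (r.to g) in
          i , h , code-separated KD _ _ (S.trans (r.natural h _) (push-inv (r.to g)))
      ; separate = λ {T} {i} {j} x y p → S′.trans (S′.sym (inv-push (i , x))) (S′.trans
          (push-resp inv (S.trans (S.sym (r.natural x _)) (S.trans (Inverse.to-cong (r.iso _) p) (r.natural y _))))
          (inv-push (j , y))) }

  record Factors {A} (sys : FC.System A) {T} (s : T ⇒ F₀ A) : Set (o ⊔ ℓ) where
    field
      {obj}   : C.Obj
      incl    : obj C.⇒ A
      solves  : FC.Solves incl sys
      lift    : T ⇒ F₀ obj
      commute : F₁ incl ∘ lift ≈ s

  -- Although {a : u(a,-) = v(a,-)} need not be an object of C, a point of Φ A
  -- solving Φ u = Φ v already does so in some stage Φ Hₖ of Φ (Hom(X, Y)).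
  private
    factor₁ : ∀ {A} (e : FC.Equation A) {T} (s : T ⇒ F₀ A) → Solves s (hatSystem (e ∷ [])) → Factors (e ∷ []) s
    factor₁ {A} e {T} s (p , _) = record
      { incl = ε ; solves = eq , tt ; lift = Eq.lift s agree ; commute = Eq.commute }
      where
      open FC.Equation e
      module h = IsHom (HomObj-isHom KC dom cod) using (code-pair; eval; eval-tr)
      module H = IndObj (KC.HomObj dom cod) using (tr)
      coded = h.code-pair lhs rhs
      k = proj₁ coded
      x = proj₁ (proj₂ coded)
      y = proj₁ (proj₂ (proj₂ coded))
      ex = proj₁ (proj₂ (proj₂ (proj₂ coded)))
      ey = proj₂ (proj₂ (proj₂ (proj₂ coded)))
      at-s : ∀ {z g} → h.eval k FC.[ z ] C.≈ g → hat (h.eval k) [ F₁ z ∘ s ] ≈ hat g [ s ]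
      at-s q = ≈-trans (≈-sym []-∘) ([]-resp (≈-trans (≈-sym hat-[]) (hat-resp q)) ≈-refl)
      agreement = stage-agree (Functor.F₀ (IndF Φ) (KC.HomObj dom cod))
        (IsHom.separate (hat-isHom dom cod) (F₁ x ∘ s) (F₁ y ∘ s) (≈-trans (at-s ex) (≈-trans p (≈-sym (at-s ey)))))
      m = proj₁ agreement
      a = proj₁ (proj₂ agreement)
      equal = KC.equalizer (H.tr a C.∘ x) (H.tr a C.∘ y)
      ε = proj₁ (proj₂ equal)
      isEq = proj₂ (proj₂ equal)
      module Eq = IsEqualizer (Φ.equalizer isEq) using (commute; lift)
      agree : F₁ (H.tr a C.∘ x) ∘ s ≈ F₁ (H.tr a C.∘ y) ∘ s
      agree = ≈-trans (homomorphism ⟩∘⟨refl) (≈-trans assoc (≈-trans (proj₂ (proj₂ agreement))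
        (≈-sym (≈-trans (homomorphism ⟩∘⟨refl) assoc))))
      at-ε : ∀ {z g} → h.eval k FC.[ z ] C.≈ g → h.eval m FC.[ (H.tr a C.∘ z) C.∘ ε ] C.≈ g FC.[ ε ]
      at-ε q = C.≈-trans (C.≈-sym FC.[]-∘) (FC.[]-resp
        (C.≈-trans (C.≈-sym FC.[]-∘) (C.≈-trans (FC.[]-resp (h.eval-tr a) C.≈-refl) q)) C.≈-refl)
      eq : lhs FC.[ ε ] C.≈ rhs FC.[ ε ]
      eq = C.≈-trans (C.≈-sym (at-ε ex)) (C.≈-trans (FC.[]-resp C.≈-refl (IsEqualizer.equality isEq)) (at-ε ey))

  private
    factor′ : ∀ {A} (sys : FC.System A) {T} (s : T ⇒ F₀ A) → Solves s (hatSystem sys) → Factors sys s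
    factor′ [] s _ = record { incl = C.id ; solves = tt ; lift = s ; commute = ≈-trans (identity ⟩∘⟨refl) identityˡ }
    factor′ (e ∷ sys) {T} s (p , ps) = record
      { incl = f.incl C.∘ f₁.incl
      ; solves = C.≈-trans (C.≈-sym FC.[]-∘) (C.≈-trans (proj₁ f₁.solves) FC.[]-∘) , FC.Solves-∘ sys f.solves
      ; lift = f₁.lift
      ; commute = ≈-trans (homomorphism ⟩∘⟨refl) (≈-trans assoc (≈-trans (refl⟩∘⟨ f₁.commute) f.commute)) }
      where
      open FC.Equation e
      module f = Factors (factor′ sys s ps) using (commute; incl; lift; obj; solves)
      shift : ∀ {X Y} {g : _ KC.⊠ X C.⇒ Y} → hat (g FC.[ f.incl ]) [ f.lift ] ≈ hat g [ s ]
      shift = ≈-trans ([]-resp hat-[] ≈-refl) ([]-[] f.commute)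
      e′ : FC.Equation f.obj
      e′ = FC.equation (lhs FC.[ f.incl ]) (rhs FC.[ f.incl ])
      factored : Factors (e′ ∷ []) f.lift
      factored = factor₁ e′ f.lift (≈-trans shift (≈-trans p (≈-sym shift)) , tt)
      module f₁ = Factors factored using (commute; incl; lift; solves)

  opaque
    factor : ∀ {A} (sys : FC.System A) {T} (s : T ⇒ F₀ A) → Solves s (hatSystem sys) → Factors sys s
    factor = factor′

  opaque
    hat-faithful : ∀ {K X Y} {γ : K KC.⊠ X C.⇒ Y} → FC.Faithful γ → Faithful (hat γ)
    hat-faithful {K} {γ = γ} faithful {T} x y p = begin
      x                                ≈⟨ ≈-sym (at p₁ π₁-⟪⟫) ⟩
      F₁ (p₁ C.∘ f.incl) ∘ f.lift      ≈⟨ F-resp-≈ equal ⟩∘⟨refl ⟩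
      F₁ (p₂ C.∘ f.incl) ∘ f.lift      ≈⟨ at p₂ π₂-⟪⟫ ⟩
      y                                ∎
      where
      p₁ p₂ : K KC.⊠ K C.⇒ K
      p₁ = KC.π₁
      p₂ = KC.π₂
      pair-π : ∀ {k : K KC.⊠ K C.⇒ K} {z : T ⇒ F₀ K} → F₁ k ∘ ⟪ x , y ⟫ ≈ z → hat (γ FC.[ k ]) [ ⟪ x , y ⟫ ] ≈ hat γ [ z ]
      pair-π q = ≈-trans ([]-resp hat-[] ≈-refl) ([]-[] q)
      coincide : FC.System (K KC.⊠ K)
      coincide = FC.equation (γ FC.[ p₁ ]) (γ FC.[ p₂ ]) ∷ []
      factored : Factors coincide ⟪ x , y ⟫
      factored = factor coincide ⟪ x , y ⟫ (≈-trans (pair-π π₁-⟪⟫) (≈-trans p (≈-sym (pair-π π₂-⟪⟫))) , tt)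
      module f = Factors factored using (commute; incl; lift; solves)
      equal : p₁ C.∘ f.incl C.≈ p₂ C.∘ f.incl
      equal = faithful _ _ (C.≈-trans (C.≈-sym FC.[]-∘) (C.≈-trans (proj₁ f.solves) FC.[]-∘))
      at : ∀ {z : T ⇒ F₀ K} (k : K KC.⊠ K C.⇒ K) → F₁ k ∘ ⟪ x , y ⟫ ≈ z → F₁ (k C.∘ f.incl) ∘ f.lift ≈ z
      at k q = ≈-trans (homomorphism ⟩∘⟨refl) (≈-trans assoc (≈-trans (refl⟩∘⟨ f.commute) q))

    hat-lift : ∀ {A} {sys : FC.System A} (L : FC.Locus sys) {T} (s : T ⇒ F₀ A) → Solves s (hatSystem sys) →
               Σ[ h ∈ T ⇒ F₀ (FC.Locus.obj L) ] F₁ (FC.Locus.incl L) ∘ h ≈ s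
    hat-lift {sys = sys} L s p = F₁ (L.lift f.incl f.solves) ∘ f.lift ,
      ≈-trans (≈-sym assoc) (≈-trans (≈-trans (≈-sym homomorphism) (F-resp-≈ (L.commute _ _)) ⟩∘⟨refl) f.commute)
      where
      module L = FC.Locus L using (commute; lift)
      module f = Factors (factor sys s p) using (commute; incl; lift; solves)

    preserves-mono : ∀ {A B} {m : A C.⇒ B} → (∀ {T} {x y : T C.⇒ A} → m C.∘ x C.≈ m C.∘ y → x C.≈ y) →
                     ∀ {T} {x y : T ⇒ F₀ A} → F₁ m ∘ x ≈ F₁ m ∘ y → x ≈ y
    preserves-mono {A} {B} {m} mono {T} {x} {y} p = begin
      x                       ≈⟨ ≈-sym π₁-⟪⟫ ⟩
      F₁ KC.π₁ ∘ s            ≈⟨ ≈-trans (refl⟩∘⟨ ≈-sym Eq.commute) (≈-sym assoc) ⟩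
      (F₁ KC.π₁ ∘ F₁ ε) ∘ h   ≈⟨ ≈-trans (≈-sym homomorphism) (≈-trans (F-resp-≈ (mono (C.≈-trans (C.≈-sym C.assoc)
                                  (C.≈-trans (IsEqualizer.equality isEq) C.assoc)))) homomorphism) ⟩∘⟨refl ⟩
      (F₁ KC.π₂ ∘ F₁ ε) ∘ h   ≈⟨ ≈-trans assoc (refl⟩∘⟨ Eq.commute) ⟩
      F₁ KC.π₂ ∘ s            ≈⟨ π₂-⟪⟫ ⟩
      y                       ∎
      where
      s : T ⇒ F₀ (A KC.⊠ A)
      s = ⟪ x , y ⟫
      equal : Σ[ E ∈ C.Obj ] Σ[ e ∈ E C.⇒ A KC.⊠ A ] IsEqualizer C e (m C.∘ KC.π₁) (m C.∘ KC.π₂)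
      equal = KC.equalizer (m C.∘ KC.π₁ {A} {A}) (m C.∘ KC.π₂)
      ε : proj₁ equal C.⇒ A KC.⊠ A
      ε = proj₁ (proj₂ equal)
      isEq : IsEqualizer C ε (m C.∘ KC.π₁) (m C.∘ KC.π₂)
      isEq = proj₂ (proj₂ equal)
      module Eq = IsEqualizer (Φ.equalizer isEq) using (commute; lift)
      h : T ⇒ F₀ (proj₁ equal)
      h = Eq.lift s (≈-trans (homomorphism ⟩∘⟨refl) (≈-trans assoc (≈-trans (refl⟩∘⟨ π₁-⟪⟫) (≈-trans p (≈-sym
            (≈-trans (homomorphism ⟩∘⟨refl) (≈-trans assoc (refl⟩∘⟨ π₂-⟪⟫))))))))

module _ {C : Category o ℓ} (K : IndClosed C)
         (semiStrict : ∀ X Y → SemiStrict (IndClosed.HomObj K X Y)) where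
  open Category C
  open IndClosed K
  open Families cartesian
  open IndElements {C = C}

  private
    locus₁ : ∀ {A} (e : Equation A) → Locus (e ∷ [])
    locus₁ {A} e = record
      { obj = proj₁ equal ; incl = P.base ∘ ε
      ; solves = ≈-trans (≈-sym (at ex _)) (≈-trans (h.respect same-code) (at ey _)) , tt
      ; lift = λ s (e , _) → Eq.lift (lift s e) (≈-trans (lift₁ s e) (≈-sym (lift₂ s e)))
      ; commute = λ s (e , _) → ≈-trans assoc (≈-trans (refl⟩∘⟨ Eq.commute) (lift₁ s e))
      ; mono = λ {T} {x} {y} r → ε-mono (P.unique (≈-trans (≈-sym assoc) (≈-trans r assoc))
          (El-≈ (ι₀ A) (≈-trans (second-ε x) (≈-trans r (≈-sym (second-ε y)))))) }
      where
      open Equation e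
      module h = IsHom (HomObj-isHom K dom cod) using (code-pair; eval; respect; separate)
      H = HomObj dom cod
      coded = h.code-pair lhs rhs
      k = proj₁ coded
      x = proj₁ (proj₂ coded)
      y = proj₁ (proj₂ (proj₂ coded))
      ex = proj₁ (proj₂ (proj₂ (proj₂ coded)))
      ey = proj₂ (proj₂ (proj₂ (proj₂ coded)))
      pullback : CompactPullback (element {B = H} (k , x)) (k , y)
      pullback = compactPullback (element (k , x)) (k , y) (semiStrict dom cod (A , Isos.id≅ (Ind C)) (element (k , x)))
      module P = CompactPullback pullback using (base; commute; lift; obj; point; project₁; project₂; unique)
      second : P.obj ⇒ A
      second = proj₂ P.point
      equal = equalizer P.base second
      ε = proj₁ (proj₂ equal)
      module Eq = IsEqualizer (proj₂ (proj₂ equal)) using (commute; equality; lift; unique)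
      ε-mono : ∀ {T} {x y : T ⇒ proj₁ equal} → ε ∘ x ≈ ε ∘ y → x ≈ y
      ε-mono {x = x} {y} r = ≈-trans (≈-sym (Eq.unique {eq = ≈-trans (≈-sym assoc) (≈-trans (Eq.equality ⟩∘⟨refl) assoc)} ≈-refl))
        (Eq.unique (≈-sym r))
      second-ε : ∀ {T} (x : T ⇒ proj₁ equal) → second ∘ ε ∘ x ≈ (P.base ∘ ε) ∘ x
      second-ε x = ≈-trans (≈-sym assoc) (≈-sym Eq.equality ⟩∘⟨refl)
      module S {Z : Obj} = Setoid (El-setoid H Z) using (trans)
      same-code : SameEl H (k , x ∘ (P.base ∘ ε)) (k , y ∘ (P.base ∘ ε))
      same-code = S.trans (El-≈ H (≈-trans (refl⟩∘⟨ Eq.equality) (≈-sym assoc)))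
        (S.trans (El-restrict-resp H ε P.commute) (El-≈ H assoc))
      at : ∀ {T z g} → h.eval k [ z ] ≈ g → (s : T ⇒ A) → h.eval k [ z ∘ s ] ≈ g [ s ]
      at e s = ≈-trans (≈-sym []-∘) ([]-resp e ≈-refl)
      module _ {T} (s : T ⇒ A) (e : lhs [ s ] ≈ rhs [ s ]) where
        agree : SameEl H (k , x ∘ s) (k , y ∘ s)
        agree = h.separate (x ∘ s) (y ∘ s) (≈-trans (at ex s) (≈-trans e (≈-sym (at ey s))))
        lift : T ⇒ P.obj
        lift = P.lift s (tt , s) agree
        lift₁ : P.base ∘ lift ≈ s
        lift₁ = P.project₁ s (tt , s) agree
        lift₂ : second ∘ lift ≈ s
        lift₂ = unι-resp {f = element (tt , second ∘ lift)} {element (tt , s)} (λ _ → P.project₂ s (tt , s) agree)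

  opaque
    loci : ∀ {A} (sys : System A) → Locus sys
    loci = locus locus₁

module _ {C : Category o ℓ} {D : Category o′ ℓ} (KC : IndClosed C) (KD : IndClosed D)
         (Φ : Functor C D) (closed : IsClosed KC KD Φ) where
  private
    module C = Category C using (Obj; _⇒_; ≈-sym; ≈-trans)
    module KC = IndClosed KC using (HomObj; _⊠_; cartesian; π₁; π₂)
    module KD = IndClosed KD using (cartesian; π₂)
    module Φ = IsClosed closed using (products)
    module FC = Families KC.cartesian using (Fam; IsoFam; System; _[_]; _[_]≅; []-π₂; []-•; equation; _•_)
  open Category D
  open Functor Φ
  open Families KD.cartesian
  open Hat KC.cartesian KD.cartesian Φ Φ.products

  record LiftedIso {X Y T} (θ : IsoFam T (F₀ X) (F₀ Y)) : Set (o ⊔ ℓ) where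
    field
      {obj}  : C.Obj
      family : FC.IsoFam obj X Y
      point  : T ⇒ F₀ obj
      agree  : hat (Isos.to (FC.Fam obj) family) [ point ] ≈ Isos.to (Fam T) θ

  private
    liftIso′ : ∀ {X Y T} (θ : IsoFam T (F₀ X) (F₀ Y)) → LiftedIso θ
    liftIso′ {X} {Y} {T} θ = record
      { family = Isos.mk≅ (FC.Fam f.obj) (g FC.[ f.incl ]) (g′ FC.[ f.incl ])
          (C.≈-trans (C.≈-sym FC.[]-•) (C.≈-trans (proj₁ f.solves) FC.[]-π₂))
          (C.≈-trans (C.≈-sym FC.[]-•) (C.≈-trans (proj₁ (proj₂ f.solves)) FC.[]-π₂))
      ; point = f.lift
      ; agree = ≈-trans (hat-at f.commute) g-s }
      where
      module h = IsHom (HomObj-isHom KC X Y) using (eval)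
      module h′ = IsHom (HomObj-isHom KC Y X) using (eval)
      open Isos (Fam T)
      coded = IsHom.code (hat-isHom KC KD Φ closed X Y) (to θ)
      coded′ = IsHom.code (hat-isHom KC KD Φ closed Y X) (from θ)
      i = proj₁ coded
      j = proj₁ coded′
      A : C.Obj
      A = IndObj.ob (KC.HomObj X Y) i KC.⊠ IndObj.ob (KC.HomObj Y X) j
      s : T ⇒ F₀ A
      s = ⟪ proj₁ (proj₂ coded) , proj₁ (proj₂ coded′) ⟫
      g : A KC.⊠ X C.⇒ Y
      g = h.eval i FC.[ KC.π₁ ]
      g′ : A KC.⊠ Y C.⇒ X
      g′ = h′.eval j FC.[ KC.π₂ ]
      g-s : hat g [ s ] ≈ to θ
      g-s = ≈-trans (hat-at π₁-⟪⟫) (proj₂ (proj₂ coded))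
      g′-s : hat g′ [ s ] ≈ from θ
      g′-s = ≈-trans (hat-at π₂-⟪⟫) (proj₂ (proj₂ coded′))
      inverse : FC.System A
      inverse = FC.equation (g′ FC.• g) KC.π₂ ∷ FC.equation (g FC.• g′) KC.π₂ ∷ []
      π₂-s : ∀ {Z} → hat (KC.π₂ {A} {Z}) [ s ] ≈ KD.π₂
      π₂-s = ≈-trans ([]-resp hat-π₂ ≈-refl) []-π₂
      factored : Factors KC KD Φ closed inverse s
      factored = factor KC KD Φ closed inverse s
        ( ≈-trans (≈-trans ([]-resp hat-• ≈-refl) []-•) (≈-trans (•-resp g′-s g-s) (≈-trans (from∘to θ) (≈-sym π₂-s)))
        , ≈-trans (≈-trans ([]-resp hat-• ≈-refl) []-•) (≈-trans (•-resp g-s g′-s) (≈-trans (to∘from θ) (≈-sym π₂-s)))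
        , tt )
      module f = Factors factored using (commute; incl; lift; obj; solves)

  opaque
    liftIso : ∀ {X Y T} (θ : IsoFam T (F₀ X) (F₀ Y)) → LiftedIso θ
    liftIso = liftIso′

module _ {C : Category o ℓ} (c : Cartesian C) where
  open Category C
  open Cartesian c
  open Families c

  opaque
    ⟨π₁,⟩-• : ∀ {T X Y Z} {g : T ⊠ Y ⇒ Z} {f : T ⊠ X ⇒ Y} → ⟨ π₁ , g ⟩ ∘ ⟨ π₁ , f ⟩ ≈ ⟨ π₁ , g • f ⟩
    ⟨π₁,⟩-• = ≈-trans ⟨⟩∘ (⟨⟩-resp project₁ ≈-refl)

    ⟨π₁,⟩-inverse : ∀ {T X Y} {g : T ⊠ Y ⇒ X} {f : T ⊠ X ⇒ Y} → g • f ≈ π₂ → ⟨ π₁ , g ⟩ ∘ ⟨ π₁ , f ⟩ ≈ id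
    ⟨π₁,⟩-inverse p = ≈-trans ⟨π₁,⟩-• (≈-trans (⟨⟩-resp ≈-refl p) ⟨π₁,π₂⟩)

    over-ext : ∀ {T X Y} {g : T ⊠ X ⇒ T ⊠ Y} → π₁ ∘ g ≈ π₁ → ⟨ π₁ , π₂ ∘ g ⟩ ≈ g
    over-ext p = unique p ≈-refl

    over-inverse : ∀ {T X Y} {g : T ⊠ Y ⇒ T ⊠ X} {f : T ⊠ X ⇒ T ⊠ Y} → π₁ ∘ f ≈ π₁ → g ∘ f ≈ id →
                   (π₂ ∘ g) • (π₂ ∘ f) ≈ π₂
    over-inverse p q = ≈-trans (refl⟩∘⟨ over-ext p) (≈-trans assoc (≈-trans (refl⟩∘⟨ q) identityʳ))

  isoOver : ∀ {T X Y} → IsoFam T X Y → IsoOver c T X Y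
  isoOver {T} θ = record
    { fwd = ⟨ π₁ , to θ ⟩ ; over = project₁
    ; isIso = record { inv = ⟨ π₁ , from θ ⟩ ; isoˡ = ⟨π₁,⟩-inverse (from∘to θ) ; isoʳ = ⟨π₁,⟩-inverse (to∘from θ) } }
    where open Isos (Fam T)

  isoFam : ∀ {T X Y} → IsoOver c T X Y → IsoFam T X Y
  isoFam {T} a = Isos.mk≅ (Fam T) (π₂ ∘ a.fwd) (π₂ ∘ a.bwd)
    (over-inverse a.over a.isoˡ) (over-inverse a.over-bwd a.isoʳ)
    where module a = IsoOver a using (bwd; fwd; isoʳ; isoˡ; over; over-bwd)

  record FaithfulFactor {T X Y} (θ : IsoFam T X Y) : Set (o ⊔ ℓ) where
    field
      {obj}    : Obj
      family   : IsoFam obj X Y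
      faithful : Faithful (Isos.to (Fam obj) family)
      arrow    : T ⇒ obj
      agree    : Isos.to (Fam obj) family [ arrow ] ≈ Isos.to (Fam T) θ

  module _ {X Y : Obj} {B : IndObj C} (rep : B IndRepresents BiPresheaf c X Y) (strict : Strict B) where
    open IndElements {C = C}
    private
      module I = Category (Ind C) using (_∘_)
      module II = Isos (Ind C) using (from; id≅; to)
      module r = PresheafIso rep using (from; iso; natural; to)
      module P = Presheaf (BiPresheaf c X Y) using (_∣_)
      module S {Z : Obj} = Setoid (El-setoid B Z) using (refl; sym; trans)

    private
      faithfulFactor′ : ∀ {T} (θ : IsoFam T X Y) → FaithfulFactor θ
      faithfulFactor′ {T} θ = record
        { family = isoFam b
        ; faithful = λ x y p → unι-resp {f = ι₁ x} {ι₁ y}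
            (mono-≅ {m = m} mono iso (ι₁ x) (ι₁ y) (λ _ → same-point x y p))
        ; arrow = s
        ; agree = ≈-trans assoc (≈-trans (≈-sym project₂) (≈-trans (refl⟩∘⟨ same-over) project₂)) }
        where
        code : El B T
        code = r.to (isoOver θ)
        fac = strict (T , II.id≅) (element code)
        W : Obj
        W = proj₁ (proj₁ (proj₂ fac))
        iso = proj₂ (proj₁ (proj₂ fac))
        h = proj₁ (proj₂ (proj₂ fac))
        m = proj₁ (proj₂ (proj₂ (proj₂ fac)))
        mono = proj₁ (proj₂ (proj₂ (proj₂ (proj₂ fac))))
        commute = proj₂ (proj₂ (proj₂ (proj₂ (proj₂ fac))))
        m′ : IndHom (ι₀ W) B
        m′ = m I.∘ II.to iso
        point : El B W
        point = IndHom.comp m′ tt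
        b : IsoOver c W X Y
        b = r.from point
        code-b : ∀ {S} (x : S ⇒ W) → SameEl B (r.to (b P.∣ x)) (El-restrict B x point)
        code-b x = S.trans (r.natural x b) (El-restrict-resp B x (Inverse.inverseˡ (r.iso _) (≈-refl {x = IsoOver.fwd b})))
        s : T ⇒ W
        s = unι (II.from iso I.∘ h)
        same-code : SameEl B (r.to (b P.∣ s)) code
        same-code = S.trans (code-b s) (factor-≅ {m = m} {h} {element code} commute iso tt)
        decode : ∀ {S} {a a′ : IsoOver c S X Y} → SameEl B (r.to a) (r.to a′) → IsoOver.fwd a ≈ IsoOver.fwd a′
        decode e = ≈-trans (≈-sym (Inverse.inverseʳ (r.iso _) S.refl)) (Inverse.inverseʳ (r.iso _) e)
        same-over : ⟨ π₁ , π₂ ∘ IsoOver.fwd b ∘ (s ⁂ id) ⟩ ≈ ⟨ π₁ , Isos.to (Fam T) θ ⟩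
        same-over = decode {a = b P.∣ s} {isoOver θ} same-code
        same-point : ∀ {S} (x y : S ⇒ W) → (π₂ ∘ IsoOver.fwd b) [ x ] ≈ (π₂ ∘ IsoOver.fwd b) [ y ] →
                     SameEl B (El-restrict B x point) (El-restrict B y point)
        same-point x y p = S.trans (S.sym (code-b x)) (S.trans (Inverse.to-cong (r.iso _) {b P.∣ x} {b P.∣ y}
          (⟨⟩-resp ≈-refl (≈-trans (≈-sym assoc) (≈-trans p assoc)))) (code-b y))

    opaque
      faithfulFactor : ∀ {T} (θ : IsoFam T X Y) → FaithfulFactor θ
      faithfulFactor = faithfulFactor′

module _ {C : Category o ℓ} (K : IndClosed C) {X Y Z : Category.Obj C} (k : Category._⇒_ C X Y) where
  open Category C
  open IndClosed K
  open Families cartesian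
  private
    HX = HomObj Z X
    HY = HomObj Z Y
    module X = IsHom (HomObj-isHom K Z X) using (code; eval; respect; separate)
    module Y = IsHom (HomObj-isHom K Z Y) using (code; eval; respect; separate)

    eval-push : ∀ {T} (x : El HX T) → let y = push (postcompose Z k) x in
                Y.eval (proj₁ y) [ proj₂ y ] ≈ k ∘ X.eval (proj₁ x) [ proj₂ x ]
    eval-push (i , h) = ≈-trans (≈-sym []-∘) (≈-trans ([]-resp (proj₂ (proj₂ (Y.code (k ∘ ev Z X i)))) ≈-refl) (≈-sym ∘-[]))

  record PostcomposePullback {A} (s : A ⊠ Z ⇒ Y) : Set (o ⊔ ℓ) where
    field
      {obj}    : Obj
      base     : obj ⇒ A
      family   : obj ⊠ Z ⇒ X
      commute  : k ∘ family ≈ s [ base ]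
      lift     : ∀ {T} (a : T ⇒ A) (x : T ⊠ Z ⇒ X) → k ∘ x ≈ s [ a ] → T ⇒ obj
      project₁ : ∀ {T} (a : T ⇒ A) (x : T ⊠ Z ⇒ X) p → base ∘ lift a x p ≈ a
      project₂ : ∀ {T} (a : T ⇒ A) (x : T ⊠ Z ⇒ X) p → family [ lift a x p ] ≈ x
      unique   : ∀ {T} {h h′ : T ⇒ obj} → base ∘ h ≈ base ∘ h′ → family [ h ] ≈ family [ h′ ] → h ≈ h′

  private
    postcomposePullback′ : Proper (postcompose Z k) → ∀ {A} (s : A ⊠ Z ⇒ Y) → PostcomposePullback s
    postcomposePullback′ proper {A} s = record
      { base = P.base ; family = X.eval (proj₁ P.point) [ proj₂ P.point ]
      ; commute = ≈-trans (≈-sym (eval-push P.point)) (≈-trans (Y.respect P.commute) (at P.base))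
      ; lift = λ a x p → P.lift a (coded x) (agree a x p)
      ; project₁ = λ a x p → P.project₁ a (coded x) (agree a x p)
      ; project₂ = λ a x p → ≈-trans []-∘ (≈-trans (X.respect (P.project₂ a (coded x) (agree a x p))) (proj₂ (proj₂ (X.code x))))
      ; unique = λ p q → P.unique p (X.separate _ _ (≈-trans (≈-sym []-∘) (≈-trans q []-∘))) }
      where
      j = proj₁ (Y.code s)
      y = proj₁ (proj₂ (Y.code s))
      pullback : CompactPullback (postcompose Z k) (j , y)
      pullback = compactPullback (postcompose Z k) (j , y) proper
      module P = CompactPullback pullback using (base; commute; lift; point; project₁; project₂; unique)
      at : ∀ {T} (a : T ⇒ A) → Y.eval j [ y ∘ a ] ≈ s [ a ]
      at a = ≈-trans (≈-sym []-∘) ([]-resp (proj₂ (proj₂ (Y.code s))) ≈-refl)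
      coded : ∀ {T} → T ⊠ Z ⇒ X → El HX T
      coded x = proj₁ (X.code x) , proj₁ (proj₂ (X.code x))
      agree : ∀ {T} (a : T ⇒ A) (x : T ⊠ Z ⇒ X) → k ∘ x ≈ s [ a ] →
              SameEl HY (push (postcompose Z k) (coded x)) (El-restrict HY a (j , y))
      agree a x p = Y.separate _ _ (≈-trans (eval-push (coded x))
        (≈-trans (refl⟩∘⟨ proj₂ (proj₂ (X.code x))) (≈-trans p (≈-sym (at a)))))

  opaque
    postcomposePullback : Proper (postcompose Z k) → ∀ {A} (s : A ⊠ Z ⇒ Y) → PostcomposePullback s
    postcomposePullback = postcomposePullback′

module Sandwiches {C : Category o ℓ} (c : Cartesian C) where
  open Category C
  open Cartesian c
  open Families c

  -- q exhibits α(n) h(t) b(n) as the member w(q(t, n)) of the family w, for all n.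
  Sandwich : ∀ {N V S W T} → W ⊠ S ⇒ S → N ⊠ V ⇒ S → N ⊠ S ⇒ V → T ⊠ V ⇒ V → T ⊠ N ⇒ W → Set ℓ
  Sandwich w α b h q = w [ q ] ≈ α [ π₂ ] • h [ π₁ ] • b [ π₂ ]

  module _ {N V S W} {w : W ⊠ S ⇒ S} {α : N ⊠ V ⇒ S} {b : N ⊠ S ⇒ V} where

    opaque
      sandwich-[⁂] : ∀ {T A} (h : A ⊠ V ⇒ V) (s : T ⇒ A) →
                     (α [ π₂ ] • h [ π₁ ] • b [ π₂ ]) [ s ⁂ id ] ≈ α [ π₂ ] • h [ s ] [ π₁ ] • b [ π₂ ]
      sandwich-[⁂] h s = ≈-trans []-• (•-resp ([]-[] []-π₂) (≈-trans []-• (•-resp ([]-square project₁) ([]-[] []-π₂))))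

      sandwich-[] : ∀ {T A} {h : A ⊠ V ⇒ V} {q : A ⊠ N ⇒ W} (s : T ⇒ A) →
                    Sandwich w α b h q → Sandwich w α b (h [ s ]) (q [ s ])
      sandwich-[] {h = h} s p = ≈-trans (≈-sym []-∘) (≈-trans ([]-resp p ≈-refl) (sandwich-[⁂] h s))

      sandwich-resp : ∀ {T} {h h′ : T ⊠ V ⇒ V} {q q′ : T ⊠ N ⇒ W} → h ≈ h′ → q ≈ q′ →
                      Sandwich w α b h q → Sandwich w α b h′ q′
      sandwich-resp e e′ p = ≈-trans ([]-resp ≈-refl (≈-sym e′)) (≈-trans p
        (•-resp ≈-refl (•-resp ([]-resp e ≈-refl) ≈-refl)))

    module _ {A} (h : A ⊠ V ⇒ V) (q : A ⊠ N ⇒ W) where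

      sandwichEquation : Equation A
      sandwichEquation = equation (w [ q ] ∘ assocˡ) ((α [ π₂ ] • h [ π₁ ] • b [ π₂ ]) ∘ assocˡ)

      opaque
        solves→sandwich : ∀ {T} {s : T ⇒ A} → Solves s (sandwichEquation ∷ []) → Sandwich w α b (h [ s ]) (q [ s ])
        solves→sandwich {s = s} (p , _) = begin
          w [ q [ s ] ]                                                    ≈⟨ ≈-sym []-∘ ⟩
          w [ q ] [ s ⁂ id ]                                               ≈⟨ uncurry ⟩
          (w [ q ] ∘ assocˡ) [ s ] ∘ assocʳ                                ≈⟨ p ⟩∘⟨refl ⟩
          ((α [ π₂ ] • h [ π₁ ] • b [ π₂ ]) ∘ assocˡ) [ s ] ∘ assocʳ       ≈⟨ ≈-sym uncurry ⟩
          (α [ π₂ ] • h [ π₁ ] • b [ π₂ ]) [ s ⁂ id ]                      ≈⟨ sandwich-[⁂] h s ⟩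
          α [ π₂ ] • h [ s ] [ π₁ ] • b [ π₂ ]                             ∎
          where
          uncurry : ∀ {X} {v : (A ⊠ N) ⊠ S ⇒ X} → v [ s ⁂ id ] ≈ (v ∘ assocˡ) [ s ] ∘ assocʳ
          uncurry = ≈-sym (≈-trans (≈-trans assoc (refl⟩∘⟨ assocˡ-natural) ⟩∘⟨refl) (≈-trans assoc
            (refl⟩∘⟨ ≈-trans assoc (≈-trans (refl⟩∘⟨ assocˡ∘assocʳ) identityʳ))))

        sandwich→solves : ∀ {T} {s : T ⇒ A} → Sandwich w α b (h [ s ]) (q [ s ]) → Solves s (sandwichEquation ∷ [])
        sandwich→solves {s = s} p = ≈-trans curry (≈-trans
            (≈-trans []-∘ (≈-trans p (≈-sym (sandwich-[⁂] h s))) ⟩∘⟨refl) (≈-sym curry)) , tt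
          where
          curry : ∀ {X} {v : (A ⊠ N) ⊠ S ⇒ X} → (v ∘ assocˡ) [ s ] ≈ v [ s ⁂ id ] ∘ assocˡ
          curry = ≈-trans assoc (≈-trans (refl⟩∘⟨ assocˡ-natural) (≈-sym assoc))

  record Stabilizer {N V S W} (w : W ⊠ S ⇒ S) (α : N ⊠ V ⇒ S) (b : N ⊠ S ⇒ V) : Set (o ⊔ ℓ) where
    field
      {obj}       : Obj
      family      : IsoFam obj V V
    module γ = IsoFam family using (to)
    field
      witness     : obj ⊠ N ⇒ W
      sandwich    : Sandwich w α b γ.to witness
      faithful    : Faithful γ.to
      realize    : ∀ {T} (h : IsoFam T V V) (q : T ⊠ N ⇒ W) → Sandwich w α b (Isos.to (Fam T) h) q → T ⇒ obj
      realize-eq : ∀ {T} (h : IsoFam T V V) (q : T ⊠ N ⇒ W) (p : Sandwich w α b (Isos.to (Fam T) h) q) →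
                    γ.to [ realize h q p ] ≈ Isos.to (Fam T) h

module HatSandwich {C : Category o ℓ} {D : Category o′ ℓ′} (c : Cartesian C) (d : Cartesian D)
                   (Φ : Functor C D) (pres : PreservesFiniteProducts Φ) where
  private
    module C = Category C using (_⇒_; _∘_)
    module c = Cartesian c using (_⊠_; assocʳ; π₁; π₂)
    module FC = Families c using (_[_]; _[_]≅; assocˡ; assocˡ∘assocʳ; _•_)
    module SC = Sandwiches c using (Sandwich; sandwichEquation)
  open Category D
  open Cartesian d
  open Functor Φ
  open Families d
  open Hat c d Φ pres
  open Sandwiches d

  opaque
    φ-epi : ∀ {T A B Z} {x y : T ⊠ F₀ (A c.⊠ B) ⇒ Z} → x ∘ (id ⁂ φ) ≈ y ∘ (id ⁂ φ) → x ≈ y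
    φ-epi p = ≈-trans (expand _) (≈-trans (p ⟩∘⟨refl) (≈-sym (expand _)))
      where
      φ⁻ : ∀ {A B} → F₀ (A c.⊠ B) ⇒ F₀ A ⊠ F₀ B
      φ⁻ = ⟨ F₁ c.π₁ , F₁ c.π₂ ⟩
      split : ∀ {A B} → φ {A} {B} ∘ φ⁻ ≈ id
      split = φ-ext (≈-trans π₁-⟪⟫ (≈-sym identityʳ)) (≈-trans π₂-⟪⟫ (≈-sym identityʳ))
      expand : ∀ {T A B Z} (x : T ⊠ F₀ (A c.⊠ B) ⇒ Z) → x ≈ (x ∘ (id ⁂ φ)) ∘ (id ⁂ φ⁻)
      expand x = ≈-sym (≈-trans assoc (≈-trans (refl⟩∘⟨ ≈-trans ⁂∘⁂ (≈-trans (⁂-resp identityˡ split) id⁂id)) identityʳ))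

    φ-assocˡ : ∀ {A B E} → F₁ (FC.assocˡ {A} {B} {E}) ∘ φ ∘ (id ⁂ φ) ≈ φ ∘ (φ ⁂ id) ∘ assocˡ
    φ-assocˡ {A} {B} {E} = begin
      F₁ l ∘ φ ∘ (id ⁂ φ)                          ≈⟨ ≈-sym identityʳ ⟩
      (F₁ l ∘ φ ∘ (id ⁂ φ)) ∘ id                   ≈⟨ refl⟩∘⟨ ≈-sym assocʳ∘assocˡ ⟩
      (F₁ l ∘ φ ∘ (id ⁂ φ)) ∘ assocʳ ∘ assocˡ      ≈⟨ ≈-trans (≈-sym assoc) (≈-trans assoc (refl⟩∘⟨ assoc) ⟩∘⟨refl) ⟩
      (F₁ l ∘ φ ∘ (id ⁂ φ) ∘ assocʳ) ∘ assocˡ      ≈⟨ (refl⟩∘⟨ φ-assoc) ⟩∘⟨refl ⟩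
      (F₁ l ∘ F₁ r ∘ φ ∘ (φ ⁂ id)) ∘ assocˡ        ≈⟨ ≈-trans (≈-sym assoc) (≈-trans (≈-sym homomorphism)
                                                       (≈-trans (F-resp-≈ FC.assocˡ∘assocʳ) identity) ⟩∘⟨refl) ⟩∘⟨refl ⟩
      (id ∘ φ ∘ (φ ⁂ id)) ∘ assocˡ                 ≈⟨ ≈-trans (identityˡ ⟩∘⟨refl) assoc ⟩
      φ ∘ (φ ⁂ id) ∘ assocˡ                        ∎
      where
      l : A c.⊠ (B c.⊠ E) C.⇒ (A c.⊠ B) c.⊠ E
      l = FC.assocˡ
      r : (A c.⊠ B) c.⊠ E C.⇒ A c.⊠ (B c.⊠ E)
      r = c.assocʳ

    φ-assocˡ-at : ∀ {A B E T X} {v : (A c.⊠ B) c.⊠ E C.⇒ X} {s : T ⇒ F₀ A} →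
                  hat (v C.∘ FC.assocˡ) [ s ] ∘ (id ⁂ φ) ≈ hat v [ φ ∘ (s ⁂ id) ] ∘ assocˡ
    φ-assocˡ-at {A} {B} {E} {v = v} {s} = begin
      (hat (v C.∘ FC.assocˡ) ∘ (s ⁂ id)) ∘ (id ⁂ φ)      ≈⟨ (≈-sym hat-∘ ⟩∘⟨refl) ⟩∘⟨refl ⟩
      ((F₁ v ∘ F₁ FC.assocˡ ∘ φ) ∘ (s ⁂ id)) ∘ (id ⁂ φ)  ≈⟨ ≈-trans assoc (≈-trans assoc (refl⟩∘⟨ swap)) ⟩
      F₁ v ∘ (F₁ FC.assocˡ ∘ φ) ∘ (id ⁂ φ) ∘ (s ⁂ id)    ≈⟨ refl⟩∘⟨ ≈-trans (≈-sym assoc) (≈-trans assoc φ-assocˡ ⟩∘⟨refl) ⟩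
      F₁ v ∘ (φ ∘ (φ ⁂ id) ∘ assocˡ) ∘ (s ⁂ id)          ≈⟨ refl⟩∘⟨ ≈-trans assoc (refl⟩∘⟨ pulled) ⟩
      F₁ v ∘ φ ∘ ((φ ∘ (s ⁂ id)) ⁂ id) ∘ assocˡ          ≈⟨ ≈-trans (≈-sym assoc) (≈-sym assoc) ⟩
      hat v [ φ ∘ (s ⁂ id) ] ∘ assocˡ                    ∎
      where
      swap : (F₁ (FC.assocˡ {A} {B} {E}) ∘ φ) ∘ (s ⁂ id) ∘ (id ⁂ φ) ≈ (F₁ FC.assocˡ ∘ φ) ∘ (id ⁂ φ) ∘ (s ⁂ id)
      swap = refl⟩∘⟨ ≈-trans ⁂∘⁂ (≈-trans (⁂-resp (≈-trans identityʳ (≈-sym identityˡ)) (≈-trans identityˡ (≈-sym identityʳ))) (≈-sym ⁂∘⁂))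
      pulled : ((φ {A} {B} ⁂ id) ∘ assocˡ) ∘ (s ⁂ id) ≈ ((φ ∘ (s ⁂ id)) ⁂ id {F₀ E}) ∘ assocˡ
      pulled = ≈-trans assoc (≈-trans (refl⟩∘⟨ assocˡ-natural) (≈-trans (≈-sym assoc) (≈-trans ⁂∘⁂ (⁂-resp ≈-refl identityˡ) ⟩∘⟨refl)))

  module _ {N V S W} {w : W c.⊠ S C.⇒ S} {α : N c.⊠ V C.⇒ S} {b : N c.⊠ S C.⇒ V} where

    opaque
      hat-sandwich-expand : ∀ {A T} (h : A c.⊠ V C.⇒ V) (s : T ⇒ F₀ A) →
        hat (α FC.[ c.π₂ ] FC.• h FC.[ c.π₁ ] FC.• b FC.[ c.π₂ ]) [ φ ∘ (s ⁂ id) ] ≈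
        hat α [ π₂ ] • hat h [ s ] [ π₁ ] • hat b [ π₂ ]
      hat-sandwich-expand h s = ≈-trans ([]-resp (≈-trans hat-• (•-resp ≈-refl hat-•)) ≈-refl)
        (≈-trans []-• (•-resp (hat-at e₂) (≈-trans []-• (•-resp (≈-trans (hat-at e₁) (≈-sym []-∘)) (hat-at e₂)))))
        where
        e₁ : ∀ {A B T} {s : T ⇒ F₀ A} → F₁ c.π₁ ∘ (φ {A} {B} ∘ (s ⁂ id)) ≈ s ∘ π₁
        e₁ = ≈-trans (≈-sym assoc) (≈-trans (π₁-φ ⟩∘⟨refl) project₁)
        e₂ : ∀ {A B T} {s : T ⇒ F₀ A} → F₁ c.π₂ ∘ (φ {A} {B} ∘ (s ⁂ id)) ≈ π₂
        e₂ = ≈-trans (≈-sym assoc) (≈-trans (π₂-φ ⟩∘⟨refl) []-π₂)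

      hat-sandwich : ∀ {A} {h : A c.⊠ V C.⇒ V} {q : A c.⊠ N C.⇒ W} → SC.Sandwich w α b h q →
                     Sandwich (hat w) (hat α) (hat b) (hat h) (hat q)
      hat-sandwich {h = h} {q} p = begin
        hat w [ hat q ]                              ≈⟨ ≈-sym []-∘ ⟩
        hat w [ F₁ q ] [ φ ]                         ≈⟨ []-resp (≈-sym hat-[]) (≈-sym (≈-trans (refl⟩∘⟨ id⁂id) identityʳ)) ⟩
        hat (w FC.[ q ]) [ φ ∘ (id ⁂ id) ]           ≈⟨ []-resp (hat-resp p) ≈-refl ⟩
        hat (α FC.[ c.π₂ ] FC.• h FC.[ c.π₁ ] FC.• b FC.[ c.π₂ ]) [ φ ∘ (id ⁂ id) ]  ≈⟨ hat-sandwich-expand h id ⟩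
        hat α [ π₂ ] • hat h [ id ] [ π₁ ] • hat b [ π₂ ]  ≈⟨ •-resp ≈-refl (•-resp ([]-resp []-id ≈-refl) ≈-refl) ⟩
        hat α [ π₂ ] • hat h [ π₁ ] • hat b [ π₂ ]   ∎

      hat-sandwich→solves : ∀ {A T} {h : A c.⊠ V C.⇒ V} {q : A c.⊠ N C.⇒ W} {s : T ⇒ F₀ A} →
        Sandwich (hat w) (hat α) (hat b) (hat h [ s ]) (hat q [ s ]) →
        Solves s (hatSystem (SC.sandwichEquation {w = w} {α} {b} h q ∷ []))
      hat-sandwich→solves {A} {h = h} {q} {s} p =
        φ-epi (≈-trans φ-assocˡ-at (≈-trans (≈-trans left (≈-trans p (≈-sym (hat-sandwich-expand h s))) ⟩∘⟨refl) (≈-sym φ-assocˡ-at))) , tt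
        where
        left : hat (w FC.[ q ]) [ φ ∘ (s ⁂ id) ] ≈ hat w [ hat q [ s ] ]
        left = ≈-trans ([]-resp hat-[] ≈-refl) ([]-[] (≈-sym assoc))

module _ {C : Category o ℓ} (K : IndClosed C)
         (bi-strict : ∀ X Y → Σ[ B ∈ IndObj C ] (B IndRepresents BiPresheaf (IndClosed.cartesian K) X Y) × Strict B)
         (proper : ∀ {X Y : Category.Obj C} (k : Category._⇒_ C X Y) → Category.IsMono C k → ∀ Z →
                   Proper (IndClosed.postcompose K Z k)) where
  open Category C
  open IndClosed K
  open Families cartesian
  open Sandwiches cartesian

  module _ {N V S W : Obj} (w : IsoFam W S S) (α : IsoFam N V S) (b : IsoFam N S V)
           (w-faithful : Faithful (IsoFam.to w)) (n₀ : 𝟏 ⇒ N) where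
    private
      module w {T} (x : T ⇒ W) = IsoFam (w [ x ]≅)
      module α {T} (x : T ⇒ N) = IsoFam (α [ x ]≅)
      module b {T} (x : T ⇒ N) = IsoFam (b [ x ]≅)

      n̄ : ∀ {T} → T ⇒ N
      n̄ = n₀ ∘ !

      n̄-∘ : ∀ {S T} {x : S ⇒ T} → n̄ ∘ x ≈ n̄
      n̄-∘ = ≈-trans assoc (refl⟩∘⟨ ≈-sym (!-unique _))

      translate : IsoFam (W ⊠ N) S S
      translate = α [ π₂ ]≅ ⊙ flip (α [ n̄ ]≅) ⊙ w [ π₁ ]≅ ⊙ flip (b [ n̄ ]≅) ⊙ b [ π₂ ]≅
        where open Isos (Fam (W ⊠ N))

      opaque
        translate-at : ∀ {T} (a : T ⇒ W) (h : T ⊠ V ⇒ V) → w.to a ≈ α.to n̄ • h • b.to n̄ →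
                       IsoFam.to translate [ a ⁂ id ] ≈ α.to π₂ • h [ π₁ ] • b.to π₂
        translate-at {T} a h e = ≈-trans (≈-trans []-• (•-resp ([]-[] []-π₂) (≈-trans []-• (•-resp ([]-[] n̄-∘)
            (≈-trans []-• (•-resp ([]-square project₁) (≈-trans []-• (•-resp ([]-[] n̄-∘) ([]-[] []-π₂)))))))))
          (•-resp ≈-refl (≈-trans (•-resp ≈-refl (•-resp
              (≈-trans ([]-resp e ≈-refl) (≈-trans []-• (•-resp ([]-[] n̄-∘) (≈-trans []-• (•-resp ≈-refl ([]-[] n̄-∘))))))
              ≈-refl))
            (F.cancel-middle (F.from∘to (α [ n̄ ]≅)) (F.to∘from (b [ n̄ ]≅)))))
          where module F = Isos (Fam (T ⊠ N)) using (cancel-middle; from∘to; to∘from)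

      factored : FaithfulFactor cartesian translate
      factored = faithfulFactor cartesian (proj₁ (proj₂ (bi-strict S S))) (proj₂ (proj₂ (bi-strict S S))) translate
      module f = FaithfulFactor factored using (agree; arrow; faithful; family; obj)
      w′ : f.obj ⊠ S ⇒ S
      w′ = IsoFam.to f.family

      at-n̄ : ∀ {T} → T ⇒ T ⊠ N
      at-n̄ = ⟨ id , n̄ ⟩

      k : W ⇒ f.obj
      k = f.arrow ∘ at-n̄

      opaque
        w′-k : ∀ {T} (x : T ⇒ W) → w′ [ k ∘ x ] ≈ w.to x
        w′-k {T} x = begin
          w′ [ k ∘ x ]                                    ≈⟨ []-resp ≈-refl (≈-trans assoc (refl⟩∘⟨ ≈-trans ⟨⟩∘ (≈-trans (⟨⟩-resp identityˡ n̄-∘)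
                                                              (≈-sym (≈-trans ⁂∘⟨⟩ (⟨⟩-resp identityʳ identityˡ)))))) ⟩
          w′ [ f.arrow ∘ (x ⁂ id) ∘ at-n̄ ]                  ≈⟨ ≈-sym (≈-trans ([]-resp []-∘ ≈-refl) (≈-trans []-∘ ([]-resp ≈-refl assoc))) ⟩
          w′ [ f.arrow ] [ x ⁂ id ] [ at-n̄ ]                ≈⟨ []-resp ([]-resp f.agree ≈-refl) ≈-refl ⟩
          IsoFam.to translate [ x ⁂ id ] [ at-n̄ ]   ≈⟨ []-resp (translate-at x _ (≈-sym (F.conjugate (F.to∘from (α [ n̄ ]≅)) (F.from∘to (b [ n̄ ]≅))))) ≈-refl ⟩
          (α.to π₂ • (α.from n̄ • w.to x • b.from n̄) [ π₁ ] • b.to π₂) [ at-n̄ ]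
                                                          ≈⟨ ≈-trans []-• (•-resp ([]-[] project₂) (≈-trans []-• (•-resp (≈-trans ([]-[] project₁) []-id) ([]-[] project₂)))) ⟩
          α.to n̄ • (α.from n̄ • w.to x • b.from n̄) • b.to n̄ ≈⟨ F.conjugate (F.to∘from (α [ n̄ ]≅)) (F.from∘to (b [ n̄ ]≅)) ⟩
          w.to x                                          ∎
          where module F = Isos (Fam T) using (conjugate; from∘to; to∘from)

        k-mono : IsMono k
        k-mono x y e = w-faithful x y (≈-trans (≈-sym (w′-k x)) (≈-trans ([]-resp ≈-refl e) (w′-k y)))

      pullback : PostcomposePullback K k f.arrow
      pullback = postcomposePullback K k (proper k k-mono N) f.arrow
      module P = PostcomposePullback pullback using (base; commute; family; lift; obj; project₁; unique)

      family : IsoFam P.obj V V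
      family = flip (α [ n̄ ]≅) ⊙ w [ P.base ]≅ ⊙ flip (b [ n̄ ]≅)
        where open Isos (Fam P.obj)

      γ : P.obj ⊠ V ⇒ V
      γ = IsoFam.to family

      opaque
        w-base : w.to P.base ≈ α.to n̄ • γ • b.to n̄
        w-base = ≈-sym (F.conjugate (F.to∘from (α [ n̄ ]≅)) (F.from∘to (b [ n̄ ]≅)))
          where module F = Isos (Fam P.obj) using (conjugate; from∘to; to∘from)

        sandwich : Sandwich (IsoFam.to w) (IsoFam.to α) (IsoFam.to b) γ P.family
        sandwich = begin
          w.to P.family                             ≈⟨ ≈-sym (w′-k P.family) ⟩
          w′ [ k ∘ P.family ]                       ≈⟨ []-resp ≈-refl P.commute ⟩
          w′ [ f.arrow ∘ (P.base ⁂ id) ]              ≈⟨ ≈-trans (≈-sym []-∘) ([]-resp f.agree ≈-refl) ⟩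
          IsoFam.to translate [ P.base ⁂ id ] ≈⟨ translate-at P.base γ w-base ⟩
          α.to π₂ • γ [ π₁ ] • b.to π₂              ∎

        γ-base : ∀ {T} (x : T ⇒ P.obj) → w.to (P.base ∘ x) ≈ α.to n̄ • γ [ x ] • b.to n̄
        γ-base x = ≈-trans (≈-sym []-∘) (≈-trans ([]-resp w-base ≈-refl)
          (≈-trans []-• (•-resp ([]-[] n̄-∘) (≈-trans []-• (•-resp ≈-refl ([]-[] n̄-∘))))))

        faithful : Faithful γ
        faithful x y e = P.unique base-eq (k-mono _ _ (≈-trans (at x) (≈-trans ([]-resp ≈-refl base-eq) (≈-sym (at y)))))
          where
          base-eq : P.base ∘ x ≈ P.base ∘ y
          base-eq = w-faithful _ _ (≈-trans (γ-base x) (≈-trans (•-resp ≈-refl (•-resp e ≈-refl)) (≈-sym (γ-base y))))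
          at : ∀ {T} (x : T ⇒ P.obj) → k ∘ P.family [ x ] ≈ f.arrow [ P.base ∘ x ]
          at x = ≈-trans ∘-[] (≈-trans (P.commute ⟩∘⟨refl) []-∘)

      module _ {T} (h : IsoFam T V V) (q : T ⊠ N ⇒ W)
               (p : Sandwich (IsoFam.to w) (IsoFam.to α) (IsoFam.to b) (IsoFam.to h) q) where
        private
          module h = IsoFam h using (to)
          a : T ⇒ W
          a = q ∘ at-n̄

        opaque
          w-a : w.to a ≈ α.to n̄ • h.to • b.to n̄
          w-a = ≈-trans (≈-sym []-∘) (≈-trans ([]-resp p ≈-refl) (≈-trans []-• (•-resp ([]-[] project₂)
            (≈-trans []-• (•-resp (≈-trans ([]-[] project₁) []-id) ([]-[] project₂))))))

          square : k ∘ q ≈ f.arrow [ a ]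
          square = f.faithful _ _ (≈-trans (w′-k q) (≈-trans p (≈-sym (≈-trans (≈-sym []-∘)
            (≈-trans ([]-resp f.agree ≈-refl) (translate-at a h.to w-a))))))

        realize : T ⇒ P.obj
        realize = P.lift a q square

        opaque
          realize-eq : γ [ realize ] ≈ h.to
          realize-eq = begin
            γ [ realize ]                              ≈⟨ ≈-trans []-• (•-resp ([]-[] n̄-∘) (≈-trans []-• (•-resp []-∘ ([]-[] n̄-∘)))) ⟩
            α.from n̄ • w.to (P.base ∘ realize) • b.from n̄ ≈⟨ •-resp ≈-refl (•-resp (≈-trans ([]-resp ≈-refl (P.project₁ a q square)) w-a) ≈-refl) ⟩
            α.from n̄ • (α.to n̄ • h.to • b.to n̄) • b.from n̄ ≈⟨ ≈-trans (•-resp ≈-refl (≈-trans •-assoc (•-resp ≈-refl (cancelʳ (b.to∘from n̄)))))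
                                                           (cancelˡ (α.from∘to n̄)) ⟩
            h.to                                       ∎
            where open Isos (Fam T) using (cancelˡ; cancelʳ)

    opaque
      baseStabilizer : Stabilizer (IsoFam.to w) (IsoFam.to α) (IsoFam.to b)
      baseStabilizer = record
        { family = family ; witness = P.family ; sandwich = sandwich ; faithful = faithful
        ; realize = realize ; realize-eq = realize-eq }

module SubInd {C : Category o ℓ} (c : Cartesian C) (A : IndObj C) where
  open Category C
  open Families c
  private module A = IndObj A using (filtered; idᵢ; index; ob; tr; tr-id; tr-resp; tr-∘; _↝_; _∘ᵢ_)

  module Restrict (sys : ∀ k → System (A.ob k)) (L : ∀ k → Locus (sys k))
           (stable : ∀ {k l} (a : k A.↝ l) {T} (s : T ⇒ A.ob k) → Solves s (sys k) → Solves (A.tr a ∘ s) (sys l)) where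
    private
      module L k = Locus (L k)

      tr : ∀ {k l} → k A.↝ l → L.obj k ⇒ L.obj l
      tr {k} {l} a = L.lift l (A.tr a ∘ L.incl k) (stable a (L.incl k) (L.solves k))

    opaque
      incl-tr : ∀ {k l} (a : k A.↝ l) → L.incl l ∘ tr a ≈ A.tr a ∘ L.incl k
      incl-tr a = L.commute _ _ _

      private
        tr-resp : ∀ {k l} {a b : k A.↝ l} → Category._≈_ A.index a b → tr a ≈ tr b
        tr-resp e = L.mono _ (≈-trans (incl-tr _) (≈-trans (A.tr-resp e ⟩∘⟨refl) (≈-sym (incl-tr _))))

        tr-id : ∀ {k} → tr (A.idᵢ {k}) ≈ id
        tr-id = L.mono _ (≈-trans (incl-tr _) (≈-trans (A.tr-id ⟩∘⟨refl) (≈-trans identityˡ (≈-sym identityʳ))))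

        tr-∘ : ∀ {k l m} {a : k A.↝ l} {b : l A.↝ m} → tr (b A.∘ᵢ a) ≈ tr b ∘ tr a
        tr-∘ {a = a} {b} = L.mono _ (≈-trans (incl-tr _) (≈-trans (A.tr-∘ ⟩∘⟨refl) (≈-trans assoc
          (≈-trans (refl⟩∘⟨ ≈-sym (incl-tr a)) (≈-trans (≈-sym assoc) (≈-trans (≈-sym (incl-tr b) ⟩∘⟨refl) assoc))))))

    subInd : IndObj C
    subInd = record
      { index = A.index ; filtered = A.filtered
      ; diagram = record
        { F₀ = L.obj ; F₁ = tr ; F-resp-≈ = tr-resp ; identity = tr-id ; homomorphism = tr-∘ } }

    opaque
      subInd-separate : ∀ {T k l} {x : T ⇒ L.obj k} {y : T ⇒ L.obj l} →
                        SameEl A (k , L.incl k ∘ x) (l , L.incl l ∘ y) → SameEl subInd (k , x) (l , y)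
      subInd-separate (same a b p) = same a b (L.mono _ (≈-trans (shift a) (≈-trans p (≈-sym (shift b)))))
        where
        shift : ∀ {T k m} {x : T ⇒ L.obj k} (a : k A.↝ m) → L.incl m ∘ tr a ∘ x ≈ A.tr a ∘ L.incl k ∘ x
        shift a = ≈-trans (≈-sym assoc) (≈-trans (incl-tr a ⟩∘⟨refl) assoc)

      subInd-hat-separate : ∀ {D : Category o′ ℓ} (Φ : Functor C D) (let module Φ = Functor Φ) (let module D = Category D) →
        (∀ {X Y} {m : X ⇒ Y} → (∀ {T} {x y : T ⇒ X} → m ∘ x ≈ m ∘ y → x ≈ y) →
           ∀ {T} {x y : T D.⇒ Φ.F₀ X} → Φ.F₁ m D.∘ x D.≈ Φ.F₁ m D.∘ y → x D.≈ y) →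
        ∀ {T k l} {x : T D.⇒ Φ.F₀ (L.obj k)} {y : T D.⇒ Φ.F₀ (L.obj l)} →
        SameEl (Functor.F₀ (IndF Φ) A) (k , Φ.F₁ (L.incl k) D.∘ x) (l , Φ.F₁ (L.incl l) D.∘ y) →
        SameEl (Functor.F₀ (IndF Φ) subInd) (k , x) (l , y)
      subInd-hat-separate {D = D} Φ mono (same {m} a b p) =
        same a b (mono (L.mono m) (D.≈-trans (shift a) (D.≈-trans p (D.≈-sym (shift b)))))
        where
        module Φ = Functor Φ using (F-resp-≈; F₀; F₁; homomorphism)
        module D = Category D using (_⇒_; _∘_; _≈_; assoc; ≈-sym; ≈-trans; _⟩∘⟨refl)
        shift : ∀ {T k m} {x : T D.⇒ Φ.F₀ (L.obj k)} (a : k A.↝ m) →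
                Φ.F₁ (L.incl m) D.∘ Φ.F₁ (tr a) D.∘ x D.≈ Φ.F₁ (A.tr a) D.∘ Φ.F₁ (L.incl k) D.∘ x
        shift a = D.≈-trans (D.≈-sym D.assoc) (D.≈-trans (D.≈-trans (D.≈-sym Φ.homomorphism)
          (D.≈-trans (Φ.F-resp-≈ (incl-tr a)) Φ.homomorphism) D.⟩∘⟨refl) D.assoc)

module _ {C : Category o ℓ} (c : Cartesian C) {A B : IndObj C} where
  open Category C
  open Cartesian c
  private
    P = Cartesian._⊠_ (Ind-cartesian c) A B

  opaque
    product-separate : ∀ {T} {k l : IndObj.Index P} {x : T ⇒ IndObj.ob P k} {y : T ⇒ IndObj.ob P l} →
      SameEl A (proj₁ k , π₁ ∘ x) (proj₁ l , π₁ ∘ y) → SameEl B (proj₂ k , π₂ ∘ x) (proj₂ l , π₂ ∘ y) →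
      SameEl P (k , x) (l , y)
    product-separate (same a b p) (same a′ b′ p′) = same (a , a′) (b , b′)
      (⊠-ext (≈-trans (e₁ (IndObj.tr A a)) (≈-trans p (≈-sym (e₁ (IndObj.tr A b)))))
             (≈-trans (e₂ (IndObj.tr B a′)) (≈-trans p′ (≈-sym (e₂ (IndObj.tr B b′))))))
      where
      e₁ : ∀ {T X Y X′ Y′} (f : X ⇒ X′) {g : Y ⇒ Y′} {x : T ⇒ X ⊠ Y} → π₁ ∘ (f ⁂ g) ∘ x ≈ f ∘ π₁ ∘ x
      e₁ f = ≈-trans (≈-sym assoc) (≈-trans (project₁ ⟩∘⟨refl) assoc)
      e₂ : ∀ {T X Y X′ Y′} {f : X ⇒ X′} (g : Y ⇒ Y′) {x : T ⇒ X ⊠ Y} → π₂ ∘ (f ⁂ g) ∘ x ≈ g ∘ π₂ ∘ x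
      e₂ g = ≈-trans (≈-sym assoc) (≈-trans (project₂ ⟩∘⟨refl) assoc)

module _ {C : Category o ℓ} {D : Category o′ ℓ} (c : Cartesian C) (d : Cartesian D)
         (Φ : Functor C D) (pres : PreservesFiniteProducts Φ) {A B : IndObj C} where
  private
    module c = Cartesian c using (_⁂_; _⊠_; project₁; project₂; π₁; π₂)
    module C = Category C using (_⇒_)
    P = Cartesian._⊠_ (Ind-cartesian c) A B
    module A = IndObj A using (tr)
    module B = IndObj B using (tr)
  open Category D
  open Functor Φ
  open Hat c d Φ pres

  opaque
    product-hat-separate : ∀ {T} {k l : IndObj.Index P} {x : T ⇒ F₀ (IndObj.ob P k)} {y : T ⇒ F₀ (IndObj.ob P l)} →
      SameEl (Functor.F₀ (IndF Φ) A) (proj₁ k , F₁ c.π₁ ∘ x) (proj₁ l , F₁ c.π₁ ∘ y) →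
      SameEl (Functor.F₀ (IndF Φ) B) (proj₂ k , F₁ c.π₂ ∘ x) (proj₂ l , F₁ c.π₂ ∘ y) →
      SameEl (Functor.F₀ (IndF Φ) P) (k , x) (l , y)
    product-hat-separate (same a b p) (same a′ b′ p′) = same (a , a′) (b , b′)
      (φ-ext (≈-trans (e₁ (A.tr a)) (≈-trans p (≈-sym (e₁ (A.tr b))))) (≈-trans (e₂ (B.tr a′)) (≈-trans p′ (≈-sym (e₂ (B.tr b′))))))
      where
      e₁ : ∀ {T X Y X′ Y′} (f : X C.⇒ X′) {g : Y C.⇒ Y′} {x : T ⇒ F₀ (X c.⊠ Y)} → F₁ c.π₁ ∘ F₁ (f c.⁂ g) ∘ x ≈ F₁ f ∘ F₁ c.π₁ ∘ x
      e₁ f = ≈-trans (≈-sym assoc) (≈-trans (F-square c.project₁ ⟩∘⟨refl) assoc)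
      e₂ : ∀ {T X Y X′ Y′} {f : X C.⇒ X′} (g : Y C.⇒ Y′) {x : T ⇒ F₀ (X c.⊠ Y)} → F₁ c.π₂ ∘ F₁ (f c.⁂ g) ∘ x ≈ F₁ g ∘ F₁ c.π₂ ∘ x
      e₂ g = ≈-trans (≈-sym assoc) (≈-trans (F-square c.project₂ ⟩∘⟨refl) assoc)

module CoverFamilies {u} {C₀ C : Category u u} (K₀ : IndClosed C₀) (K : IndClosed C) (cover : InternalCover K₀ K) where
  private
    module C = Category C using (Obj; _⇒_; _∘_; _≈_)
    module K₀ = IndClosed K₀
    module K = IndClosed K using (cartesian)
    open InternalCover cover
    module I = Functor I using (F₀; F₁)
    module F = Functor F using (F-resp-≈; F₀; F₁; homomorphism)
    module Î = Hat K₀.cartesian K.cartesian I (IsClosed.products I-closed) using (hat; π₁-φ; π₂-φ; φ)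
    module F̂ = Hat K.cartesian K₀.cartesian F (IsClosed.products F-closed) using (hat; hat≅; π₁-φ; π₂-φ; φ)
    module N = NaturalIsomorphism F∘I≅id using (isIso; natural; η)
    module FC = Families K.cartesian
  open Category C₀
  open K₀ using (_⊠_; π₁; π₂; _⁂_; ⁂∘⁂; ⁂-resp; ⁂∘⟨⟩; ⟨⟩-resp; project₁; project₂)
  open Families K₀.cartesian
  open Sandwiches K₀.cartesian
  open Isos C₀

  η : ∀ X → F.F₀ (I.F₀ X) ≅ X
  η X = record { to = N.η X ; isIso = N.isIso X }

  η̄ : ∀ {T X} → IsoFam T (F.F₀ (I.F₀ X)) X
  η̄ {X = X} = map≅ constF (η X)

  opaque
    η-hat : ∀ {A X Y} (g : A ⊠ X ⇒ Y) → N.η Y ∘ F̂.hat (Î.hat g) ≈ g ∘ (N.η A ⁂ N.η X)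
    η-hat g = begin
      N.η _ ∘ F.F₁ (I.F₁ g C.∘ Î.φ) ∘ F̂.φ            ≈⟨ refl⟩∘⟨ ≈-trans (F.homomorphism ⟩∘⟨refl) assoc ⟩
      N.η _ ∘ F.F₁ (I.F₁ g) ∘ F.F₁ Î.φ ∘ F̂.φ         ≈⟨ ≈-trans (≈-sym assoc) (≈-trans (N.natural g ⟩∘⟨refl) assoc) ⟩
      g ∘ N.η _ ∘ F.F₁ Î.φ ∘ F̂.φ                     ≈⟨ refl⟩∘⟨ K₀.⊠-ext
                                                        (≈-trans (slide Î.π₁-φ) (≈-trans (refl⟩∘⟨ F̂.π₁-φ) (≈-sym project₁)))
                                                        (≈-trans (slide Î.π₂-φ) (≈-trans (refl⟩∘⟨ F̂.π₂-φ) (≈-sym project₂))) ⟩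
      g ∘ (N.η _ ⁂ N.η _)                            ∎
      where
      slide : ∀ {T A B} {k : A ⇒ B} {r : T C.⇒ I.F₀ A} {s : T C.⇒ I.F₀ B} {z} {x : z ⇒ F.F₀ T} → I.F₁ k C.∘ r C.≈ s →
              k ∘ N.η A ∘ F.F₁ r ∘ x ≈ N.η B ∘ F.F₁ s ∘ x
      slide e = ≈-trans (≈-sym assoc) (≈-trans (≈-sym (N.natural _) ⟩∘⟨refl) (≈-trans assoc (refl⟩∘⟨
        ≈-trans (≈-sym assoc) (≈-trans (≈-sym F.homomorphism) (F.F-resp-≈ e) ⟩∘⟨refl))))

    η-conjugate : ∀ {T A X} (g : A ⊠ X ⇒ X) (q : T ⇒ F.F₀ (I.F₀ A)) →
                  g [ N.η A ∘ q ] ≈ IsoFam.to η̄ • F̂.hat (Î.hat g) [ q ] • IsoFam.from η̄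
    η-conjugate {A = A} {X} g q = ≈-sym (begin
      const (N.η X) • F̂.hat (Î.hat g) [ q ] • const (from (η X))   ≈⟨ ≈-trans const-• ∘-• ⟩
      (N.η X ∘ F̂.hat (Î.hat g) [ q ]) • const (from (η X))         ≈⟨ (≈-trans ∘-[] (η-hat g ⟩∘⟨refl)) ⟩∘⟨refl ⟩
      ((g ∘ (N.η A ⁂ N.η X)) ∘ (q ⁂ id)) • const (from (η X))      ≈⟨ ≈-trans (≈-trans assoc (refl⟩∘⟨ ⁂∘⁂) ⟩∘⟨refl) assoc ⟩
      g ∘ ((N.η A ∘ q) ⁂ (N.η X ∘ id)) ∘ K₀.⟨ π₁ , from (η X) ∘ π₂ ⟩ ≈⟨ refl⟩∘⟨ ≈-trans ⁂∘⟨⟩ (⟨⟩-resp ≈-refl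
                                                                        (≈-trans (identityʳ ⟩∘⟨refl) (≈-trans (≈-sym assoc) (to∘from (η X) ⟩∘⟨refl)))) ⟩
      g [ N.η A ∘ q ]                                              ∎)

  module _ {N X : C.Obj} {Y W : Obj} (w : W ⊠ Y ⇒ Y)
           (α : FC.IsoFam N X (I.F₀ Y)) (b : FC.IsoFam N (I.F₀ Y) X) where

    α₀ : IsoFam (F.F₀ N) (F.F₀ X) Y
    α₀ = η̄ ⊙′ F̂.hat≅ α
      where open Isos (Fam (F.F₀ N)) renaming (_⊙_ to _⊙′_)

    b₀ : IsoFam (F.F₀ N) Y (F.F₀ X)
    b₀ = F̂.hat≅ b ⊙′ flip′ η̄
      where open Isos (Fam (F.F₀ N)) renaming (_⊙_ to _⊙′_; flip to flip′)

    private
      α̂ = F̂.hat (FC.IsoFam.to α)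
      b̂ = F̂.hat (FC.IsoFam.to b)
      ŵ = F̂.hat (Î.hat w)

      opaque
        expand : ∀ {T} (h : T ⊠ F.F₀ X ⇒ F.F₀ X) →
                 IsoFam.to α₀ [ π₂ ] • h [ π₁ ] • IsoFam.to b₀ [ π₂ {T} ] ≈
                 IsoFam.to η̄ • (α̂ [ π₂ ] • h [ π₁ ] • b̂ [ π₂ ]) • IsoFam.from η̄
        expand h = ≈-trans (•-resp (≈-trans []-• (•-resp []-const ≈-refl)) (•-resp ≈-refl (≈-trans []-• (•-resp ≈-refl []-const))))
          (≈-trans •-assoc (•-resp ≈-refl (≈-sym (≈-trans •-assoc (•-resp ≈-refl •-assoc)))))

    opaque
      descend : ∀ {T} {h : T ⊠ F.F₀ X ⇒ F.F₀ X} {q : T ⊠ F.F₀ N ⇒ F.F₀ (I.F₀ W)} →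
                Sandwich ŵ α̂ b̂ h q → Sandwich w (IsoFam.to α₀) (IsoFam.to b₀) h (N.η W ∘ q)
      descend p = ≈-trans (η-conjugate w _) (≈-trans (•-resp ≈-refl (•-resp p ≈-refl)) (≈-sym (expand _)))

      ascend : ∀ {T} {h : T ⊠ F.F₀ X ⇒ F.F₀ X} {q : T ⊠ F.F₀ N ⇒ W} →
               Sandwich w (IsoFam.to α₀) (IsoFam.to b₀) h q → Sandwich ŵ α̂ b̂ h (from (η W) ∘ q)
      ascend {T} {q = q} p = E.to-epi (E.flip η̄) (E.to-mono η̄ (begin
        IsoFam.to η̄ • ŵ [ from (η W) ∘ q ] • IsoFam.from η̄    ≈⟨ ≈-sym (η-conjugate w _) ⟩
        w [ N.η W ∘ from (η W) ∘ q ]                          ≈⟨ []-resp ≈-refl (cancelˡ (to∘from (η W))) ⟩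
        w [ q ]                                               ≈⟨ ≈-trans p (expand _) ⟩
        IsoFam.to η̄ • _ • IsoFam.from η̄                       ∎))
        where module E = Isos (Fam (T ⊠ F.F₀ N)) using (flip; to-epi; to-mono)

module Stabilizers {u} {C₀ C : Category u u} (K₀ : IndClosed C₀) (K : IndClosed C) (cover : InternalCover K₀ K)
  (semiStrict : ∀ X Y → SemiStrict (IndClosed.HomObj K X Y))
  (bi-strict : ∀ X Y → Σ[ B ∈ IndObj C₀ ] (B IndRepresents BiPresheaf (IndClosed.cartesian K₀) X Y) × Strict B)
  (reflectsCompact : ∀ (X : IndObj C) → Compact (Functor.F₀ (IndF (InternalCover.F cover)) X) → Compact X)
  (proper : ∀ {X Y : Category.Obj C₀} (k : Category._⇒_ C₀ X Y) → Category.IsMono C₀ k → ∀ Z →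
            Proper (IndClosed.postcompose K₀ Z k)) where
  private
    module C₀ = Category C₀ using (Obj; _⇒_; _∘_; _≈_; assoc; id; refl⟩∘⟨_; ≈-refl; ≈-sym; ≈-trans; _⟩∘⟨refl)
    module C = Category C using (Obj)
    module K₀ = IndClosed K₀ using (_⊠_; cartesian; π₂; 𝟏)
    module K = IndClosed K
    module F₀ = Families K₀.cartesian
    module S₀ = Sandwiches K₀.cartesian
  open InternalCover cover
  open CoverFamilies K₀ K cover
  private
    module I = Functor I using (F₀)
    module F = Functor F using (F-resp-≈; F₀; F₁; homomorphism)
    module Î = Hat K₀.cartesian K.cartesian I (IsClosed.products I-closed) using (hat)
    module F̂ = Hat K.cartesian K₀.cartesian F (IsClosed.products F-closed) using (hat; hat-[]; hat-at; hat-resp; hat-π₂; hat-•; hatSystem; π₁-⟪⟫; π₂-⟪⟫; ⟪_,_⟫)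
    module F̂S = HatSandwich K.cartesian K₀.cartesian F (IsClosed.products F-closed) using (hat-sandwich; hat-sandwich→solves)
  open Category C
  open K using (_⊠_; π₁; π₂; ⟨_,_⟩; project₁; project₂)
  open Families K.cartesian
  open Sandwiches K.cartesian

  private
    opaque
      unfold : ∀ {A B D T X Y} (f : A ⊠ X ⇒ Y) (s : B ⇒ A) (t : D ⇒ B) (x : T ⇒ D) → f [ s ∘ t ∘ x ] ≈ f [ s ] [ t ] [ x ]
      unfold f s t x = ≈-trans (≈-sym []-∘) (≈-sym []-∘)

      unfold₂ : ∀ {A B B′ D T X Y} (f : A ⊠ X ⇒ Y) (s : B ⇒ A) (s′ : B′ ⇒ B) (t : D ⇒ B′) (x : T ⇒ D) →
                f [ s ∘ s′ ∘ t ∘ x ] ≈ f [ s ∘ s′ ] [ t ] [ x ]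
      unfold₂ f s s′ t x = ≈-trans ([]-resp ≈-refl (≈-sym assoc)) (unfold f (s ∘ s′) t x)

      hat-unfold : ∀ {A B D T X Y} (f : A ⊠ X ⇒ Y) (s : B ⇒ A) (t : D ⇒ B) (x : T C₀.⇒ F.F₀ D) →
                   F̂.hat f F₀.[ F.F₁ s C₀.∘ F.F₁ t C₀.∘ x ] C₀.≈ F̂.hat (f [ s ] [ t ]) F₀.[ x ]
      hat-unfold f s t x = C₀.≈-sym (C₀.≈-trans (F̂.hat-at C₀.≈-refl) (F̂.hat-at C₀.≈-refl))

      hat-unfold₂ : ∀ {A B B′ D T X Y} (f : A ⊠ X ⇒ Y) (s : B ⇒ A) (s′ : B′ ⇒ B) (t : D ⇒ B′) (x : T C₀.⇒ F.F₀ D) →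
                    F̂.hat f F₀.[ F.F₁ s C₀.∘ F.F₁ s′ C₀.∘ F.F₁ t C₀.∘ x ] C₀.≈ F̂.hat (f [ s ∘ s′ ] [ t ]) F₀.[ x ]
      hat-unfold₂ f s s′ t x = C₀.≈-sym (C₀.≈-trans (F̂.hat-at C₀.≈-refl) (F̂.hat-at (C₀.≈-trans (F.homomorphism C₀.⟩∘⟨refl) C₀.assoc)))

  module _ {N X : C.Obj} {Y W : C₀.Obj} (w : F₀.IsoFam W Y Y) (w-faithful : F₀.Faithful (F₀.IsoFam.to w))
           (α : IsoFam N X (I.F₀ Y)) (b : IsoFam N (I.F₀ Y) X) (n₀ : K₀.𝟏 C₀.⇒ F.F₀ N) where
    private
      ŵ : I.F₀ W ⊠ I.F₀ Y ⇒ I.F₀ Y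
      ŵ = Î.hat (F₀.IsoFam.to w)

      ŵ-faithful : Faithful ŵ
      ŵ-faithful = hat-faithful K₀ K I I-closed w-faithful

      α′ = IsoFam.to α
      b′ = IsoFam.to b

      record Good {T} (h h′ : T ⊠ X ⇒ X) (q : T ⊠ N ⇒ I.F₀ W) : Set u where
        constructor mk
        field
          inverseˡ : h′ • h ≈ π₂
          inverseʳ : h • h′ ≈ π₂
          exhibits : Sandwich ŵ α′ b′ h q

      record Good₀ {T} (h h′ : T K₀.⊠ F.F₀ X C₀.⇒ F.F₀ X) (q : T K₀.⊠ F.F₀ N C₀.⇒ F.F₀ (I.F₀ W)) : Set u where
        constructor mk₀
        field
          inverseˡ : h′ F₀.• h C₀.≈ K₀.π₂
          inverseʳ : h F₀.• h′ C₀.≈ K₀.π₂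
          exhibits : S₀.Sandwich (F̂.hat ŵ) (F̂.hat α′) (F̂.hat b′) h q

      opaque
        good-resp : ∀ {T} {h h₁ h′ h′₁ : T ⊠ X ⇒ X} {q q₁ : T ⊠ N ⇒ I.F₀ W} →
                    h ≈ h₁ → h′ ≈ h′₁ → q ≈ q₁ → Good h h′ q → Good h₁ h′₁ q₁
        good-resp e e′ e″ (mk p p′ p″) =
          mk (≈-trans (•-resp (≈-sym e′) (≈-sym e)) p) (≈-trans (•-resp (≈-sym e) (≈-sym e′)) p′) (sandwich-resp e e″ p″)

        good₀-resp : ∀ {T} {h h₁ h′ h′₁ : T K₀.⊠ F.F₀ X C₀.⇒ F.F₀ X} {q q₁ : T K₀.⊠ F.F₀ N C₀.⇒ F.F₀ (I.F₀ W)} →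
                     h C₀.≈ h₁ → h′ C₀.≈ h′₁ → q C₀.≈ q₁ → Good₀ h h′ q → Good₀ h₁ h′₁ q₁
        good₀-resp e e′ e″ (mk₀ p p′ p″) =
          mk₀ (C₀.≈-trans (F₀.•-resp (C₀.≈-sym e′) (C₀.≈-sym e)) p) (C₀.≈-trans (F₀.•-resp (C₀.≈-sym e) (C₀.≈-sym e′)) p′) (S₀.sandwich-resp e e″ p″)

        good-[] : ∀ {A T} {h h′ : A ⊠ X ⇒ X} {q : A ⊠ N ⇒ I.F₀ W} (s : T ⇒ A) → Good h h′ q → Good (h [ s ]) (h′ [ s ]) (q [ s ])
        good-[] s (mk p p′ p″) =
          mk (≈-trans (≈-sym []-•) (≈-trans ([]-resp p ≈-refl) []-π₂)) (≈-trans (≈-sym []-•) (≈-trans ([]-resp p′ ≈-refl) []-π₂)) (sandwich-[] s p″)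

        good₀-[] : ∀ {A T} {h h′ : A K₀.⊠ F.F₀ X C₀.⇒ F.F₀ X} {q : A K₀.⊠ F.F₀ N C₀.⇒ F.F₀ (I.F₀ W)} (s : T C₀.⇒ A) →
                   Good₀ h h′ q → Good₀ (h F₀.[ s ]) (h′ F₀.[ s ]) (q F₀.[ s ])
        good₀-[] s (mk₀ p p′ p″) =
          mk₀ (C₀.≈-trans (C₀.≈-sym F₀.[]-•) (C₀.≈-trans (F₀.[]-resp p C₀.≈-refl) F₀.[]-π₂))
              (C₀.≈-trans (C₀.≈-sym F₀.[]-•) (C₀.≈-trans (F₀.[]-resp p′ C₀.≈-refl) F₀.[]-π₂)) (S₀.sandwich-[] s p″)

        good-hat : ∀ {A} {h h′ : A ⊠ X ⇒ X} {q : A ⊠ N ⇒ I.F₀ W} → Good h h′ q → Good₀ (F̂.hat h) (F̂.hat h′) (F̂.hat q)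
        good-hat (mk p p′ p″) =
          mk₀ (C₀.≈-trans (C₀.≈-sym F̂.hat-•) (C₀.≈-trans (F̂.hat-resp p) F̂.hat-π₂))
              (C₀.≈-trans (C₀.≈-sym F̂.hat-•) (C₀.≈-trans (F̂.hat-resp p′) F̂.hat-π₂)) (F̂S.hat-sandwich p″)

        good-determined : ∀ {T} {h h₁ h′ h′₁ : T ⊠ X ⇒ X} {q q₁ : T ⊠ N ⇒ I.F₀ W} →
                          Good h h′ q → Good h₁ h′₁ q₁ → h ≈ h₁ → h′ ≈ h′₁ × q ≈ q₁
        good-determined {T} (mk p _ s) (mk _ p₁ s₁) e = Isos.inverse-unique (Fam T) e p p₁ ,
          ŵ-faithful _ _ (≈-trans s (≈-trans (•-resp ≈-refl (•-resp ([]-resp e ≈-refl) ≈-refl)) (≈-sym s₁)))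

        good₀-determined : ∀ {T} {h h₁ h′ h′₁ : T K₀.⊠ F.F₀ X C₀.⇒ F.F₀ X} {q q₁ : T K₀.⊠ F.F₀ N C₀.⇒ F.F₀ (I.F₀ W)} →
                           Good₀ h h′ q → Good₀ h₁ h′₁ q₁ → h C₀.≈ h₁ → h′ C₀.≈ h′₁ × q C₀.≈ q₁
        good₀-determined {T} (mk₀ p _ s) (mk₀ _ p₁ s₁) e = Isos.inverse-unique (F₀.Fam T) e p p₁ ,
          hat-faithful K K₀ F F-closed ŵ-faithful _ _ (C₀.≈-trans s (C₀.≈-trans
            (F₀.•-resp C₀.≈-refl (F₀.•-resp (F₀.[]-resp e C₀.≈-refl) C₀.≈-refl)) (C₀.≈-sym s₁)))

      H L HL A : IndObj C
      H = K.HomObj X X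
      L = K.HomObj N (I.F₀ W)
      HL = Cartesian._⊠_ (Ind-cartesian K.cartesian) H L
      A = Cartesian._⊠_ (Ind-cartesian K.cartesian) H HL
      module A = IndObj A using (Index; ob; tr; _↝_)
      module evH = IsHom (HomObj-isHom K X X) using (code; eval; eval-tr; separate)
      module evL = IsHom (HomObj-isHom K N (I.F₀ W)) using (code; eval; eval-tr; separate)
      module evFH = IsHom (hat-isHom K K₀ F F-closed X X) using (code; eval; separate)
      module evFL = IsHom (hat-isHom K K₀ F F-closed N (I.F₀ W)) using (code; eval; separate)

      opaque
        g g′ : ∀ k → A.ob k ⊠ X ⇒ X
        g k = evH.eval (proj₁ k) [ π₁ ]
        g′ k = evH.eval (proj₁ (proj₂ k)) [ π₁ ∘ π₂ ]

        r : ∀ k → A.ob k ⊠ N ⇒ I.F₀ W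
        r k = evL.eval (proj₂ (proj₂ k)) [ π₂ ∘ π₂ ]

        g-tr : ∀ {k l} (a : k A.↝ l) → g l [ A.tr a ] ≈ g k
        g-tr (a , _) = ≈-trans ([]-square project₁) ([]-resp (evH.eval-tr a) ≈-refl)

        g′-tr : ∀ {k l} (a : k A.↝ l) → g′ l [ A.tr a ] ≈ g′ k
        g′-tr (_ , a , _) = ≈-trans ([]-square (≈-trans assoc (≈-trans (refl⟩∘⟨ project₂)
          (≈-trans (≈-sym assoc) (≈-trans (project₁ ⟩∘⟨refl) assoc))))) ([]-resp (evH.eval-tr a) ≈-refl)

        r-tr : ∀ {k l} (a : k A.↝ l) → r l [ A.tr a ] ≈ r k
        r-tr (_ , _ , a) = ≈-trans ([]-square (≈-trans assoc (≈-trans (refl⟩∘⟨ project₂)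
          (≈-trans (≈-sym assoc) (≈-trans (project₂ ⟩∘⟨refl) assoc))))) ([]-resp (evL.eval-tr a) ≈-refl)

        sys : ∀ k → System (A.ob k)
        sys k = equation (g′ k • g k) π₂ ∷ equation (g k • g′ k) π₂ ∷
                sandwichEquation {w = ŵ} {α′} {b′} (g k) (r k) ∷ []

        solves→good : ∀ {k T} {s : T ⇒ A.ob k} → Solves s (sys k) → Good (g k [ s ]) (g′ k [ s ]) (r k [ s ])
        solves→good {k} (p , p′ , p″) = mk (≈-trans (≈-sym []-•) (≈-trans p []-π₂)) (≈-trans (≈-sym []-•) (≈-trans p′ []-π₂))
          (solves→sandwich (g k) (r k) p″)

        good→solves : ∀ {k T} {s : T ⇒ A.ob k} → Good (g k [ s ]) (g′ k [ s ]) (r k [ s ]) → Solves s (sys k)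
        good→solves {k} (mk p p′ p″) = ≈-trans []-• (≈-trans p (≈-sym []-π₂)) , ≈-trans []-• (≈-trans p′ (≈-sym []-π₂)) ,
          sandwich→solves (g k) (r k) p″

        good₀→solves : ∀ {k T} {s : T C₀.⇒ F.F₀ (A.ob k)} →
                       Good₀ (F̂.hat (g k) F₀.[ s ]) (F̂.hat (g′ k) F₀.[ s ]) (F̂.hat (r k) F₀.[ s ]) →
                       F₀.Solves s (F̂.hatSystem (sys k))
        good₀→solves {k} {s = s} (mk₀ p p′ p″) =
          C₀.≈-trans (F₀.[]-resp F̂.hat-• C₀.≈-refl) (C₀.≈-trans F₀.[]-• (C₀.≈-trans p (C₀.≈-sym π₂-s))) ,
          C₀.≈-trans (F₀.[]-resp F̂.hat-• C₀.≈-refl) (C₀.≈-trans F₀.[]-• (C₀.≈-trans p′ (C₀.≈-sym π₂-s))) ,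
          F̂S.hat-sandwich→solves p″
          where
          π₂-s : ∀ {Z} → F̂.hat (π₂ {A.ob k} {Z}) F₀.[ s ] C₀.≈ K₀.π₂
          π₂-s = C₀.≈-trans (F₀.[]-resp F̂.hat-π₂ C₀.≈-refl) F₀.[]-π₂

        stable : ∀ {k l} (a : k A.↝ l) {T} (s : T ⇒ A.ob k) → Solves s (sys k) → Solves (A.tr a ∘ s) (sys l)
        stable {k} {l} a s p = good→solves {l} (good-resp (shift (g-tr {k} {l} a)) (shift (g′-tr {k} {l} a)) (shift (r-tr {k} {l} a)) (solves→good {k} {s = s} p))
          where
          shift : ∀ {A B T X Y} {f : B ⊠ X ⇒ Y} {f′ : A ⊠ X ⇒ Y} {t : A ⇒ B} {s : T ⇒ A} → f [ t ] ≈ f′ → f′ [ s ] ≈ f [ t ∘ s ]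
          shift e = ≈-trans ([]-resp (≈-sym e) ≈-refl) []-∘

      L′ : ∀ k → Locus (sys k)
      L′ k = loci K semiStrict (sys k)
      module E k = Locus (L′ k)

      module R = SubInd.Restrict K.cartesian A sys L′ stable using (incl-tr; subInd; subInd-hat-separate; subInd-separate)

      𝒦 : IndObj C
      𝒦 = R.subInd
      F𝒦 : IndObj C₀
      F𝒦 = Functor.F₀ (IndF F) 𝒦
      module 𝒦 = IndObj 𝒦 using (Index; tr; _↝_)

      opaque
        unfolding g g′ r sys

        h h′ : ∀ k → E.obj k ⊠ X ⇒ X
        h k = g k [ E.incl k ]
        h′ k = g′ k [ E.incl k ]
        q : ∀ k → E.obj k ⊠ N ⇒ I.F₀ W
        q k = r k [ E.incl k ]

        good : ∀ k → Good (h k) (h′ k) (q k)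
        good k = solves→good {k} {s = E.incl k} (E.solves k)

        E-tr : ∀ {k l} (a : k 𝒦.↝ l) → E.incl l ∘ 𝒦.tr {k} {l} a ≈ A.tr {k} {l} a ∘ E.incl k
        E-tr {k} {l} a = R.incl-tr {k} {l} a

        h-tr : ∀ {k l} (a : k 𝒦.↝ l) → h l [ 𝒦.tr {k} {l} a ] ≈ h k
        h-tr {k} {l} a = ≈-trans ([]-square {g = g l} {E.incl l} {𝒦.tr {k} {l} a} {A.tr {k} {l} a} {E.incl k} (E-tr {k} {l} a))
          ([]-resp {g = g l [ A.tr {k} {l} a ]} {g k} {E.incl k} (g-tr {k} {l} a) ≈-refl)

        h-respect : ∀ {T k l} {x : T ⇒ E.obj k} {y : T ⇒ E.obj l} → SameEl 𝒦 (k , x) (l , y) → h k [ x ] ≈ h l [ y ]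
        h-respect {k = k} {l} {x} {y} (same {m} a b p) = ≈-trans ([]-resp {g = h k} (≈-sym (h-tr {k} {m} a)) ≈-refl)
          (≈-trans ([]-square {g = h m} {𝒦.tr {k} {m} a} {x} {𝒦.tr {l} {m} b} {y} p) ([]-resp {g′ = h l} (h-tr {l} {m} b) ≈-refl))

        h-at : ∀ k {T} (x : T ⇒ E.obj k) → evH.eval (proj₁ k) [ π₁ ∘ E.incl k ∘ x ] ≈ h k [ x ]
        h-at k x = unfold (evH.eval (proj₁ k)) π₁ (E.incl k) x

        h′-at : ∀ k {T} (x : T ⇒ E.obj k) → evH.eval (proj₁ (proj₂ k)) [ π₁ ∘ π₂ ∘ E.incl k ∘ x ] ≈ h′ k [ x ]
        h′-at k x = unfold₂ (evH.eval (proj₁ (proj₂ k))) π₁ π₂ (E.incl k) x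

        q-at : ∀ k {T} (x : T ⇒ E.obj k) → evL.eval (proj₂ (proj₂ k)) [ π₂ ∘ π₂ ∘ E.incl k ∘ x ] ≈ q k [ x ]
        q-at k x = unfold₂ (evL.eval (proj₂ (proj₂ k))) π₂ π₂ (E.incl k) x

        hat-h-at : ∀ k {T} (x : T C₀.⇒ F.F₀ (E.obj k)) →
                   evFH.eval (proj₁ k) F₀.[ F.F₁ π₁ C₀.∘ F.F₁ (E.incl k) C₀.∘ x ] C₀.≈ F̂.hat (h k) F₀.[ x ]
        hat-h-at k x = hat-unfold (evH.eval (proj₁ k)) π₁ (E.incl k) x

        hat-h′-at : ∀ k {T} (x : T C₀.⇒ F.F₀ (E.obj k)) →
                    evFH.eval (proj₁ (proj₂ k)) F₀.[ F.F₁ π₁ C₀.∘ F.F₁ π₂ C₀.∘ F.F₁ (E.incl k) C₀.∘ x ] C₀.≈ F̂.hat (h′ k) F₀.[ x ]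
        hat-h′-at k x = hat-unfold₂ (evH.eval (proj₁ (proj₂ k))) π₁ π₂ (E.incl k) x

        hat-q-at : ∀ k {T} (x : T C₀.⇒ F.F₀ (E.obj k)) →
                   evFL.eval (proj₂ (proj₂ k)) F₀.[ F.F₁ π₂ C₀.∘ F.F₁ π₂ C₀.∘ F.F₁ (E.incl k) C₀.∘ x ] C₀.≈ F̂.hat (q k) F₀.[ x ]
        hat-q-at k x = hat-unfold₂ (evL.eval (proj₂ (proj₂ k))) π₂ π₂ (E.incl k) x

        separate : ∀ {T k l} {x : T ⇒ E.obj k} {y : T ⇒ E.obj l} → h k [ x ] ≈ h l [ y ] → SameEl 𝒦 (k , x) (l , y)
        separate {T} {k} {l} {x} {y} e = R.subInd-separate {k = k} {l} {x} {y} all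
          where
          det : h′ k [ x ] ≈ h′ l [ y ] × q k [ x ] ≈ q l [ y ]
          det = good-determined (good-[] x (good k)) (good-[] y (good l)) e
          in₁ : SameEl H (proj₁ k , π₁ ∘ E.incl k ∘ x) (proj₁ l , π₁ ∘ E.incl l ∘ y)
          in₁ = evH.separate _ _ (≈-trans (h-at k x) (≈-trans e (≈-sym (h-at l y))))
          in₂ : SameEl H (proj₁ (proj₂ k) , π₁ ∘ π₂ ∘ E.incl k ∘ x) (proj₁ (proj₂ l) , π₁ ∘ π₂ ∘ E.incl l ∘ y)
          in₂ = evH.separate _ _ (≈-trans (h′-at k x) (≈-trans (proj₁ det) (≈-sym (h′-at l y))))
          in₃ : SameEl L (proj₂ (proj₂ k) , π₂ ∘ π₂ ∘ E.incl k ∘ x) (proj₂ (proj₂ l) , π₂ ∘ π₂ ∘ E.incl l ∘ y)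
          in₃ = evL.separate _ _ (≈-trans (q-at k x) (≈-trans (proj₂ det) (≈-sym (q-at l y))))
          rest : SameEl HL (proj₂ k , π₂ ∘ E.incl k ∘ x) (proj₂ l , π₂ ∘ E.incl l ∘ y)
          rest = product-separate K.cartesian {H} {L} {k = proj₂ k} {proj₂ l} {π₂ ∘ E.incl k ∘ x} {π₂ ∘ E.incl l ∘ y} in₂ in₃
          all : SameEl A (k , E.incl k ∘ x) (l , E.incl l ∘ y)
          all = product-separate K.cartesian {H} {HL} {k = k} {l} {E.incl k ∘ x} {E.incl l ∘ y} in₁ rest

        separate₀ : ∀ {T k l} {x : T C₀.⇒ F.F₀ (E.obj k)} {y : T C₀.⇒ F.F₀ (E.obj l)} →
                    F̂.hat (h k) F₀.[ x ] C₀.≈ F̂.hat (h l) F₀.[ y ] → SameEl F𝒦 (k , x) (l , y)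
        separate₀ {T} {k} {l} {x} {y} e = R.subInd-hat-separate F (preserves-mono K K₀ F F-closed) {k = k} {l} {x} {y} all
          where
          det : F̂.hat (h′ k) F₀.[ x ] C₀.≈ F̂.hat (h′ l) F₀.[ y ] × F̂.hat (q k) F₀.[ x ] C₀.≈ F̂.hat (q l) F₀.[ y ]
          det = good₀-determined (good₀-[] x (good-hat (good k))) (good₀-[] y (good-hat (good l))) e
          in₁ : SameEl (Functor.F₀ (IndF F) H) (proj₁ k , F.F₁ π₁ C₀.∘ F.F₁ (E.incl k) C₀.∘ x) (proj₁ l , F.F₁ π₁ C₀.∘ F.F₁ (E.incl l) C₀.∘ y)
          in₁ = evFH.separate _ _ (C₀.≈-trans (hat-h-at k x) (C₀.≈-trans e (C₀.≈-sym (hat-h-at l y))))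
          in₂ : SameEl (Functor.F₀ (IndF F) H) (proj₁ (proj₂ k) , F.F₁ π₁ C₀.∘ F.F₁ π₂ C₀.∘ F.F₁ (E.incl k) C₀.∘ x)
                                               (proj₁ (proj₂ l) , F.F₁ π₁ C₀.∘ F.F₁ π₂ C₀.∘ F.F₁ (E.incl l) C₀.∘ y)
          in₂ = evFH.separate _ _ (C₀.≈-trans (hat-h′-at k x) (C₀.≈-trans (proj₁ det) (C₀.≈-sym (hat-h′-at l y))))
          in₃ : SameEl (Functor.F₀ (IndF F) L) (proj₂ (proj₂ k) , F.F₁ π₂ C₀.∘ F.F₁ π₂ C₀.∘ F.F₁ (E.incl k) C₀.∘ x)
                                               (proj₂ (proj₂ l) , F.F₁ π₂ C₀.∘ F.F₁ π₂ C₀.∘ F.F₁ (E.incl l) C₀.∘ y)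
          in₃ = evFL.separate _ _ (C₀.≈-trans (hat-q-at k x) (C₀.≈-trans (proj₂ det) (C₀.≈-sym (hat-q-at l y))))
          rest : SameEl (Functor.F₀ (IndF F) HL) (proj₂ k , F.F₁ π₂ C₀.∘ F.F₁ (E.incl k) C₀.∘ x)
                                                 (proj₂ l , F.F₁ π₂ C₀.∘ F.F₁ (E.incl l) C₀.∘ y)
          rest = product-hat-separate K.cartesian K₀.cartesian F (IsClosed.products F-closed) {H} {L} {k = proj₂ k} {proj₂ l}
                   {F.F₁ π₂ C₀.∘ F.F₁ (E.incl k) C₀.∘ x} {F.F₁ π₂ C₀.∘ F.F₁ (E.incl l) C₀.∘ y} in₂ in₃
          all : SameEl (Functor.F₀ (IndF F) A) (k , F.F₁ (E.incl k) C₀.∘ x) (l , F.F₁ (E.incl l) C₀.∘ y)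
          all = product-hat-separate K.cartesian K₀.cartesian F (IsClosed.products F-closed) {H} {HL} {k = k} {l}
                  {F.F₁ (E.incl k) C₀.∘ x} {F.F₁ (E.incl l) C₀.∘ y} in₁ rest

      base : S₀.Stabilizer (F₀.IsoFam.to w) (F₀.IsoFam.to (α₀ (F₀.IsoFam.to w) α b)) (F₀.IsoFam.to (b₀ (F₀.IsoFam.to w) α b))
      base = baseStabilizer K₀ bi-strict proper w (α₀ (F₀.IsoFam.to w) α b) (b₀ (F₀.IsoFam.to w) α b) w-faithful n₀
      module M = S₀.Stabilizer base using (faithful; family; obj; realize; realize-eq; sandwich; witness)
      γ₀ : M.obj K₀.⊠ F.F₀ X C₀.⇒ F.F₀ X
      γ₀ = F₀.IsoFam.to M.family

      q₀ : M.obj K₀.⊠ F.F₀ N C₀.⇒ F.F₀ (I.F₀ W)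
      q₀ = Isos.from C₀ (η W) C₀.∘ M.witness

      good-base : Good₀ γ₀ (F₀.IsoFam.from M.family) q₀
      good-base = mk₀ (F₀.IsoFam.from∘to M.family) (F₀.IsoFam.to∘from M.family) (ascend (F₀.IsoFam.to w) α b M.sandwich)

      opaque
        unfolding g g′ r sys h h′ q

        encode₀ : ∀ {T} {k k′ : T K₀.⊠ F.F₀ X C₀.⇒ F.F₀ X} {p : T K₀.⊠ F.F₀ N C₀.⇒ F.F₀ (I.F₀ W)} → Good₀ k k′ p →
                  Σ[ i ∈ A.Index ] Σ[ x ∈ T C₀.⇒ F.F₀ (E.obj i) ] F̂.hat (h i) F₀.[ x ] C₀.≈ k
        encode₀ {T} {k} {k′} {p} G = stage , proj₁ lifted , h-x
          where
          stage : A.Index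
          stage = proj₁ (evFH.code k) , proj₁ (evFH.code k′) , proj₁ (evFL.code p)
          c₁ : T C₀.⇒ F.F₀ (IndObj.ob H (proj₁ stage))
          c₁ = proj₁ (proj₂ (evFH.code k))
          c₂ : T C₀.⇒ F.F₀ (IndObj.ob H (proj₁ (proj₂ stage)))
          c₂ = proj₁ (proj₂ (evFH.code k′))
          c₃ : T C₀.⇒ F.F₀ (IndObj.ob L (proj₂ (proj₂ stage)))
          c₃ = proj₁ (proj₂ (evFL.code p))
          s : T C₀.⇒ F.F₀ (A.ob stage)
          s = F̂.⟪ c₁ , F̂.⟪ c₂ , c₃ ⟫ ⟫
          second : ∀ {B} {t : A.ob (stage) ⇒ B} {t′ : IndObj.ob HL (proj₂ stage) ⇒ B} → t ≈ t′ ∘ π₂ → F.F₁ t C₀.∘ s C₀.≈ F.F₁ t′ C₀.∘ F̂.⟪ c₂ , c₃ ⟫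
          second e = C₀.≈-trans (C₀.≈-trans (F.F-resp-≈ e) F.homomorphism C₀.⟩∘⟨refl) (C₀.≈-trans C₀.assoc (C₀.refl⟩∘⟨ F̂.π₂-⟪⟫))
          g-s : F̂.hat (g stage) F₀.[ s ] C₀.≈ k
          g-s = C₀.≈-trans (F̂.hat-at {g = evH.eval (proj₁ stage)} {π₁} {s} {c₁} F̂.π₁-⟪⟫) (proj₂ (proj₂ (evFH.code k)))
          g′-s : F̂.hat (g′ stage) F₀.[ s ] C₀.≈ k′
          g′-s = C₀.≈-trans (F̂.hat-at {g = evH.eval (proj₁ (proj₂ stage))} {π₁ ∘ π₂} {s} {c₂} (C₀.≈-trans (second ≈-refl) F̂.π₁-⟪⟫)) (proj₂ (proj₂ (evFH.code k′)))
          r-s : F̂.hat (r stage) F₀.[ s ] C₀.≈ p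
          r-s = C₀.≈-trans (F̂.hat-at {g = evL.eval (proj₂ (proj₂ stage))} {π₂ ∘ π₂} {s} {c₃} (C₀.≈-trans (second ≈-refl) F̂.π₂-⟪⟫)) (proj₂ (proj₂ (evFL.code p)))
          lifted : Σ[ x ∈ T C₀.⇒ F.F₀ (E.obj stage) ] F.F₁ (E.incl stage) C₀.∘ x C₀.≈ s
          lifted = hat-lift K K₀ F F-closed (L′ stage) s
            (good₀→solves {stage} {s = s} (good₀-resp (C₀.≈-sym g-s) (C₀.≈-sym g′-s) (C₀.≈-sym r-s) G))
          h-x : F̂.hat (h stage) F₀.[ proj₁ lifted ] C₀.≈ k
          h-x = C₀.≈-trans (F̂.hat-at {g = g stage} {E.incl stage} {proj₁ lifted} {s} (proj₂ lifted)) g-s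

        encode : ∀ {T} {k k′ : T ⊠ X ⇒ X} {p : T ⊠ N ⇒ I.F₀ W} → Good k k′ p →
                 Σ[ i ∈ A.Index ] Σ[ x ∈ T ⇒ E.obj i ] h i [ x ] ≈ k
        encode {T} {k} {k′} {p} G = stage , E.lift stage s solves , h-x
          where
          stage : A.Index
          stage = proj₁ (evH.code k) , proj₁ (evH.code k′) , proj₁ (evL.code p)
          s : T ⇒ A.ob stage
          s = ⟨ proj₁ (proj₂ (evH.code k)) , ⟨ proj₁ (proj₂ (evH.code k′)) , proj₁ (proj₂ (evL.code p)) ⟩ ⟩
          g-s : g stage [ s ] ≈ k
          g-s = ≈-trans ([]-[] project₁) (proj₂ (proj₂ (evH.code k)))
          g′-s : g′ stage [ s ] ≈ k′
          g′-s = ≈-trans ([]-[] (≈-trans assoc (≈-trans (refl⟩∘⟨ project₂) project₁))) (proj₂ (proj₂ (evH.code k′)))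
          r-s : r stage [ s ] ≈ p
          r-s = ≈-trans ([]-[] (≈-trans assoc (≈-trans (refl⟩∘⟨ project₂) project₂))) (proj₂ (proj₂ (evL.code p)))
          solves : Solves s (sys stage)
          solves = good→solves {stage} (good-resp (≈-sym g-s) (≈-sym g′-s) (≈-sym r-s) G)
          h-x : h stage [ E.lift stage s solves ] ≈ k
          h-x = ≈-trans ([]-[] (E.commute stage s solves)) g-s

      opaque
        encoded₀ : Σ[ i ∈ A.Index ] Σ[ x ∈ M.obj C₀.⇒ F.F₀ (E.obj i) ] F̂.hat (h i) F₀.[ x ] C₀.≈ γ₀
        encoded₀ = encode₀ {k = γ₀} {F₀.IsoFam.from M.family} {q₀} good-base

        stage₀ : A.Index
        stage₀ = proj₁ encoded₀

        point₀ : M.obj C₀.⇒ F.F₀ (E.obj stage₀)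
        point₀ = proj₁ (proj₂ encoded₀)

        agree₀ : F̂.hat (h stage₀) F₀.[ point₀ ] C₀.≈ γ₀
        agree₀ = proj₂ (proj₂ encoded₀)

      hat-h : ∀ k → F₀.IsoFam (F.F₀ (E.obj k)) (F.F₀ X) (F.F₀ X)
      hat-h k = Isos.mk≅ (F₀.Fam (F.F₀ (E.obj k))) (F̂.hat (h k)) (F̂.hat (h′ k)) (Good₀.inverseˡ (good-hat (good k))) (Good₀.inverseʳ (good-hat (good k)))

      descended : ∀ k → S₀.Sandwich (F₀.IsoFam.to w) (F₀.IsoFam.to (α₀ (F₀.IsoFam.to w) α b)) (F₀.IsoFam.to (b₀ (F₀.IsoFam.to w) α b))
                    (F̂.hat (h k)) (Isos.to C₀ (η W) C₀.∘ F̂.hat (q k))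
      descended k = descend (F₀.IsoFam.to w) α b (Good₀.exhibits (good-hat (good k)))

      opaque
        v : ∀ k → F.F₀ (E.obj k) C₀.⇒ M.obj
        v k = M.realize (hat-h k) (Isos.to C₀ (η W) C₀.∘ F̂.hat (q k)) (descended k)

        γ₀-v : ∀ k → γ₀ F₀.[ v k ] C₀.≈ F̂.hat (h k)
        γ₀-v k = M.realize-eq (hat-h k) (Isos.to C₀ (η W) C₀.∘ F̂.hat (q k)) (descended k)

        v-tr : ∀ {k l} (a : k 𝒦.↝ l) → v l C₀.∘ F.F₁ (𝒦.tr {k} {l} a) C₀.≈ v k
        v-tr {k} {l} a = M.faithful (v l C₀.∘ F.F₁ (𝒦.tr {k} {l} a)) (v k) (C₀.≈-trans (C₀.≈-sym F₀.[]-∘) (C₀.≈-trans (F₀.[]-resp (γ₀-v l) C₀.≈-refl)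
          (C₀.≈-trans (C₀.≈-sym F̂.hat-[]) (C₀.≈-trans (F̂.hat-resp (h-tr {k} {l} a)) (C₀.≈-sym (γ₀-v k))))))

        γ₀-v∘ : ∀ k {T} (x : T C₀.⇒ F.F₀ (E.obj k)) → γ₀ F₀.[ v k C₀.∘ x ] C₀.≈ F̂.hat (h k) F₀.[ x ]
        γ₀-v∘ k x = C₀.≈-trans (C₀.≈-sym (F₀.[]-∘ {g = γ₀} {v k} {x})) (F₀.[]-resp (γ₀-v k) C₀.≈-refl)

        agree-id : F̂.hat (h stage₀) F₀.[ point₀ ] C₀.≈ γ₀ F₀.[ C₀.id ]
        agree-id = C₀.≈-trans agree₀ (C₀.≈-sym (F₀.[]-id {g = γ₀}))

        v-x-γ : γ₀ F₀.[ v stage₀ C₀.∘ point₀ ] C₀.≈ γ₀ F₀.[ C₀.id ]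
        v-x-γ = C₀.≈-trans (γ₀-v∘ stage₀ point₀) agree-id

        v-x : v stage₀ C₀.∘ point₀ C₀.≈ C₀.id
        v-x = M.faithful (v stage₀ C₀.∘ point₀) C₀.id v-x-γ

        point-v : ∀ k → F̂.hat (h stage₀) F₀.[ point₀ C₀.∘ v k ] C₀.≈ F̂.hat (h k) F₀.[ C₀.id ]
        point-v k = C₀.≈-trans (C₀.≈-sym (F₀.[]-∘ {g = F̂.hat (h stage₀)} {point₀} {v k})) (C₀.≈-trans (F₀.[]-resp agree₀ C₀.≈-refl)
          (C₀.≈-trans (γ₀-v k) (C₀.≈-sym (F₀.[]-id {g = F̂.hat (h k)}))))

        x-v : ∀ k → SameEl F𝒦 (stage₀ , point₀ C₀.∘ v k) (k , C₀.id)
        x-v k = separate₀ {k = stage₀} {k} {point₀ C₀.∘ v k} {C₀.id} (point-v k)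

      open IndElements

      base≅F𝒦 : Category._≅_ (Ind C₀) (ι₀ M.obj) F𝒦
      base≅F𝒦 = Isos.mk≅ (Ind C₀) (element {B = F𝒦} (stage₀ , point₀))
        (record { comp = λ k → tt , v k ; compat = λ {k} {l} a → El-≈ (ι₀ M.obj) (v-tr {k} {l} a) })
        (λ _ → El-≈ (ι₀ M.obj) v-x) x-v

      compact : Compact 𝒦
      compact = reflectsCompact 𝒦 (M.obj , base≅F𝒦)

      Z : C.Obj
      Z = proj₁ compact
      Z≅𝒦 : Category._≅_ (Ind C) (ι₀ Z) 𝒦
      Z≅𝒦 = proj₂ compact
      module Z = Isos (Ind C) using (from; to; to-mono; to∘from)
      k₀ : 𝒦.Index
      k₀ = proj₁ (IndHom.comp (Z.to Z≅𝒦) tt)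
      z : Z ⇒ E.obj k₀
      z = proj₂ (IndHom.comp (Z.to Z≅𝒦) tt)

      preimage : ∀ {T} → El 𝒦 T → T ⇒ Z
      preimage y = proj₂ (push (Z.from Z≅𝒦) y)

      opaque
        preimage-eq : ∀ {T} (y : El 𝒦 T) → SameEl 𝒦 (k₀ , z ∘ preimage y) y
        preimage-eq y = S.trans (S.sym (push-∘ (Z.to Z≅𝒦) (Z.from Z≅𝒦) y))
          (S.trans (push-≈ {f = Category._∘_ (Ind C) (Z.to Z≅𝒦) (Z.from Z≅𝒦)} {Category.id (Ind C)} (Z.to∘from Z≅𝒦) y) (push-id y))
          where module S {T : C.Obj} = Setoid (El-setoid 𝒦 T) using (sym; trans)

        z-mono : ∀ {T} {x y : T ⇒ Z} → SameEl 𝒦 (k₀ , z ∘ x) (k₀ , z ∘ y) → x ≈ y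
        z-mono {x = x} {y} p = unι-resp {f = ι₁ x} {ι₁ y} (Z.to-mono Z≅𝒦 {x = ι₁ x} {ι₁ y} (λ _ → p))

      good-z : Good (h k₀ [ z ]) (h′ k₀ [ z ]) (q k₀ [ z ])
      good-z = good-[] z (good k₀)

    opaque
     stabilizer : Stabilizer ŵ α′ b′
     stabilizer = record
      { family = Isos.mk≅ (Fam Z) (h k₀ [ z ]) (h′ k₀ [ z ]) (Good.inverseˡ good-z) (Good.inverseʳ good-z)
      ; witness = q k₀ [ z ]
      ; sandwich = Good.exhibits good-z
      ; faithful = λ x y p → z-mono (separate (≈-trans (≈-sym []-∘) (≈-trans p []-∘)))
      ; realize = λ f p s → preimage (code f p s)
      ; realize-eq = λ f p s → ≈-trans []-∘ (≈-trans (h-respect (preimage-eq (code f p s))) (proj₂ (proj₂ (encode (good-of f p s))))) }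
      where
      good-of : ∀ {T} (f : IsoFam T X X) (p : T ⊠ N ⇒ I.F₀ W) → Sandwich ŵ α′ b′ (IsoFam.to f) p → Good (IsoFam.to f) (IsoFam.from f) p
      good-of f p s = mk (IsoFam.from∘to f) (IsoFam.to∘from f) s
      code : ∀ {T} (f : IsoFam T X X) (p : T ⊠ N ⇒ I.F₀ W) → Sandwich ŵ α′ b′ (IsoFam.to f) p → El 𝒦 T
      code f p s = proj₁ (encode (good-of f p s)) , proj₁ (proj₂ (encode (good-of f p s)))

module _ {C : Category o ℓ} (c : Cartesian C) where
  open Category C
  open Cartesian c
  open Families c

  -- ζ(s z, t x) = ζ(z, x)
  Invariant : ∀ {T Z X Y} → Z ⊠ X ⇒ Y → T ⊠ Z ⇒ Z → T ⊠ X ⇒ X → Set ℓ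
  Invariant ζ s t = ζ ∘ ⟨ s ∘ (id ⁂ π₁) , t ∘ (id ⁂ π₂) ⟩ ≈ ζ ∘ π₂

  opaque
    invariant-pointwise : ∀ {T Z X Y} {ζ : Z ⊠ X ⇒ Y} {s : T ⊠ Z ⇒ Z} {t : T ⊠ X ⇒ X} → Invariant ζ s t →
                          ζ [ s ] • t [ π₁ ] ≈ ζ [ π₂ ]
    invariant-pointwise {ζ = ζ} {s} {t} p = begin
      (ζ ∘ (s ⁂ id)) ∘ ⟨ π₁ , t [ π₁ ] ⟩                          ≈⟨ assoc ⟩
      ζ ∘ (s ⁂ id) ∘ ⟨ π₁ , t [ π₁ ] ⟩                            ≈⟨ refl⟩∘⟨ ⁂∘⟨⟩ ⟩
      ζ ∘ ⟨ s ∘ π₁ , id ∘ t [ π₁ ] ⟩                              ≈⟨ refl⟩∘⟨ ⟨⟩-resp (refl⟩∘⟨ e₁) (≈-trans identityˡ (refl⟩∘⟨ e₂)) ⟩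
      ζ ∘ ⟨ s ∘ (id ⁂ π₁) ∘ assocʳ , t ∘ (id ⁂ π₂) ∘ assocʳ ⟩     ≈⟨ refl⟩∘⟨ ≈-sym (≈-trans ⟨⟩∘ (⟨⟩-resp assoc assoc)) ⟩
      ζ ∘ ⟨ s ∘ (id ⁂ π₁) , t ∘ (id ⁂ π₂) ⟩ ∘ assocʳ              ≈⟨ ≈-trans (≈-sym assoc) (≈-trans (p ⟩∘⟨refl) assoc) ⟩
      ζ ∘ π₂ ∘ assocʳ                                             ≈⟨ refl⟩∘⟨ project₂ ⟩
      ζ [ π₂ ]                                                    ∎
      where
      e₁ : ∀ {A B D} → π₁ ≈ (id ⁂ π₁) ∘ assocʳ {A} {B} {D}
      e₁ = ≈-sym (≈-trans ⁂∘⟨⟩ (≈-trans (⟨⟩-resp identityˡ project₁) (⊠-ext project₁ project₂)))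
      e₂ : ∀ {A B D} → π₁ ⁂ id ≈ (id ⁂ π₂) ∘ assocʳ {A} {B} {D}
      e₂ = ≈-sym (≈-trans ⁂∘⟨⟩ (⟨⟩-resp identityˡ project₂))

module _ {C₀ : Category o′ ℓ′} {C : Category o ℓ} (I : Functor C₀ C) (c : Cartesian C) where
  open Category C
  open Cartesian c
  open Families c

  -- An object of automorphisms of X. Through ζ, membership of a family t of
  -- automorphisms can be tested by finitely many equations.
  record Automorphisms (X : Obj) : Set (o ⊔ ℓ ⊔ o′) where
    field
      obj        : Obj
      family     : IsoFam obj X X
      faithful   : Faithful (IsoFam.to family)
      mul        : obj ⊠ obj ⇒ obj
      unit       : 𝟏 ⇒ obj
      inv        : obj ⇒ obj
      family-mul : IsoFam.to family [ mul ] ≈ IsoFam.to family [ π₁ ] • IsoFam.to family [ π₂ ]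
      family-unit : IsoFam.to family [ unit ] ≈ π₂
      family-inv : IsoFam.to family [ inv ] ≈ IsoFam.from family
      aux        : Obj
      target     : Category.Obj C₀
      ζ          : aux ⊠ X ⇒ Functor.F₀ I target
      realize    : ∀ {T} (t : IsoFam T X X) (s : IsoFam T aux aux) → Invariant c ζ (IsoFam.to s) (IsoFam.to t) →
                   Σ[ h ∈ T ⇒ obj ] IsoFam.to family [ h ] ≈ IsoFam.to t

module StabilizerGroup {C₀ : Category o′ ℓ′} {C : Category o ℓ} (I : Functor C₀ C) (c : Cartesian C)
  (loci : ∀ {A} (sys : Families.System c A) → Families.Locus c sys)
  {X Z W : Category.Obj C} {Y : Category.Obj C₀} (ζ≅ : Families.IsoFam c Z X (Functor.F₀ I Y)) (ŵ : Category._⇒_ C (Cartesian._⊠_ c W (Functor.F₀ I Y)) (Functor.F₀ I Y))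
  (stab₁ : Sandwiches.Stabilizer c ŵ (Families._[_] c (Families.IsoFam.to c ζ≅) (Cartesian.π₁ c))
                                     (Families._[_] c (Families.IsoFam.from c ζ≅) (Cartesian.π₂ c)))
  where
  open Category C
  open Cartesian c
  open Families c
  open Sandwiches c
  private
    V : Obj
    V = Functor.F₀ I Y

    module S₁ = Stabilizer stab₁ using (family; obj; realize; realize-eq; sandwich; witness)

    ζ : Z ⊠ X ⇒ V
    ζ = IsoFam.to ζ≅
    ζ⁻ : Z ⊠ V ⇒ X
    ζ⁻ = IsoFam.from ζ≅
    γ₁ : S₁.obj ⊠ X ⇒ X
    γ₁ = IsoFam.to S₁.family

  N : Obj
  N = (Z ⊠ Z) ⊠ S₁.obj

  α : N ⊠ X ⇒ V
  α = ζ [ π₁ ∘ π₁ ]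

  b : N ⊠ V ⇒ X
  b = γ₁ [ π₂ ] • ζ⁻ [ π₂ ∘ π₁ ]

  module StableGroup (stab₂ : Stabilizer ŵ α b) where
    private
      module S₂ = Stabilizer stab₂ using (faithful; family; obj; realize; realize-eq; sandwich)

      γ₂ : S₂.obj ⊠ X ⇒ X
      γ₂ = IsoFam.to S₂.family

    record Stable {T} (g : T ⊠ X ⇒ X) : Set ℓ where
      constructor stable-by
      field
        {witness} : T ⊠ N ⇒ W
        sandwich  : Sandwich ŵ α b g witness

    opaque
      at₁ : ∀ {S} (k : S ⇒ S₁.obj) (a c : S ⇒ Z) →
            ŵ [ S₁.witness ∘ ⟨ k , ⟨ a , c ⟩ ⟩ ] ≈ ζ [ a ] • γ₁ [ k ] • ζ⁻ [ c ]
      at₁ k a c = ≈-trans (≈-sym []-∘) (≈-trans ([]-resp S₁.sandwich ≈-refl) (≈-trans []-• (•-resp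
          (≈-trans ([]-∘ {g = ζ [ π₁ ]} {π₂}) ([]-[] {g = ζ} {π₁} {_} {a} (≈-trans (refl⟩∘⟨ project₂) project₁)))
          (≈-trans []-• (•-resp ([]-[] {g = γ₁} {π₁} {_} {k} project₁)
            (≈-trans ([]-∘ {g = ζ⁻ [ π₂ ]} {π₂}) ([]-[] {g = ζ⁻} {π₂} {_} {c} (≈-trans (refl⟩∘⟨ project₂) project₂))))))))

      expand₂ : ∀ {S T} (g : T ⊠ X ⇒ X) {r : S ⇒ T ⊠ N} {t : S ⇒ T} {a c : S ⇒ Z} {k : S ⇒ S₁.obj} →
                π₁ ∘ r ≈ t → (π₁ ∘ π₁) ∘ π₂ ∘ r ≈ a → (π₂ ∘ π₁) ∘ π₂ ∘ r ≈ c → π₂ ∘ π₂ ∘ r ≈ k →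
                (α [ π₂ ] • g [ π₁ ] • b [ π₂ ]) [ r ] ≈ ζ [ a ] • g [ t ] • γ₁ [ k ] • ζ⁻ [ c ]
      expand₂ g {r} {t} {a} {c} {k} et ea ec ek = ≈-trans []-• (•-resp
          (≈-trans ([]-∘ {g = α} {π₂} {r}) ([]-[] {g = ζ} {π₁ ∘ π₁} {π₂ ∘ r} {a} ea))
          (≈-trans []-• (•-resp ([]-[] {g = g} {π₁} {r} {t} et)
            (≈-trans ([]-∘ {g = b} {π₂} {r}) (≈-trans ([]-• {g = γ₁ [ π₂ ]} {ζ⁻ [ π₂ ∘ π₁ ]} {π₂ ∘ r})
              (•-resp ([]-[] {g = γ₁} {π₂} {π₂ ∘ r} {k} ek) ([]-[] {g = ζ⁻} {π₂ ∘ π₁} {π₂ ∘ r} {c} ec)))))))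

      at₂ : ∀ {S T} {g : T ⊠ X ⇒ X} (s : Stable g) (t : S ⇒ T) (a c : S ⇒ Z) (k : S ⇒ S₁.obj) →
            ŵ [ Stable.witness s ∘ ⟨ t , ⟨ ⟨ a , c ⟩ , k ⟩ ⟩ ] ≈ ζ [ a ] • g [ t ] • γ₁ [ k ] • ζ⁻ [ c ]
      at₂ {g = g} (stable-by s) t a c k = ≈-trans (≈-sym []-∘) (≈-trans ([]-resp s ≈-refl)
        (expand₂ g project₁ (e ⟨π₁⟩) (e ⟨π₂⟩) (≈-trans (refl⟩∘⟨ project₂) project₂)))
        where
        ⟨π₁⟩ : π₁ ∘ ⟨ a , c ⟩ ≈ a
        ⟨π₁⟩ = project₁
        ⟨π₂⟩ : π₂ ∘ ⟨ a , c ⟩ ≈ c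
        ⟨π₂⟩ = project₂
        e : ∀ {p : Z ⊠ Z ⇒ Z} {x} → p ∘ ⟨ a , c ⟩ ≈ x → (p ∘ π₁) ∘ π₂ ∘ ⟨ t , ⟨ ⟨ a , c ⟩ , k ⟩ ⟩ ≈ x
        e q = ≈-trans (refl⟩∘⟨ project₂) (≈-trans assoc (≈-trans (refl⟩∘⟨ project₁) q))

    module _ {T : Obj} where
      z₁ z₂ : T ⊠ N ⇒ Z
      z₁ = (π₁ ∘ π₁) ∘ π₂
      z₂ = (π₂ ∘ π₁) ∘ π₂
      k₁ : T ⊠ N ⇒ S₁.obj
      k₁ = π₂ ∘ π₂

    opaque
      stable : ∀ {T} {g : T ⊠ X ⇒ X} (q : T ⊠ N ⇒ W) →
               ŵ [ q ] ≈ ζ [ z₁ ] • g [ π₁ ] • γ₁ [ k₁ ] • ζ⁻ [ z₂ ] → Stable g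
      stable {g = g} q e = stable-by {witness = q} (≈-trans e (≈-trans (≈-sym
        (expand₂ g {r = id} identityʳ (refl⟩∘⟨ identityʳ) (refl⟩∘⟨ identityʳ) (refl⟩∘⟨ identityʳ))) []-id))

      stable-resp : ∀ {T} {g h : T ⊠ X ⇒ X} → g ≈ h → Stable g → Stable h
      stable-resp e (stable-by s) = stable-by (sandwich-resp e ≈-refl s)

      stable-[] : ∀ {S T} {g : T ⊠ X ⇒ X} (h : S ⇒ T) → Stable g → Stable (g [ h ])
      stable-[] h (stable-by s) = stable-by (sandwich-[] h s)

      stable-γ₂ : Stable γ₂
      stable-γ₂ = stable-by S₂.sandwich

      stable-id : ∀ {T} → Stable (π₂ {T} {X})
      stable-id = stable (S₁.witness ∘ ⟨ k₁ , ⟨ z₁ , z₂ ⟩ ⟩) (≈-trans (at₁ k₁ z₁ z₂)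
        (•-resp ≈-refl (≈-sym (≈-trans (•-resp []-π₂ ≈-refl) •-identityˡ))))

      -- The families stable on K₁ form a monoid: if g K₁ ⊆ K₁ and h K₁ ⊆ K₁ then g h K₁ ⊆ K₁.
      stable-• : ∀ {T} {g : T ⊠ X ⇒ X} → Stable g → (h : IsoFam T X X) → Stable (IsoFam.to h) → Stable (g • IsoFam.to h)
      stable-• {T} {g} sg h sh = stable (Stable.witness sg ∘ ⟨ π₁ , ⟨ ⟨ z₁ , z₂ ⟩ , r ⟩ ⟩)
        (≈-trans (at₂ sg π₁ z₁ z₂ r) (•-resp ≈-refl (≈-trans (•-resp ≈-refl (≈-trans (•-resp γ₁-r ≈-refl) •-assoc))
          (≈-trans (≈-sym •-assoc) (•-resp (≈-sym []-•) ≈-refl)))))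
        where
        q : (T ⊠ N) ⊠ (Z ⊠ Z) ⇒ W
        q = Stable.witness sh ∘ ⟨ π₁ ∘ π₁ , ⟨ ⟨ π₁ ∘ π₂ , π₂ ∘ π₂ ⟩ , k₁ ∘ π₁ ⟩ ⟩
        hk : IsoFam (T ⊠ N) X X
        hk = h [ π₁ ]≅ ⊙ S₁.family [ k₁ ]≅
          where open Isos (Fam (T ⊠ N))
        q-law : Sandwich ŵ (ζ [ π₁ ]) (ζ⁻ [ π₂ ]) (IsoFam.to hk) q
        q-law = ≈-trans (at₂ sh (π₁ ∘ π₁) (π₁ ∘ π₂) (π₂ ∘ π₂) (k₁ ∘ π₁)) (•-resp (≈-sym []-∘)
          (≈-trans (≈-sym •-assoc) (•-resp (≈-sym (≈-trans []-• (•-resp []-∘ []-∘))) (≈-sym []-∘))))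
        r : T ⊠ N ⇒ S₁.obj
        r = S₁.realize hk q q-law
        γ₁-r : γ₁ [ r ] ≈ IsoFam.to h [ π₁ ] • γ₁ [ k₁ ]
        γ₁-r = S₁.realize-eq hk q q-law

      stable-invariant : ∀ {T} {g : T ⊠ X ⇒ X} (s : T ⊠ Z ⇒ Z) → ζ [ s ] ≈ ζ [ π₂ ] • g [ π₁ ] → Stable g
      stable-invariant {T} {g} s e = stable (S₁.witness ∘ ⟨ k₁ , ⟨ s ∘ ⟨ π₁ , z₁ ⟩ , z₂ ⟩ ⟩)
        (≈-trans (at₁ k₁ (s ∘ ⟨ π₁ , z₁ ⟩) z₂) (≈-trans (•-resp
          (≈-trans (≈-sym []-∘) (≈-trans ([]-resp e ≈-refl) (≈-trans []-• (•-resp ([]-[] project₂) ([]-[] project₁))))) ≈-refl) •-assoc))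

    inverse-pair : System (S₂.obj ⊠ S₂.obj)
    inverse-pair = equation (γ₂ [ π₂ ] • γ₂ [ π₁ ]) π₂ ∷ []
    pairs : Locus inverse-pair
    pairs = loci inverse-pair
    module G = Locus pairs using (commute; incl; lift; mono; obj; solves)

    γ≅ : IsoFam G.obj X X
    γ≅ = S₂.family [ π₁ ∘ G.incl ]≅
    γ : G.obj ⊠ X ⇒ X
    γ = IsoFam.to γ≅

    opaque
      γ⁻ : γ₂ [ π₂ ∘ G.incl ] ≈ IsoFam.from γ≅
      γ⁻ = Isos.inverse-unique (Fam G.obj) {f = γ} {γ} ≈-refl
        (≈-trans (•-resp (≈-sym []-∘) (≈-sym []-∘)) (≈-trans (≈-sym []-•) (≈-trans (proj₁ G.solves) []-π₂)))
        (IsoFam.to∘from γ≅)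

      stable-γ : Stable γ
      stable-γ = stable-[] (π₁ ∘ G.incl) stable-γ₂

      stable-γ⁻ : Stable (IsoFam.from γ≅)
      stable-γ⁻ = stable-resp γ⁻ (stable-[] (π₂ ∘ G.incl) stable-γ₂)

      γ-faithful : Faithful γ
      γ-faithful x y e = G.mono (⊠-ext
        (≈-trans (≈-sym assoc) (≈-trans (S₂.faithful ((π₁ ∘ G.incl) ∘ x) ((π₁ ∘ G.incl) ∘ y) (≈-trans (≈-sym []-∘) (≈-trans e []-∘))) assoc))
        (≈-trans (≈-sym assoc) (≈-trans (S₂.faithful ((π₂ ∘ G.incl) ∘ x) ((π₂ ∘ G.incl) ∘ y)
          (≈-trans (≈-sym []-∘) (≈-trans (≈-trans ([]-resp γ⁻ ≈-refl) (≈-trans e⁻ ([]-resp (≈-sym γ⁻) ≈-refl))) []-∘))) assoc)))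
        where
        e⁻ : IsoFam.from γ≅ [ x ] ≈ IsoFam.from γ≅ [ y ]
        e⁻ = Isos.inverse-unique (Fam _) {f = γ [ x ]} {γ [ y ]} e (IsoFam.from∘to (γ≅ [ x ]≅)) (IsoFam.to∘from (γ≅ [ y ]≅))

      member : ∀ {T} (f : IsoFam T X X) → Stable (IsoFam.to f) → Stable (IsoFam.from f) →
               Σ[ h ∈ T ⇒ G.obj ] γ [ h ] ≈ IsoFam.to f
      member {T} f (stable-by {q} s) (stable-by {q′} s′) = G.lift p solves ,
        ≈-trans []-∘ (≈-trans ([]-resp ≈-refl (≈-trans assoc (≈-trans (refl⟩∘⟨ G.commute p solves) project₁))) (S₂.realize-eq f q s))
        where
        f⁻ : IsoFam T X X
        f⁻ = Isos.flip (Fam T) f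
        p : T ⇒ S₂.obj ⊠ S₂.obj
        p = ⟨ S₂.realize f q s , S₂.realize f⁻ q′ s′ ⟩
        solves : Solves p inverse-pair
        solves = ≈-trans []-• (≈-trans (•-resp (≈-trans ([]-[] project₂) (S₂.realize-eq f⁻ q′ s′)) (≈-trans ([]-[] project₁) (S₂.realize-eq f q s)))
          (≈-trans (IsoFam.from∘to f) (≈-sym []-π₂))) , tt

      member-mul : Σ[ h ∈ G.obj ⊠ G.obj ⇒ G.obj ] γ [ h ] ≈ γ [ π₁ ] • γ [ π₂ ]
      member-mul = member (γ≅ [ π₁ ]≅ ⊙ γ≅ [ π₂ ]≅)
        (stable-• (stable-[] π₁ stable-γ) (γ≅ [ π₂ ]≅) (stable-[] π₂ stable-γ))
        (stable-• (stable-[] π₂ stable-γ⁻) (flip (γ≅ [ π₁ ]≅)) (stable-[] π₁ stable-γ⁻))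
        where open Isos (Fam (G.obj ⊠ G.obj))

      member-unit : Σ[ h ∈ 𝟏 ⇒ G.obj ] γ [ h ] ≈ π₂
      member-unit = member (Isos.id≅ (Fam 𝟏)) stable-id stable-id

      member-inv : Σ[ h ∈ G.obj ⇒ G.obj ] γ [ h ] ≈ IsoFam.from γ≅
      member-inv = member (Isos.flip (Fam G.obj) γ≅) stable-γ⁻ stable-γ

      member-invariant : ∀ {T} (t : IsoFam T X X) (s : IsoFam T Z Z) → Invariant c ζ (IsoFam.to s) (IsoFam.to t) →
                         Σ[ h ∈ T ⇒ G.obj ] γ [ h ] ≈ IsoFam.to t
      member-invariant {T} t s p = member t
        (stable-invariant (IsoFam.from s) (begin
          ζ [ IsoFam.from s ]                                                    ≈⟨ ≈-sym ([]-[] project₂) ⟩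
          ζ [ π₂ ] [ ⟨ π₁ , IsoFam.from s ⟩ ]                                    ≈⟨ []-resp (≈-sym q) ≈-refl ⟩
          (ζ [ IsoFam.to s ] • IsoFam.to t [ π₁ ]) [ ⟨ π₁ , IsoFam.from s ⟩ ]    ≈⟨ []-• ⟩
          ζ [ IsoFam.to s ] [ ⟨ π₁ , IsoFam.from s ⟩ ] • IsoFam.to t [ π₁ ] [ ⟨ π₁ , IsoFam.from s ⟩ ]
                                                                                 ≈⟨ •-resp ([]-[] (IsoFam.to∘from s)) ([]-[] project₁) ⟩
          ζ [ π₂ ] • IsoFam.to t [ π₁ ]                                          ∎))
        (stable-invariant (IsoFam.to s) (begin
          ζ [ IsoFam.to s ]                                                      ≈⟨ ≈-sym (Isos.cancelʳ (Fam (T ⊠ Z)) (IsoFam.to∘from (t [ π₁ ]≅))) ⟩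
          (ζ [ IsoFam.to s ] • IsoFam.to t [ π₁ ]) • IsoFam.from t [ π₁ ]        ≈⟨ •-resp q ≈-refl ⟩
          ζ [ π₂ ] • IsoFam.from t [ π₁ ]                                        ∎))
        where
        q : ζ [ IsoFam.to s ] • IsoFam.to t [ π₁ ] ≈ ζ [ π₂ ]
        q = invariant-pointwise c p


    automorphisms : Automorphisms I c X
    automorphisms = record
      { family = γ≅ ; faithful = γ-faithful
      ; mul = proj₁ member-mul ; unit = proj₁ member-unit ; inv = proj₁ member-inv
      ; family-mul = proj₂ member-mul ; family-unit = proj₂ member-unit ; family-inv = proj₂ member-inv
      ; target = Y ; ζ = ζ ; realize = member-invariant }

module AutomorphismObjects {u} {C₀ C : Category u u} (K₀ : IndClosed C₀) (K : IndClosed C) (cover : InternalCover K₀ K)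
  (semiStrict : ∀ X Y → SemiStrict (IndClosed.HomObj K X Y))
  (bi-strict : ∀ X Y → Σ[ B ∈ IndObj C₀ ] (B IndRepresents BiPresheaf (IndClosed.cartesian K₀) X Y) × Strict B)
  (reflectsCompact : ∀ (X : IndObj C) → Compact (Functor.F₀ (IndF (InternalCover.F cover)) X) → Compact X)
  (proper : ∀ {X Y : Category.Obj C₀} (k : Category._⇒_ C₀ X Y) → Category.IsMono C₀ k → ∀ Z →
            Proper (IndClosed.postcompose K₀ Z k)) where
  private
    module C₀ = Category C₀ using (Obj; _⇒_; _∘_)
    module K₀ = IndClosed K₀ using (cartesian; 𝟏)
    module K = IndClosed K
    module Fam₀ = Families K₀.cartesian
  open InternalCover cover
  open CoverFamilies K₀ K cover
  open Stabilizers K₀ K cover semiStrict bi-strict reflectsCompact proper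
  private
    module I = Functor I using (F₀; F₁)
    module F = Functor F using (F₀; F₁)
    module Î = Hat K₀.cartesian K.cartesian I (IsClosed.products I-closed) using (hat; hat-at; hat-resp)
    module F̂ = Hat K.cartesian K₀.cartesian F (IsClosed.products F-closed) using (⟪_,_⟫)
    module F𝟏 = IsTerminal (IsClosed.terminal F-closed K.isTerminal) using (!)
  open Category C
  open K using (_⊠_; π₁; π₂; ⟨_,_⟩; project₁; project₂; 𝟏)
  open Families K.cartesian
  open Sandwiches K.cartesian

  module _ (X : Obj) where
    private
      Y : C₀.Obj
      Y = F.F₀ X

      ζ-lifted : LiftedIso K K₀ F F-closed {X} {I.F₀ Y} {K₀.𝟏} (Isos.flip (Fam₀.Fam K₀.𝟏) η̄)
      ζ-lifted = liftIso K K₀ F F-closed (Isos.flip (Fam₀.Fam K₀.𝟏) η̄)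

      Z : Obj
      Z = LiftedIso.obj ζ-lifted
      ζ≅ : IsoFam Z X (I.F₀ Y)
      ζ≅ = LiftedIso.family ζ-lifted
      ζ : Z ⊠ X ⇒ I.F₀ Y
      ζ = IsoFam.to ζ≅
      ζ⁻ : Z ⊠ I.F₀ Y ⇒ X
      ζ⁻ = IsoFam.from ζ≅
      z₀ : K₀.𝟏 C₀.⇒ F.F₀ Z
      z₀ = LiftedIso.point ζ-lifted

      difference : IsoFam (Z ⊠ Z) (I.F₀ Y) (I.F₀ Y)
      difference = ζ≅ [ π₁ ]≅ ⊙ flip (ζ≅ [ π₂ ]≅)
        where open Isos (Fam (Z ⊠ Z))

      δ-lifted : LiftedIso K₀ K I I-closed difference
      δ-lifted = liftIso K₀ K I I-closed difference
      module δ = LiftedIso δ-lifted using (agree; family; point)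

      δ-factored : FaithfulFactor K₀.cartesian δ.family
      δ-factored = faithfulFactor K₀.cartesian (proj₁ (proj₂ (bi-strict Y Y))) (proj₂ (proj₂ (bi-strict Y Y))) δ.family
      module W = FaithfulFactor δ-factored using (agree; arrow; faithful; family; obj)

      ŵ : I.F₀ W.obj ⊠ I.F₀ Y ⇒ I.F₀ Y
      ŵ = Î.hat (Fam₀.IsoFam.to W.family)

      m : Z ⊠ Z ⇒ I.F₀ W.obj
      m = I.F₁ W.arrow ∘ δ.point

      opaque
        ŵ-m : ŵ [ m ] ≈ ζ [ π₁ ] • ζ⁻ [ π₂ ]
        ŵ-m = ≈-trans (≈-sym (Î.hat-at {g = Fam₀.IsoFam.to W.family} {W.arrow} {δ.point} ≈-refl))
          (≈-trans ([]-resp (Î.hat-resp W.agree) ≈-refl) δ.agree)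

      b₁ : IsoFam (Z ⊠ Z) (I.F₀ Y) X
      b₁ = Isos.flip (Fam (Z ⊠ Z)) (ζ≅ [ π₂ ]≅)

      n₁ : K₀.𝟏 C₀.⇒ F.F₀ (Z ⊠ Z)
      n₁ = F̂.⟪ z₀ , z₀ ⟫

      stab₁ : Stabilizer ŵ (ζ [ π₁ ]) (ζ⁻ [ π₂ ])
      stab₁ = stabilizer W.family W.faithful (ζ≅ [ π₁ ]≅) b₁ n₁
      module S₁ = Stabilizer stab₁ using (family; obj; realize)

      opaque
        one-sandwich : Sandwich ŵ (ζ [ π₁ ]) (ζ⁻ [ π₂ ]) (π₂ {𝟏} {X}) (m ∘ π₂)
        one-sandwich = ≈-trans (≈-sym []-∘) (≈-trans ([]-resp ŵ-m ≈-refl) (≈-trans []-•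
          (•-resp ≈-refl (≈-sym (≈-trans (•-resp []-π₂ ≈-refl) •-identityˡ)))))

      one₁ : 𝟏 ⇒ S₁.obj
      one₁ = S₁.realize (Isos.id≅ (Fam 𝟏)) (m ∘ π₂) one-sandwich

      module SG = StabilizerGroup I K.cartesian (loci K semiStrict) ζ≅ ŵ stab₁

      b₂ : IsoFam SG.N (I.F₀ Y) X
      b₂ = S₁.family [ π₂ ]≅ ⊙ flip (ζ≅ [ π₂ ∘ π₁ ]≅)
        where open Isos (Fam SG.N)

      n₂ : K₀.𝟏 C₀.⇒ F.F₀ SG.N
      n₂ = F̂.⟪ n₁ , F.F₁ one₁ C₀.∘ F𝟏.! ⟫

      stab₂ : Stabilizer ŵ SG.α SG.b
      stab₂ = stabilizer W.family W.faithful (ζ≅ [ π₁ ∘ π₁ ]≅) b₂ n₂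

    opaque
     automorphisms : Automorphisms I K.cartesian X
     automorphisms = SG.StableGroup.automorphisms stab₂

module _ {C : Category o ℓ} (c : Cartesian C) where
  open Category C
  open Cartesian c
  open Families c

  module _ {G : Obj} {J : Set o} {X : J → Obj} (γ : ∀ j → IsoFam G (X j) (X j))
           (faithful : ∀ {T} {x y : T ⇒ G} → (∀ j → IsoFam.to (γ j) [ x ] ≈ IsoFam.to (γ j) [ y ]) → x ≈ y)
           (mul : G ⊠ G ⇒ G) (unit : 𝟏 ⇒ G) (inv : G ⇒ G)
           (γ-mul : ∀ j → IsoFam.to (γ j) [ mul ] ≈ IsoFam.to (γ j) [ π₁ ] • IsoFam.to (γ j) [ π₂ ])
           (γ-unit : ∀ j → IsoFam.to (γ j) [ unit ] ≈ π₂)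
           (γ-inv : ∀ j → IsoFam.to (γ j) [ inv ] ≈ IsoFam.from (γ j)) where
    private
      opaque
        γ-mul-∘ : ∀ {T} (x y : T ⇒ G) j {f g} → IsoFam.to (γ j) [ x ] ≈ f → IsoFam.to (γ j) [ y ] ≈ g →
                  IsoFam.to (γ j) [ mul ∘ ⟨ x , y ⟩ ] ≈ f • g
        γ-mul-∘ x y j p q = ≈-trans (≈-sym []-∘) (≈-trans ([]-resp (γ-mul j) ≈-refl) (≈-trans []-•
          (•-resp (≈-trans ([]-[] project₁) p) (≈-trans ([]-[] project₂) q))))

        γ-unit-! : ∀ {T} j → IsoFam.to (γ j) [ unit ∘ ! {T} ] ≈ π₂
        γ-unit-! j = ≈-trans (≈-sym []-∘) (≈-trans ([]-resp (γ-unit j) ≈-refl) []-π₂)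

        assoc-law : mul ∘ (mul ⁂ id) ≈ mul ∘ (id ⁂ mul) ∘ assocʳ
        assoc-law = faithful (λ j → ≈-trans
          (γ-mul-∘ (mul ∘ π₁) (id ∘ π₂) j {g = IsoFam.to (γ j) [ π₂ ]}
            (≈-trans (≈-sym []-∘) (≈-trans ([]-resp (γ-mul j) ≈-refl) []-•)) ([]-resp ≈-refl identityˡ))
          (≈-trans •-assoc (≈-sym (≈-trans ([]-resp ≈-refl (refl⟩∘⟨ ⁂∘⟨⟩))
            (γ-mul-∘ (id ∘ π₁ ∘ π₁) (mul ∘ (π₂ ⁂ id)) j
              (≈-trans ([]-resp ≈-refl identityˡ) (≈-sym []-∘))
              (γ-mul-∘ (π₂ ∘ π₁) (id ∘ π₂) j (≈-sym []-∘) ([]-resp ≈-refl identityˡ)))))))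

    groupObj : GroupObj c
    groupObj = record
      { carrier = G ; mul = mul ; unit = unit ; inv = inv ; mul-assoc = assoc-law
      ; unitˡ = faithful (λ j → ≈-trans (γ-mul-∘ (unit ∘ !) id j (γ-unit-! j) ≈-refl) •-identityˡ)
      ; unitʳ = faithful (λ j → ≈-trans (γ-mul-∘ id (unit ∘ !) j ≈-refl (γ-unit-! j)) •-identityʳ)
      ; invˡ = faithful (λ j → ≈-trans (γ-mul-∘ inv id j (γ-inv j) []-id) (≈-trans (IsoFam.from∘to (γ j)) (≈-sym (γ-unit-! j))))
      ; invʳ = faithful (λ j → ≈-trans (γ-mul-∘ id inv j []-id (γ-inv j)) (≈-trans (IsoFam.to∘from (γ j)) (≈-sym (γ-unit-! j)))) }

module Stages {C₀ C : Category u u} (I : Functor C₀ C) (c : Cartesian C)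
              (loci : ∀ {A} (sys : Families.System c A) → Families.Locus c sys)
              (auts : ∀ X → Automorphisms I c X) where
  private module I = Functor I using (F₀)
  open Category C
  open Cartesian c
  open Families c
  module A X = Automorphisms (auts X)

  γ : ∀ X → A.obj X ⊠ X ⇒ X
  γ X = IsoFam.to (A.family X)

  ∏ : List Obj → Obj
  ∏ []       = 𝟏
  ∏ (X ∷ Xs) = A.obj X ⊠ ∏ Xs

  proj : ∀ {Xs X} → X ∈ Xs → ∏ Xs ⇒ A.obj X
  proj (here refl) = π₁
  proj (there x)   = proj x ∘ π₂

  Points : Obj → List Obj → Set u
  Points T Xs = ∀ {X} → X ∈ Xs → T ⇒ A.obj X

  tuple : ∀ {T} Xs → Points T Xs → T ⇒ ∏ Xs
  tuple []       x = !
  tuple (X ∷ Xs) x = ⟨ x (here refl) , tuple Xs (λ i → x (there i)) ⟩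

  opaque
    proj-tuple : ∀ {T Xs} (x : Points T Xs) {X} (i : X ∈ Xs) → proj i ∘ tuple Xs x ≈ x i
    proj-tuple x (here refl) = project₁
    proj-tuple x (there i)   = ≈-trans assoc (≈-trans (refl⟩∘⟨ project₂) (proj-tuple (λ i → x (there i)) i))

    ∏-ext : ∀ {T} Xs {x y : T ⇒ ∏ Xs} → (∀ {X} (i : X ∈ Xs) → proj i ∘ x ≈ proj i ∘ y) → x ≈ y
    ∏-ext []       e = ≈-trans (≈-sym (!-unique _)) (!-unique _)
    ∏-ext (X ∷ Xs) e = ⊠-ext (e (here refl)) (∏-ext Xs (λ i → ≈-trans (≈-sym assoc) (≈-trans (e (there i)) assoc)))

  data Edge (Xs : List Obj) : Set u where
    natural : ∀ {X Y} → X ∈ Xs → Y ∈ Xs → X ⇒ Y → Edge Xs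
    fixed   : ∀ X₀ → I.F₀ X₀ ∈ Xs → Edge Xs

  Families′ : Obj → List Obj → Set u
  Families′ T Xs = ∀ {X} → X ∈ Xs → T ⊠ X ⇒ X

  Holds : ∀ {T Xs} → Families′ T Xs → Edge Xs → Set u
  Holds t (natural i j f) = const f • t i ≈ t j • const f
  Holds t (fixed X₀ i)    = t i ≈ π₂

  families : ∀ {T Xs} → Points T Xs → Families′ T Xs
  families x {X} i = γ X [ x i ]

  mapEdge : ∀ {Xs Ys} → (∀ {X} → X ∈ Xs → X ∈ Ys) → Edge Xs → Edge Ys
  mapEdge σ (natural i j f) = natural (σ i) (σ j) f
  mapEdge σ (fixed X₀ i)    = fixed X₀ (σ i)

  opaque
    holds-map : ∀ {T Xs Ys} (σ : ∀ {X} → X ∈ Xs → X ∈ Ys) {t : Families′ T Ys} (e : Edge Xs) →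
                Holds t (mapEdge σ e) → Holds (λ i → t (σ i)) e
    holds-map σ (natural i j f) p = p
    holds-map σ (fixed X₀ i)    p = p

    holds-resp : ∀ {T Xs} {t s : Families′ T Xs} (e : Edge Xs) → (∀ {X} (i : X ∈ Xs) → t i ≈ s i) → Holds t e → Holds s e
    holds-resp (natural i j f) q p = ≈-trans (•-resp ≈-refl (≈-sym (q i))) (≈-trans p (•-resp (q j) ≈-refl))
    holds-resp (fixed X₀ i)    q p = ≈-trans (≈-sym (q i)) p

    holds-[] : ∀ {S T Xs} {t : Families′ T Xs} (e : Edge Xs) (h : S ⇒ T) → Holds t e → Holds (λ i → t i [ h ]) e
    holds-[] (natural i j f) h p = ≈-trans (•-resp (≈-sym []-const) ≈-refl) (≈-trans (≈-sym []-•)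
      (≈-trans ([]-resp p ≈-refl) (≈-trans []-• (•-resp ≈-refl []-const))))
    holds-[] (fixed X₀ i)    h p = ≈-trans ([]-resp p ≈-refl) []-π₂

    holds-• : ∀ {T Xs} {t s : Families′ T Xs} (e : Edge Xs) → Holds t e → Holds s e → Holds (λ i → t i • s i) e
    holds-• (natural i j f) p q = ≈-trans (≈-sym •-assoc) (≈-trans (•-resp p ≈-refl) (≈-trans •-assoc
      (≈-trans (•-resp ≈-refl q) (≈-sym •-assoc))))
    holds-• (fixed X₀ i)    p q = ≈-trans (•-resp p q) •-identityˡ

    holds-id : ∀ {T Xs} (e : Edge Xs) → Holds {T} (λ i → π₂) e
    holds-id (natural i j f) = ≈-trans •-identityʳ (≈-sym •-identityˡ)
    holds-id (fixed X₀ i)    = ≈-refl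

    holds-inverse : ∀ {T Xs} (t : ∀ {X} → X ∈ Xs → IsoFam T X X) (e : Edge Xs) →
                    Holds (λ i → IsoFam.to (t i)) e → Holds (λ i → IsoFam.from (t i)) e
    holds-inverse {T} t (natural i j f) p = F.to-epi (t i) (F.to-mono (t j)
      (≈-trans (•-resp ≈-refl (F.cancelʳ (IsoFam.from∘to (t i)))) (≈-trans (≈-sym p)
        (≈-sym (≈-trans (•-resp ≈-refl •-assoc) (≈-trans (F.cancelˡ (IsoFam.to∘from (t j))) ≈-refl))))))
      where module F = Isos (Fam T) using (cancelʳ; cancelˡ; to-epi; to-mono)
    holds-inverse {T} t (fixed X₀ i)    p = ≈-trans (≈-sym •-identityˡ) (≈-trans (•-resp (≈-sym p) ≈-refl) (IsoFam.to∘from (t i)))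

  edgeEquation : ∀ {Xs} → Edge Xs → Equation (∏ Xs)
  edgeEquation (natural {X} {Y} i j f) = equation (const f • γ X [ proj i ]) (γ Y [ proj j ] • const f)
  edgeEquation (fixed X₀ i)            = equation (γ (I.F₀ X₀) [ proj i ]) π₂

  system : ∀ {Xs} → List (Edge Xs) → System (∏ Xs)
  system = map edgeEquation

  Solves₁ : ∀ {A T} → T ⇒ A → Equation A → Set u
  Solves₁ s e = Equation.lhs e [ s ] ≈ Equation.rhs e [ s ]

  opaque
    holds→solves₁ : ∀ {T Xs} {s : T ⇒ ∏ Xs} (e : Edge Xs) → Holds (λ {X} i → γ X [ proj i ∘ s ]) e → Solves₁ s (edgeEquation e)
    holds→solves₁ (natural i j f) p = ≈-trans []-• (≈-trans (•-resp []-const []-∘) (≈-trans p (≈-sym (≈-trans []-• (•-resp []-∘ []-const)))))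
    holds→solves₁ (fixed X₀ i)    p = ≈-trans []-∘ (≈-trans p (≈-sym []-π₂))

    solves₁→holds : ∀ {T Xs} {s : T ⇒ ∏ Xs} (e : Edge Xs) → Solves₁ s (edgeEquation e) → Holds (λ {X} i → γ X [ proj i ∘ s ]) e
    solves₁→holds (natural i j f) p = ≈-trans (≈-sym (≈-trans []-• (•-resp []-const []-∘))) (≈-trans p (≈-trans []-• (•-resp []-∘ []-const)))
    solves₁→holds (fixed X₀ i)    p = ≈-trans (≈-sym []-∘) (≈-trans p []-π₂)

    holds→solves : ∀ {T Xs} {s : T ⇒ ∏ Xs} (es : List (Edge Xs)) →
                   (∀ {e} → e ∈ es → Holds (λ {X} i → γ X [ proj i ∘ s ]) e) → Solves s (system es)
    holds→solves []       p = tt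
    holds→solves (e ∷ es) p = holds→solves₁ e (p (here refl)) , holds→solves es (λ i → p (there i))

    solves→holds : ∀ {T Xs} {s : T ⇒ ∏ Xs} (es : List (Edge Xs)) → Solves s (system es) →
                   ∀ {e} → e ∈ es → Holds (λ {X} i → γ X [ proj i ∘ s ]) e
    solves→holds (e ∷ es) (p , ps) (here refl) = solves₁→holds e p
    solves→holds (e ∷ es) (p , ps) (there i)   = solves→holds es ps i

  record Stage : Set u where
    constructor stage
    field
      nodes : List Obj
      edges : List (Edge nodes)

  module _ (D : Stage) where
    open Stage D
    edgeLocus : Locus (system edges)
    edgeLocus = loci (system edges)
    module L = Locus edgeLocus using (commute; incl; lift; mono; obj; solves)

    group : Obj
    group = L.obj

    coord : ∀ {X} → X ∈ nodes → group ⇒ A.obj X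
    coord i = proj i ∘ L.incl

    coordFamily : ∀ {X} → X ∈ nodes → IsoFam group X X
    coordFamily {X} i = A.family X [ coord i ]≅

    opaque
      coord-holds : ∀ {e} → e ∈ edges → Holds (families coord) e
      coord-holds = solves→holds edges L.solves

      coord-ext : ∀ {T} {x y : T ⇒ group} → (∀ {X} (i : X ∈ nodes) → coord i ∘ x ≈ coord i ∘ y) → x ≈ y
      coord-ext e = L.mono (∏-ext nodes (λ i → ≈-trans (≈-sym assoc) (≈-trans (e i) assoc)))

      coord-faithful : ∀ {T} {x y : T ⇒ group} → (∀ {X} (i : X ∈ nodes) → γ X [ coord i ] [ x ] ≈ γ X [ coord i ] [ y ]) → x ≈ y
      coord-faithful e = coord-ext (λ {X} i → A.faithful X _ _ (≈-trans (≈-sym []-∘) (≈-trans (e i) []-∘)))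

    private
      module _ {T} (x : Points T nodes) (p : ∀ {e} → e ∈ edges → Holds (families x) e) where
        solves : Solves (tuple nodes x) (system edges)
        solves = holds→solves edges (λ {e} i → holds-resp e (λ j → []-resp ≈-refl (≈-sym (proj-tuple x j))) (p i))

    opaque
      liftPoints : ∀ {T} (x : Points T nodes) (p : ∀ {e} → e ∈ edges → Holds (families x) e) →
                   Σ[ h ∈ T ⇒ group ] (∀ {X} (i : X ∈ nodes) → coord i ∘ h ≈ x i)
      liftPoints x p = L.lift (tuple nodes x) (solves x p) ,
        (λ i → ≈-trans assoc (≈-trans (refl⟩∘⟨ L.commute _ _) (proj-tuple x i)))

      liftFamilies : ∀ {T} (x : Points T nodes) (t : Families′ T nodes) → (∀ {X} (i : X ∈ nodes) → γ X [ x i ] ≈ t i) →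
                     (∀ {e} → e ∈ edges → Holds t e) →
                     Σ[ h ∈ T ⇒ group ] (∀ {X} (i : X ∈ nodes) → γ X [ coord i ] [ h ] ≈ t i)
      liftFamilies x t q p =
        let (h , e) = liftPoints x (λ {e} i → holds-resp e (λ j → ≈-sym (q j)) (p i))
        in h , λ i → ≈-trans ([]-[] (e i)) (q i)

      group-mul : Σ[ m ∈ group ⊠ group ⇒ group ] (∀ {X} (i : X ∈ nodes) →
                    γ X [ coord i ] [ m ] ≈ γ X [ coord i ] [ π₁ ] • γ X [ coord i ] [ π₂ ])
      group-mul = liftFamilies (λ {X} i → A.mul X ∘ ⟨ coord i ∘ π₁ , coord i ∘ π₂ ⟩) _
        (λ {X} i → ≈-trans (≈-sym []-∘) (≈-trans ([]-resp (A.family-mul X) ≈-refl) (≈-trans []-•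
          (•-resp (≈-trans ([]-[] project₁) (≈-sym []-∘)) (≈-trans ([]-[] project₂) (≈-sym []-∘))))))
        (λ {e} i → holds-• e (holds-[] e π₁ (coord-holds i)) (holds-[] e π₂ (coord-holds i)))

      group-unit : Σ[ m ∈ 𝟏 ⇒ group ] (∀ {X} (i : X ∈ nodes) → γ X [ coord i ] [ m ] ≈ π₂)
      group-unit = liftFamilies (λ {X} i → A.unit X) _ (λ {X} i → A.family-unit X) (λ {e} i → holds-id e)

      group-inv : Σ[ m ∈ group ⇒ group ] (∀ {X} (i : X ∈ nodes) → γ X [ coord i ] [ m ] ≈ IsoFam.from (coordFamily i))
      group-inv = liftFamilies (λ {X} i → A.inv X ∘ coord i) _
        (λ {X} i → ≈-trans (≈-sym []-∘) ([]-resp (A.family-inv X) ≈-refl))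
        (λ {e} i → holds-inverse coordFamily e (coord-holds i))

    groupAt : GroupObj c
    groupAt = groupObj c {J = Σ[ X ∈ Obj ] X ∈ nodes} {proj₁} (λ (X , i) → coordFamily i)
      (λ e → coord-faithful (λ {X} i → e (X , i)))
      (proj₁ group-mul) (proj₁ group-unit) (proj₁ group-inv)
      (λ (X , i) → proj₂ group-mul i) (λ (X , i) → proj₂ group-unit i) (λ (X , i) → proj₂ group-inv i)

  record Restriction (D D′ : Stage) : Set u where
    open Stage
    field
      restrict : group D′ ⇒ group D
      index    : ∀ {X} → X ∈ nodes D → X ∈ nodes D′
      agree    : ∀ {X} (i : X ∈ nodes D) → coord D i ∘ restrict ≈ coord D′ (index i)

  private
    module _ {D D′ : Stage} (r : Restriction D D′) where
      open Restriction r
      opaque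
        restrict-family : ∀ {X} (i : X ∈ Stage.nodes D) → γ X [ coord D i ] [ restrict ] ≈ γ X [ coord D′ (index i) ]
        restrict-family i = []-[] (agree i)

        restrict-mul : restrict ∘ proj₁ (group-mul D′) ≈ proj₁ (group-mul D) ∘ (restrict ⁂ restrict)
        restrict-mul = coord-faithful D (λ {X} i → ≈-trans (≈-sym []-∘) (≈-trans ([]-resp (restrict-family i) ≈-refl)
          (≈-trans (proj₂ (group-mul D′) (index i)) (≈-sym (≈-trans (≈-sym []-∘) (≈-trans ([]-resp (proj₂ (group-mul D) i) ≈-refl)
            (≈-trans []-• (•-resp (at i project₁) (at i project₂)))))))))
          where
          at : ∀ {X} (i : X ∈ Stage.nodes D) {π : group D ⊠ group D ⇒ group D} {π′ : group D′ ⊠ group D′ ⇒ group D′} →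
               π ∘ (restrict ⁂ restrict) ≈ restrict ∘ π′ →
               γ X [ coord D i ] [ π ] [ restrict ⁂ restrict ] ≈ γ X [ coord D′ (index i) ] [ π′ ]
          at i e = ≈-trans ([]-square e) ([]-resp (restrict-family i) ≈-refl)

  restrictHom : ∀ {D D′} → Restriction D D′ → GroupHom c (groupAt D′) (groupAt D)
  restrictHom r = record { hom = Restriction.restrict r ; hom-mul = restrict-mul r }

  Index : Category u u
  Index = index-category
    where
    open Category
    open Restriction
    index-category : Category u u
    index-category .Obj = Stage
    index-category ._⇒_ = Restriction
    index-category ._≈_ r s = Category._≈_ C (restrict r) (restrict s)
    index-category .id = record { restrict = Category.id C ; index = λ i → i ; agree = λ i → Category.identityʳ C }
    index-category ._∘_ r s = record
      { restrict = Category._∘_ C (restrict s) (restrict r) ; index = λ i → index r (index s i)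
      ; agree = λ i → Category.≈-trans C (Category.≈-sym C (Category.assoc C)) (Category.≈-trans C
          (Category._⟩∘⟨refl C (agree s i)) (agree r (index s i))) }
    index-category .equiv = record { refl = Category.≈-refl C ; sym = Category.≈-sym C ; trans = Category.≈-trans C }
    index-category .∘-resp-≈ p q = Category.∘-resp-≈ C q p
    index-category .assoc = Category.≈-sym C (Category.assoc C)
    index-category .identityˡ = Category.identityʳ C
    index-category .identityʳ = Category.identityˡ C

  restriction : ∀ {D D′} (σ : ∀ {X} → X ∈ Stage.nodes D → X ∈ Stage.nodes D′) →
                (∀ {e} → e ∈ Stage.edges D → Holds (λ {X} i → γ X [ coord D′ (σ i) ]) e) → Restriction D D′
  restriction {D} {D′} σ p =
    let (r , e) = liftPoints D (λ i → coord D′ (σ i)) p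
    in record { restrict = r ; index = σ ; agree = e }

  -- Identifying the images of the nodes of D along r and s, by edges labelled id, makes r and s equal.
  private
    identify : ∀ {Xs Ys} (r s : ∀ {X} → X ∈ Xs → X ∈ Ys) → List (Edge Ys)
    identify {[]}     r s = []
    identify {X ∷ Xs} r s = natural (r (here refl)) (s (here refl)) id ∷ identify (λ i → r (there i)) (λ i → s (there i))

    identify-∈ : ∀ {Xs Ys} (r s : ∀ {X} → X ∈ Xs → X ∈ Ys) {X} (i : X ∈ Xs) → natural (r i) (s i) id ∈ identify r s
    identify-∈ r s (here refl) = here refl
    identify-∈ r s (there i)   = there (identify-∈ (λ i → r (there i)) (λ i → s (there i)) i)

  Index-filtered : Filtered Index
  Index-filtered = record
    { point = stage [] []
    ; upperBound = upperBound
    ; coequalize = coequalize }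
    where
    upperBound : ∀ D D′ → Σ[ D″ ∈ Stage ] Restriction D D″ × Restriction D′ D″
    upperBound D D′ = D″
      , restriction ∈-++⁺ˡ (λ {e} i → holds-map ∈-++⁺ˡ e (coord-holds D″ (∈-++⁺ˡ (∈-map⁺ (mapEdge ∈-++⁺ˡ) i))))
      , restriction (∈-++⁺ʳ (Stage.nodes D)) (λ {e} i → holds-map (∈-++⁺ʳ (Stage.nodes D)) e
          (coord-holds D″ (∈-++⁺ʳ (map (mapEdge ∈-++⁺ˡ) (Stage.edges D)) (∈-map⁺ (mapEdge (∈-++⁺ʳ (Stage.nodes D))) i))))
      where
      D″ : Stage
      D″ = stage (Stage.nodes D ++ Stage.nodes D′)
        (map (mapEdge ∈-++⁺ˡ) (Stage.edges D) ++ map (mapEdge (∈-++⁺ʳ (Stage.nodes D))) (Stage.edges D′))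
    coequalize : ∀ {D D′} (r s : Restriction D D′) → Σ[ D″ ∈ Stage ] Σ[ t ∈ Restriction D′ D″ ]
                 Restriction.restrict r ∘ Restriction.restrict t ≈ Restriction.restrict s ∘ Restriction.restrict t
    coequalize {D} {D′} r s = D″ , t , coord-ext D (λ {X} i → ≈-trans (shift r i) (≈-trans (A.faithful X _ _ (identified i)) (≈-sym (shift s i))))
      where
      module D′ = Stage D′ using (edges; nodes)
      module r = Restriction r using (index)
      module s = Restriction s using (index)
      D″ : Stage
      D″ = stage D′.nodes (identify r.index s.index ++ D′.edges)
      t : Restriction D′ D″
      t = restriction (λ i → i) (λ i → coord-holds D″ (∈-++⁺ʳ (identify r.index s.index) i))
      module t = Restriction t using (agree; index; restrict)
      shift : (q : Restriction D D′) → ∀ {X} (i : X ∈ Stage.nodes D) →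
              coord D i ∘ Restriction.restrict q ∘ t.restrict ≈ coord D″ (t.index (Restriction.index q i))
      shift q i = ≈-trans (≈-sym assoc) (≈-trans (Restriction.agree q i ⟩∘⟨refl) (t.agree (Restriction.index q i)))
      identified : ∀ {X} (i : X ∈ Stage.nodes D) → γ X [ coord D″ (r.index i) ] ≈ γ X [ coord D″ (s.index i) ]
      identified i = ≈-trans (≈-sym (≈-trans const-• identityˡ)) (≈-trans (coord-holds D″ (∈-++⁺ˡ (identify-∈ r.index s.index i)))
        (≈-trans (•-resp ≈-refl identityˡ) •-identityʳ))

  proGroup : Category.Obj (ProGroup c)
  proGroup = record
    { index = Index ; filtered = Index-filtered
    ; diagram = record
      { F₀ = groupAt ; F₁ = restrictHom ; F-resp-≈ = λ e → e
      ; identity = ≈-refl ; homomorphism = ≈-refl } }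

module Properties {C : Category o ℓ} (c : Cartesian C) where
  open Category C
  open Cartesian c
  open Families c

  Monic : ∀ {A B} → A ⇒ B → Set (o ⊔ ℓ)
  Monic {A} m = ∀ {T} {x y : T ⇒ A} → m ∘ x ≈ m ∘ y → x ≈ y

  LiftsThrough : ∀ {A E} → E ⇒ A → System A → Set (o ⊔ ℓ)
  LiftsThrough {A} {E} m sys = ∀ {T} (s : T ⇒ A) → Solves s sys → Σ[ h ∈ T ⇒ E ] m ∘ h ≈ s

  Realizes : ∀ {X Y Z K} → Z ⊠ X ⇒ Y → K ⊠ X ⇒ X → Set (o ⊔ ℓ)
  Realizes {X} {Z = Z} {K} ζ γ = ∀ {T} (t : IsoFam T X X) (s : IsoFam T Z Z) →
    Invariant c ζ (IsoFam.to s) (IsoFam.to t) → Σ[ h ∈ T ⇒ K ] γ [ h ] ≈ IsoFam.to t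

record Transfer {C : Category o ℓ} {D : Category o′ ℓ′} (c : Cartesian C) (d : Cartesian D)
                (Φ : Functor C D) (pres : PreservesFiniteProducts Φ) : Set (o ⊔ o′ ⊔ ℓ ⊔ ℓ′) where
  private
    module PC = Properties c using (LiftsThrough; Monic; Realizes)
    module PD = Properties d using (LiftsThrough; Monic; Realizes)
    module C = Category C using (_⇒_)
    module c = Cartesian c using (_⊠_)
    module FC = Families c using (Faithful; System)
    module FD = Families d using (Faithful)
  open Functor Φ
  open Hat c d Φ pres
  field
    mono     : ∀ {A B} {m : A C.⇒ B} → PC.Monic m → PD.Monic (F₁ m)
    lifts    : ∀ {A E} {m : E C.⇒ A} (sys : FC.System A) → PC.Monic m → PC.LiftsThrough m sys →
               PD.LiftsThrough (F₁ m) (hatSystem sys)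
    faithful : ∀ {K X Y} {γ : K c.⊠ X C.⇒ Y} → FC.Faithful γ → FD.Faithful (hat γ)
    realizes : ∀ {X Y Z K} {ζ : Z c.⊠ X C.⇒ Y} {γ : K c.⊠ X C.⇒ X} → FC.Faithful γ → PC.Realizes ζ γ →
               PD.Realizes (hat ζ) (hat γ)

module Representation {C₀ C : Category u u} (I : Functor C₀ C) (c : Cartesian C)
  (loci : ∀ {A} (sys : Families.System c A) → Families.Locus c sys)
  (auts : ∀ X → Automorphisms I c X)
  {E : Category o ℓ} (e : Cartesian E) (Φ : Functor C E) (pres : PreservesFiniteProducts Φ)
  (transfer : Transfer c e Φ pres) where
  private
    module C = Category C using (Obj; _⇒_)
    module c = Cartesian c using (_⊠_; isTerminal; π₁; π₂)
    module FC = Families c using (_[_]; _[_]≅; const)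
    module I = Functor I using (F₀)
  open Category E
  open Cartesian e
  open Functor Φ
  open Families e
  open Hat c e Φ pres
  open Stages I c loci auts
  open Transfer transfer

  record LimitCone : Set (u ⊔ o ⊔ ℓ) where
    field
      apex       : Obj
      leg        : ∀ D → apex ⇒ F₀ (group D)
      leg-natural : ∀ {D D′} (r : Restriction D D′) → F₁ (Restriction.restrict r) ∘ leg D′ ≈ leg D
      limit      : ∀ {T} (h : ∀ D → T ⇒ F₀ (group D)) → (∀ {D D′} (r : Restriction D D′) → F₁ (Restriction.restrict r) ∘ h D′ ≈ h D) →
                   Σ[ k ∈ T ⇒ apex ] (∀ D → leg D ∘ k ≈ h D)
      leg-ext    : ∀ {T} {x y : T ⇒ apex} → (∀ D → leg D ∘ x ≈ leg D ∘ y) → x ≈ y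
      mul        : apex ⊠ apex ⇒ apex
      leg-mul    : ∀ D → leg D ∘ mul ≈ F₁ (proj₁ (group-mul D)) ∘ φ ∘ (leg D ⁂ leg D)

  γ̂ : ∀ X → F₀ (A.obj X) ⊠ F₀ X ⇒ F₀ X
  γ̂ X = hat (γ X)

  γ̂≅ : ∀ X → IsoFam (F₀ (A.obj X)) (F₀ X) (F₀ X)
  γ̂≅ X = hat≅ (A.family X)

  private
    opaque
      product-lift : ∀ {T} Xs (x : ∀ {X} → X ∈ Xs → T ⇒ F₀ (A.obj X)) →
                     Σ[ s ∈ T ⇒ F₀ (∏ Xs) ] (∀ {X} (i : X ∈ Xs) → F₁ (proj i) ∘ s ≈ x i)
      product-lift [] x = IsTerminal.! (PreservesFiniteProducts.terminal pres c.isTerminal) , λ ()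
      product-lift {T} (X ∷ Xs) x = ⟪ x (here refl) , proj₁ rest ⟫ , at
        where
        rest : Σ[ s ∈ T ⇒ F₀ (∏ Xs) ] (∀ {X} (i : X ∈ Xs) → F₁ (proj i) ∘ s ≈ x (there i))
        rest = product-lift Xs (λ i → x (there i))
        at : ∀ {X′} (i : X′ ∈ X ∷ Xs) → F₁ (proj i) ∘ ⟪ x (here refl) , proj₁ rest ⟫ ≈ x i
        at (here refl) = π₁-⟪⟫
        at (there i)   = ≈-trans (homomorphism ⟩∘⟨refl) (≈-trans assoc (≈-trans (refl⟩∘⟨ π₂-⟪⟫) (proj₂ rest i)))

      product-ext : ∀ {T} Xs {x y : T ⇒ F₀ (∏ Xs)} → (∀ {X} (i : X ∈ Xs) → F₁ (proj i) ∘ x ≈ F₁ (proj i) ∘ y) → x ≈ y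
      product-ext [] p = ≈-trans (≈-sym (F𝟏.!-unique _)) (F𝟏.!-unique _)
        where module F𝟏 = IsTerminal (PreservesFiniteProducts.terminal pres c.isTerminal) using (!-unique)
      product-ext (X ∷ Xs) p = φ-ext (p (here refl)) (product-ext Xs (λ i → ≈-trans (≈-sym assoc)
        (≈-trans (≈-sym homomorphism ⟩∘⟨refl) (≈-trans (p (there i)) (≈-trans (homomorphism ⟩∘⟨refl) assoc)))))

      coord-hat-ext : ∀ D {T} {x y : T ⇒ F₀ (group D)} →
                      (∀ {X} (i : X ∈ Stage.nodes D) → γ̂ X [ F₁ (coord D i) ∘ x ] ≈ γ̂ X [ F₁ (coord D i) ∘ y ]) → x ≈ y
      coord-hat-ext D p = mono (L.mono D) (product-ext (Stage.nodes D) (λ {X} i →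
        ≈-trans (≈-sym assoc) (≈-trans (≈-sym homomorphism ⟩∘⟨refl) (≈-trans (faithful (A.faithful X) _ _ (p i))
          (≈-trans (homomorphism ⟩∘⟨refl) assoc)))))

  HatHolds : ∀ {T Xs} → (∀ {X} → X ∈ Xs → T ⊠ F₀ X ⇒ F₀ X) → Edge Xs → Set ℓ
  HatHolds t (natural i j f) = const (F₁ f) • t i ≈ t j • const (F₁ f)
  HatHolds t (fixed X₀ i)    = t i ≈ π₂

  private
    opaque
      hat-solves : ∀ {T Xs} {s : T ⇒ F₀ (∏ Xs)} (es : List (Edge Xs)) →
                   (∀ {e} → e ∈ es → HatHolds (λ {X} i → γ̂ X [ F₁ (proj i) ∘ s ]) e) → Solves s (hatSystem (system es))
      hat-solves [] p = tt
      hat-solves {s = s} (natural i j f ∷ es) p = ≈-trans (≈-trans ([]-resp hat-• ≈-refl) []-•)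
        (≈-trans (•-resp const-s (hat-at ≈-refl)) (≈-trans (p (here refl))
          (≈-sym (≈-trans (≈-trans ([]-resp hat-• ≈-refl) []-•) (•-resp (hat-at ≈-refl) const-s))))) , hat-solves es (λ i → p (there i))
        where
        const-s : ∀ {X Y} {f : X C.⇒ Y} → hat (FC.const f) [ s ] ≈ const (F₁ f)
        const-s = ≈-trans ([]-resp hat-const ≈-refl) []-const
      hat-solves {s = s} (fixed X₀ i ∷ es) p = ≈-trans (hat-at ≈-refl) (≈-trans (p (here refl))
        (≈-sym (≈-trans ([]-resp hat-π₂ ≈-refl) []-π₂))) , hat-solves es (λ i → p (there i))

      hat-holds : ∀ {T Xs A} {t : ∀ {X} → X ∈ Xs → A c.⊠ X C.⇒ X} (s : T ⇒ F₀ A) (e : Edge Xs) → Holds t e → HatHolds (λ i → hat (t i) [ s ]) e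
      hat-holds s (natural i j f) p = ≈-trans (•-resp (≈-sym const-s) ≈-refl) (≈-trans (≈-sym (≈-trans ([]-resp hat-• ≈-refl) []-•))
        (≈-trans ([]-resp (hat-resp p) ≈-refl) (≈-trans (≈-trans ([]-resp hat-• ≈-refl) []-•) (•-resp ≈-refl const-s))))
        where
        const-s : ∀ {X Y} {f : X C.⇒ Y} → hat (FC.const f) [ s ] ≈ const (F₁ f)
        const-s = ≈-trans ([]-resp hat-const ≈-refl) []-const
      hat-holds s (fixed X₀ i) p = ≈-trans ([]-resp (hat-resp p) ≈-refl) (≈-trans ([]-resp hat-π₂ ≈-refl) []-π₂)

      hatHolds-resp : ∀ {T Xs} {t s : ∀ {X} → X ∈ Xs → T ⊠ F₀ X ⇒ F₀ X} (e : Edge Xs) → (∀ {X} (i : X ∈ Xs) → t i ≈ s i) →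
                      HatHolds t e → HatHolds s e
      hatHolds-resp (natural i j f) q p = ≈-trans (•-resp ≈-refl (≈-sym (q i))) (≈-trans p (•-resp (q j) ≈-refl))
      hatHolds-resp (fixed X₀ i)    q p = ≈-trans (≈-sym (q i)) p

      stage-lift : ∀ D {T} (x : ∀ {X} → X ∈ Stage.nodes D → T ⇒ F₀ (A.obj X)) →
                   (∀ {e} → e ∈ Stage.edges D → HatHolds (λ {X} i → γ̂ X [ x i ]) e) →
                   Σ[ h ∈ T ⇒ F₀ (group D) ] (∀ {X} (i : X ∈ Stage.nodes D) → F₁ (coord D i) ∘ h ≈ x i)
      stage-lift D {T} x p = proj₁ lifted , λ i → ≈-trans (homomorphism ⟩∘⟨refl) (≈-trans assoc (≈-trans (refl⟩∘⟨ proj₂ lifted) (proj₂ tupled i)))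
        where
        tupled : Σ[ s ∈ T ⇒ F₀ (∏ (Stage.nodes D)) ] (∀ {X} (i : X ∈ Stage.nodes D) → F₁ (proj i) ∘ s ≈ x i)
        tupled = product-lift (Stage.nodes D) x
        lifted : Σ[ h ∈ T ⇒ F₀ (group D) ] F₁ (L.incl D) ∘ h ≈ proj₁ tupled
        lifted = lifts (system (Stage.edges D)) (L.mono D) (λ s q → L.lift D s q , L.commute D s q) (proj₁ tupled)
          (hat-solves (Stage.edges D) (λ {e} i → hatHolds-resp e (λ j → []-resp ≈-refl (≈-sym (proj₂ tupled j))) (p i)))

  single : C.Obj → Stage
  single X = stage (X ∷ []) []

  singleton : ∀ {D X} → X ∈ Stage.nodes D → Restriction (single X) D
  singleton {D} {X} i = restriction σ (λ ())
    where
    σ : ∀ {X′} → X′ ∈ X ∷ [] → X′ ∈ Stage.nodes D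
    σ (here refl) = i

  Autᴱ : Obj → Set _
  Autᴱ = Aut e Φ I

  module _ {T : Obj} (t : Autᴱ T) where
    private module t = Aut t using (act; fixes; inv; isoʳ; isoˡ; natural)

    autFamily : ∀ X → IsoFam T (F₀ X) (F₀ X)
    autFamily X = Isos.mk≅ (Fam T) (t.act X) (π₂ ∘ t.inv)
      (≈-trans (•-resp ≈-refl (≈-sym project₂)) (over-inverse e project₁ t.isoˡ))
      (≈-trans (•-resp (≈-sym project₂) ≈-refl) (over-inverse e over t.isoʳ))
      where
      opaque
        over : π₁ ∘ t.inv {X} ≈ π₁
        over = ≈-trans (≈-sym project₁ ⟩∘⟨refl) (≈-trans assoc (≈-trans (refl⟩∘⟨ t.isoʳ) identityʳ))

    opaque
      aut-invariant : ∀ X → Invariant e (hat (A.ζ X)) (t.act (A.aux X)) (t.act X)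
      aut-invariant X = begin
        (F₁ (A.ζ X) ∘ φ) ∘ ⟨ t.act (A.aux X) ∘ (id ⁂ π₁) , t.act X ∘ (id ⁂ π₂) ⟩   ≈⟨ assoc ⟩
        F₁ (A.ζ X) ∘ ⟪ t.act (A.aux X) ∘ (id ⁂ π₁) , t.act X ∘ (id ⁂ π₂) ⟫         ≈⟨ refl⟩∘⟨ paired ⟩
        F₁ (A.ζ X) ∘ t.act (A.aux X c.⊠ X) ∘ (id ⁂ φ)                             ≈⟨ ≈-trans (≈-sym assoc) (t.natural (A.ζ X) ⟩∘⟨refl) ⟩
        (t.act (I.F₀ (A.target X)) ∘ (id ⁂ F₁ (A.ζ X))) ∘ (id ⁂ φ)                ≈⟨ (t.fixes (A.target X) ⟩∘⟨refl) ⟩∘⟨refl ⟩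
        (π₂ ∘ (id ⁂ F₁ (A.ζ X))) ∘ (id ⁂ φ)                                       ≈⟨ ≈-trans (project₂ ⟩∘⟨refl) (≈-trans assoc (≈-trans (refl⟩∘⟨ project₂) (≈-sym assoc))) ⟩
        hat (A.ζ X) ∘ π₂                                                          ∎
        where
        component : ∀ {Y} (p : A.aux X c.⊠ X C.⇒ Y) {q : F₀ (A.aux X) ⊠ F₀ X ⇒ F₀ Y} → F₁ p ∘ φ ≈ q →
                    F₁ p ∘ t.act (A.aux X c.⊠ X) ∘ (id ⁂ φ) ≈ t.act Y ∘ (id ⁂ q)
        component p r = ≈-trans (≈-sym assoc) (≈-trans (t.natural p ⟩∘⟨refl) (≈-trans assoc (refl⟩∘⟨
          ≈-trans ⁂∘⁂ (⁂-resp identityˡ r))))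
        paired : ⟪ t.act (A.aux X) ∘ (id ⁂ π₁) , t.act X ∘ (id ⁂ π₂) ⟫ ≈ t.act (A.aux X c.⊠ X) ∘ (id ⁂ φ)
        paired = φ-ext (≈-trans π₁-⟪⟫ (≈-sym (component c.π₁ π₁-φ))) (≈-trans π₂-⟪⟫ (≈-sym (component c.π₂ π₂-φ)))

      aut-point : ∀ X → Σ[ h ∈ T ⇒ F₀ (A.obj X) ] γ̂ X [ h ] ≈ t.act X
      aut-point X = realizes (A.faithful X) (A.realize X) (autFamily X) (autFamily (A.aux X)) (aut-invariant X)

      aut-holds : ∀ {Xs} (e : Edge Xs) → HatHolds (λ {X} i → γ̂ X [ proj₁ (aut-point X) ]) e
      aut-holds (natural {X} {Y} i j f) = ≈-trans (•-resp ≈-refl (proj₂ (aut-point X))) (≈-trans const-• (≈-trans (t.natural f)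
        (≈-trans (refl⟩∘⟨ ⟨⟩-resp identityˡ ≈-refl) (•-resp (≈-sym (proj₂ (aut-point Y))) ≈-refl))))
      aut-holds (fixed X₀ i) = ≈-trans (proj₂ (aut-point (I.F₀ X₀))) (t.fixes X₀)

      aut-stage : ∀ D → Σ[ h ∈ T ⇒ F₀ (group D) ] (∀ {X} (i : X ∈ Stage.nodes D) → F₁ (coord D i) ∘ h ≈ proj₁ (aut-point X))
      aut-stage D = stage-lift D (λ {X} i → proj₁ (aut-point X)) (λ {e} i → aut-holds e)

      aut-stage-natural : ∀ {D D′} (r : Restriction D D′) → F₁ (Restriction.restrict r) ∘ proj₁ (aut-stage D′) ≈ proj₁ (aut-stage D)
      aut-stage-natural {D} {D′} r = coord-hat-ext D (λ i → []-resp ≈-refl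
        (≈-trans (≈-sym assoc) (≈-trans (≈-trans (≈-sym homomorphism) (F-resp-≈ (Restriction.agree r i)) ⟩∘⟨refl)
          (≈-trans (proj₂ (aut-stage D′) (Restriction.index r i)) (≈-sym (proj₂ (aut-stage D) i))))))

  module _ (U : LimitCone) where
    private module U = LimitCone U using (apex; leg; leg-ext; leg-mul; leg-natural; limit; mul)

    component : ∀ {T} (h : T ⇒ U.apex) X → T ⇒ F₀ (A.obj X)
    component h X = F₁ (coord (single X) (here refl)) ∘ U.leg (single X) ∘ h

    opaque
      component-at : ∀ {T} (h : T ⇒ U.apex) {D X} (i : X ∈ Stage.nodes D) → F₁ (coord D i) ∘ U.leg D ∘ h ≈ component h X
      component-at h {D} i = ≈-sym (≈-trans (refl⟩∘⟨ (≈-sym (U.leg-natural (singleton {D} i)) ⟩∘⟨refl))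
        (≈-trans (refl⟩∘⟨ assoc) (≈-trans (≈-sym assoc) (≈-trans (≈-sym homomorphism) (F-resp-≈ (Restriction.agree (singleton {D} i) (here refl))) ⟩∘⟨refl))))

      component-holds : ∀ {T} (h : T ⇒ U.apex) D {e} → e ∈ Stage.edges D → HatHolds (λ {X} i → γ̂ X [ component h X ]) e
      component-holds h D {e} i = hatHolds-resp e (λ j → ≈-trans (hat-at ≈-refl) ([]-resp ≈-refl (component-at h j)))
        (hat-holds (U.leg D ∘ h) e (coord-holds D i))

    action : ∀ {T} (h : T ⇒ U.apex) X → IsoFam T (F₀ X) (F₀ X)
    action h X = γ̂≅ X [ component h X ]≅

    act : ∀ {T} (h : T ⇒ U.apex) X → T ⊠ F₀ X ⇒ F₀ X
    act h X = γ̂ X [ component h X ]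

    opaque
      act-natural : ∀ {T} (h : T ⇒ U.apex) {X Y} (f : X C.⇒ Y) → F₁ f ∘ act h X ≈ act h Y ∘ (id ⁂ F₁ f)
      act-natural h {X} {Y} f = ≈-trans (≈-sym const-•) (≈-trans
        (component-holds h (stage (X ∷ Y ∷ []) (natural (here refl) (there (here refl)) f ∷ [])) (here refl))
        (refl⟩∘⟨ ⟨⟩-resp (≈-sym identityˡ) ≈-refl))

      act-fixes : ∀ {T} (h : T ⇒ U.apex) X₀ → act h (I.F₀ X₀) ≈ π₂
      act-fixes h X₀ = component-holds h (stage (I.F₀ X₀ ∷ []) (fixed X₀ (here refl) ∷ [])) (here refl)

    toAut : ∀ {T} → T ⇒ U.apex → Autᴱ T
    toAut h = record
      { act = act h
      ; natural = act-natural h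
      ; invertible = λ X → record { inv = ⟨ π₁ , IsoFam.from (action h X) ⟩
          ; isoˡ = ⟨π₁,⟩-inverse e (IsoFam.from∘to (action h X)) ; isoʳ = ⟨π₁,⟩-inverse e (IsoFam.to∘from (action h X)) }
      ; fixes = act-fixes h }

    opaque
      fromAut : ∀ {T} → Autᴱ T → T ⇒ U.apex
      fromAut t = proj₁ (U.limit (λ D → proj₁ (aut-stage t D)) (aut-stage-natural t))

      leg-fromAut : ∀ {T} (t : Autᴱ T) D → U.leg D ∘ fromAut t ≈ proj₁ (aut-stage t D)
      leg-fromAut t = proj₂ (U.limit (λ D → proj₁ (aut-stage t D)) (aut-stage-natural t))

      act-resp : ∀ {T} {h k : T ⇒ U.apex} → h ≈ k → ∀ X → act h X ≈ act k X
      act-resp p X = []-resp ≈-refl (refl⟩∘⟨ refl⟩∘⟨ p)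

      act-fromAut : ∀ {T} (t : Autᴱ T) X → act (fromAut t) X ≈ Aut.act t X
      act-fromAut t X = ≈-trans ([]-resp ≈-refl (≈-trans (refl⟩∘⟨ leg-fromAut t (single X)) (proj₂ (aut-stage t (single X)) (here refl))))
        (proj₂ (aut-point t X))

      act-injective : ∀ {T} {h k : T ⇒ U.apex} → (∀ X → act h X ≈ act k X) → h ≈ k
      act-injective {h = h} {k} p = U.leg-ext (λ D → coord-hat-ext D (λ {X} i →
        ≈-trans ([]-resp ≈-refl (component-at h i)) (≈-trans (p X) ([]-resp ≈-refl (≈-sym (component-at k i))))))

      act-∘ : ∀ {S T} (f : S ⇒ T) (h : T ⇒ U.apex) X → act (h ∘ f) X ≈ act h X ∘ (f ⁂ id)
      act-∘ f h X = ≈-trans ([]-resp ≈-refl (≈-sym (≈-trans assoc (refl⟩∘⟨ assoc)))) (≈-sym []-∘)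

      act-mul : ∀ {T} (f g : T ⇒ U.apex) X → act (U.mul ∘ ⟨ f , g ⟩) X ≈ act f X • act g X
      act-mul f g X = begin
        γ̂ X [ F₁ p ∘ U.leg D ∘ U.mul ∘ ⟨ f , g ⟩ ]                    ≈⟨ []-resp ≈-refl (refl⟩∘⟨ mul-⟪⟫) ⟩
        γ̂ X [ F₁ p ∘ F₁ m ∘ ⟪ U.leg D ∘ f , U.leg D ∘ g ⟫ ]           ≈⟨ ≈-sym (≈-trans (hat-at ≈-refl) (hat-at ≈-refl)) ⟩
        hat (γ X FC.[ p ] FC.[ m ]) [ ⟪ U.leg D ∘ f , U.leg D ∘ g ⟫ ]  ≈⟨ []-resp (≈-trans (hat-resp (proj₂ (group-mul D) (here refl))) hat-•) ≈-refl ⟩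
        (hat (γ X FC.[ p ] FC.[ c.π₁ ]) • hat (γ X FC.[ p ] FC.[ c.π₂ ])) [ ⟪ U.leg D ∘ f , U.leg D ∘ g ⟫ ]
                                                                      ≈⟨ ≈-trans []-• (•-resp (≈-trans (hat-at π₁-⟪⟫) (hat-at ≈-refl)) (≈-trans (hat-at π₂-⟪⟫) (hat-at ≈-refl))) ⟩
        act f X • act g X                                             ∎
        where
        D : Stage
        D = single X
        p : group D C.⇒ A.obj X
        p = coord D (here refl)
        m : group D c.⊠ group D C.⇒ group D
        m = proj₁ (group-mul D)
        mul-⟪⟫ : U.leg D ∘ U.mul ∘ ⟨ f , g ⟩ ≈ F₁ m ∘ ⟪ U.leg D ∘ f , U.leg D ∘ g ⟫
        mul-⟪⟫ = ≈-trans (≈-sym assoc) (≈-trans (U.leg-mul D ⟩∘⟨refl) (≈-trans assoc (refl⟩∘⟨ ≈-trans assoc (refl⟩∘⟨ ⁂∘⟨⟩))))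

    aut-inverse : ∀ T → Inverse (hom-setoid T U.apex) (Group.setoid (AutGroup e Φ I T))
    aut-inverse T = record
      { to = toAut ; from = fromAut
      ; to-cong = λ p → act-resp p
      ; from-cong = λ {s} {t} p → act-injective (λ X → ≈-trans (act-fromAut s X) (≈-trans (p X) (≈-sym (act-fromAut t X))))
      ; inverse = (λ {t} {h} p X → ≈-trans (act-resp p X) (act-fromAut t X))
                , (λ {h} {t} p → act-injective (λ X → ≈-trans (act-fromAut t X) (p X))) }

module _ {C : Category o ℓ} {D : Category o′ ℓ′} {E : Category o″ ℓ″} (c : Cartesian C) (d : Cartesian D) (e : Cartesian E)
         {Φ : Functor C D} {Ψ : Functor D E} (Φ-pres : PreservesFiniteProducts Φ) (Ψ-pres : PreservesFiniteProducts Ψ) where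
  private
    module Φ = PreservesFiniteProducts Φ-pres using (product; terminal)
    module Ψ = PreservesFiniteProducts Ψ-pres using (product; terminal)
    module C = Category C using (_⇒_)
    module c = Cartesian c using (_⊠_)
    module FC = Families c
    module FΨ = Functor Ψ using (F-resp-≈; F₀; F₁; homomorphism)
    module FΦ = Functor Φ using (F₀; F₁)

  ∘-preserves : PreservesFiniteProducts (Ψ ∘F Φ)
  ∘-preserves = record { terminal = λ t → Ψ.terminal (Φ.terminal t) ; product = λ p → Ψ.product (Φ.product p) }

  private
    module HΦ = Hat c d Φ Φ-pres using (hat; hatSystem; π₁-φ; π₂-φ)
    module HΨ = Hat d e Ψ Ψ-pres using (hat; hatSystem; π₁-φ; π₂-φ; φ)
    module H = Hat c e (Ψ ∘F Φ) ∘-preserves using (hat; hatSystem; π₁-φ; π₂-φ; φ; φ-ext)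
  open Category E
  open Cartesian e using (_⊠_)
  open Families e

  opaque
    hat-comp : ∀ {A X Y} (g : A c.⊠ X C.⇒ Y) → HΨ.hat (HΦ.hat g) ≈ H.hat g
    hat-comp g = ≈-trans (FΨ.homomorphism ⟩∘⟨refl) (≈-trans assoc (refl⟩∘⟨ H.φ-ext
      (≈-trans (at HΦ.π₁-φ) (≈-trans HΨ.π₁-φ (≈-sym H.π₁-φ)))
      (≈-trans (at HΦ.π₂-φ) (≈-trans HΨ.π₂-φ (≈-sym H.π₂-φ)))))
      where
      open Category D using () renaming (_⇒_ to _⇒ᴰ_; _∘_ to _∘ᴰ_; _≈_ to _≈ᴰ_)
      at : ∀ {A B D} {p : A ⇒ᴰ B} {q : D ⇒ᴰ A} {r : D ⇒ᴰ B} {T} {x : T ⇒ FΨ.F₀ D} → p ∘ᴰ q ≈ᴰ r → FΨ.F₁ p ∘ FΨ.F₁ q ∘ x ≈ FΨ.F₁ r ∘ x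
      at q = ≈-trans (≈-sym assoc) (≈-trans (≈-sym FΨ.homomorphism) (FΨ.F-resp-≈ q) ⟩∘⟨refl)

    hat-comp-∘ : ∀ {A X Y T} (g : A c.⊠ X C.⇒ Y) {r : T ⇒ FΨ.F₀ (FΦ.F₀ A) ⊠ FΨ.F₀ (FΦ.F₀ X)} →
                 FΨ.F₁ (HΦ.hat g) ∘ HΨ.φ ∘ r ≈ FΨ.F₁ (FΦ.F₁ g) ∘ H.φ ∘ r
    hat-comp-∘ g = ≈-trans (≈-sym assoc) (≈-trans (hat-comp g ⟩∘⟨refl) assoc)

    hat-comp-solves : ∀ {A T} {s : T ⇒ FΨ.F₀ (FΦ.F₀ A)} (sys : FC.System A) → Solves s (H.hatSystem sys) → Solves s (HΨ.hatSystem (HΦ.hatSystem sys))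
    hat-comp-solves []       _        = tt
    hat-comp-solves (q ∷ sys) (p , ps) = ≈-trans ([]-resp (hat-comp (FC.Equation.lhs q)) ≈-refl)
      (≈-trans p ([]-resp (≈-sym (hat-comp (FC.Equation.rhs q))) ≈-refl)) , hat-comp-solves sys ps

  transfer-∘ : Transfer c d Φ Φ-pres → Transfer d e Ψ Ψ-pres → Transfer c e (Ψ ∘F Φ) ∘-preserves
  transfer-∘ S T = record
    { mono = λ m → T.mono (S.mono m)
    ; lifts = λ sys m l s p → T.lifts (HΦ.hatSystem sys) (S.mono m) (S.lifts sys m l) s (hat-comp-solves sys p)
    ; faithful = λ {K} {X} {Y} {γ} f x y p → T.faithful (S.faithful f) x y
        (≈-trans ([]-resp (hat-comp γ) ≈-refl) (≈-trans p ([]-resp (≈-sym (hat-comp γ)) ≈-refl)))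
    ; realizes = λ {X} {Y} {Z} {K} {ζ} {γ} f r t s p →
        let (h , q) = T.realizes (S.faithful f) (S.realizes f r) t s
                        (≈-trans (hat-comp ζ ⟩∘⟨refl) (≈-trans p (≈-sym (hat-comp ζ) ⟩∘⟨refl)))
        in h , ≈-trans ([]-resp (≈-sym (hat-comp γ)) ≈-refl) q }
    where
    module S = Transfer S using (faithful; lifts; mono; realizes)
    module T = Transfer T using (faithful; lifts; mono; realizes)

module _ {C : Category o ℓ} (c : Cartesian C) where
  open Category C
  open Cartesian c
  open Families c
  open Properties c
  open IndElements {C = C}
  private
    module I = Category (Ind C) using (_∘_; _≈_)
    ic = Ind-cartesian c
    module ic = Cartesian ic using (_⊠_)
    module FI = Families ic
    open Hat c ic ι (ι-preserves c)

  opaque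
    same-ι : ∀ {X Z} {x y : El (ι₀ X) Z} → SameEl (ι₀ X) x y → proj₂ x ≈ proj₂ y
    same-ι (same _ _ p) = ≈-trans (≈-sym identityˡ) (≈-trans p identityˡ)

  private
    module _ {T : IndObj C} where
      private module T = IndObj T using (ob; tr; _↝_)

      at : ∀ {X} → IndHom T (ι₀ X) → ∀ j → T.ob j ⇒ X
      at x j = proj₂ (IndHom.comp x j)

      at⊠ : ∀ {X Y} → IndHom (T ic.⊠ ι₀ X) (ι₀ Y) → ∀ j → T.ob j ⊠ X ⇒ Y
      at⊠ g j = proj₂ (IndHom.comp g (j , tt))

      opaque
        at-tr : ∀ {X Y} (g : IndHom (T ic.⊠ ι₀ X) (ι₀ Y)) {i j} (a : i T.↝ j) → at⊠ g j [ T.tr a ] ≈ at⊠ g i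
        at-tr g a = same-ι (IndHom.compat g (a , tt))

        at-hat : ∀ {A X Y} (g : A ⊠ X ⇒ Y) (s : IndHom T (ι₀ A)) j → at⊠ (hat g FI.[ s ]) j ≈ g [ at s j ]
        at-hat g s j = ≈-trans (refl⟩∘⟨ ⟨π₁,π₂⟩) identityʳ ⟩∘⟨refl

        at-solves : ∀ {A} {s : IndHom T (ι₀ A)} (sys : System A) → FI.Solves s (hatSystem sys) → ∀ j → Solves (at s j) sys
        at-solves []          _        j = tt
        at-solves {s = s} (q ∷ sys) (p , ps) j = ≈-trans (≈-sym (at-hat (Equation.lhs q) s j)) (≈-trans (same-ι (p (j , tt))) (at-hat (Equation.rhs q) s j))
          , at-solves sys ps j

      glue : ∀ {X} (x : ∀ j → T.ob j ⇒ X) → (∀ {i j} (a : i T.↝ j) → x j ∘ T.tr a ≈ x i) → IndHom T (ι₀ X)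
      glue {X} x p = record { comp = λ j → tt , x j ; compat = λ a → El-≈ (ι₀ X) (p a) }

      lift-ι : ∀ {A E} {m : E ⇒ A} (sys : System A) → Monic m → LiftsThrough m sys →
               (s : IndHom T (ι₀ A)) → FI.Solves s (hatSystem sys) → Σ[ h ∈ IndHom T (ι₀ E) ] ι₁ m I.∘ h I.≈ s
      lift-ι {A} {E} {m} sys mono lifts s p = glue (λ j → proj₁ (l j))
          (λ a → mono (≈-trans (≈-sym assoc) (≈-trans (proj₂ (l _) ⟩∘⟨refl)
            (≈-trans (same-ι (IndHom.compat s a)) (≈-sym (proj₂ (l _)))))))
        , (λ j → El-≈ (ι₀ A) (proj₂ (l j)))
        where
        l : ∀ j → Σ[ h ∈ T.ob j ⇒ E ] m ∘ h ≈ at s j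
        l j = lifts (at s j) (at-solves sys p j)

      at-iso : ∀ {X} → FI.IsoFam T (ι₀ X) (ι₀ X) → ∀ j → IsoFam (T.ob j) X X
      at-iso t j = Isos.mk≅ (Fam (T.ob j)) (at⊠ (FI.IsoFam.to t) j) (at⊠ (FI.IsoFam.from t) j)
        (same-ι (FI.IsoFam.from∘to t (j , tt))) (same-ι (FI.IsoFam.to∘from t (j , tt)))

      realize-ι : ∀ {X Y Z K} {ζ : Z ⊠ X ⇒ Y} {γ : K ⊠ X ⇒ X} → Faithful γ → Realizes ζ γ →
                  (t : FI.IsoFam T (ι₀ X) (ι₀ X)) (s : FI.IsoFam T (ι₀ Z) (ι₀ Z)) → Invariant ic (hat ζ) (FI.IsoFam.to s) (FI.IsoFam.to t) →
                  Σ[ h ∈ IndHom T (ι₀ K) ] hat γ FI.[ h ] I.≈ FI.IsoFam.to t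
      realize-ι {X} {Y} {Z} {K} {ζ} {γ} faithful realizes t s p = glue (λ j → proj₁ (l j))
          (λ {i} {j} a → faithful (proj₁ (l j) ∘ T.tr a) (proj₁ (l i)) (≈-trans (≈-sym []-∘) (≈-trans ([]-resp (proj₂ (l j)) ≈-refl)
            (≈-trans (at-tr (FI.IsoFam.to t) a) (≈-sym (proj₂ (l i)))))))
        , (λ (j , _) → El-≈ (ι₀ X) (≈-trans (≈-trans (refl⟩∘⟨ ⟨π₁,π₂⟩) identityʳ ⟩∘⟨refl) (proj₂ (l j))))
        where
        invariant : ∀ j → Invariant c ζ (IsoFam.to (at-iso s j)) (IsoFam.to (at-iso t j))
        invariant j = ≈-trans (≈-sym (≈-trans (refl⟩∘⟨ ⟨π₁,π₂⟩) identityʳ) ⟩∘⟨refl) (≈-trans (same-ι (p (j , tt , tt)))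
          (≈-trans (refl⟩∘⟨ ⟨π₁,π₂⟩) identityʳ ⟩∘⟨refl))
        l : ∀ j → Σ[ h ∈ T.ob j ⇒ K ] γ [ h ] ≈ IsoFam.to (at-iso t j)
        l j = realizes (at-iso t j) (at-iso s j) (invariant j)

  ι-transfer : Transfer c ic ι (ι-preserves c)
  ι-transfer = record
    { mono = λ {A} {B} {m} mono {T} {x} {y} p j → El-≈ (ι₀ A) (mono (same-ι (p j)))
    ; lifts = λ sys mono lifts {T} s p → lift-ι {T} sys mono lifts s p
    ; faithful = λ {K} {X} {Y} {γ} faithful {T} x y p j → El-≈ (ι₀ K) (faithful (at x j) (at y j)
        (≈-trans (≈-sym (at-hat γ x j)) (≈-trans (same-ι (p (j , tt))) (at-hat γ y j))))
    ; realizes = λ {X} {Y} {Z} {K} {ζ} {γ} faithful realizes {T} t s p → realize-ι {T} {X} {Y} {Z} {K} {ζ} {γ} faithful realizes t s p }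

module _ {B : Category o ℓ} {E : Category o′ ℓ′} (c : Cartesian B) (e : Cartesian E)
         (Φ : Functor B E) (pres : PreservesFiniteProducts Φ) where
  private
    module B = Category B using (_⇒_; _∘_; _≈_; assoc; id; identityʳ; identityˡ; refl⟩∘⟨_; ≈-refl; ≈-sym; ≈-trans)
    module c = Cartesian c using (_⁂_; _⊠_; project₁; project₂; π₁; π₂; ⁂-resp; ⁂∘⁂; ⟨_,_⟩; ⟨⟩-resp; ⟨⟩∘)
    module FB = Families c
    module PB = Properties c using (LiftsThrough; Monic; Realizes)
    module PE = Properties e using (Monic)
  open Category E
  open Cartesian e
  open Families e
  open Functor Φ
  open Hat c e Φ pres
  open HatSandwich c e Φ pres using (φ-epi)

  -- T is the limit of a cofiltered diagram in B, and data over T in the image of Φ come from a stage.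
  record Legs (T : Obj) : Set (lsuc ℓ ⊔ o ⊔ ℓ′) where
    field
      stages : IndObj (op B)
    private module T = IndObj stages using (Index; idᵢ; ob; tr; tr-∘; upperBound; _↝_; _∘ᵢ_)
    field
      leg        : ∀ i → T ⇒ F₀ (T.ob i)
      leg-tr     : ∀ {i k} (a : i T.↝ k) → F₁ (T.tr a) ∘ leg k ≈ leg i
      at-leg     : ∀ {A} (x : T ⇒ F₀ A) → Σ[ i ∈ T.Index ] Σ[ x₀ ∈ T.ob i B.⇒ A ] F₁ x₀ ∘ leg i ≈ x
      at-hat-leg : ∀ {X Y} (g : T ⊠ F₀ X ⇒ F₀ Y) → Σ[ i ∈ T.Index ] Σ[ g₀ ∈ T.ob i c.⊠ X B.⇒ Y ] hat g₀ [ leg i ] ≈ g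
      leg-agree  : ∀ {i X Y} {f g : T.ob i c.⊠ X B.⇒ Y} → hat f [ leg i ] ≈ hat g [ leg i ] →
                   Σ[ k ∈ T.Index ] Σ[ a ∈ i T.↝ k ] f FB.[ T.tr a ] B.≈ g FB.[ T.tr a ]

    opaque
      move : ∀ {i k A} (a : i T.↝ k) {x₀ : T.ob i B.⇒ A} {x : T ⇒ F₀ A} → F₁ x₀ ∘ leg i ≈ x → F₁ (x₀ B.∘ T.tr a) ∘ leg k ≈ x
      move a p = ≈-trans (homomorphism ⟩∘⟨refl) (≈-trans assoc (≈-trans (refl⟩∘⟨ leg-tr a) p))

      move-hat : ∀ {i k X Y} (a : i T.↝ k) {g : T.ob i c.⊠ X B.⇒ Y} {h : T ⊠ F₀ X ⇒ F₀ Y} → hat g [ leg i ] ≈ h → hat (g FB.[ T.tr a ]) [ leg k ] ≈ h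
      move-hat a p = ≈-trans (hat-at (leg-tr a)) p

      solve-stage : ∀ {i} (sys : FB.System (T.ob i)) → Solves (leg i) (hatSystem sys) →
                    Σ[ k ∈ T.Index ] Σ[ a ∈ i T.↝ k ] FB.Solves (T.tr a) sys
      solve-stage {i} []        _        = i , T.idᵢ , tt
      solve-stage {i} (q ∷ sys) (p , ps) = m , b T.∘ᵢ a ,
          B.≈-trans (split (FB.Equation.lhs q)) (B.≈-trans (proj₂ (proj₂ agreed)) (B.≈-sym (split (FB.Equation.rhs q))))
        , FB.Solves-≈ sys (B.≈-sym T.tr-∘) (FB.Solves-∘ sys (proj₂ (proj₂ rest)))
        where
        rest : Σ[ k ∈ T.Index ] Σ[ a ∈ i T.↝ k ] FB.Solves (T.tr a) sys
        rest = solve-stage sys ps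
        k : T.Index
        k = proj₁ rest
        a : i T.↝ k
        a = proj₁ (proj₂ rest)
        agreed : Σ[ m ∈ T.Index ] Σ[ b ∈ k T.↝ m ] FB.Equation.lhs q FB.[ T.tr a ] FB.[ T.tr b ] B.≈ FB.Equation.rhs q FB.[ T.tr a ] FB.[ T.tr b ]
        agreed = leg-agree (≈-trans (hat-at (leg-tr a)) (≈-trans p (≈-sym (hat-at (leg-tr a)))))
        m : T.Index
        m = proj₁ agreed
        b : k T.↝ m
        b = proj₁ (proj₂ agreed)
        split : ∀ {X Y} (f : T.ob i c.⊠ X B.⇒ Y) → f FB.[ T.tr (b T.∘ᵢ a) ] B.≈ f FB.[ T.tr a ] FB.[ T.tr b ]
        split f = B.≈-trans (FB.[]-resp B.≈-refl T.tr-∘) (B.≈-sym FB.[]-∘)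

  module _ (mono : ∀ {A A′} {m : A B.⇒ A′} → PB.Monic m → PE.Monic (F₁ m)) (legs : ∀ T → Legs T) where
    private
      module _ {T : Obj} where
        open Legs (legs T)
        private module T = IndObj stages using (Index; ob; tr; upperBound; _↝_)

        opaque
          lift-stage : ∀ {A K} {m : K B.⇒ A} (sys : FB.System A) → PB.LiftsThrough m sys →
                       (s : T ⇒ F₀ A) → Solves s (hatSystem sys) → Σ[ h ∈ T ⇒ F₀ K ] F₁ m ∘ h ≈ s
          lift-stage {A} {K} {m} sys lifts s p =
            let (i , s₀ , q) = at-leg s
                (k , a , r)  = solve-stage (pull s₀ sys) (pull-solves s₀ q sys p)
                (h , t)      = lifts (s₀ B.∘ T.tr a) (pull-solved s₀ sys r)
            in F₁ h ∘ leg k , ≈-trans (≈-sym assoc) (≈-trans (≈-trans (≈-sym homomorphism) (F-resp-≈ t) ⟩∘⟨refl) (move a q))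
            where
            pull : ∀ {S} (s₀ : S B.⇒ A) → FB.System A → FB.System S
            pull s₀ []        = []
            pull s₀ (q ∷ sys) = FB.equation (FB.Equation.lhs q FB.[ s₀ ]) (FB.Equation.rhs q FB.[ s₀ ]) ∷ pull s₀ sys
            pull-solves : ∀ {i} (s₀ : T.ob i B.⇒ A) → F₁ s₀ ∘ leg i ≈ s → ∀ sys → Solves s (hatSystem sys) → Solves (leg i) (hatSystem (pull s₀ sys))
            pull-solves s₀ q []        _        = tt
            pull-solves s₀ q (_ ∷ sys) (p , ps) = ≈-trans (hat-at q) (≈-trans p (≈-sym (hat-at q))) , pull-solves s₀ q sys ps
            pull-solved : ∀ {R S} (s₀ : S B.⇒ A) {x : R B.⇒ S} → ∀ sys → FB.Solves x (pull s₀ sys) → FB.Solves (s₀ B.∘ x) sys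
            pull-solved s₀ []        _        = tt
            pull-solved s₀ (_ ∷ sys) (p , ps) = B.≈-trans (B.≈-sym FB.[]-∘) (B.≈-trans p FB.[]-∘) , pull-solved s₀ sys ps

          faithful-stage : ∀ {K X Y} {γ : K c.⊠ X B.⇒ Y} → FB.Faithful γ → (x y : T ⇒ F₀ K) → hat γ [ x ] ≈ hat γ [ y ] → x ≈ y
          faithful-stage {γ = γ} faithful x y p =
            let (i , x₀ , q)  = at-leg x
                (j , y₀ , r)  = at-leg y
                (k , a , b)   = T.upperBound i j
                (l , d , eq)  = leg-agree (≈-trans (hat-at (move a q)) (≈-trans p (≈-sym (hat-at (move b r)))))
            in ≈-trans (≈-sym (move d (move a q))) (≈-trans
                 (F-resp-≈ (faithful _ _ (B.≈-trans (B.≈-sym FB.[]-∘) (B.≈-trans eq FB.[]-∘))) ⟩∘⟨refl) (move d (move b r)))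

          hat-invariant : ∀ {i X Y Z} (ζ : Z c.⊠ X B.⇒ Y) (s : T.ob i c.⊠ Z B.⇒ Z) (t : T.ob i c.⊠ X B.⇒ X) →
            hat (ζ B.∘ c.⟨ s B.∘ (B.id c.⁂ c.π₁) , t B.∘ (B.id c.⁂ c.π₂) ⟩) [ leg i ] ∘ (id ⁂ φ) ≈
            hat ζ ∘ ⟨ hat s [ leg i ] ∘ (id ⁂ π₁) , hat t [ leg i ] ∘ (id ⁂ π₂) ⟩
          hat-invariant {i} {X} {Y} {Z} ζ s t = begin
            (hat (ζ B.∘ st) ∘ (leg i ⁂ id)) ∘ (id ⁂ φ)                   ≈⟨ (≈-sym hat-∘ ⟩∘⟨refl) ⟩∘⟨refl ⟩
            ((F₁ ζ ∘ hat st) ∘ (leg i ⁂ id)) ∘ (id ⁂ φ)                  ≈⟨ ≈-trans (assoc ⟩∘⟨refl) assoc ⟩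
            F₁ ζ ∘ (hat st ∘ (leg i ⁂ id)) ∘ (id ⁂ φ)                    ≈⟨ refl⟩∘⟨ φ-ext
                (≈-trans (component c.project₁ π₁-φ) (≈-sym π₁-⟪⟫))
                (≈-trans (component c.project₂ π₂-φ) (≈-sym π₂-⟪⟫)) ⟩
            F₁ ζ ∘ ⟪ hat s [ leg i ] ∘ (id ⁂ π₁) , hat t [ leg i ] ∘ (id ⁂ π₂) ⟫ ≈⟨ ≈-sym assoc ⟩
            hat ζ ∘ ⟨ hat s [ leg i ] ∘ (id ⁂ π₁) , hat t [ leg i ] ∘ (id ⁂ π₂) ⟩ ∎
            where
            st : T.ob i c.⊠ (Z c.⊠ X) B.⇒ Z c.⊠ X
            st = c.⟨ s B.∘ (B.id c.⁂ c.π₁) , t B.∘ (B.id c.⁂ c.π₂) ⟩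
            component : ∀ {V} {p : Z c.⊠ X B.⇒ V} {q : Z c.⊠ X B.⇒ V} {p′ : F₀ Z ⊠ F₀ X ⇒ F₀ V} {f : T.ob i c.⊠ V B.⇒ V} →
                        p B.∘ st B.≈ f B.∘ (B.id c.⁂ q) → F₁ q ∘ φ ≈ p′ →
                        F₁ p ∘ (hat st ∘ (leg i ⁂ id)) ∘ (id ⁂ φ) ≈ hat f [ leg i ] ∘ (id ⁂ p′)
            component {p = p} {q} {p′} {f} e₁ e₂ = begin
              F₁ p ∘ (hat st ∘ (leg i ⁂ id)) ∘ (id ⁂ φ)              ≈⟨ ≈-trans (≈-sym assoc) (≈-trans (≈-sym assoc) (≈-trans hat-∘ (hat-resp e₁) ⟩∘⟨refl) ⟩∘⟨refl) ⟩
              (hat (f B.∘ (B.id c.⁂ q)) ∘ (leg i ⁂ id)) ∘ (id ⁂ φ)   ≈⟨ ≈-trans assoc (refl⟩∘⟨ ≈-trans ⁂∘⁂ (⁂-resp identityʳ identityˡ)) ⟩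
              hat (f B.∘ (B.id c.⁂ q)) ∘ (leg i ⁂ φ)                 ≈⟨ ≈-trans (≈-trans (≈-sym hat-∘) (refl⟩∘⟨ ≈-sym φ-natural) ⟩∘⟨refl) assoc ⟩
              F₁ f ∘ (φ ∘ (F₁ B.id ⁂ F₁ q)) ∘ (leg i ⁂ φ)            ≈⟨ ≈-trans (refl⟩∘⟨ ≈-trans assoc (refl⟩∘⟨ ≈-trans ⁂∘⁂
                                                                          (≈-trans (⁂-resp (≈-trans (identity ⟩∘⟨refl) (≈-trans identityˡ (≈-sym identityʳ))) (≈-trans e₂ (≈-sym identityˡ)))
                                                                            (≈-sym ⁂∘⁂)))) (≈-sym assoc) ⟩
              hat f ∘ (leg i ⁂ id) ∘ (id ⁂ p′)                       ≈⟨ ≈-sym assoc ⟩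
              hat f [ leg i ] ∘ (id ⁂ p′)                            ∎

          realize-stage : ∀ {X Y Z K} {ζ : Z c.⊠ X B.⇒ Y} {γ : K c.⊠ X B.⇒ X} → PB.Realizes ζ γ →
                          (t : IsoFam T (F₀ X) (F₀ X)) (s : IsoFam T (F₀ Z) (F₀ Z)) → Invariant e (hat ζ) (IsoFam.to s) (IsoFam.to t) →
                          Σ[ h ∈ T ⇒ F₀ K ] hat γ [ h ] ≈ IsoFam.to t
          realize-stage {X} {Y} {Z} {K} {ζ} {γ} realizes t s p = F₁ (proj₁ h) ∘ leg n ,
              ≈-trans (≈-trans ([]-resp ≈-refl ≈-refl) (≈-sym (hat-at ≈-refl))) (≈-trans ([]-resp (hat-resp (proj₂ h)) ≈-refl) (move-hat d t-k))
            where
            a₁ : Σ[ i ∈ T.Index ] Σ[ g ∈ T.ob i c.⊠ X B.⇒ X ] hat g [ leg i ] ≈ IsoFam.to t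
            a₁ = at-hat-leg (IsoFam.to t)
            a₂ : Σ[ i ∈ T.Index ] Σ[ g ∈ T.ob i c.⊠ X B.⇒ X ] hat g [ leg i ] ≈ IsoFam.from t
            a₂ = at-hat-leg (IsoFam.from t)
            a₃ : Σ[ i ∈ T.Index ] Σ[ g ∈ T.ob i c.⊠ Z B.⇒ Z ] hat g [ leg i ] ≈ IsoFam.to s
            a₃ = at-hat-leg (IsoFam.to s)
            a₄ : Σ[ i ∈ T.Index ] Σ[ g ∈ T.ob i c.⊠ Z B.⇒ Z ] hat g [ leg i ] ≈ IsoFam.from s
            a₄ = at-hat-leg (IsoFam.from s)
            u₁ : Σ[ m ∈ T.Index ] (proj₁ a₁ T.↝ m) × (proj₁ a₂ T.↝ m)
            u₁ = T.upperBound (proj₁ a₁) (proj₁ a₂)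
            u₂ : Σ[ m ∈ T.Index ] (proj₁ a₃ T.↝ m) × (proj₁ a₄ T.↝ m)
            u₂ = T.upperBound (proj₁ a₃) (proj₁ a₄)
            u₀ : Σ[ m ∈ T.Index ] (proj₁ u₁ T.↝ m) × (proj₁ u₂ T.↝ m)
            u₀ = T.upperBound (proj₁ u₁) (proj₁ u₂)
            k : T.Index
            k = proj₁ u₀
            t₀ t₀⁻ : T.ob k c.⊠ X B.⇒ X
            t₀ = proj₁ (proj₂ a₁) FB.[ T.tr (proj₁ (proj₂ u₁)) ] FB.[ T.tr (proj₁ (proj₂ u₀)) ]
            t₀⁻ = proj₁ (proj₂ a₂) FB.[ T.tr (proj₂ (proj₂ u₁)) ] FB.[ T.tr (proj₁ (proj₂ u₀)) ]
            s₀ s₀⁻ : T.ob k c.⊠ Z B.⇒ Z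
            s₀ = proj₁ (proj₂ a₃) FB.[ T.tr (proj₁ (proj₂ u₂)) ] FB.[ T.tr (proj₂ (proj₂ u₀)) ]
            s₀⁻ = proj₁ (proj₂ a₄) FB.[ T.tr (proj₂ (proj₂ u₂)) ] FB.[ T.tr (proj₂ (proj₂ u₀)) ]
            t-k : hat t₀ [ leg k ] ≈ IsoFam.to t
            t-k = move-hat (proj₁ (proj₂ u₀)) (move-hat (proj₁ (proj₂ u₁)) (proj₂ (proj₂ a₁)))
            t⁻-k : hat t₀⁻ [ leg k ] ≈ IsoFam.from t
            t⁻-k = move-hat (proj₁ (proj₂ u₀)) (move-hat (proj₂ (proj₂ u₁)) (proj₂ (proj₂ a₂)))
            s-k : hat s₀ [ leg k ] ≈ IsoFam.to s
            s-k = move-hat (proj₂ (proj₂ u₀)) (move-hat (proj₁ (proj₂ u₂)) (proj₂ (proj₂ a₃)))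
            s⁻-k : hat s₀⁻ [ leg k ] ≈ IsoFam.from s
            s⁻-k = move-hat (proj₂ (proj₂ u₀)) (move-hat (proj₂ (proj₂ u₂)) (proj₂ (proj₂ a₄)))
            left right : T.ob k c.⊠ (Z c.⊠ X) B.⇒ Y
            left = ζ B.∘ c.⟨ s₀ B.∘ (B.id c.⁂ c.π₁) , t₀ B.∘ (B.id c.⁂ c.π₂) ⟩
            right = ζ B.∘ c.π₂
            sys : FB.System (T.ob k)
            sys = FB.equation (t₀⁻ FB.• t₀) c.π₂ ∷ FB.equation (t₀ FB.• t₀⁻) c.π₂ ∷
                  FB.equation (s₀⁻ FB.• s₀) c.π₂ ∷ FB.equation (s₀ FB.• s₀⁻) c.π₂ ∷ FB.equation left right ∷ []
            π₂-k : ∀ {V} → π₂ {T} {F₀ V} ≈ hat c.π₂ [ leg k ]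
            π₂-k = ≈-sym (≈-trans ([]-resp hat-π₂ ≈-refl) []-π₂)
            composite : ∀ {V} {f g : T.ob k c.⊠ V B.⇒ V} {f′ g′ : T ⊠ F₀ V ⇒ F₀ V} → hat f [ leg k ] ≈ f′ → hat g [ leg k ] ≈ g′ → f′ • g′ ≈ π₂ →
                        hat (f FB.• g) [ leg k ] ≈ hat c.π₂ [ leg k ]
            composite q r eq = ≈-trans (≈-trans ([]-resp hat-• ≈-refl) []-•) (≈-trans (•-resp q r) (≈-trans eq π₂-k))
            invariant-k : hat left [ leg k ] ≈ hat right [ leg k ]
            invariant-k = φ-epi (≈-trans (hat-invariant ζ s₀ t₀) (≈-trans (refl⟩∘⟨ ⟨⟩-resp (s-k ⟩∘⟨refl) (t-k ⟩∘⟨refl)) (≈-trans p (≈-sym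
              (≈-trans (≈-trans ([]-resp hat-const ≈-refl) []-const ⟩∘⟨refl) (≈-trans assoc (≈-trans (refl⟩∘⟨ project₂) (≈-sym assoc))))))))
            solved : Σ[ n ∈ T.Index ] Σ[ d ∈ k T.↝ n ] FB.Solves (T.tr d) sys
            solved = solve-stage sys (composite t⁻-k t-k (IsoFam.from∘to t) , composite t-k t⁻-k (IsoFam.to∘from t) ,
              composite s⁻-k s-k (IsoFam.from∘to s) , composite s-k s⁻-k (IsoFam.to∘from s) , invariant-k , tt)
            n : T.Index
            n = proj₁ solved
            d : k T.↝ n
            d = proj₁ (proj₂ solved)
            eqs : FB.Solves (T.tr d) sys
            eqs = proj₂ (proj₂ solved)
            inverse-n : ∀ {V} {f g : T.ob k c.⊠ V B.⇒ V} → (f FB.• g) FB.[ T.tr d ] B.≈ c.π₂ FB.[ T.tr d ] → f FB.[ T.tr d ] FB.• g FB.[ T.tr d ] B.≈ c.π₂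
            inverse-n q = B.≈-trans (B.≈-sym FB.[]-•) (B.≈-trans q FB.[]-π₂)
            t-n : FB.IsoFam (T.ob n) X X
            t-n = Isos.mk≅ (FB.Fam (T.ob n)) (t₀ FB.[ T.tr d ]) (t₀⁻ FB.[ T.tr d ]) (inverse-n (proj₁ eqs)) (inverse-n (proj₁ (proj₂ eqs)))
            s-n : FB.IsoFam (T.ob n) Z Z
            s-n = Isos.mk≅ (FB.Fam (T.ob n)) (s₀ FB.[ T.tr d ]) (s₀⁻ FB.[ T.tr d ]) (inverse-n (proj₁ (proj₂ (proj₂ eqs)))) (inverse-n (proj₁ (proj₂ (proj₂ (proj₂ eqs)))))
            swap : ∀ {U V V′} {q : V c.⊠ V′ B.⇒ U} {f : T.ob k c.⊠ U B.⇒ U} → (f B.∘ (B.id c.⁂ q)) FB.[ T.tr d ] B.≈ f FB.[ T.tr d ] B.∘ (B.id c.⁂ q)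
            swap = B.≈-trans B.assoc (B.≈-trans (B.refl⟩∘⟨ B.≈-trans c.⁂∘⁂ (B.≈-trans (c.⁂-resp (B.≈-trans B.identityˡ (B.≈-sym B.identityʳ))
              (B.≈-trans B.identityʳ (B.≈-sym B.identityˡ))) (B.≈-sym c.⁂∘⁂))) (B.≈-sym B.assoc))
            invariant-n : Invariant c ζ (FB.IsoFam.to s-n) (FB.IsoFam.to t-n)
            invariant-n = B.≈-trans (B.≈-sym (B.≈-trans B.assoc (B.refl⟩∘⟨ B.≈-trans c.⟨⟩∘ (c.⟨⟩-resp swap swap))))
              (B.≈-trans (proj₁ (proj₂ (proj₂ (proj₂ (proj₂ eqs))))) FB.[]-const)
            h : Σ[ h ∈ T.ob n B.⇒ K ] γ FB.[ h ] B.≈ FB.IsoFam.to t-n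
            h = realizes t-n s-n invariant-n

    legs-transfer : Transfer c e Φ pres
    legs-transfer = record
      { mono = mono ; lifts = λ sys _ lifts s p → lift-stage sys lifts s p
      ; faithful = λ f x y p → faithful-stage f x y p ; realizes = λ _ r t s p → realize-stage r t s p }

module _ {B : Category o ℓ} (c : Cartesian B) where
  open Category B
  open Cartesian c
  open Families c
  open Properties c
  private
    module P = Category (Pro B) using (_⇒_; _∘_; _≈_; assoc; id; ∘-resp-≈; ≈-refl; ≈-sym; ≈-trans)
    pc = Pro-cartesian c
    module pc = Cartesian pc using (_⁂_; _⊠_; ⁂-resp)
    module FP = Families pc using (_[_]; _[_]≅)
    module κ = Functor (κ {C = B}) using (F₀; F₁)

    opaque
      κ-ext : ∀ {T A A′ A″} {p : A ⇒ A′} {q : A ⇒ A″} → (∀ {S} {x y : S ⇒ A} → p ∘ x ≈ p ∘ y → q ∘ x ≈ q ∘ y → x ≈ y) →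
              {x y : T P.⇒ κ.F₀ A} → κ.F₁ p P.∘ x P.≈ κ.F₁ p P.∘ y → κ.F₁ q P.∘ x P.≈ κ.F₁ q P.∘ y → x P.≈ y
      κ-ext {T} ext {x} {y} e e′ _ with e tt | e′ tt
      ... | same a b r | same a′ b′ r′ with IndObj.merge T a b a′ b′
      ... | _ , s , t , sa , sb = same (s T.∘ᵢ a) (s T.∘ᵢ b) (ext
              (≈-trans (shift s a) (≈-trans (r ⟩∘⟨refl) (≈-sym (shift s b))))
              (≈-trans (refl⟩∘⟨ refl⟩∘⟨ T.tr-resp sa) (≈-trans (shift t a′) (≈-trans (r′ ⟩∘⟨refl) (≈-sym (≈-trans (refl⟩∘⟨ refl⟩∘⟨ T.tr-resp sb) (shift t b′)))))))
        where
        module T = IndObj T using (ob; tr; tr-resp; tr-∘; _↝_; _∘ᵢ_)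
        shift : ∀ {X Y i j k} {f : X ⇒ Y} {g : T.ob i ⇒ X} (s : j T.↝ k) (a : i T.↝ j) → f ∘ g ∘ T.tr (s T.∘ᵢ a) ≈ ((f ∘ g) ∘ T.tr a) ∘ T.tr s
        shift s a = ≈-trans (≈-sym assoc) (≈-trans (refl⟩∘⟨ T.tr-∘) (≈-sym assoc))

  κ-preserves : PreservesFiniteProducts (κ {C = B})
  κ-preserves = record { terminal = terminal ; product = product }
    where
    terminal : ∀ {X} → IsTerminal B X → IsTerminal (Pro B) (κ.F₀ X)
    terminal {X} t = record
      { ! = λ {T} → record { comp = λ _ → IndObj.point T , t.! ; compat = λ _ → El-≈ T identityˡ }
      ; !-unique = λ {T} f _ → let (_ , a , b) = IndObj.upperBound T (IndObj.point T) (proj₁ (IndHom.comp f tt)) in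
          same a b (≈-trans (≈-sym (t.!-unique _)) (t.!-unique _)) }
      where module t = IsTerminal t using (!; !-unique)

    product : ∀ {X Y Z} {p : Z ⇒ X} {q : Z ⇒ Y} → IsProduct B p q → IsProduct (Pro B) (κ.F₁ p) (κ.F₁ q)
    product {X} {Y} {Z} {p} {q} isP = record
      { ⟨_,_⟩ = pairing
      ; project₁ = λ {T} {f} {g} → fst {T} {f} {g}
      ; project₂ = λ {T} {f} {g} → snd {T} {f} {g}
      ; unique = λ {T} {f} {g} {h} e₁ e₂ → κ-ext ext {x = pairing f g} {h}
          (P.≈-trans {i = κ.F₁ p P.∘ pairing f g} {f} {κ.F₁ p P.∘ h} (fst {T} {f} {g}) (P.≈-sym {x = κ.F₁ p P.∘ h} {f} e₁))
          (P.≈-trans {i = κ.F₁ q P.∘ pairing f g} {g} {κ.F₁ q P.∘ h} (snd {T} {f} {g}) (P.≈-sym {x = κ.F₁ q P.∘ h} {g} e₂)) }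
      where
      module isP = IsProduct isP using (project₁; project₂; unique; ⟨_,_⟩)
      ext : ∀ {S} {x y : S ⇒ Z} → p ∘ x ≈ p ∘ y → q ∘ x ≈ q ∘ y → x ≈ y
      ext e₁ e₂ = ≈-trans (≈-sym (isP.unique e₁ e₂)) (isP.unique ≈-refl ≈-refl)
      pairing : ∀ {T} → T P.⇒ κ.F₀ X → T P.⇒ κ.F₀ Y → T P.⇒ κ.F₀ Z
      pairing {T} f g = record { comp = λ _ → k , isP.⟨ proj₂ (IndHom.comp f tt) ∘ T.tr a , proj₂ (IndHom.comp g tt) ∘ T.tr b ⟩
                               ; compat = λ _ → El-≈ T identityˡ }
        where
        module T = IndObj T using (tr; upperBound)
        ub = T.upperBound (proj₁ (IndHom.comp f tt)) (proj₁ (IndHom.comp g tt))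
        k = proj₁ ub
        a = proj₁ (proj₂ ub)
        b = proj₂ (proj₂ ub)
      fst : ∀ {T} {f : T P.⇒ κ.F₀ X} {g : T P.⇒ κ.F₀ Y} → κ.F₁ p P.∘ pairing f g P.≈ f
      fst {T} {f} _ = Setoid.trans (El-setoid T _) (El-≈ T isP.project₁) (Setoid.sym (El-setoid T _) (El-tr T _ (proj₂ (IndHom.comp f tt))))
      snd : ∀ {T} {f : T P.⇒ κ.F₀ X} {g : T P.⇒ κ.F₀ Y} → κ.F₁ q P.∘ pairing f g P.≈ g
      snd {T} {f} {g} _ = Setoid.trans (El-setoid T _) (El-≈ T isP.project₂) (Setoid.sym (El-setoid T _) (El-tr T _ (proj₂ (IndHom.comp g tt))))

  open Hat c pc κ κ-preserves

  private
    module E = IndElements {C = op B} using (element)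

  leg : (T : IndObj (op B)) → ∀ i → T P.⇒ κ.F₀ (IndObj.ob T i)
  leg T i = E.element {B = T} (i , id)

  corner : (T S : IndObj (op B)) → ∀ i j → (T pc.⊠ S) P.⇒ κ.F₀ (IndObj.ob T i ⊠ IndObj.ob S j)
  corner T S i j = E.element {B = T pc.⊠ S} ((i , j) , id)

  opaque
    corner-φ : (T S : IndObj (op B)) → ∀ i j → φ P.∘ (leg T i pc.⁂ leg S j) P.≈ corner T S i j
    corner-φ T S i j = φ-⁂ {f = leg T i} {leg S j} {corner T S i j} (λ _ → first) (λ _ → second)
      where
      module T = IndObj T using (idᵢ; point; upperBound)
      module S = IndObj S using (idᵢ; point; upperBound)
      first : SameEl (T pc.⊠ S) ((i , j) , π₁ ∘ id) ((i , S.point) , id ∘ π₁)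
      first with S.upperBound j S.point
      ... | _ , a , b = same (T.idᵢ , a) (T.idᵢ , b) (≈-trans (identityʳ ⟩∘⟨refl) (≈-trans project₁ (≈-sym (≈-trans (identityˡ ⟩∘⟨refl) project₁))))
      second : SameEl (T pc.⊠ S) ((i , j) , π₂ ∘ id) ((T.point , j) , id ∘ π₂)
      second with T.upperBound i T.point
      ... | _ , a , b = same (a , S.idᵢ) (b , S.idᵢ) (≈-trans (identityʳ ⟩∘⟨refl) (≈-trans project₂ (≈-sym (≈-trans (identityˡ ⟩∘⟨refl) project₂))))

  module _ (T : IndObj (op B)) where
    private
      module T = IndObj T using (Index; coequalize; ob; tr; tr-resp; tr-∘; _↝_; _∘ᵢ_)
      module S {Z : Obj} = Setoid (El-setoid T Z) using (sym; trans)

    opaque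
      leg-tr : ∀ {i k} (a : i T.↝ k) → κ.F₁ (T.tr a) P.∘ leg T k P.≈ leg T i
      leg-tr {i} {k} a _ = S.trans (El-≈ T (≈-trans identityʳ (≈-sym identityˡ))) (S.sym (El-tr T a id))

      at-leg : ∀ {A} (x : T P.⇒ κ.F₀ A) → κ.F₁ (proj₂ (IndHom.comp x tt)) P.∘ leg T (proj₁ (IndHom.comp x tt)) P.≈ x
      at-leg x _ = El-≈ T identityʳ

      leg-∘ : ∀ {S} (x : S P.⇒ T) i → SameEl S (IndHom.comp (leg T i P.∘ x) tt) (IndHom.comp x i)
      leg-∘ {S} x i = El-≈ S identityˡ

      leg-ext : ∀ {S} {x y : S P.⇒ T} → (∀ i → leg T i P.∘ x P.≈ leg T i P.∘ y) → x P.≈ y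
      leg-ext {S} {x} {y} e i = Setoid.trans (El-setoid S _) (Setoid.sym (El-setoid S _) (leg-∘ x i))
        (Setoid.trans (El-setoid S _) (e i tt) (leg-∘ y i))

    pro-limit : ∀ {S} (h : ∀ i → S P.⇒ κ.F₀ (T.ob i)) → (∀ {i k} (a : i T.↝ k) → κ.F₁ (T.tr a) P.∘ h k P.≈ h i) →
                Σ[ x ∈ S P.⇒ T ] (∀ i → leg T i P.∘ x P.≈ h i)
    pro-limit {S} h e = record { comp = λ i → IndHom.comp (h i) tt ; compat = λ a → e a tt } , λ i _ → El-≈ S identityˡ

    private
      opaque
        hat-leg : ∀ {i X Y} (f : T.ob i ⊠ X ⇒ Y) → hat f FP.[ leg T i ] P.≈ κ.F₁ f P.∘ corner T (κ.F₀ X) i tt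
        hat-leg {i} {X} f _ = Setoid.trans (El-setoid (T pc.⊠ κ.F₀ X) _) (P.assoc {f = κ.F₁ f} {φ} {leg T i pc.⁂ P.id} tt)
          (El-restrict-resp (T pc.⊠ κ.F₀ X) f (corner-id tt))
          where
          corner-id : φ P.∘ (leg T i pc.⁂ P.id) P.≈ corner T (κ.F₀ X) i tt
          corner-id = P.≈-trans {i = φ P.∘ (leg T i pc.⁂ P.id)} {φ P.∘ (leg T i pc.⁂ leg (κ.F₀ X) tt)} {corner T (κ.F₀ X) i tt}
            (P.∘-resp-≈ {f = φ} {φ} {leg T i pc.⁂ P.id} {leg T i pc.⁂ leg (κ.F₀ X) tt} (P.≈-refl {x = φ})
              (pc.⁂-resp {f = leg T i} {leg T i} {P.id {κ.F₀ X}} {leg (κ.F₀ X) tt} (P.≈-refl {x = leg T i}) (P.≈-refl {x = P.id {κ.F₀ X}})))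
            (corner-φ T (κ.F₀ X) i tt)

        at-hat-leg : ∀ {X Y} (g : (T pc.⊠ κ.F₀ X) P.⇒ κ.F₀ Y) →
                     hat (proj₂ (IndHom.comp g tt)) FP.[ leg T (proj₁ (proj₁ (IndHom.comp g tt))) ] P.≈ g
        at-hat-leg {X} {Y} g = P.≈-trans {i = hat g₀ FP.[ leg T i ]} {κ.F₁ g₀ P.∘ corner T (κ.F₀ X) i tt} {g} (hat-leg g₀) (λ _ → El-≈ (T pc.⊠ κ.F₀ X) identityʳ)
          where
          i : T.Index
          i = proj₁ (proj₁ (IndHom.comp g tt))
          g₀ : T.ob i ⊠ X ⇒ Y
          g₀ = proj₂ (IndHom.comp g tt)

        corner-agree : ∀ {i X Y} {f g : T.ob i ⊠ X ⇒ Y} → SameEl (T pc.⊠ κ.F₀ X) ((i , tt) , f ∘ id) ((i , tt) , g ∘ id) →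
                       Σ[ k ∈ T.Index ] Σ[ a ∈ i T.↝ k ] f [ T.tr a ] ≈ g [ T.tr a ]
        corner-agree {f = f} {g} (same (a , _) (b , _) p) with T.coequalize a b
        ... | k , c , q = k , c T.∘ᵢ a , ≈-trans ([]-resp ≈-refl T.tr-∘) (≈-trans (≈-sym []-∘)
                (≈-trans ([]-resp (≈-trans (≈-sym identityʳ ⟩∘⟨refl) (≈-trans p (identityʳ ⟩∘⟨refl))) ≈-refl) (≈-trans []-∘ ([]-resp ≈-refl
                  (≈-trans (≈-sym T.tr-∘) (≈-sym (T.tr-resp q)))))))

        leg-agree : ∀ {i X Y} {f g : T.ob i ⊠ X ⇒ Y} → hat f FP.[ leg T i ] P.≈ hat g FP.[ leg T i ] →
                    Σ[ k ∈ T.Index ] Σ[ a ∈ i T.↝ k ] f [ T.tr a ] ≈ g [ T.tr a ]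
        leg-agree {i} {X} {Y} {f} {g} e = corner-agree {i} {X} {Y} {f} {g}
            (S′.trans (S′.sym (hat-leg f tt)) (S′.trans (e tt) (hat-leg g tt)))
          where module S′ {Z : Obj} = Setoid (El-setoid (T pc.⊠ κ.F₀ X) Z) using (sym; trans)

    legs : Legs c pc κ κ-preserves T
    legs = record
      { stages = T ; leg = leg T ; leg-tr = leg-tr
      ; at-leg = λ x → proj₁ (IndHom.comp x tt) , proj₂ (IndHom.comp x tt) , at-leg x
      ; at-hat-leg = λ g → proj₁ (proj₁ (IndHom.comp g tt)) , proj₂ (IndHom.comp g tt) , at-hat-leg g
      ; leg-agree = leg-agree }

  κ-transfer : Transfer c pc κ κ-preserves
  κ-transfer = legs-transfer c pc κ κ-preserves
    (λ {A} {A′} {m} mono {T} {x} {y} e → κ-ext {T} {p = m} {m} (λ e₁ _ → mono e₁) {x} {y} e e) legs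

module _ {C₀ : Category o′ ℓ′} {C : Category o ℓ} {E : Category o″ ℓ″} (e : Cartesian E) (j : Functor C E) (I : Functor C₀ C) where
  open Category E
  open Cartesian e

  record Represents {U : Obj} (mul : U ⊠ U ⇒ U) : Set (o ⊔ o′ ⊔ ℓ ⊔ o″ ⊔ ℓ″) where
    field
      iso : ∀ T → Inverse (hom-setoid T U) (Group.setoid (AutGroup e j I T))
    act : ∀ {T} → T ⇒ U → ∀ X → T ⊠ Functor.F₀ j X ⇒ Functor.F₀ j X
    act {T} h = Aut.act (Inverse.to (iso T) h)
    field
      natural : ∀ {S T} (f : S ⇒ T) (g : T ⇒ U) X → act (g ∘ f) X ≈ act g X ∘ (f ⁂ id)
      homo    : ∀ {T} (f g : T ⇒ U) X → act (mul ∘ ⟨ f , g ⟩) X ≈ act f X ∘ ⟨ π₁ , act g X ⟩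

    opaque
      act-resp : ∀ {T} {f g : T ⇒ U} → f ≈ g → ∀ X → act f X ≈ act g X
      act-resp {T} = Inverse.to-cong (iso T)

      act-injective : ∀ {T} {f g : T ⇒ U} → (∀ X → act f X ≈ act g X) → f ≈ g
      act-injective {T} {f} {g} p = ≈-trans (≈-sym (Inverse.inverseʳ (iso T) {f} {Inverse.to (iso T) f} (λ X → ≈-refl)))
        (Inverse.inverseʳ (iso T) {g} {Inverse.to (iso T) f} p)

  module _ {U V : Obj} {m : U ⊠ U ⇒ U} {n : V ⊠ V ⇒ V} (R : Represents m) (S : Represents n) where
    private
      module R = Represents R using (act; act-resp; homo; iso; natural)
      module S = Represents S using (act; act-injective; homo; iso; natural)

    compare : U ⇒ V
    compare = Inverse.from (S.iso U) (Inverse.to (R.iso U) id)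

    opaque
      act-compare : ∀ {T} (x : T ⇒ U) X → S.act (compare ∘ x) X ≈ R.act x X
      act-compare x X = ≈-trans (S.natural x compare X) (≈-trans
        (Inverse.inverseˡ (S.iso U) {Inverse.to (R.iso U) id} ≈-refl X ⟩∘⟨refl)
        (≈-trans (≈-sym (R.natural x id X)) (R.act-resp identityˡ X)))

      compare-mul : compare ∘ m ≈ n ∘ (compare ⁂ compare)
      compare-mul = S.act-injective (λ X → ≈-trans (act-compare m X) (≈-trans
        (R.act-resp (≈-sym (≈-trans (refl⟩∘⟨ ⟨π₁,π₂⟩) identityʳ)) X) (≈-trans (R.homo π₁ π₂ X)
        (≈-sym (≈-trans (S.homo (compare ∘ π₁) (compare ∘ π₂) X)
          (∘-resp-≈ (act-compare π₁ X) (⟨⟩-resp ≈-refl (act-compare π₂ X))))))))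

  opaque
    compare-inverse : {U V : Obj} {m : U ⊠ U ⇒ U} {n : V ⊠ V ⇒ V} (R : Represents m) (S : Represents n) →
                      compare S R ∘ compare R S ≈ id
    compare-inverse R S = R.act-injective (λ X → ≈-trans (act-compare S R (compare R S) X) (≈-trans
        (S.act-resp (≈-sym identityʳ) X) (act-compare R S id X)))
      where
      module R = Represents R using (act-injective)
      module S = Represents S using (act-resp)

module _ {B : Category o ℓ} (c : Cartesian B) where
  open Category B
  open Cartesian c
  private
    module P = Category (Pro B) using (Obj; _⇒_; _∘_; _≈_)
    pc = Pro-cartesian c
    module pc = Cartesian pc using (_⁂_; _⊠_)
    module κ = Functor (κ {C = B}) using (F₁)
    module PG = Category (ProGroup c) using (Obj; _⇒_; _≈_)
    open module H = Hat c pc κ (κ-preserves c) using (φ)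

  opaque
    leg-pro-mul : ∀ (G : PG.Obj) i → leg c (underlying c G) i P.∘ pro-mul c G P.≈
                  κ.F₁ (GroupObj.mul (IndObj.ob G i)) P.∘ φ P.∘ (leg c (underlying c G) i pc.⁂ leg c (underlying c G) i)
    leg-pro-mul G i _ = S.trans (El-≈ (U pc.⊠ U) (≈-trans identityˡ (≈-sym identityʳ)))
        (El-restrict-resp (U pc.⊠ U) (GroupObj.mul (IndObj.ob G i)) (S.sym (corner-φ c U U i i tt)))
      where
      U : P.Obj
      U = underlying c G
      module S {Z : Obj} = Setoid (El-setoid (U pc.⊠ U) Z) using (sym; trans)

  module _ {G G′ : PG.Obj} (f : underlying c G P.⇒ underlying c G′)
           (f-mul : f P.∘ pro-mul c G P.≈ pro-mul c G′ P.∘ (f pc.⁂ f)) where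
    private
      U = underlying c G
      V = underlying c G′
      module G = IndObj G using (Index; coequalize; index; merge; ob; tr; _↝_; _∘ᵢ_)
      module G′ = IndObj G′ using (Index; ob; tr; _↝_)
      module U = IndObj U using (tr; tr-resp; tr-∘)
      module SU {Z : Obj} = Setoid (El-setoid U Z) using (sym; trans)

    module _ (j : G′.Index) where
      private
        module Gⱼ = GroupObj (G′.ob j) using (carrier; mul)
        i : G.Index
        i = proj₁ (IndHom.comp f j)
        module Gᵢ = GroupObj (G.ob i) using (carrier; mul)
        fⱼ : Gᵢ.carrier ⇒ Gⱼ.carrier
        fⱼ = proj₂ (IndHom.comp f j)

        opaque
          multiplicative-later : SameEl (U pc.⊠ U) ((i , i) , fⱼ ∘ Gᵢ.mul) ((i , i) , Gⱼ.mul ∘ (fⱼ ⁂ fⱼ))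
          multiplicative-later = S.trans (El-≈ (U pc.⊠ U) (≈-sym identityˡ)) (S.trans (eq tt) (El-≈ (U pc.⊠ U) identityʳ))
            where
            module S {Z : Obj} = Setoid (El-setoid (U pc.⊠ U) Z) using (trans)
            eq : leg c V j P.∘ f P.∘ pro-mul c G P.≈ κ.F₁ (Gⱼ.mul ∘ (fⱼ ⁂ fⱼ)) P.∘ corner c U U i i
            eq = H.leg-multiplicative {l = leg c U i} {leg c V j} {f} {fⱼ} {pro-mul c G} {pro-mul c G′} {Gⱼ.mul} {leg c V j} {corner c U U i i}
              (λ _ → El-≈ U (≈-trans identityˡ (≈-sym identityʳ))) (leg-pro-mul G′ j) f-mul (corner-φ c U U i i)

          merged : SameEl (U pc.⊠ U) ((i , i) , fⱼ ∘ Gᵢ.mul) ((i , i) , Gⱼ.mul ∘ (fⱼ ⁂ fⱼ)) →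
                   Σ[ k ∈ G.Index ] Σ[ a ∈ i G.↝ k ] (fⱼ ∘ Gᵢ.mul) ∘ (U.tr a ⁂ U.tr a) ≈ (Gⱼ.mul ∘ (fⱼ ⁂ fⱼ)) ∘ (U.tr a ⁂ U.tr a)
          merged (same (a , b) (a′ , b′) p) with G.merge a a′ b b′
          ... | m , s , t , e₁ , e₂ with G.coequalize (s G.∘ᵢ a) (s G.∘ᵢ a′)
          ... | k , h , e₃ = k , h G.∘ᵢ s G.∘ᵢ a ,
                ≈-trans (refl⟩∘⟨ ⁂-resp ≈-refl (U.tr-resp {f = h G.∘ᵢ s G.∘ᵢ a} {h G.∘ᵢ t G.∘ᵢ b} (IX.∘-resp-≈ IX.≈-refl e₁)))
                (≈-trans (split {a = a} {b}) (≈-trans (p ⟩∘⟨refl) (≈-trans (≈-sym (split {a = a′} {b′}))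
                (refl⟩∘⟨ ⁂-resp (U.tr-resp {f = h G.∘ᵢ s G.∘ᵢ a′} {h G.∘ᵢ s G.∘ᵢ a} (IX.≈-sym e₃))
                  (U.tr-resp {f = h G.∘ᵢ t G.∘ᵢ b′} {h G.∘ᵢ s G.∘ᵢ a} (IX.≈-trans (IX.∘-resp-≈ IX.≈-refl (IX.≈-sym e₂)) (IX.≈-sym e₃)))))))
            where
            module IX = Category G.index using (assoc; ∘-resp-≈; ≈-refl; ≈-sym; ≈-trans)
            tr₂ : ∀ {x y z w} {f : x G.↝ y} {g : y G.↝ z} {h : z G.↝ w} → U.tr (h G.∘ᵢ g G.∘ᵢ f) ≈ U.tr f ∘ U.tr (h G.∘ᵢ g)
            tr₂ {f = f} {g} {h} = ≈-trans (U.tr-resp (IX.≈-sym IX.assoc)) U.tr-∘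
            split : ∀ {x y : G.Index} {a : i G.↝ x} {b : i G.↝ y} {s : x G.↝ m} {t : y G.↝ m} {Z} {r : _ ⊠ _ ⇒ Z} →
                    r ∘ (U.tr (h G.∘ᵢ s G.∘ᵢ a) ⁂ U.tr (h G.∘ᵢ t G.∘ᵢ b)) ≈ (r ∘ (U.tr a ⁂ U.tr b)) ∘ (U.tr (h G.∘ᵢ s) ⁂ U.tr (h G.∘ᵢ t))
            split {a = a} {b} {s} {t} = ≈-trans (refl⟩∘⟨ ≈-trans (⁂-resp (tr₂ {f = a} {s} {h}) (tr₂ {f = b} {t} {h})) (≈-sym ⁂∘⁂)) (≈-sym assoc)

        later : Σ[ k ∈ G.Index ] Σ[ a ∈ i G.↝ k ] (fⱼ ∘ Gᵢ.mul) ∘ (U.tr a ⁂ U.tr a) ≈ (Gⱼ.mul ∘ (fⱼ ⁂ fⱼ)) ∘ (U.tr a ⁂ U.tr a)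
        later = merged multiplicative-later

      componentHom : El G (G′.ob j)
      componentHom = proj₁ later , record
        { hom = fⱼ ∘ U.tr (proj₁ (proj₂ later))
        ; hom-mul = ≈-trans assoc (≈-trans (refl⟩∘⟨ GroupHom.hom-mul (G.tr (proj₁ (proj₂ later)))) (≈-trans (≈-sym assoc)
            (≈-trans (proj₂ (proj₂ later)) (≈-trans assoc (refl⟩∘⟨ ⁂∘⁂))))) }

      opaque
        componentHom-same : SameEl U (proj₁ componentHom , GroupHom.hom (proj₂ componentHom)) (IndHom.comp f j)
        componentHom-same = SU.sym (El-tr U (proj₁ (proj₂ later)) fⱼ)

    liftHom : G PG.⇒ G′
    liftHom = record { comp = componentHom ; compat = compat }
      where
      opaque
        compat : ∀ {i j} (a : i G′.↝ j) → SameEl G (El-restrict G (G′.tr a) (componentHom j)) (componentHom i)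
        compat {i} {j} a with SU.trans (El-restrict-resp U (GroupHom.hom (G′.tr a)) (componentHom-same j)) (SU.trans (IndHom.compat f a) (SU.sym (componentHom-same i)))
        ... | same b d p = same b d p

    opaque
      liftHom-underlying : Functor.F₁ (ProF (forget c)) {G} {G′} liftHom P.≈ f
      liftHom-underlying = componentHom-same

  opaque
    underlying-faithful : ∀ {G G′ : PG.Obj} {f g : G PG.⇒ G′} →
      Functor.F₁ (ProF (forget c)) {G} {G′} f P.≈ Functor.F₁ (ProF (forget c)) {G} {G′} g → f PG.≈ g
    underlying-faithful e i with e i
    ... | same a b p = same a b p

module _ {C₀ : Category o′ ℓ′} {C : Category o″ ℓ″} {B : Category o ℓ} (c : Cartesian B) (j : Functor C (Pro B)) (I : Functor C₀ C)
         (G G′ : Category.Obj (ProGroup c)) where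
  private
    module P = Category (Pro B) using (Obj; _⇒_; _∘_; id; ∘-resp-≈; ≈-trans)
    module PG = Category (ProGroup c) using (Obj; _⇒_; _∘_; _≈_; id)
    pc = Pro-cartesian c
    ∣_∣ : PG.Obj → P.Obj
    ∣_∣ = underlying c
    U = Functor.F₁ (ProF (forget c))

  module _ (R : Represents (Pro-cartesian c) j I {underlying c G} (pro-mul c G))
           (S : Represents (Pro-cartesian c) j I {underlying c G′} (pro-mul c G′)) where
    private
      f : ∣ G ∣ P.⇒ ∣ G′ ∣
      f = compare pc j I R S
      g : ∣ G′ ∣ P.⇒ ∣ G ∣
      g = compare pc j I S R
      f̃ : G PG.⇒ G′
      f̃ = liftHom c {G} {G′} f (compare-mul pc j I R S)
      g̃ : G′ PG.⇒ G
      g̃ = liftHom c {G′} {G} g (compare-mul pc j I S R)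

      opaque
        g̃∘f̃ : g̃ PG.∘ f̃ PG.≈ PG.id
        g̃∘f̃ = underlying-faithful c {G} {G} {g̃ PG.∘ f̃} {PG.id} (P.≈-trans {i = U {G′} {G} g̃ P.∘ U {G} {G′} f̃} {g P.∘ f} {P.id}
          (P.∘-resp-≈ {f = U {G′} {G} g̃} {g} {U {G} {G′} f̃} {f} (liftHom-underlying c {G′} {G} g (compare-mul pc j I S R))
            (liftHom-underlying c {G} {G′} f (compare-mul pc j I R S))) (compare-inverse pc j I R S))

        f̃∘g̃ : f̃ PG.∘ g̃ PG.≈ PG.id
        f̃∘g̃ = underlying-faithful c {G′} {G′} {f̃ PG.∘ g̃} {PG.id} (P.≈-trans {i = U {G} {G′} f̃ P.∘ U {G′} {G} g̃} {f P.∘ g} {P.id}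
          (P.∘-resp-≈ {f = U {G} {G′} f̃} {f} {U {G′} {G} g̃} {g} (liftHom-underlying c {G} {G′} f (compare-mul pc j I R S))
            (liftHom-underlying c {G′} {G} g (compare-mul pc j I S R))) (compare-inverse pc j I S R))

    represents-unique : Category._≅_ (ProGroup c) G G′
    represents-unique = Isos.mk≅ (ProGroup c) f̃ g̃ g̃∘f̃ f̃∘g̃

module ProGroupImage {C₀ C : Category u u} {B : Category o u} (I : Functor C₀ C) (c : Cartesian C) (d : Cartesian B)
  (Φ : Functor C B) (pres : PreservesFiniteProducts Φ) (transfer : Transfer c d Φ pres)
  (loci : ∀ {A} (sys : Families.System c A) → Families.Locus c sys) (auts : ∀ X → Automorphisms I c X) where
  private
    pd = Pro-cartesian d
    module P = Category (Pro B) using (Obj; _⇒_; _∘_; _≈_; ≈-trans)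
    module pd = Cartesian pd using (_⁂_)
    module κ = Functor (κ {C = B}) using (F₁)

    Ψ : Functor C (Pro B)
    Ψ = κ ∘F Φ

    Ψ-preserves : PreservesFiniteProducts Ψ
    Ψ-preserves = ∘-preserves c d pd pres (κ-preserves d)

    module S = Stages I c loci auts using (group; group-mul; proGroup)
    module R = Representation I c loci auts pd Ψ Ψ-preserves (transfer-∘ c d pd pres (κ-preserves d) transfer (κ-transfer d)) using (LimitCone; act-mul; act-∘; aut-inverse)
    module Hκ = Hat d pd κ (κ-preserves d) using (φ)
    module HΦ = Hat c d Φ pres using (hat)
    module H = Hat c pd Ψ Ψ-preserves using (φ)

  image : Category.Obj (ProGroup d)
  image = Functor.F₀ (ProF (GrpF c d Φ pres)) S.proGroup

  private
    U : P.Obj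
    U = underlying d image

    l : ∀ D → U P.⇒ Functor.F₀ Ψ (S.group D)
    l = leg d U

    opaque
      leg-mul : ∀ D → l D P.∘ pro-mul d image P.≈ Functor.F₁ Ψ (proj₁ (S.group-mul D)) P.∘ H.φ P.∘ (l D pd.⁂ l D)
      leg-mul D = P.≈-trans {i = l D P.∘ pro-mul d image} {κ.F₁ (HΦ.hat m) P.∘ Hκ.φ P.∘ (l D pd.⁂ l D)} {Functor.F₁ Ψ m P.∘ H.φ P.∘ (l D pd.⁂ l D)}
        (leg-pro-mul d image D) (hat-comp-∘ c d pd {Φ} {κ} pres (κ-preserves d) m {l D pd.⁂ l D})
        where
        m : Category._⇒_ C (Cartesian._⊠_ c (S.group D) (S.group D)) (S.group D)
        m = proj₁ (S.group-mul D)

    cone : R.LimitCone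
    cone = record
      { apex = U ; leg = l
      ; leg-natural = λ r → leg-tr d U r
      ; limit = λ h e → pro-limit d U h e
      ; leg-ext = λ {T} {x} {y} e → leg-ext d U {T} {x} {y} e
      ; mul = pro-mul d image
      ; leg-mul = leg-mul }

  image-represents : Represents (Pro-cartesian d) (κ {C = B} ∘F Φ) I {underlying d image} (pro-mul d image)
  image-represents = record
    { iso = R.aut-inverse cone
    ; natural = λ {S} {T} f g X → R.act-∘ cone {S} {T} f g X
    ; homo = λ {T} f g X → R.act-mul cone {T} f g X }

  represents-image : ∀ G → Represents (Pro-cartesian d) (κ {C = B} ∘F Φ) I {underlying d G} (pro-mul d G) →
    Σ[ H ∈ Category.Obj (ProGroup c) ] Category._≅_ (ProGroup d) (Functor.F₀ (ProF (GrpF c d Φ pres)) H) G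
  represents-image G R = S.proGroup , represents-unique d (κ {C = B} ∘F Φ) I image G image-represents R

module _ {C₀ C : Category u u} (c : Cartesian C) (I : Functor C₀ C) where
  fromRepresentsAut : ∀ {G} → RepresentsAut c I G → Represents (Pro-cartesian (Ind-cartesian c)) (κ {C = Ind C} ∘F ι {C = C}) I {underlying (Ind-cartesian c) G} (pro-mul (Ind-cartesian c) G)
  fromRepresentsAut {G} R = record
    { iso = R.iso ; natural = λ {S} {T} f g X → R.natural {S} {T} f g X ; homo = λ {T} f g X → R.homo {T} f g X }
    where module R = RepresentsAut {G = G} R using (homo; iso; natural)

  toRepresentsAut : ∀ {G} → Represents (Pro-cartesian (Ind-cartesian c)) (κ {C = Ind C} ∘F ι {C = C}) I {underlying (Ind-cartesian c) G} (pro-mul (Ind-cartesian c) G) → RepresentsAut c I G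
  toRepresentsAut {G} R = record
    { iso = R.iso ; natural = λ {S} {T} f g X → R.natural {S} {T} f g X ; homo = λ {T} f g X → R.homo {T} f g X }
    where module R = Represents R using (homo; iso; natural)

  module _ (loci : ∀ {A} (sys : Families.System c A) → Families.Locus c sys) (auts : ∀ X → Automorphisms I c X) where

    representable : Σ[ G ∈ Category.Obj (ProGroup (Ind-cartesian c)) ] RepresentsAut c I G
    representable = Image.image , toRepresentsAut Image.image-represents
      where module Image = ProGroupImage I c (Ind-cartesian c) ι (ι-preserves c) (ι-transfer c) loci auts

    representing-isProGroupIn : ∀ G → RepresentsAut c I G → IsProGroupIn c G
    representing-isProGroupIn G R = represents-image I c _ ι (ι-preserves c) (ι-transfer c) loci auts G (fromRepresentsAut {G} R)
      where open ProGroupImage using (represents-image)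

theorem5p3 : ∀ {u : Level} {C₀ C : Category u u} (K₀ : IndClosed C₀) (K : IndClosed C)
    (cover : InternalCover K₀ K) →
    let module C₀ = Category C₀
        module C = Category C
        module K₀ = IndClosed K₀
        module K = IndClosed K
        open InternalCover cover
        ProGroupInd = Category.Obj (ProGroup (Ind-cartesian K.cartesian))
    in
    -- (1)
    (∀ (X Y : C.Obj) → SemiStrict (K.HomObj X Y)) →
    -- (2)
    (∀ (X Y : C₀.Obj) → Σ[ B ∈ IndObj C₀ ] (B IndRepresents BiPresheaf K₀.cartesian X Y) × Strict B) →
    -- (3)
    (∀ (X : IndObj C) → Compact (Functor.F₀ (IndF F) X) → Compact X) →
    -- (4)
    (∀ {X Y : C₀.Obj} (k : X C₀.⇒ Y) → C₀.IsMono k → ∀ (Z : C₀.Obj) → Proper (K₀.postcompose Z k)) →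
    -- the pro-group of automorphisms exists, and it is a pro-group in C
    (Σ[ G ∈ ProGroupInd ] RepresentsAut K.cartesian I G)
      × (∀ (G : ProGroupInd) → RepresentsAut K.cartesian I G → IsProGroupIn K.cartesian G)
theorem5p3 K₀ K cover semiStrict bi-strict reflectsCompact proper =
  representable _ I locs auts , representing-isProGroupIn _ I locs auts
  where
  open InternalCover cover
  locs : ∀ {A} (sys : Families.System (IndClosed.cartesian K) A) → Families.Locus (IndClosed.cartesian K) sys
  locs = loci K semiStrict
  auts : ∀ X → Automorphisms I (IndClosed.cartesian K) X
  auts = AutomorphismObjects.automorphisms K₀ K cover semiStrict bi-strict reflectsCompact proper
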